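{- For every finite hypergraph $H$ there exist constants $C$ and $j$ (depending only on $H$) such that the following holds. Let $n\in\mathbb{N}$ and $C<k<n/C$, and suppose that $\mathcal{F}\subseteq\binom{[n]}{k}$ is free of $H^{+}$. Then there exists an $H^{+}$-free junta $\mathcal{J}\subseteq\binom{[n]}{k}$ which depends on at most $j$ coordinates (i.e. $\mathcal{J}$ is a $J$-junta for some $J\subseteq[n]$ with $|J|\le j$), such that \[ |\mathcal{F}\setminus\mathcal{J}|\le\max\left(e^{ -k/C},\,C\frac{k}{n}\right)\cdot|\mathcal{J}|. \]
   Context: For a hypergraph $H$ whose edges have size at most $k$, its $k$-expansion $H^{+}$ is the $k$-uniform hypergraph obtained from $H$ by enlarging each edge $E$ by $k-|E|$ new vertices, where the new vertices added to different edges are distinct and do not belong to $H$. A family $\mathcal{F}\subseteq\binom{[n]}{k}$ is $H^{+}$-free if it contains no copy (isomorphic image) of $H^{+}$. For $J\subseteq[n]$ with $|J|<k$, a family $\mathcal{J}\subseteq\binom{[n]}{k}$ is a $J$-junta if whether $A\in\mathcal{J}$ depends only on $A\cap J$ (i.e. $A\cap J=B\cap J$ implies $A\in\mathcal{J}\Leftrightarrow B\in\mathcal{J}$). -}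

module Defs where

open import Data.Nat using (ℕ; zero; suc; _+_; _*_; _∸_; _^_; _≤_; _<_; _!)

open import Data.Bool using (Bool; true; false; not; _∧_)
open import Data.Fin using (Fin)
open import Data.Fin.Subset using (Subset; _∈_; _∩_; ∣_∣)
open import Data.Vec using (Vec; []; _∷_)
open import Data.List using (List; []; _∷_; map; _++_; length; filter)
open import Data.Product using (Σ; ∃; ∃-syntax; _×_; _,_)
open import Data.Sum using (_⊎_)
open import Relation.Binary.PropositionalEquality using (_≡_)
open import Relation.Nullary using (¬_)
open import Function using (_⇔_)
open import Function.Definitions using (Injective)
open import Data.Bool.Properties using (T?)
open import Data.Bool using (T)

-- Finite hypergraphs: vertex set Fin v, edge set indexed by Fin m,
-- edges are subsets of the vertex set, and distinct indices give
-- distinct edges (the edge set is a set, not a multiset).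

record FinHypergraph : Set where
  field
    v     : ℕ
    m     : ℕ
    edge  : Fin m → Subset v
    edge-inj : Injective _≡_ _≡_ edge

record Hypergraph : Set₁ where
  field
    Vtx : Set
    Edg : Set
    mem : Edg → Vtx → Set

expansion : FinHypergraph → ℕ → Hypergraph
expansion H k = record
  { Vtx = Fin v ⊎ Σ (Fin m) (λ e → Fin (k ∸ ∣ edge e ∣))
  ; Edg = Fin m
  ; mem = mem⁺
  }
  where
  open FinHypergraph H
  mem⁺ : Fin m → Fin v ⊎ Σ (Fin m) (λ e → Fin (k ∸ ∣ edge e ∣)) → Set
  mem⁺ e (Data.Sum.inj₁ x) = x ∈ edge e
  mem⁺ e (Data.Sum.inj₂ (e' , _)) = e' ≡ e

Family : ℕ → Set
Family n = Subset n → Bool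

IsUniform : ∀ {n} → ℕ → Family n → Set
IsUniform k 𝓕 = ∀ A → 𝓕 A ≡ true → ∣ A ∣ ≡ k

allSubsets : ∀ n → List (Subset n)
allSubsets zero = [] ∷ []
allSubsets (suc n) = map (true ∷_) (allSubsets n) ++ map (false ∷_) (allSubsets n)

count : ∀ {n} → Family n → ℕ
count {n} 𝓕 = length (filter (λ A → T? (𝓕 A)) (allSubsets n))

_∖_ : ∀ {n} → Family n → Family n → Family n
(𝓕 ∖ 𝓙) A = 𝓕 A ∧ not (𝓙 A)

ContainsCopy : ∀ {n} → Hypergraph → Family n → Set
ContainsCopy {n} G 𝓕 =
  Σ (Vtx → Fin n) λ φ → Injective _≡_ _≡_ φ ×
  Σ (Edg → Subset n) λ A →
    (∀ e → 𝓕 (A e) ≡ true) ×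
    (∀ e x → (x ∈ A e) ⇔ (∃[ u ] (mem e u × φ u ≡ x)))
  where open Hypergraph G

HPlusFree : ∀ {n} → FinHypergraph → ℕ → Family n → Set
HPlusFree H k 𝓕 = ¬ ContainsCopy (expansion H k) 𝓕

IsJunta : ∀ {n} → ℕ → Subset n → Family n → Set
IsJunta k J 𝓙 =
  ∣ J ∣ < k ×
  (∀ A B → ∣ A ∣ ≡ k → ∣ B ∣ ≡ k → A ∩ J ≡ B ∩ J → 𝓙 A ≡ 𝓙 B)

-- Exponential without reals.
-- expSum k m = m! * Σ_{i ≤ m} k^i / i!   (a natural number)
expSum : ℕ → ℕ → ℕ
expSum k zero = 1
expSum k (suc m) = suc m * expSum k m + k ^ suc m

-- a * e^k ≤ b  (for natural a, b, k), since e^k = sup_m Σ_{i≤m} k^i/i!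
_*e^_≤_ : ℕ → ℕ → ℕ → Set
a *e^ k ≤ b = ∀ m → a * expSum k m ≤ b * (m !)

-- x ≤ max(e^{-k/C}, C k / n) · y   for C ≥ 1, n ≥ 1, natural x, y.
-- x ≤ e^{-k/C} y  ⇔  x^C e^k ≤ y^C ;  x ≤ (Ck/n) y  ⇔  x n ≤ C k y.
JuntaBound : (C n k x y : ℕ) → Set
JuntaBound C n k x y = ((x ^ C) *e^ k ≤ (y ^ C)) ⊎ (x * n ≤ C * k * y)

{-# OPTIONS --safe #-}
-- Write c for the number of vertices common to all edges of H, and p = k / n. A star
-- {A : T ⊆ A} with ∣T∣ = c + 1 is H⁺-free, so a junta has only to account for the members
-- of 𝓕 up to an error of order p^(c+2), or 2^(-k/C) p^(c+1).
--
-- Call a set S spread if its link in 𝓕 is dense and remains so after deleting the members that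
-- meet a few given points. By Russo's formula and Friedgut's form of the KKL inequality a spread
-- family reaches measure near 1 at a bias still O(k/n) when it is closed upwards, so spread
-- families contain rainbow matchings, whose kernel vertices can be chosen one at a time because
-- a dense family meets every large set in about the expected number of points. Hence disjoint
-- spread petals around few points extend to a copy of H⁺: in an H⁺-free family no set of at
-- most c points is the kernel of many spread petals. Branching over the blocking sets gives a
-- tree of bounded size with leaves of c + 1 points; those which still are kernels of many spread
-- petals are the centres of the junta.
--
-- Spread sets cover 𝓕 up to the error: for n ≤ 2^(O(k)) k because a link that is not spread has
-- a denser link inside it, and for larger n because the members not covered can be decoded from
-- few data, most of their points being determined by those already known.

module Submission where

-- The colouring with m colours dictates the biases: a colour class is a random set of bias 1/m, so
-- measures are compared at the constants 1/2m and 1/m, independent of k and n. Density (k/n)^r of a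
-- slice family survives the passage to 1/2m as a bound free of n, because the intersection of t
-- random sets of bias q has bias q^t, and the measure of an increasing family at q^t is at most the
-- t-th power of its measure at q. Spreadness is far weaker than pseudorandomness: the link of u + 1
-- points may exceed its expected share by a factor of order n/k. Hence a violation raises the
-- density by a power of n/k, and boundedly many rounds suffice. Yet compared with a link of u
-- fairly chosen points it bounds all degrees by a constant fraction, as deletions require. Fair
-- choice rests on an exponential tail for k-sets and so on densities at least 2^(-k/D). This splits
-- the proof at n = 4^X k, with X linear in k. Beyond, density increments may lead to sparser
-- families; but there any factor polynomial in k is negligible against 2^X, which is the room that
-- decoding needs.

-- Ordered arithmetic of the rationals.

module QOrd where
  open import Data.Nat as ℕ using (ℕ; zero; suc)
  import Data.Nat.Properties as ℕₚ
  open import Data.Rational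
  open import Data.Rational.Properties
  open import Relation.Binary.PropositionalEquality
  open import Tactic.RingSolver using (solve-∀)
  open import Tactic.RingSolver.Core.AlmostCommutativeRing using (AlmostCommutativeRing; fromCommutativeRing)
  open import Data.Maybe using (Maybe; just; nothing)
  open import Data.Sum using (inj₁; inj₂)
  open import Relation.Nullary using (yes; no)
  open import Data.Empty using (⊥-elim)
  open import Level using (0ℓ)

  ℚring : AlmostCommutativeRing 0ℓ 0ℓ
  ℚring = fromCommutativeRing +-*-commutativeRing zero?
    where
    zero? : ∀ x → Maybe (0ℚ ≡ x)
    zero? x with 0ℚ ≟ x
    ... | yes p = just p
    ... | no _ = nothing

  -- The pattern of nearly all inequalities over ℚ below: the difference is written as an expression
  -- built from visibly nonnegative parts with `_⊕_` and `_⊗_`, and the remaining identity is left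
  -- to the ring solver.
  slack : ∀ {a b} s → 0ℚ ≤ s → b ≡ a + s → a ≤ b
  slack {a} s s≥0 refl = subst (_≤ a + s) (+-identityʳ a) (+-monoʳ-≤ a s≥0)

  gap : ∀ {a b} → a ≤ b → 0ℚ ≤ b - a
  gap {a} {b} h = subst (_≤ b - a) (+-inverseʳ a) (+-monoˡ-≤ (- a) h)

  ungap : ∀ {a b} → 0ℚ ≤ b - a → a ≤ b
  ungap {a} {b} h = slack (b - a) h (eq a b)
    where
    eq : ∀ a b → b ≡ a + (b - a)
    eq = solve-∀ ℚring

  infixl 6 _⊕_
  infixl 7 _⊗_

  _⊕_ : ∀ {a b} → 0ℚ ≤ a → 0ℚ ≤ b → 0ℚ ≤ a + b
  _⊕_ = +-mono-≤ {0ℚ} {_} {0ℚ}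

  mulˡ : ∀ {a b} c → 0ℚ ≤ c → a ≤ b → c * a ≤ c * b
  mulˡ c h = *-monoˡ-≤-nonNeg c {{nonNegative h}}

  mulʳ : ∀ {a b} c → 0ℚ ≤ c → a ≤ b → a * c ≤ b * c
  mulʳ c h = *-monoʳ-≤-nonNeg c {{nonNegative h}}

  _⊗_ : ∀ {a b} → 0ℚ ≤ a → 0ℚ ≤ b → 0ℚ ≤ a * b
  _⊗_ {a} {b} h k = subst (_≤ a * b) (*-zeroʳ a) (mulˡ a h k)

  mul-mono : ∀ {a b c d} → 0ℚ ≤ a → 0ℚ ≤ d → a ≤ b → c ≤ d → a * c ≤ b * d
  mul-mono {a} {b} {c} {d} a≥0 d≥0 h k = ≤-trans (mulˡ a a≥0 k) (mulʳ d d≥0 h)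

  square≥0 : ∀ x → 0ℚ ≤ x * x
  square≥0 x with ≤-total 0ℚ x
  ... | inj₁ h = h ⊗ h
  ... | inj₂ h = subst (0ℚ ≤_) (eq x) (neg⊗ ⊗ neg⊗)
    where
    neg⊗ : 0ℚ ≤ 0ℚ - x
    neg⊗ = gap h
    eq : ∀ x → (0ℚ - x) * (0ℚ - x) ≡ x * x
    eq = solve-∀ ℚring

  0≤1 : 0ℚ ≤ 1ℚ
  0≤1 = square≥0 1ℚ

  ι : ℕ → ℚ
  ι zero = 0ℚ
  ι (suc n) = 1ℚ + ι n

  ι≥0 : ∀ n → 0ℚ ≤ ι n
  ι≥0 zero = ≤-refl
  ι≥0 (suc n) = 0≤1 ⊕ ι≥0 n

  ι-+ : ∀ m n → ι (m ℕ.+ n) ≡ ι m + ι n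
  ι-+ zero n = sym (+-identityˡ (ι n))
  ι-+ (suc m) n = trans (cong (1ℚ +_) (ι-+ m n)) (sym (+-assoc 1ℚ (ι m) (ι n)))

  ι-* : ∀ m n → ι (m ℕ.* n) ≡ ι m * ι n
  ι-* zero n = sym (*-zeroˡ (ι n))
  ι-* (suc m) n = trans (ι-+ n (m ℕ.* n)) (trans (cong (ι n +_) (ι-* m n)) (eq (ι m) (ι n)))
    where
    eq : ∀ x y → y + x * y ≡ (1ℚ + x) * y
    eq = solve-∀ ℚring

  ι-mono : ∀ {m n} → m ℕ.≤ n → ι m ≤ ι n
  ι-mono {n = n} ℕ.z≤n = ι≥0 n
  ι-mono (ℕ.s≤s h) = +-monoʳ-≤ 1ℚ (ι-mono h)

  0<1 : 0ℚ < 1ℚ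
  0<1 = positive⁻¹ 1ℚ

  ι-cancel : ∀ {m n} → ι m ≤ ι n → m ℕ.≤ n
  ι-cancel {m} {n} h with m ℕ.≤? n
  ... | yes p = p
  ... | no m≰n = ⊥-elim (<-irrefl refl (<-≤-trans bigger (≤-trans (ι-mono (ℕₚ.≰⇒> m≰n)) h)))
    where
    bigger : ι n < 1ℚ + ι n
    bigger = subst (_< 1ℚ + ι n) (+-identityˡ (ι n)) (+-monoˡ-< (ι n) 0<1)

  ι1+>0 : ∀ n → 0ℚ < ι (suc n)
  ι1+>0 n = <-≤-trans 0<1 (subst (_≤ 1ℚ + ι n) (+-identityʳ 1ℚ) (+-monoʳ-≤ 1ℚ (ι≥0 n)))

  -- The junk value at 0 is 1.
  recip : ℕ → ℚ
  recip n = 1/_ (ι (suc (ℕ.pred n))) {{>-nonZero (ι1+>0 (ℕ.pred n))}}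

  ι*recip : ∀ n → 1 ℕ.≤ n → ι n * recip n ≡ 1ℚ
  ι*recip (suc n) _ = *-inverseʳ (ι (suc n)) {{>-nonZero (ι1+>0 n)}}

  div-cancel : ∀ {a b} c → 0ℚ < c → c * a ≤ c * b → a ≤ b
  div-cancel c c>0 = *-cancelˡ-≤-pos c {{positive c>0}}

  recip≥0 : ∀ n → 0ℚ ≤ recip n
  recip≥0 zero = 0≤1
  recip≥0 (suc n) = div-cancel (ι (suc n)) (ι1+>0 n)
    (subst₂ _≤_ (sym (*-zeroʳ (ι (suc n)))) (sym (ι*recip (suc n) (ℕ.s≤s ℕ.z≤n))) 0≤1)

  infixr 8 _^_
  _^_ : ℚ → ℕ → ℚ
  x ^ zero = 1ℚ
  x ^ suc n = x * x ^ n

  ^≥0 : ∀ {x} n → 0ℚ ≤ x → 0ℚ ≤ x ^ n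
  ^≥0 zero h = 0≤1
  ^≥0 (suc n) h = h ⊗ ^≥0 n h

  ^-mono : ∀ {x y} n → 0ℚ ≤ x → x ≤ y → x ^ n ≤ y ^ n
  ^-mono zero _ _ = ≤-refl
  ^-mono (suc n) h k = mul-mono h (^≥0 n (≤-trans h k)) k (^-mono n h k)

  1≤^ : ∀ {x} n → 1ℚ ≤ x → 1ℚ ≤ x ^ n
  1≤^ zero h = ≤-refl
  1≤^ (suc n) h = mul-mono 0≤1 (≤-trans 0≤1 (1≤^ n h)) h (1≤^ n h)

  ^-+ : ∀ x m n → x ^ (m ℕ.+ n) ≡ x ^ m * x ^ n
  ^-+ x zero n = sym (*-identityˡ (x ^ n))
  ^-+ x (suc m) n = trans (cong (x *_) (^-+ x m n)) (sym (*-assoc x (x ^ m) (x ^ n)))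

  ^-*ᵈ : ∀ x y n → (x * y) ^ n ≡ x ^ n * y ^ n
  ^-*ᵈ x y zero = refl
  ^-*ᵈ x y (suc n) = trans (cong ((x * y) *_) (^-*ᵈ x y n)) (eq x y (x ^ n) (y ^ n))
    where
    eq : ∀ a b c d → a * b * (c * d) ≡ a * c * (b * d)
    eq = solve-∀ ℚring

  ^-* : ∀ x m n → x ^ (m ℕ.* n) ≡ (x ^ n) ^ m
  ^-* x zero n = refl
  ^-* x (suc m) n = trans (^-+ x n (m ℕ.* n)) (cong (x ^ n *_) (^-* x m n))

  ι-^ : ∀ m n → ι (m ℕ.^ n) ≡ ι m ^ n
  ι-^ m zero = refl
  ι-^ m (suc n) = trans (ι-* m (m ℕ.^ n)) (cong (ι m *_) (ι-^ m n))

  1^ : ∀ n → 1ℚ ^ n ≡ 1ℚ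
  1^ zero = refl
  1^ (suc n) = trans (*-identityˡ _) (1^ n)

  bernoulli : ∀ x n → 0ℚ ≤ x → x ≤ 1ℚ → 1ℚ - ι n * x ≤ (1ℚ - x) ^ n
  bernoulli x zero h k = slack 0ℚ ≤-refl (eq x)
    where
    eq : ∀ x → 1ℚ ≡ (1ℚ - 0ℚ * x) + 0ℚ
    eq = solve-∀ ℚring
  bernoulli x (suc n) h k = ≤-trans
    (slack (ι n * (x * x)) (ι≥0 n ⊗ square≥0 x) (eq x (ι n)))
    (mulˡ (1ℚ - x) (gap k) (bernoulli x n h k))
    where
    eq : ∀ x y → (1ℚ - x) * (1ℚ - y * x) ≡ (1ℚ - (1ℚ + y) * x) + y * (x * x)
    eq = solve-∀ ℚring

-- Biased measures on the discrete cube, influences and monotonicity.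

module Cube where
  open QOrd
  open import Data.Nat using (zero; suc)
  open import Data.Bool using (Bool; true; false; _≤_)
  open import Data.Fin using (Fin; zero; suc)
  open import Data.Fin.Subset using (Subset)
  open import Data.Vec using ([]; _∷_)
  open import Data.Rational hiding (_≤_)
  open import Data.Rational using () renaming (_≤_ to _≤ℚ_)
  open import Data.Rational.Properties
  open import Relation.Binary.PropositionalEquality
  open import Tactic.RingSolver using (solve-∀)
  open import Data.Product using (_×_; _,_)
  open import Data.Sum using (_⊎_; inj₁; inj₂)
  open import Data.Unit using (⊤; tt)

  -- E q f is the expectation of f at a random set to which every element belongs
  -- independently with probability q.

  E : ℚ → ∀ {n} → (Subset n → ℚ) → ℚ
  E q {zero} f = f []
  E q {suc n} f = q * E q (λ x → f (true ∷ x)) + (1ℚ - q) * E q (λ x → f (false ∷ x))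

  E-cong : ∀ q {n} {f g : Subset n → ℚ} → (∀ x → f x ≡ g x) → E q f ≡ E q g
  E-cong q {zero} h = h []
  E-cong q {suc n} h = cong₂ (λ a b → q * a + (1ℚ - q) * b)
    (E-cong q (λ x → h (true ∷ x))) (E-cong q (λ x → h (false ∷ x)))

  E-lin : ∀ q {n} a b (f g : Subset n → ℚ) →
    E q (λ x → a * f x + b * g x) ≡ a * E q f + b * E q g
  E-lin q {zero} a b f g = refl
  E-lin q {suc n} a b f g = trans
    (cong₂ (λ s t → q * s + (1ℚ - q) * t)
      (E-lin q a b (λ x → f (true ∷ x)) (λ x → g (true ∷ x)))
      (E-lin q a b (λ x → f (false ∷ x)) (λ x → g (false ∷ x))))
    (eq q a b (E q (λ x → f (true ∷ x))) (E q (λ x → g (true ∷ x)))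
      (E q (λ x → f (false ∷ x))) (E q (λ x → g (false ∷ x))))
    where
    eq : ∀ q a b s t u v → q * (a * s + b * t) + (1ℚ - q) * (a * u + b * v)
      ≡ a * (q * s + (1ℚ - q) * u) + b * (q * t + (1ℚ - q) * v)
    eq = solve-∀ ℚring

  E-const : ∀ q {n} c → E q {n} (λ _ → c) ≡ c
  E-const q {zero} c = refl
  E-const q {suc n} c = trans (cong₂ (λ s t → q * s + (1ℚ - q) * t) (E-const q {n} c) (E-const q {n} c)) (eq q c)
    where
    eq : ∀ q c → q * c + (1ℚ - q) * c ≡ c
    eq = solve-∀ ℚring

  module _ {q : ℚ} (q≥0 : 0ℚ ≤ℚ q) (q≤1 : q ≤ℚ 1ℚ) where

    E-mono : ∀ {n} {f g : Subset n → ℚ} → (∀ x → f x ≤ℚ g x) → E q f ≤ℚ E q g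
    E-mono {zero} h = h []
    E-mono {suc n} h = +-mono-≤ (mulˡ q q≥0 (E-mono (λ x → h (true ∷ x))))
      (mulˡ (1ℚ - q) (gap q≤1) (E-mono (λ x → h (false ∷ x))))

    E≥0 : ∀ {n} {f : Subset n → ℚ} → (∀ x → 0ℚ ≤ℚ f x) → 0ℚ ≤ℚ E q f
    E≥0 {n} {f} h = subst (λ z → z ≤ℚ E q f) (E-const q {n} 0ℚ) (E-mono h)

  𝟙 : Bool → ℚ
  𝟙 true = 1ℚ
  𝟙 false = 0ℚ

  𝟙≥0 : ∀ b → 0ℚ ≤ℚ 𝟙 b
  𝟙≥0 true = 0≤1
  𝟙≥0 false = ≤-refl

  𝟙≤1 : ∀ b → 𝟙 b ≤ℚ 1ℚ
  𝟙≤1 true = ≤-refl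
  𝟙≤1 false = 0≤1

  -- Monotonicity in each coordinate separately, split along the first one, so that inductions on
  -- the dimension can take it apart.
  Mono : ∀ {n} → (Subset n → Bool) → Set
  Mono {zero} F = ⊤
  Mono {suc n} F = (∀ x → F (false ∷ x) ≤ F (true ∷ x)) ×
    Mono (λ x → F (true ∷ x)) × Mono (λ x → F (false ∷ x))

  -- The derivative in direction i stays a function on the whole cube, constant in coordinate i. For
  -- an increasing indicator it is the indicator that i is pivotal.
  Δ : ∀ {n} → Fin n → (Subset n → ℚ) → Subset n → ℚ
  Δ zero f (b ∷ x) = f (true ∷ x) - f (false ∷ x)
  Δ (suc i) f (b ∷ x) = Δ i (λ y → f (b ∷ y)) x

  𝟙-mono : ∀ {a b} → a ≤ b → 𝟙 a ≤ℚ 𝟙 b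
  𝟙-mono Data.Bool.b≤b = ≤-refl
  𝟙-mono Data.Bool.f≤t = 0≤1

  private
    𝟙-jump : ∀ {a b} → a ≤ b → (𝟙 b - 𝟙 a ≡ 0ℚ) ⊎ (𝟙 b - 𝟙 a ≡ 1ℚ)
    𝟙-jump {true} Data.Bool.b≤b = inj₁ refl
    𝟙-jump {false} Data.Bool.b≤b = inj₁ refl
    𝟙-jump Data.Bool.f≤t = inj₂ refl

  Δ-01 : ∀ {n} (F : Subset n → Bool) → Mono F → ∀ i x →
    (Δ i (λ y → 𝟙 (F y)) x ≡ 0ℚ) ⊎ (Δ i (λ y → 𝟙 (F y)) x ≡ 1ℚ)
  Δ-01 F (m , _) zero (b ∷ x) = 𝟙-jump (m x)
  Δ-01 F (_ , m , _) (suc i) (true ∷ x) = Δ-01 (λ y → F (true ∷ y)) m i x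
  Δ-01 F (_ , _ , m) (suc i) (false ∷ x) = Δ-01 (λ y → F (false ∷ y)) m i x

  Σf : ∀ {n} → (Fin n → ℚ) → ℚ
  Σf {zero} a = 0ℚ
  Σf {suc n} a = a zero + Σf (λ i → a (suc i))

  Σf-cong : ∀ {n} {a b : Fin n → ℚ} → (∀ i → a i ≡ b i) → Σf a ≡ Σf b
  Σf-cong {zero} h = refl
  Σf-cong {suc n} h = cong₂ _+_ (h zero) (Σf-cong (λ i → h (suc i)))

  Σf-mono : ∀ {n} {a b : Fin n → ℚ} → (∀ i → a i ≤ℚ b i) → Σf a ≤ℚ Σf b
  Σf-mono {zero} h = ≤-refl
  Σf-mono {suc n} h = +-mono-≤ (h zero) (Σf-mono (λ i → h (suc i)))

  Σf-lin : ∀ {n} x y (a b : Fin n → ℚ) → Σf (λ i → x * a i + y * b i) ≡ x * Σf a + y * Σf b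
  Σf-lin {zero} x y a b = eq x y
    where
    eq : ∀ x y → 0ℚ ≡ x * 0ℚ + y * 0ℚ
    eq = solve-∀ ℚring
  Σf-lin {suc n} x y a b = trans (cong (x * a zero + y * b zero +_) (Σf-lin x y (λ i → a (suc i)) (λ i → b (suc i))))
    (eq x y (a zero) (b zero) _ _)
    where
    eq : ∀ x y s t u v → x * s + y * t + (x * u + y * v) ≡ x * (s + u) + y * (t + v)
    eq = solve-∀ ℚring

  Σf≥0 : ∀ {n} {a : Fin n → ℚ} → (∀ i → 0ℚ ≤ℚ a i) → 0ℚ ≤ℚ Σf a
  Σf≥0 {zero} h = ≤-refl
  Σf≥0 {suc n} h = h zero ⊕ Σf≥0 (λ i → h (suc i))

  -- By Russo's formula the derivative of `E q f` in `q`; for an increasing indicator, the total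
  -- influence.
  infl : ℚ → ∀ {n} → (Subset n → ℚ) → ℚ
  infl q f = Σf (λ i → E q (Δ i f))

  -- Z J f is the expectation of f at a random set from which J is removed.
  Z : ℚ → ∀ {n} → Subset n → (Subset n → ℚ) → ℚ
  Z q [] f = f []
  Z q (true ∷ J) f = Z q J (λ x → f (false ∷ x))
  Z q (false ∷ J) f = q * Z q J (λ x → f (true ∷ x)) + (1ℚ - q) * Z q J (λ x → f (false ∷ x))

  Z-lin : ∀ q {n} J a b (f g : Subset n → ℚ) → Z q J (λ x → a * f x + b * g x) ≡ a * Z q J f + b * Z q J g
  Z-lin q [] a b f g = refl
  Z-lin q (true ∷ J) a b f g = Z-lin q J a b (λ x → f (false ∷ x)) (λ x → g (false ∷ x))
  Z-lin q (false ∷ J) a b f g = trans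
    (cong₂ (λ s t → q * s + (1ℚ - q) * t)
      (Z-lin q J a b (λ x → f (true ∷ x)) (λ x → g (true ∷ x)))
      (Z-lin q J a b (λ x → f (false ∷ x)) (λ x → g (false ∷ x))))
    (eq q a b (Z q J (λ x → f (true ∷ x))) (Z q J (λ x → g (true ∷ x)))
      (Z q J (λ x → f (false ∷ x))) (Z q J (λ x → g (false ∷ x))))
    where
    eq : ∀ q a b s t u v → q * (a * s + b * t) + (1ℚ - q) * (a * u + b * v)
      ≡ a * (q * s + (1ℚ - q) * u) + b * (q * t + (1ℚ - q) * v)
    eq = solve-∀ ℚring

  Z-mono : ∀ {q} → 0ℚ ≤ℚ q → q ≤ℚ 1ℚ → ∀ {n} J {f g : Subset n → ℚ} → (∀ x → f x ≤ℚ g x) → Z q J f ≤ℚ Z q J g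
  Z-mono q≥0 q≤1 [] h = h []
  Z-mono q≥0 q≤1 (true ∷ J) h = Z-mono q≥0 q≤1 J (λ x → h (false ∷ x))
  Z-mono {q} q≥0 q≤1 (false ∷ J) h = +-mono-≤ (mulˡ q q≥0 (Z-mono q≥0 q≤1 J (λ x → h (true ∷ x))))
      (mulˡ (1ℚ - q) (gap q≤1) (Z-mono q≥0 q≤1 J (λ x → h (false ∷ x))))

  Increasing : ∀ {n} → (Subset n → ℚ) → Set
  Increasing {zero} f = ⊤
  Increasing {suc n} f = (∀ x → f (false ∷ x) ≤ℚ f (true ∷ x)) ×
    Increasing (λ x → f (true ∷ x)) × Increasing (λ x → f (false ∷ x))

  Increasing-𝟙 : ∀ {n} (F : Subset n → Bool) → Mono F → Increasing (λ x → 𝟙 (F x))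
  Increasing-𝟙 {zero} F m = tt
  Increasing-𝟙 {suc n} F (m , mt , mf) = (λ x → 𝟙-mono (m x)) , Increasing-𝟙 _ mt , Increasing-𝟙 _ mf

  Increasing-lin : ∀ {n a b} {f g : Subset n → ℚ} → 0ℚ ≤ℚ a → 0ℚ ≤ℚ b → Increasing f → Increasing g →
    Increasing (λ x → a * f x + b * g x)
  Increasing-lin {zero} _ _ _ _ = tt
  Increasing-lin {suc n} {a} {b} a≥0 b≥0 (h , ht , hf) (k , kt , kf) =
    (λ x → +-mono-≤ (mulˡ a a≥0 (h x)) (mulˡ b b≥0 (k x))) ,
    Increasing-lin a≥0 b≥0 ht kt , Increasing-lin a≥0 b≥0 hf kf

  E-bias : ∀ {q q'} → 0ℚ ≤ℚ q → q ≤ℚ q' → q' ≤ℚ 1ℚ → ∀ {n} {f : Subset n → ℚ} → Increasing f → E q f ≤ℚ E q' f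
  E-bias h k l {zero} m = ≤-refl
  E-bias {q} {q'} h k l {suc n} {f} (m , mt , mf) = slack _
    (≤-trans h k ⊗ gap (E-bias h k l mt) ⊕ gap l ⊗ gap (E-bias h k l mf)
      ⊕ gap k ⊗ gap (E-mono h (≤-trans k l) m))
    (eq q q' (E q (λ x → f (true ∷ x))) (E q (λ x → f (false ∷ x))) (E q' (λ x → f (true ∷ x))) (E q' (λ x → f (false ∷ x))))
    where
    eq : ∀ q q' a b a' b' → q' * a' + (1ℚ - q') * b' ≡ q * a + (1ℚ - q) * b
      + (q' * (a' - a) + (1ℚ - q') * (b' - b) + (q' - q) * (a - b))
    eq = solve-∀ ℚring

  Z-bias : ∀ {q q'} → 0ℚ ≤ℚ q → q ≤ℚ q' → q' ≤ℚ 1ℚ → ∀ {n} J {f : Subset n → ℚ} → Increasing f → Z q J f ≤ℚ Z q' J f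
  Z-bias h k l [] m = ≤-refl
  Z-bias h k l (true ∷ J) (m , mt , mf) = Z-bias h k l J mf
  Z-bias {q} {q'} h k l (false ∷ J) {f} (m , mt , mf) = slack _
    (≤-trans h k ⊗ gap (Z-bias h k l J mt) ⊕ gap l ⊗ gap (Z-bias h k l J mf)
      ⊕ gap k ⊗ gap (Z-mono h (≤-trans k l) J m))
    (eq q q' (Z q J (λ x → f (true ∷ x))) (Z q J (λ x → f (false ∷ x))) (Z q' J (λ x → f (true ∷ x))) (Z q' J (λ x → f (false ∷ x))))
    where
    eq : ∀ q q' a b a' b' → q' * a' + (1ℚ - q') * b' ≡ q * a + (1ℚ - q) * b
      + (q' * (a' - a) + (1ℚ - q') * (b' - b) + (q' - q) * (a - b))
    eq = solve-∀ ℚring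

  infl≥0 : ∀ {q} → 0ℚ ≤ℚ q → q ≤ℚ 1ℚ → ∀ {n} (F : Subset n → Bool) → Mono F → ∀ i → 0ℚ ≤ℚ E q (Δ i (λ y → 𝟙 (F y)))
  infl≥0 h k F m i = E≥0 h k (λ x → nonneg (Δ-01 F m i x))
    where
    nonneg : ∀ {y} → (y ≡ 0ℚ) ⊎ (y ≡ 1ℚ) → 0ℚ ≤ℚ y
    nonneg (inj₁ refl) = ≤-refl
    nonneg (inj₂ refl) = 0≤1

-- Hypercontractivity for biased measures and Friedgut's junta theorem.

module KKL where
  open QOrd
  open Cube
  open import Data.Nat using (ℕ; zero; suc)
  open import Data.Bool using (Bool; true; false)
  open import Data.Fin using (Fin; zero; suc)
  open import Data.Fin.Subset using (Subset)
  open import Data.Vec using ([]; _∷_; lookup)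
  open import Data.Rational
  open import Data.Rational.Properties
  open import Relation.Binary.PropositionalEquality
  open import Tactic.RingSolver using (solve-∀)
  open import Data.Product using (_,_)
  open import Data.Sum using (_⊎_; inj₁; inj₂)

  -- The conditional expectation of `f` given the coordinates in `J`.
  M : ℚ → ∀ {n} → Subset n → (Subset n → ℚ) → Subset n → ℚ
  M q [] f x = f x
  M q (true ∷ J) f (b ∷ x) = M q J (λ y → f (b ∷ y)) x
  M q (false ∷ J) f (b ∷ x) = M q J (λ y → q * f (true ∷ y) + (1ℚ - q) * f (false ∷ y)) x

  -- T damps the Fourier coefficient of a set S by the factor ρ ^ |S|, where ρ * R ≡ 1.
  module Noise (q ρ R : ℚ) (q≥0 : 0ℚ ≤ q) (q≤1 : q ≤ 1ℚ) (ρ≥0 : 0ℚ ≤ ρ) (R≥1 : 1ℚ ≤ R)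
    (ρR : ρ * R ≡ 1ℚ) (ρ² : (1ℚ + 1ℚ + 1ℚ) * (ρ * ρ) + ρ * ρ * ρ ≤ 1ℚ)
    (ρ³ : (1ℚ + 1ℚ + 1ℚ) * (ρ * ρ * ρ) ≤ q * (1ℚ - q)) where

    v : ℚ
    v = q * (1ℚ - q)

    v≥0 : 0ℚ ≤ v
    v≥0 = q≥0 ⊗ gap q≤1

    A D : ∀ {n} → (Subset (suc n) → ℚ) → Subset n → ℚ
    A f x = q * f (true ∷ x) + (1ℚ - q) * f (false ∷ x)
    D f x = f (true ∷ x) - f (false ∷ x)

    -- The biased character of one coordinate, of mean 0 and variance `v`: `f (b ∷ x)` equals
    -- `A f x + χ b * D f x`, and the noise operator multiplies the second summand by `ρ`.
    χ : Bool → ℚ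
    χ true = 1ℚ - q
    χ false = 0ℚ - q

    T : ∀ {n} → (Subset n → ℚ) → Subset n → ℚ
    T {zero} f x = f x
    T {suc n} f (b ∷ x) = T (A f) x + ρ * χ b * T (D f) x

    T-cong : ∀ {n} {f g : Subset n → ℚ} → (∀ x → f x ≡ g x) → ∀ x → T f x ≡ T g x
    T-cong {zero} h x = h x
    T-cong {suc n} h (b ∷ x) = cong₂ (λ s t → s + ρ * χ b * t)
      (T-cong (λ y → cong₂ (λ s t → q * s + (1ℚ - q) * t) (h (true ∷ y)) (h (false ∷ y))) x)
      (T-cong (λ y → cong₂ _-_ (h (true ∷ y)) (h (false ∷ y))) x)

    N S : ∀ {n} → (Subset n → ℚ) → ℚ
    N f = E q (λ x → f x * f x)
    S f = E q (λ x → f x * T f x)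

    N-cong : ∀ {n} {f g : Subset n → ℚ} → (∀ x → f x ≡ g x) → N f ≡ N g
    N-cong h = E-cong q (λ x → cong₂ _*_ (h x) (h x))

    S-cong : ∀ {n} {f g : Subset n → ℚ} → (∀ x → f x ≡ g x) → S f ≡ S g
    S-cong h = E-cong q (λ x → cong₂ _*_ (h x) (T-cong h x))

    N-step : ∀ {n} (f : Subset (suc n) → ℚ) → N f ≡ N (A f) + v * N (D f)
    N-step {n} f = begin
      N f ≡⟨ E-lin q {n} q (1ℚ - q) _ _ ⟨
      E q (λ x → q * (f (true ∷ x) * f (true ∷ x)) + (1ℚ - q) * (f (false ∷ x) * f (false ∷ x)))
        ≡⟨ E-cong q (λ x → eq q (f (true ∷ x)) (f (false ∷ x))) ⟩
      E q (λ x → 1ℚ * (A f x * A f x) + v * (D f x * D f x)) ≡⟨ E-lin q {n} 1ℚ v _ _ ⟩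
      1ℚ * N (A f) + v * N (D f) ≡⟨ cong (_+ v * N (D f)) (*-identityˡ (N (A f))) ⟩
      N (A f) + v * N (D f) ∎
      where
      open ≡-Reasoning
      eq : ∀ q x y → q * (x * x) + (1ℚ - q) * (y * y) ≡
        1ℚ * ((q * x + (1ℚ - q) * y) * (q * x + (1ℚ - q) * y)) + q * (1ℚ - q) * ((x - y) * (x - y))
      eq = solve-∀ ℚring

    S-step : ∀ {n} (f : Subset (suc n) → ℚ) → S f ≡ S (A f) + ρ * v * S (D f)
    S-step {n} f = begin
      S f ≡⟨ E-lin q {n} q (1ℚ - q) _ _ ⟨
      E q (λ x → q * (f (true ∷ x) * (T (A f) x + ρ * χ true * T (D f) x))
        + (1ℚ - q) * (f (false ∷ x) * (T (A f) x + ρ * χ false * T (D f) x)))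
        ≡⟨ E-cong q (λ x → eq q ρ (f (true ∷ x)) (f (false ∷ x)) (T (A f) x) (T (D f) x)) ⟩
      E q (λ x → 1ℚ * (A f x * T (A f) x) + ρ * v * (D f x * T (D f) x)) ≡⟨ E-lin q {n} 1ℚ (ρ * v) _ _ ⟩
      1ℚ * S (A f) + ρ * v * S (D f) ≡⟨ cong (_+ ρ * v * S (D f)) (*-identityˡ (S (A f))) ⟩
      S (A f) + ρ * v * S (D f) ∎
      where
      open ≡-Reasoning
      eq : ∀ q ρ x y s t → q * (x * (s + ρ * (1ℚ - q) * t)) + (1ℚ - q) * (y * (s + ρ * (0ℚ - q) * t)) ≡
        1ℚ * ((q * x + (1ℚ - q) * y) * s) + ρ * (q * (1ℚ - q)) * ((x - y) * t)
      eq = solve-∀ ℚring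

    N≥0 : ∀ {n} (f : Subset n → ℚ) → 0ℚ ≤ N f
    N≥0 f = E≥0 q≥0 q≤1 (λ x → square≥0 (f x))

    S≥0 : ∀ {n} (f : Subset n → ℚ) → 0ℚ ≤ S f
    S≥0 {zero} f = square≥0 (f [])
    S≥0 {suc n} f = subst (0ℚ ≤_) (sym (S-step f)) (S≥0 (A f) ⊕ (ρ≥0 ⊗ v≥0) ⊗ S≥0 (D f))

    H : ∀ {n} → (Subset n → ℚ) → (Subset n → ℚ) → ℚ
    H f g = E q (λ x → T f x * T f x * (T g x * T g x))

    -- For f ≡ g this is hypercontractivity from L² to L⁴; the version for two
    -- functions is the one that goes through by induction on the dimension.
    hypercontractive : ∀ {n} (f g : Subset n → ℚ) → H f g ≤ N f * N g
    hypercontractive {zero} f g = ≤-refl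
    hypercontractive {suc n} f g = begin
      H f g ≡⟨ E-lin q {n} q (1ℚ - q) _ _ ⟨
      E q (λ x → q * (sq (a x + ρ * χ true * b x) * sq (c x + ρ * χ true * d x))
        + (1ℚ - q) * (sq (a x + ρ * χ false * b x) * sq (c x + ρ * χ false * d x)))
        ≤⟨ E-mono q≥0 q≤1 (λ x → pointwise (a x) (b x) (c x) (d x)) ⟩
      E q (λ x → 1ℚ * (1ℚ * (sq (a x) * sq (c x)) + v * (sq (a x) * sq (d x)))
        + 1ℚ * (v * (sq (b x) * sq (c x)) + v * v * (sq (b x) * sq (d x))))
        ≡⟨ E-lin q {n} 1ℚ 1ℚ _ _ ⟩
      1ℚ * E q (λ x → 1ℚ * (sq (a x) * sq (c x)) + v * (sq (a x) * sq (d x)))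
        + 1ℚ * E q (λ x → v * (sq (b x) * sq (c x)) + v * v * (sq (b x) * sq (d x)))
        ≡⟨ cong₂ (λ s t → 1ℚ * s + 1ℚ * t) (E-lin q {n} 1ℚ v _ _) (E-lin q {n} v (v * v) _ _) ⟩
      1ℚ * (1ℚ * H (A f) (A g) + v * H (A f) (D g)) + 1ℚ * (v * H (D f) (A g) + v * v * H (D f) (D g))
        ≤⟨ +-mono-≤ (mulˡ 1ℚ 0≤1 (+-mono-≤ (mulˡ 1ℚ 0≤1 (hypercontractive (A f) (A g))) (mulˡ v v≥0 (hypercontractive (A f) (D g)))))
             (mulˡ 1ℚ 0≤1 (+-mono-≤ (mulˡ v v≥0 (hypercontractive (D f) (A g))) (mulˡ (v * v) (v≥0 ⊗ v≥0) (hypercontractive (D f) (D g))))) ⟩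
      1ℚ * (1ℚ * (N (A f) * N (A g)) + v * (N (A f) * N (D g))) + 1ℚ * (v * (N (D f) * N (A g)) + v * v * (N (D f) * N (D g)))
        ≡⟨ eq v (N (A f)) (N (D f)) (N (A g)) (N (D g)) ⟩
      (N (A f) + v * N (D f)) * (N (A g) + v * N (D g)) ≡⟨ cong₂ _*_ (N-step f) (N-step g) ⟨
      N f * N g ∎
      where
      open ≤-Reasoning
      a b c d : Subset n → ℚ
      a = T (A f)
      b = T (D f)
      c = T (A g)
      d = T (D g)
      sq : ℚ → ℚ
      sq x = x * x
      eq : ∀ v a b c d → 1ℚ * (1ℚ * (a * c) + v * (a * d)) + 1ℚ * (v * (b * c) + v * v * (b * d)) ≡ (a + v * b) * (c + v * d)
      eq = solve-∀ ℚring
      -- The one-coordinate inequality as an identity with nonnegative remainder. The mixed term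
      -- abcd is turned into (ad - bc)². The third moment v((1 - q) - q) of `χ` has no sign, so its
      -- two parts are absorbed separately by squares such as (a - b)² and (a + b)². The hypotheses
      -- `ρ²` and `ρ³` pay for what these squares cost.
      slackness : ∀ q ρ a b c d →
        1ℚ * (1ℚ * (a * a * (c * c)) + q * (1ℚ - q) * (a * a * (d * d)))
          + 1ℚ * (q * (1ℚ - q) * (b * b * (c * c)) + q * (1ℚ - q) * (q * (1ℚ - q)) * (b * b * (d * d)))
        ≡ (q * ((a + ρ * (1ℚ - q) * b) * (a + ρ * (1ℚ - q) * b) * ((c + ρ * (1ℚ - q) * d) * (c + ρ * (1ℚ - q) * d)))
          + (1ℚ - q) * ((a + ρ * (0ℚ - q) * b) * (a + ρ * (0ℚ - q) * b) * ((c + ρ * (0ℚ - q) * d) * (c + ρ * (0ℚ - q) * d))))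
        + (q * (1ℚ - q) * ((1ℚ - ((1ℚ + 1ℚ + 1ℚ) * (ρ * ρ) + ρ * ρ * ρ)) * (a * a * (d * d) + b * b * (c * c)))
          + (1ℚ + 1ℚ) * (ρ * ρ) * (q * (1ℚ - q)) * ((a * d - b * c) * (a * d - b * c))
          + ρ * ρ * ρ * (q * (1ℚ - q)) * (1ℚ - q) * (d * d * ((a - b) * (a - b)) + b * b * ((c - d) * (c - d)))
          + ρ * ρ * ρ * (q * (1ℚ - q)) * q * (d * d * ((a + b) * (a + b)) + b * b * ((c + d) * (c + d)))
          + q * (1ℚ - q) * (q * (1ℚ - q) - (1ℚ + 1ℚ + 1ℚ) * (ρ * ρ * ρ)) * (b * b * (d * d))
          + ρ * ρ * ρ * (q * (1ℚ - q)) * (1ℚ - ρ * ((1ℚ - q) * (1ℚ - q) * (1ℚ - q) + q * q * q)) * (b * b * (d * d)))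
      slackness = solve-∀ ℚring
      cubes : ∀ q ρ → 1ℚ - ρ * ((1ℚ - q) * (1ℚ - q) * (1ℚ - q) + q * q * q) ≡ (1ℚ - ρ) + ρ * ((1ℚ + 1ℚ + 1ℚ) * (q * (1ℚ - q)))
      cubes = solve-∀ ℚring
      ρ≤1 : ρ ≤ 1ℚ
      ρ≤1 = subst₂ _≤_ (*-identityʳ ρ) ρR (mulˡ ρ ρ≥0 R≥1)
      ρ³≥0 : 0ℚ ≤ ρ * ρ * ρ
      ρ³≥0 = ρ≥0 ⊗ ρ≥0 ⊗ ρ≥0
      □ = square≥0
      pointwise : ∀ a b c d →
        q * (sq (a + ρ * χ true * b) * sq (c + ρ * χ true * d)) + (1ℚ - q) * (sq (a + ρ * χ false * b) * sq (c + ρ * χ false * d))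
        ≤ 1ℚ * (1ℚ * (sq a * sq c) + v * (sq a * sq d)) + 1ℚ * (v * (sq b * sq c) + v * v * (sq b * sq d))
      pointwise a b c d = slack _
        (v≥0 ⊗ (gap ρ² ⊗ (□ a ⊗ □ d ⊕ □ b ⊗ □ c))
          ⊕ (0≤1 ⊕ 0≤1) ⊗ □ ρ ⊗ v≥0 ⊗ □ (a * d - b * c)
          ⊕ ρ³≥0 ⊗ v≥0 ⊗ gap q≤1 ⊗ (□ d ⊗ □ (a - b) ⊕ □ b ⊗ □ (c - d))
          ⊕ ρ³≥0 ⊗ v≥0 ⊗ q≥0 ⊗ (□ d ⊗ □ (a + b) ⊕ □ b ⊗ □ (c + d))
          ⊕ v≥0 ⊗ gap ρ³ ⊗ (□ b ⊗ □ d)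
          ⊕ ρ³≥0 ⊗ v≥0 ⊗ subst (0ℚ ≤_) (sym (cubes q ρ)) (gap ρ≤1 ⊕ ρ≥0 ⊗ ((0≤1 ⊕ 0≤1 ⊕ 0≤1) ⊗ v≥0)) ⊗ (□ b ⊗ □ d))
        (slackness q ρ a b c d)

    W : ∀ {n} → Subset n → (Subset n → ℚ) → ℚ
    W J f = N (M q J f)

    M-cong : ∀ {n} J {f g : Subset n → ℚ} → (∀ x → f x ≡ g x) → ∀ x → M q J f x ≡ M q J g x
    M-cong [] h x = h x
    M-cong (true ∷ J) h (b ∷ x) = M-cong J (λ y → h (b ∷ y)) x
    M-cong (false ∷ J) h (b ∷ x) = M-cong J (λ y → cong₂ (λ s t → q * s + (1ℚ - q) * t) (h (true ∷ y)) (h (false ∷ y))) x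

    M-lin : ∀ {n} J a b (f g : Subset n → ℚ) x → M q J (λ y → a * f y + b * g y) x ≡ a * M q J f x + b * M q J g x
    M-lin [] a b f g x = refl
    M-lin (true ∷ J) a b f g (c ∷ x) = M-lin J a b (λ y → f (c ∷ y)) (λ y → g (c ∷ y)) x
    M-lin (false ∷ J) a b f g (c ∷ x) = trans
      (M-cong J (λ y → eq q a b (f (true ∷ y)) (f (false ∷ y)) (g (true ∷ y)) (g (false ∷ y))) x)
      (M-lin J a b (A f) (A g) x)
      where
      eq : ∀ q a b s t u v → q * (a * s + b * u) + (1ℚ - q) * (a * t + b * v) ≡ a * (q * s + (1ℚ - q) * t) + b * (q * u + (1ℚ - q) * v)
      eq = solve-∀ ℚring

    W-step-in : ∀ {n} J (f : Subset (suc n) → ℚ) → W (true ∷ J) f ≡ W J (A f) + v * W J (D f)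
    W-step-in J f = trans (N-step (M q (true ∷ J) f)) (cong₂ (λ s t → s + v * t)
      (N-cong (λ x → sym (M-lin J q (1ℚ - q) (λ y → f (true ∷ y)) (λ y → f (false ∷ y)) x)))
      (N-cong (λ x → trans (eq (M q J (λ y → f (true ∷ y)) x) (M q J (λ y → f (false ∷ y)) x)) (trans (sym (M-lin J 1ℚ (- 1ℚ) (λ y → f (true ∷ y)) (λ y → f (false ∷ y)) x))
        (M-cong J (λ y → sym (eq (f (true ∷ y)) (f (false ∷ y)))) x)))))
      where
      eq : ∀ s t → s - t ≡ 1ℚ * s + (- 1ℚ) * t
      eq = solve-∀ ℚring

    W-step-out : ∀ {n} J (f : Subset (suc n) → ℚ) → W (false ∷ J) f ≡ W J (A f)
    W-step-out J f = eq q (W J (A f))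
      where
      eq : ∀ q x → q * x + (1ℚ - q) * x ≡ x
      eq = solve-∀ ℚring

    W≥0 : ∀ {n} J (f : Subset n → ℚ) → 0ℚ ≤ W J f
    W≥0 J f = N≥0 (M q J f)

    -- In Fourier terms `I f` weighs the squared coefficient of a set S by its size, `W J f` keeps
    -- the sets S inside J, and `Γ J f` weighs S by the number of its points outside J times ρ^(∣S∣
    -- - 1). The recursive form suits induction on the dimension; `I-Σ` and `Γ-Σ` recover sums over
    -- coordinates.
    I : ∀ {n} → (Subset n → ℚ) → ℚ
    I {zero} f = 0ℚ
    I {suc n} f = I (A f) + v * (I (D f) + N (D f))

    Γ : ∀ {n} → Subset n → (Subset n → ℚ) → ℚ
    Γ [] f = 0ℚ
    Γ (true ∷ J) f = Γ J (A f) + ρ * v * Γ J (D f)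
    Γ (false ∷ J) f = v * S (D f) + (Γ J (A f) + ρ * v * Γ J (D f))

    I≥0 : ∀ {n} (f : Subset n → ℚ) → 0ℚ ≤ I f
    I≥0 {zero} f = ≤-refl
    I≥0 {suc n} f = I≥0 (A f) ⊕ v≥0 ⊗ (I≥0 (D f) ⊕ N≥0 (D f))

    Γ≥0 : ∀ {n} J (f : Subset n → ℚ) → 0ℚ ≤ Γ J f
    Γ≥0 [] f = ≤-refl
    Γ≥0 (true ∷ J) f = Γ≥0 J (A f) ⊕ ρ≥0 ⊗ v≥0 ⊗ Γ≥0 J (D f)
    Γ≥0 (false ∷ J) f = v≥0 ⊗ S≥0 (D f) ⊕ (Γ≥0 J (A f) ⊕ ρ≥0 ⊗ v≥0 ⊗ Γ≥0 J (D f))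

    β : ℕ → ℚ
    β d = ι d * R ^ d

    R≥0 : 0ℚ ≤ R
    R≥0 = ≤-trans 0≤1 R≥1

    β≥0 : ∀ d → 0ℚ ≤ β d
    β≥0 d = ι≥0 d ⊗ ^≥0 d R≥0

    β-ρ : ∀ d → β (suc d) * ρ ≡ (1ℚ + ι d) * R ^ d
    β-ρ d = trans (eq ρ R (ι d) (R ^ d)) (trans (cong (λ z → (1ℚ + ι d) * R ^ d * z) ρR) (*-identityʳ _))
      where
      eq : ∀ ρ R x y → (1ℚ + x) * (R * y) * ρ ≡ (1ℚ + x) * y * (ρ * R)
      eq = solve-∀ ℚring

    ι≤β : ∀ d → ι d ≤ β d
    ι≤β d = subst (_≤ β d) (*-identityʳ (ι d)) (mulˡ (ι d) (ι≥0 d) (1≤^ d R≥1))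

    -- A Fourier coefficient of level at least d is paid for by I, a lower one by S.
    low-high : ∀ {n} d (f : Subset n → ℚ) → ι d * N f ≤ I f + β d * S f
    low-high {zero} d f = slack ((β d - ι d) * (f [] * f [])) (gap (ι≤β d) ⊗ square≥0 (f [])) (eq (β d) (ι d) (f [] * f []))
      where
      eq : ∀ a b x → 0ℚ + a * x ≡ b * x + (a - b) * x
      eq = solve-∀ ℚring
    low-high {suc n} zero f = slack (I f) (I≥0 f) (eq (N f) (I f) (S f))
      where
      eq : ∀ a b c → b + 0ℚ * 1ℚ * c ≡ 0ℚ * a + b
      eq = solve-∀ ℚring
    low-high {suc n} (suc d) f = slack _
      (gap (low-high (suc d) (A f)) ⊕ v≥0 ⊗ gap (low-high d (D f)) ⊕ v≥0 ⊗ ^≥0 d R≥0 ⊗ S≥0 (D f))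
      (trans (cong (λ z → I f + β (suc d) * z) (S-step f))
        (trans (eq₁ (I f) (β (suc d)) ρ v (S (A f)) (S (D f)))
        (trans (cong (λ z → I f + (β (suc d) * S (A f) + z * (v * S (D f)))) (β-ρ d))
        (trans (eq₂ (I (A f)) (I (D f)) (N (A f)) (N (D f)) (S (A f)) (S (D f)) v (ι d) (R ^ d) (β (suc d)))
          (cong (λ z → (1ℚ + ι d) * z + (I (A f) + β (suc d) * S (A f) - (1ℚ + ι d) * N (A f) + v * (I (D f) + β d * S (D f) - ι d * N (D f)) + v * R ^ d * S (D f))) (sym (N-step f)) )))))
      where
      eq₁ : ∀ i b ρ v x y → i + b * (x + ρ * v * y) ≡ i + (b * x + b * ρ * (v * y))
      eq₁ = solve-∀ ℚring
      eq₂ : ∀ ia ib na nb sa sb v d r b → ia + v * (ib + nb) + (b * sa + (1ℚ + d) * r * (v * sb))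
        ≡ (1ℚ + d) * (na + v * nb) + (ia + b * sa - (1ℚ + d) * na + v * (ib + d * r * sb - d * nb) + v * r * sb)
      eq₂ = solve-∀ ℚring

    β-mono : ∀ d → β d ≤ β (suc d)
    β-mono d = slack (R ^ d * ((1ℚ + ι d) * (R - 1ℚ) + 1ℚ)) (^≥0 d R≥0 ⊗ (ι≥0 (suc d) ⊗ gap R≥1 ⊕ 0≤1)) (eq R (ι d) (R ^ d))
      where
      eq : ∀ R d r → (1ℚ + d) * (R * r) ≡ d * r + r * ((1ℚ + d) * (R - 1ℚ) + 1ℚ)
      eq = solve-∀ ℚring

    -- Coefficient by coefficient: a set inside `J` is paid for by `W`, one of size at least d by
    -- `I`, and a smaller one which leaves `J` by `Γ`, since R^d undoes its damping. For the
    -- derivative along a coordinate outside `J`, `low-high` already suffices.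
    low-high-junta : ∀ {n} d J (f : Subset n → ℚ) → ι d * N f ≤ ι d * W J f + I f + β d * Γ J f
    low-high-junta d [] f = slack 0ℚ ≤-refl (eq (ι d * N f) (β d))
      where
      eq : ∀ x b → x + 0ℚ + b * 0ℚ ≡ x + 0ℚ
      eq = solve-∀ ℚring
    low-high-junta zero (j ∷ J) f = slack (I f) (I≥0 f) (eq (N f) (I f) (W (j ∷ J) f) (Γ (j ∷ J) f))
      where
      eq : ∀ a b w c → 0ℚ * w + b + 0ℚ * 1ℚ * c ≡ 0ℚ * a + b
      eq = solve-∀ ℚring
    low-high-junta (suc d) (true ∷ J) f = slack _
      (gap (low-high-junta (suc d) J (A f)) ⊕ v≥0 ⊗ (gap (low-high-junta d J (D f)) ⊕ W≥0 J (D f) ⊕ ^≥0 d R≥0 ⊗ Γ≥0 J (D f)))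
      (trans (cong (λ z → (1ℚ + ι d) * z + I f + β (suc d) * Γ (true ∷ J) f) (W-step-in J f))
        (trans (eq₁ ((1ℚ + ι d) * (W J (A f) + v * W J (D f))) (I f) (β (suc d)) ρ v (Γ J (A f)) (Γ J (D f)))
        (trans (cong (λ z → (1ℚ + ι d) * (W J (A f) + v * W J (D f)) + I f + (β (suc d) * Γ J (A f) + z * (v * Γ J (D f)))) (β-ρ d))
        (trans (eq₂ (I (A f)) (I (D f)) (N (A f)) (N (D f)) (W J (A f)) (W J (D f)) (Γ J (A f)) (Γ J (D f)) v (ι d) (R ^ d) (β (suc d)))
          (cong (λ z → (1ℚ + ι d) * z + (((1ℚ + ι d) * W J (A f) + I (A f) + β (suc d) * Γ J (A f) - (1ℚ + ι d) * N (A f))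
            + v * (ι d * W J (D f) + I (D f) + β d * Γ J (D f) - ι d * N (D f) + W J (D f) + R ^ d * Γ J (D f)))) (sym (N-step f)))))))
      where
      eq₁ : ∀ w i b ρ v x y → w + i + b * (x + ρ * v * y) ≡ w + i + (b * x + b * ρ * (v * y))
      eq₁ = solve-∀ ℚring
      eq₂ : ∀ ia ib na nb wa wb ga gb v d r b →
        (1ℚ + d) * (wa + v * wb) + (ia + v * (ib + nb)) + (b * ga + (1ℚ + d) * r * (v * gb))
        ≡ (1ℚ + d) * (na + v * nb) + (((1ℚ + d) * wa + ia + b * ga - (1ℚ + d) * na)
          + v * (d * wb + ib + d * r * gb - d * nb + wb + r * gb))
      eq₂ = solve-∀ ℚring
    low-high-junta (suc d) (false ∷ J) f = slack _
      (gap (low-high-junta (suc d) J (A f)) ⊕ v≥0 ⊗ (gap (low-high d (D f)) ⊕ gap (β-mono d) ⊗ S≥0 (D f)) ⊕ β≥0 (suc d) ⊗ (ρ≥0 ⊗ v≥0 ⊗ Γ≥0 J (D f)))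
      (trans (cong (λ z → (1ℚ + ι d) * z + I f + β (suc d) * Γ (false ∷ J) f) (W-step-out J f))
        (trans (eq₂ (I (A f)) (I (D f)) (N (A f)) (N (D f)) (W J (A f)) (Γ J (A f)) (Γ J (D f)) (S (D f)) v ρ (ι d) (β d) (β (suc d)))
          (cong (λ z → (1ℚ + ι d) * z + (((1ℚ + ι d) * W J (A f) + I (A f) + β (suc d) * Γ J (A f) - (1ℚ + ι d) * N (A f))
            + v * (I (D f) + β d * S (D f) - ι d * N (D f) + (β (suc d) - β d) * S (D f)) + β (suc d) * (ρ * v * Γ J (D f)))) (sym (N-step f)))))
      where
      eq₂ : ∀ ia ib na nb wa ga gb sb v ρ d b₀ b →
        (1ℚ + d) * wa + (ia + v * (ib + nb)) + b * (v * sb + (ga + ρ * v * gb))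
        ≡ (1ℚ + d) * (na + v * nb) + (((1ℚ + d) * wa + ia + b * ga - (1ℚ + d) * na)
          + v * (ib + b₀ * sb - d * nb + (b - b₀) * sb) + b * (ρ * v * gb))
      eq₂ = solve-∀ ℚring

    Δ-lin : ∀ {n} (i : Fin n) a b (f g : Subset n → ℚ) x → Δ i (λ y → a * f y + b * g y) x ≡ a * Δ i f x + b * Δ i g x
    Δ-lin zero a b f g (c ∷ x) = eq a b (f (true ∷ x)) (f (false ∷ x)) (g (true ∷ x)) (g (false ∷ x))
      where
      eq : ∀ a b s t u v → a * s + b * u - (a * t + b * v) ≡ a * (s - t) + b * (u - v)
      eq = solve-∀ ℚring
    Δ-lin (suc i) a b f g (c ∷ x) = Δ-lin i a b (λ y → f (c ∷ y)) (λ y → g (c ∷ y)) x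

    Δ-cong : ∀ {n} (i : Fin n) {f g : Subset n → ℚ} → (∀ x → f x ≡ g x) → ∀ x → Δ i f x ≡ Δ i g x
    Δ-cong zero h (b ∷ x) = cong₂ _-_ (h (true ∷ x)) (h (false ∷ x))
    Δ-cong (suc i) h (b ∷ x) = Δ-cong i (λ y → h (b ∷ y)) x

    module _ {n} (f : Subset (suc n) → ℚ) where

      A-Δ : ∀ i x → A (Δ (suc i) f) x ≡ Δ i (A f) x
      A-Δ i x = sym (Δ-lin i q (1ℚ - q) (λ y → f (true ∷ y)) (λ y → f (false ∷ y)) x)

      D-Δ : ∀ i x → D (Δ (suc i) f) x ≡ Δ i (D f) x
      D-Δ i x = trans (eq (Δ i (λ y → f (true ∷ y)) x) (Δ i (λ y → f (false ∷ y)) x))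
        (trans (sym (Δ-lin i 1ℚ (- 1ℚ) (λ y → f (true ∷ y)) (λ y → f (false ∷ y)) x))
          (Δ-cong i (λ y → sym (eq (f (true ∷ y)) (f (false ∷ y)))) x))
        where
        eq : ∀ s t → s - t ≡ 1ℚ * s + (- 1ℚ) * t
        eq = solve-∀ ℚring

      A-Δ₀ : ∀ x → A (Δ zero f) x ≡ D f x
      A-Δ₀ x = eq q (D f x)
        where
        eq : ∀ q x → q * x + (1ℚ - q) * x ≡ x
        eq = solve-∀ ℚring

      D-Δ₀ : ∀ x → D (Δ zero f) x ≡ 0ℚ
      D-Δ₀ x = +-inverseʳ (D f x)

      N-Δ : ∀ i → N (Δ (suc i) f) ≡ 1ℚ * N (Δ i (A f)) + v * N (Δ i (D f))
      N-Δ i = trans (N-step (Δ (suc i) f)) (cong₂ (λ s t → s + v * t)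
        (trans (N-cong (A-Δ i)) (sym (*-identityˡ (N (Δ i (A f)))))) (N-cong (D-Δ i)))

      S-Δ : ∀ i → S (Δ (suc i) f) ≡ 1ℚ * S (Δ i (A f)) + ρ * v * S (Δ i (D f))
      S-Δ i = trans (S-step (Δ (suc i) f)) (cong₂ (λ s t → s + ρ * v * t)
        (trans (S-cong (A-Δ i)) (sym (*-identityˡ (S (Δ i (A f)))))) (S-cong (D-Δ i)))

      N-Δ₀ : N (Δ zero f) ≡ N (D f)
      N-Δ₀ = trans (N-step (Δ zero f)) (trans (cong₂ (λ s t → s + v * t) (N-cong A-Δ₀)
        (trans (N-cong D-Δ₀) (E-const q {n} 0ℚ))) (eq (N (D f)) v))
        where
        eq : ∀ x v → x + v * 0ℚ ≡ x
        eq = solve-∀ ℚring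

      S-Δ₀ : S (Δ zero f) ≡ S (D f)
      S-Δ₀ = trans (S-step (Δ zero f)) (trans (cong₂ (λ s t → s + ρ * v * t) (S-cong A-Δ₀)
        (trans (E-cong q (λ x → trans (cong (_* T (D (Δ zero f)) x) (D-Δ₀ x)) (*-zeroˡ (T (D (Δ zero f)) x)))) (E-const q {n} 0ℚ)))
        (eq (S (D f)) (ρ * v)))
        where
        eq : ∀ x v → x + v * 0ℚ ≡ x
        eq = solve-∀ ℚring

    I-Σ : ∀ {n} (f : Subset n → ℚ) → I f ≡ v * Σf (λ i → N (Δ i f))
    I-Σ {zero} f = sym (*-zeroʳ v)
    I-Σ {suc n} f = trans (cong₂ (λ s t → s + v * (t + N (D f))) (I-Σ (A f)) (I-Σ (D f)))
      (trans (eq v (Σf (λ i → N (Δ i (A f)))) (Σf (λ i → N (Δ i (D f)))) (N (D f)))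
        (cong₂ (λ s t → v * (s + t)) (sym (N-Δ₀ f))
          (sym (trans (Σf-cong (N-Δ f)) (Σf-lin 1ℚ v (λ i → N (Δ i (A f))) (λ i → N (Δ i (D f))))))))
      where
      eq : ∀ v a d x → v * a + v * (v * d + x) ≡ v * (x + (1ℚ * a + v * d))
      eq = solve-∀ ℚring

    unless : Bool → ℚ → ℚ
    unless true x = 0ℚ
    unless false x = x

    unless-lin : ∀ b x y s t → unless b (x * s + y * t) ≡ x * unless b s + y * unless b t
    unless-lin true x y s t = eq x y
      where
      eq : ∀ x y → 0ℚ ≡ x * 0ℚ + y * 0ℚ
      eq = solve-∀ ℚring
    unless-lin false x y s t = refl

    Γ-Σ : ∀ {n} J (f : Subset n → ℚ) → Γ J f ≡ v * Σf (λ i → unless (lookup J i) (S (Δ i f)))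
    Γ-Σ [] f = sym (*-zeroʳ v)
    Γ-Σ {suc n} (j ∷ J) f = trans (head j)
        (cong₂ (λ s t → v * (unless j s + t)) (sym (S-Δ₀ f))
          (sym (trans (Σf-cong (λ i → trans (cong (unless (lookup J i)) (S-Δ f i))
              (unless-lin (lookup J i) 1ℚ (ρ * v) (S (Δ i (A f))) (S (Δ i (D f))))))
            (Σf-lin 1ℚ (ρ * v) (λ i → unless (lookup J i) (S (Δ i (A f)))) (λ i → unless (lookup J i) (S (Δ i (D f))))))))
      where
      a = Σf (λ i → unless (lookup J i) (S (Δ i (A f))))
      d = Σf (λ i → unless (lookup J i) (S (Δ i (D f))))
      eqt : ∀ v a d ρ → v * a + ρ * v * (v * d) ≡ v * (0ℚ + (1ℚ * a + ρ * v * d))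
      eqt = solve-∀ ℚring
      eqf : ∀ v a d x ρ → v * x + (v * a + ρ * v * (v * d)) ≡ v * (x + (1ℚ * a + ρ * v * d))
      eqf = solve-∀ ℚring
      head : ∀ j → Γ (j ∷ J) f ≡ v * (unless j (S (D f)) + (1ℚ * a + ρ * v * d))
      head true = trans (cong₂ (λ s t → s + ρ * v * t) (Γ-Σ J (A f)) (Γ-Σ J (D f))) (eqt v a d ρ)
      head false = trans (cong₂ (λ s t → v * S (D f) + (s + ρ * v * t)) (Γ-Σ J (A f)) (Γ-Σ J (D f))) (eqf v a d (S (D f)) ρ)

    Γ≤I : ∀ {n} η → 0ℚ ≤ η → ∀ J (f : Subset n → ℚ) → (∀ i → lookup J i ≡ false → S (Δ i f) ≤ η * N (Δ i f)) → Γ J f ≤ η * I f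
    Γ≤I η η≥0 J f h = begin
      Γ J f ≡⟨ Γ-Σ J f ⟩
      v * Σf (λ i → unless (lookup J i) (S (Δ i f))) ≤⟨ mulˡ v v≥0 (Σf-mono (λ i → bound i (lookup J i) refl)) ⟩
      v * Σf (λ i → η * N (Δ i f) + 0ℚ * N (Δ i f)) ≡⟨ cong (v *_) (Σf-lin η 0ℚ (λ i → N (Δ i f)) (λ i → N (Δ i f))) ⟩
      v * (η * Σf (λ i → N (Δ i f)) + 0ℚ * Σf (λ i → N (Δ i f))) ≡⟨ eq v η (Σf (λ i → N (Δ i f))) ⟩
      η * (v * Σf (λ i → N (Δ i f))) ≡⟨ cong (η *_) (I-Σ f) ⟨
      η * I f ∎
      where
      open ≤-Reasoning
      eq : ∀ v η s → v * (η * s + 0ℚ * s) ≡ η * (v * s)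
      eq = solve-∀ ℚring
      eq₀ : ∀ a b → a * b ≡ a * b + 0ℚ * b
      eq₀ = solve-∀ ℚring
      bound : ∀ i b → lookup J i ≡ b → unless b (S (Δ i f)) ≤ η * N (Δ i f) + 0ℚ * N (Δ i f)
      bound i true _ = subst (0ℚ ≤_) (eq₀ η (N (Δ i f))) (η≥0 ⊗ N≥0 (Δ i f))
      bound i false e = subst (S (Δ i f) ≤_) (eq₀ η (N (Δ i f))) (h i e)

    -- A substitute for Hölder's inequality without fractional powers. As `g` takes the values 0 and
    -- 1, g Tg is at most w g where Tg ≤ w, and at most K³ (Tg)⁴ elsewhere; hypercontractivity
    -- bounds the fourth moment of Tg by N² ≤ w⁴ N.
    small-S : ∀ {n} w K (g : Subset n → ℚ) → 0ℚ ≤ w → 0ℚ ≤ K → K * w ≡ 1ℚ →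
      (∀ x → (g x ≡ 0ℚ) ⊎ (g x ≡ 1ℚ)) → N g ≤ w ^ 4 → S g ≤ (w + w) * N g
    small-S {n} w K g w≥0 K≥0 Kw g01 small = begin
      S g ≤⟨ E-mono q≥0 q≤1 (λ x → pointwise (g x) (T g x) (g01 x)) ⟩
      E q (λ x → w * (g x * g x) + K ^ 3 * (T g x * T g x * (T g x * T g x))) ≡⟨ E-lin q {n} w (K ^ 3) _ _ ⟩
      w * N g + K ^ 3 * H g g ≤⟨ +-monoʳ-≤ (w * N g) (mulˡ (K ^ 3) (^≥0 3 K≥0) (≤-trans (hypercontractive g g) (mulʳ (N g) (N≥0 g) small))) ⟩
      w * N g + K ^ 3 * (w ^ 4 * N g) ≡⟨ cong (w * N g +_) (eq₁ K w (N g)) ⟩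
      w * N g + (K * w) * (K * w) * (K * w) * (w * N g) ≡⟨ cong (λ z → w * N g + z * z * z * (w * N g)) Kw ⟩
      w * N g + 1ℚ * 1ℚ * 1ℚ * (w * N g) ≡⟨ eq₂ w (N g) ⟩
      (w + w) * N g ∎
      where
      open ≤-Reasoning
      eq₁ : ∀ K w x → K * (K * (K * 1ℚ)) * (w * (w * (w * (w * 1ℚ))) * x) ≡ (K * w) * (K * w) * (K * w) * (w * x)
      eq₁ = solve-∀ ℚring
      eq₂ : ∀ w x → w * x + 1ℚ * 1ℚ * 1ℚ * (w * x) ≡ (w + w) * x
      eq₂ = solve-∀ ℚring
      t⁴≥0 : ∀ t → 0ℚ ≤ K ^ 3 * (t * t * (t * t))
      t⁴≥0 t = ^≥0 3 K≥0 ⊗ (square≥0 t ⊗ square≥0 t)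
      pointwise : ∀ y t → (y ≡ 0ℚ) ⊎ (y ≡ 1ℚ) → y * t ≤ w * (y * y) + K ^ 3 * (t * t * (t * t))
      pointwise _ t (inj₁ refl) = slack (K ^ 3 * (t * t * (t * t))) (t⁴≥0 t) (eq w t (K ^ 3 * (t * t * (t * t))))
        where
        eq : ∀ w t z → w * (0ℚ * 0ℚ) + z ≡ 0ℚ * t + z
        eq = solve-∀ ℚring
      pointwise _ t (inj₂ refl) with ≤-total t w
      ... | inj₁ t≤w = slack _ (gap t≤w ⊕ t⁴≥0 t) (eq w t (K ^ 3 * (t * t * (t * t))))
        where
        eq : ∀ w t z → w * (1ℚ * 1ℚ) + z ≡ 1ℚ * t + (w - t + z)
        eq = solve-∀ ℚring
      ... | inj₂ w≤t = slack _ (w≥0 ⊕ t≥0 ⊗ gap (1≤^ 3 1≤Kt)) (eq w K t)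
        where
        t≥0 : 0ℚ ≤ t
        t≥0 = ≤-trans w≥0 w≤t
        1≤Kt : 1ℚ ≤ K * t
        1≤Kt = subst (_≤ K * t) Kw (mulˡ K K≥0 w≤t)
        eq : ∀ w K t → w * (1ℚ * 1ℚ) + K * (K * (K * 1ℚ)) * (t * t * (t * t)) ≡ 1ℚ * t + (w + t * (K * t * (K * t * (K * t * 1ℚ)) - 1ℚ))
        eq = solve-∀ ℚring

    M≤1 : ∀ {n} J {f : Subset n → ℚ} → (∀ x → f x ≤ 1ℚ) → ∀ x → M q J f x ≤ 1ℚ
    M≤1 [] h x = h x
    M≤1 (true ∷ J) h (b ∷ x) = M≤1 J (λ y → h (b ∷ y)) x
    M≤1 (false ∷ J) {f} h (b ∷ x) = M≤1 J (λ y → slack _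
      (q≥0 ⊗ gap (h (true ∷ y)) ⊕ gap q≤1 ⊗ gap (h (false ∷ y))) (eq q (f (true ∷ y)) (f (false ∷ y)))) x
      where
      eq : ∀ q s t → 1ℚ ≡ q * s + (1ℚ - q) * t + (q * (1ℚ - s) + (1ℚ - q) * (1ℚ - t))
      eq = solve-∀ ℚring

    E-M : ∀ {n} J (f : Subset n → ℚ) → E q (M q J f) ≡ E q f
    E-M [] f = refl
    E-M (true ∷ J) f = cong₂ (λ s t → q * s + (1ℚ - q) * t) (E-M J (λ y → f (true ∷ y))) (E-M J (λ y → f (false ∷ y)))
    E-M {suc n} (false ∷ J) f = trans (eq q (E q (M q J (A f)))) (trans (E-M J (A f)) (E-lin q {n} q (1ℚ - q) _ _))
      where
      eq : ∀ q x → q * x + (1ℚ - q) * x ≡ x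
      eq = solve-∀ ℚring

    -- The conditional expectation of an increasing function given the coordinates in `J` is least
    -- where all of them are absent, and there it is `Z q J f`.
    Z≤M : ∀ {n} J (f : Subset n → ℚ) → Increasing f → ∀ x → Z q J f ≤ M q J f x
    Z≤M [] f m [] = ≤-refl
    Z≤M (true ∷ J) f (m , mt , mf) (true ∷ x) = ≤-trans (Z-mono q≥0 q≤1 J m) (Z≤M J _ mt x)
    Z≤M (true ∷ J) f (m , mt , mf) (false ∷ x) = Z≤M J _ mf x
    Z≤M (false ∷ J) f (m , mt , mf) (b ∷ x) = subst (_≤ M q J (A f) x)
      (Z-lin q J q (1ℚ - q) (λ y → f (true ∷ y)) (λ y → f (false ∷ y)))
      (Z≤M J (A f) (Increasing-lin q≥0 (gap q≤1) mt mf) x)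

    N-01 : ∀ {n} (g : Subset n → ℚ) → (∀ x → (g x ≡ 0ℚ) ⊎ (g x ≡ 1ℚ)) → N g ≡ E q g
    N-01 g h = E-cong q (λ x → square (h x))
      where
      square : ∀ {y} → (y ≡ 0ℚ) ⊎ (y ≡ 1ℚ) → y * y ≡ y
      square (inj₁ refl) = refl
      square (inj₂ refl) = refl

    module _ {n} (F : Subset n → Bool) (mono : Mono F) where

      private
        f : Subset n → ℚ
        f x = 𝟙 (F x)

      -- The projection μ of `f` to `J` takes values between λ₀ and 1, so (1 - μ)(μ - λ₀) has
      -- nonnegative expectation. This keeps the second moment of μ away from its mean.
      W-gap : ∀ J → W J f + Z q J f * (1ℚ - E q f) ≤ E q f
      W-gap J = begin
        W J f + λ₀ * (1ℚ - E q f) ≡⟨ eq₁ (W J f) λ₀ (E q f) ⟩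
        1ℚ * (1ℚ * W J f + (- λ₀) * E q f) + λ₀ * 1ℚ ≡⟨ cong (λ z → 1ℚ * (1ℚ * W J f + (- λ₀) * z) + λ₀ * 1ℚ) (E-M J f) ⟨
        1ℚ * (1ℚ * W J f + (- λ₀) * E q μ) + λ₀ * 1ℚ ≡⟨ cong₂ (λ s t → 1ℚ * s + λ₀ * t) (E-lin q {n} 1ℚ (- λ₀) _ _) (E-const q {n} 1ℚ) ⟨
        1ℚ * E q (λ x → 1ℚ * (μ x * μ x) + (- λ₀) * μ x) + λ₀ * E q {n} (λ x → 1ℚ) ≡⟨ E-lin q {n} 1ℚ λ₀ _ _ ⟨
        E q (λ x → 1ℚ * (1ℚ * (μ x * μ x) + (- λ₀) * μ x) + λ₀ * 1ℚ) ≤⟨ E-mono q≥0 q≤1 (λ x →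
          slack _ (gap (M≤1 J (λ y → 𝟙≤1 (F y)) x) ⊗ gap (Z≤M J f (Increasing-𝟙 F mono) x)) (eq₂ (μ x) λ₀)) ⟩
        E q μ ≡⟨ E-M J f ⟩
        E q f ∎
        where
        open ≤-Reasoning
        λ₀ = Z q J f
        μ : Subset n → ℚ
        μ = M q J f
        eq₁ : ∀ w l e → w + l * (1ℚ - e) ≡ 1ℚ * (1ℚ * w + (- l) * e) + l * 1ℚ
        eq₁ = solve-∀ ℚring
        eq₂ : ∀ m l → m ≡ 1ℚ * (1ℚ * (m * m) + (- l) * m) + l * 1ℚ + (1ℚ - m) * (m - l)
        eq₂ = solve-∀ ℚring

      -- Friedgut's junta theorem for increasing functions.
      junta-or-large : ∀ d w K → 0ℚ ≤ w → 0ℚ ≤ K → K * w ≡ 1ℚ → β d * (w + w) ≤ 1ℚ →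
        ∀ J → (∀ i → lookup J i ≡ false → E q (Δ i f) ≤ w ^ 4) →
        ι d * (Z q J f * (1ℚ - E q f)) ≤ infl q f + infl q f
      junta-or-large d w K w≥0 K≥0 Kw small J h = slack _
        -- Small influences outside `J` give β Γ ≤ I, so d N ≤ d W + 2 I. Replacing W by `W-gap`
        -- leaves d Z (1 - E) ≤ 2 I, and I is at most the total influence.
        (gap (low-high-junta d J f) ⊕ β≥0 d ⊗ gap (Γ≤I (w + w) (w≥0 ⊕ w≥0) J f
            (λ i e → small-S w K (Δ i f) w≥0 K≥0 Kw (Δ-01 F mono i) (subst (_≤ w ^ 4) (sym (N-01 (Δ i f) (Δ-01 F mono i))) (h i e))))
          ⊕ I≥0 f ⊗ gap small ⊕ ι≥0 d ⊗ gap (W-gap J) ⊕ (gap I≤infl ⊕ gap I≤infl))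
        (trans (eq (ι d) (E q f) (W J f) (I f) (β d) (Γ J f) (w + w) (Z q J f) (infl q f))
           (cong (λ z → ι d * (Z q J f * (1ℚ - E q f)) + (ι d * W J f + I f + β d * Γ J f - ι d * z
              + β d * ((w + w) * I f - Γ J f) + I f * (1ℚ - β d * (w + w)) + ι d * (E q f - (W J f + Z q J f * (1ℚ - E q f)))
              + (infl q f - I f + (infl q f - I f)))) (sym (N-01 f (λ x → 01? (F x))))))
        where
        01? : ∀ b → (𝟙 b ≡ 0ℚ) ⊎ (𝟙 b ≡ 1ℚ)
        01? true = inj₂ refl
        01? false = inj₁ refl
        infl≥ : 0ℚ ≤ infl q f
        infl≥ = Σf≥0 (infl≥0 q≥0 q≤1 F mono)
        I≤infl : I f ≤ infl q f
        I≤infl = subst (_≤ infl q f)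
          (trans (cong (v *_) (Σf-cong (λ i → sym (N-01 (Δ i f) (Δ-01 F mono i))))) (sym (I-Σ f)))
          (slack _ ((square≥0 q ⊕ gap q≤1) ⊗ infl≥) (eqv q (infl q f)))
          where
          eqv : ∀ q x → x ≡ q * (1ℚ - q) * x + (q * q + (1ℚ - q)) * x
          eqv = solve-∀ ℚring
        eq : ∀ d e W I b g w z i → i + i ≡ d * (z * (1ℚ - e)) + (d * W + I + b * g - d * e
              + b * (w * I - g) + I * (1ℚ - b * w) + d * (e - (W + z * (1ℚ - e)))
              + (i - I + (i - I)))
        eq = solve-∀ ℚring

-- Russo's formula and the passage from bias 1/2m to bias 1/m.

module Russo where
  open QOrd
  open Cube
  open KKL
  open import Data.Nat as ℕ using (ℕ; zero; suc)
  import Data.Nat.Properties as ℕₚ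
  open import Data.Bool using (Bool; true; false)
  open import Data.Fin using (Fin; zero; suc)
  open import Data.Fin.Subset using (Subset; ∣_∣)
  open import Data.Vec using ([]; _∷_; lookup)
  open import Data.Rational hiding (∣_∣)
  open import Data.Rational.Properties
  open import Relation.Binary.PropositionalEquality hiding (J)
  open import Relation.Nullary using (yes; no)
  open import Tactic.RingSolver using (solve-∀)
  open import Data.Product using (_×_; _,_; Σ; ∃-syntax; proj₁; proj₂)

  infl-step : ∀ q {n} (f : Subset (suc n) → ℚ) → infl q f ≡
    E q (λ x → f (true ∷ x) - f (false ∷ x)) + (q * infl q (λ x → f (true ∷ x)) + (1ℚ - q) * infl q (λ x → f (false ∷ x)))
  infl-step q {n} f = cong₂ _+_ (eq q _)
    (Σf-lin q (1ℚ - q) (λ i → E q (Δ i (λ x → f (true ∷ x)))) (λ i → E q (Δ i (λ x → f (false ∷ x)))))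
    where
    eq : ∀ q x → q * x + (1ℚ - q) * x ≡ x
    eq = solve-∀ ℚring

  Δ≥0 : ∀ {n} {f : Subset n → ℚ} → Increasing f → ∀ i x → 0ℚ ≤ Δ i f x
  Δ≥0 (m , _) zero (b ∷ x) = gap (m x)
  Δ≥0 (_ , m , _) (suc i) (true ∷ x) = Δ≥0 m i x
  Δ≥0 (_ , _ , m) (suc i) (false ∷ x) = Δ≥0 m i x

  module _ {q q' κ : ℚ} (q≥0 : 0ℚ ≤ q) (q≤q' : q ≤ q') (q'≤1 : q' ≤ 1ℚ)
    (κ≥0 : 0ℚ ≤ κ) (κ≤1 : κ ≤ 1ℚ) (κ-ratio : κ * (1ℚ - q) ≤ 1ℚ - q') where

    private
      q≤1 : q ≤ 1ℚ
      q≤1 = ≤-trans q≤q' q'≤1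

    -- Each coordinate costs at most the factor `κ`: presence only gains weight as q ≤ q', and
    -- absence keeps the fraction `κ` of 1 - q.
    E-ratio : ∀ {n} (g : Subset n → ℚ) → (∀ x → 0ℚ ≤ g x) → κ ^ n * E q g ≤ E q' g
    E-ratio {zero} g h = ≤-reflexive (*-identityˡ (g []))
    E-ratio {suc n} g h = slack _
      (≤-trans q≥0 q≤q' ⊗ gap (E-ratio g₁ (λ x → h (true ∷ x)))
        ⊕ gap q'≤1 ⊗ gap (E-ratio g₀ (λ x → h (false ∷ x)))
        ⊕ (gap q≤q' ⊕ gap κ≤1 ⊗ q≥0) ⊗ (^≥0 n κ≥0 ⊗ E≥0 q≥0 q≤1 (λ x → h (true ∷ x)))
        ⊕ gap κ-ratio ⊗ (^≥0 n κ≥0 ⊗ E≥0 q≥0 q≤1 (λ x → h (false ∷ x))))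
      (eq q q' κ (κ ^ n) (E q g₁) (E q g₀) (E q' g₁) (E q' g₀))
      where
      g₁ g₀ : Subset n → ℚ
      g₁ x = g (true ∷ x)
      g₀ x = g (false ∷ x)
      eq : ∀ q q' κ r a b a' b' → q' * a' + (1ℚ - q') * b' ≡ κ * r * (q * a + (1ℚ - q) * b)
        + (q' * (a' - r * a) + (1ℚ - q') * (b' - r * b) + (q' - q + (1ℚ - κ) * q) * (r * a)
          + (1ℚ - q' - κ * (1ℚ - q)) * (r * b))
      eq = solve-∀ ℚring

    -- Russo's formula for a finite increment of the bias.
    russo : ∀ {n} (f : Subset n → ℚ) → Increasing f → E q f + (q' - q) * (κ ^ n * infl q f) ≤ E q' f
    russo {zero} f m = ≤-reflexive (eq (f []) (q' - q))
      where
      eq : ∀ x h → x + h * (1ℚ * 0ℚ) ≡ x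
      eq = solve-∀ ℚring
    russo {suc n} f (m , mt , mf) = slack _
      (q≥0 ⊗ gap (russo f₁ mt) ⊕ gap q≤1 ⊗ gap (russo f₀ mf)
        ⊕ gap q≤q' ⊗ gap (E-ratio δ (λ x → gap (m x)))
        ⊕ gap q≤q' ⊗ ((gap κ≤1 ⊗ ^≥0 n κ≥0) ⊗ Σf≥0 (λ i → E≥0 q≥0 q≤1 (Δ≥0 {f = f} (m , mt , mf) i))))
      (trans (eq q q' κ (κ ^ n) (E q f₁) (E q f₀) (E q' f₁) (E q' f₀) (E q δ) (infl q f₁) (infl q f₀))
        (cong₂ (λ i d → E q f + (q' - q) * (κ ^ suc n * i)
          + (q * (E q' f₁ - (E q f₁ + (q' - q) * (κ ^ n * infl q f₁)))
            + (1ℚ - q) * (E q' f₀ - (E q f₀ + (q' - q) * (κ ^ n * infl q f₀)))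
            + (q' - q) * (d - κ ^ n * E q δ)
            + (q' - q) * ((1ℚ - κ) * κ ^ n * i))) (sym (infl-step q f)) (sym δ-E)))
      where
      f₁ f₀ δ : Subset n → ℚ
      f₁ x = f (true ∷ x)
      f₀ x = f (false ∷ x)
      δ x = f₁ x - f₀ x
      eqδ : ∀ s t → s - t ≡ 1ℚ * s + (- 1ℚ) * t
      eqδ = solve-∀ ℚring
      δ-E : E q' δ ≡ E q' f₁ - E q' f₀
      δ-E = trans (E-cong q' (λ x → eqδ (f₁ x) (f₀ x))) (trans (E-lin q' 1ℚ (- 1ℚ) f₁ f₀) (sym (eqδ (E q' f₁) (E q' f₀))))
      eq : ∀ q q' κ r a b a' b' d i₁ i₀ → q' * a' + (1ℚ - q') * b' ≡
        q * a + (1ℚ - q) * b + (q' - q) * (κ * r * (d + (q * i₁ + (1ℚ - q) * i₀)))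
          + (q * (a' - (a + (q' - q) * (r * i₁)))
            + (1ℚ - q) * (b' - (b + (q' - q) * (r * i₀)))
            + (q' - q) * (a' - b' - r * d)
            + (q' - q) * ((1ℚ - κ) * r * (d + (q * i₁ + (1ℚ - q) * i₀))))
      eq = solve-∀ ℚring

  -- Pigeonhole among the increments; it takes the place of the mean value theorem.
  average-step : ∀ T (a : ℕ → ℚ) c → a (suc T) ≤ a 0 + ι (suc T) * c → ∃[ t ] (t ℕ.≤ T × a (suc t) ≤ a t + c)
  average-step zero a c h = 0 , ℕ.z≤n , subst (a 1 ≤_) (eq (a 0) c) h
    where
    eq : ∀ x c → x + (1ℚ + 0ℚ) * c ≡ x + c
    eq = solve-∀ ℚring
  average-step (suc T) a c h with a (suc (suc T)) ≤? a (suc T) + c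
  ... | yes p = suc T , ℕₚ.≤-refl , p
  ... | no ¬p = let t , t≤T , r = average-step T a c earlier in t , ℕₚ.m≤n⇒m≤1+n t≤T , r
    where
    eq₁ : ∀ x c → x ≡ x + c - c
    eq₁ = solve-∀ ℚring
    eq₂ : ∀ x c s → x + (1ℚ + (1ℚ + s)) * c - c ≡ x + (1ℚ + s) * c
    eq₂ = solve-∀ ℚring
    earlier : a (suc T) ≤ a 0 + ι (suc T) * c
    earlier = subst₂ _≤_ (sym (eq₁ (a (suc T)) c)) (eq₂ (a 0) c (ι T))
      (+-monoˡ-≤ (- c) (≤-trans (<⇒≤ (≰⇒> ¬p)) h))

  recip-unique : ∀ n x → 1 ℕ.≤ n → ι n * x ≡ 1ℚ → x ≡ recip n
  recip-unique n x 1≤n h = begin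
    x ≡⟨ eq x ⟩
    1ℚ * x ≡⟨ cong (_* x) (ι*recip n 1≤n) ⟨
    ι n * recip n * x ≡⟨ eq₂ (ι n) (recip n) x ⟩
    recip n * (ι n * x) ≡⟨ cong (recip n *_) h ⟩
    recip n * 1ℚ ≡⟨ *-identityʳ (recip n) ⟩
    recip n ∎
    where
    open ≡-Reasoning
    eq : ∀ x → x ≡ 1ℚ * x
    eq = solve-∀ ℚring
    eq₂ : ∀ n r x → n * r * x ≡ r * (n * x)
    eq₂ = solve-∀ ℚring

  heavy-coords : ∀ {n} c (a : Fin n → ℚ) (J : Subset n) → (∀ i → 0ℚ ≤ a i) →
    (∀ i → lookup J i ≡ true → c ≤ a i) → ι ∣ J ∣ * c ≤ Σf a
  heavy-coords c a [] a≥0 h = ≤-reflexive (*-zeroˡ c)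
  heavy-coords c a (true ∷ J) a≥0 h = subst (_≤ Σf a) (eq c (ι ∣ J ∣))
    (+-mono-≤ (h zero refl) (heavy-coords c (λ i → a (suc i)) J (λ i → a≥0 (suc i)) (λ i → h (suc i))))
    where
    eq : ∀ c j → c + j * c ≡ (1ℚ + j) * c
    eq = solve-∀ ℚring
  heavy-coords c a (false ∷ J) a≥0 h = subst (_≤ Σf a) (+-identityˡ (ι ∣ J ∣ * c))
    (+-mono-≤ (a≥0 zero) (heavy-coords c (λ i → a (suc i)) J (λ i → a≥0 (suc i)) (λ i → h (suc i))))

  above : ∀ {n} c (a : Fin n → ℚ) → Σ (Subset n) λ J →
    (∀ i → lookup J i ≡ true → c ≤ a i) × (∀ i → lookup J i ≡ false → a i ≤ c)
  above {zero} c a = [] , (λ ()) , (λ ())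
  above {suc n} c a with above c (λ i → a (suc i)) | a zero ≤? c
  ... | J , h , l | yes a≤c = false ∷ J , (λ { zero () ; (suc i) → h i }) , (λ { zero _ → a≤c ; (suc i) → l i })
  ... | J , h , l | no a≰c = true ∷ J , (λ { zero _ → <⇒≤ (≰⇒> a≰c) ; (suc i) → h i }) , (λ { zero () ; (suc i) → l i })

  -- Somewhere between the biases 1/2m and 1/m the influence is at most 4m; there J is
  -- the set of coordinates of influence above a constant.
  module Threshold (m : ℕ) (2≤m : 2 ℕ.≤ m) (e : ℕ) (1≤e : 1 ℕ.≤ e) where

    -- The constants are solved for backwards. With ρ = 1/r, d ε ρ² = 1; then w = 1/N₀ gives β d (w
    -- + w) = 1 in `junta-or-large`; and at total influence at most 4m there are at most `j`
    -- coordinates of influence at least w⁴.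
    r d : ℕ
    r = 4 ℕ.* m
    d = 16 ℕ.* m ℕ.* m ℕ.* e

    1≤m : 1 ℕ.≤ m
    1≤m = ℕₚ.≤-trans (ℕ.s≤s ℕ.z≤n) 2≤m

    N₀ j : ℕ
    N₀ = 2 ℕ.* (d ℕ.* r ℕ.^ d)
    j = 4 ℕ.* m ℕ.* N₀ ℕ.^ 4

    1≤r : 1 ℕ.≤ r
    1≤r = ℕₚ.*-mono-≤ {1} {4} (ℕ.s≤s ℕ.z≤n) 1≤m

    1≤N₀ : 1 ℕ.≤ N₀
    1≤N₀ = ℕₚ.*-mono-≤ {1} {2} (ℕ.s≤s ℕ.z≤n) (ℕₚ.*-mono-≤ {1} {d}
      (ℕₚ.*-mono-≤ {1} {16 ℕ.* m ℕ.* m} (ℕₚ.*-mono-≤ {1} {16 ℕ.* m} (ℕₚ.*-mono-≤ {1} {16} (ℕ.s≤s ℕ.z≤n) 1≤m) 1≤m) 1≤e)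
      (ℕₚ.m^n>0 r {{ℕ.>-nonZero 1≤r}} d))

    ρ : ℚ
    ρ = recip r

    ρ≥0 : 0ℚ ≤ ρ
    ρ≥0 = recip≥0 r

    4mρ : ι 4 * ι m * ρ ≡ 1ℚ
    4mρ = trans (cong (_* ρ) (sym (ι-* 4 m))) (ι*recip r 1≤r)

    q₀≡ : recip (2 ℕ.* m) ≡ ρ + ρ
    q₀≡ = sym (recip-unique (2 ℕ.* m) (ρ + ρ) (ℕₚ.*-mono-≤ {1} {2} (ℕ.s≤s ℕ.z≤n) 1≤m)
      (trans (cong (_* (ρ + ρ)) (ι-* 2 m)) (trans (eq (ι m) ρ) 4mρ)))
      where
      eq : ∀ m ρ → ι 2 * m * (ρ + ρ) ≡ ι 4 * m * ρ
      eq = solve-∀ ℚring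

    q₁≡ : recip m ≡ ρ + ρ + (ρ + ρ)
    q₁≡ = sym (recip-unique m (ρ + ρ + (ρ + ρ)) 1≤m (trans (eq (ι m) ρ) 4mρ))
      where
      eq : ∀ m ρ → m * (ρ + ρ + (ρ + ρ)) ≡ ι 4 * m * ρ
      eq = solve-∀ ℚring

    8ρ≤1 : ι 8 * ρ ≤ 1ℚ
    8ρ≤1 = subst (ι 8 * ρ ≤_) 4mρ (mulʳ ρ ρ≥0 (subst (_≤ ι 4 * ι m) refl (mulˡ (ι 4) (ι≥0 4) (ι-mono 2≤m))))

    ρ≤1-slack : ∀ ρ → 1ℚ - ρ ≡ 1ℚ - ι 8 * ρ + ι 7 * ρ
    ρ≤1-slack = solve-∀ ℚring

    1-ρ≥0 : 0ℚ ≤ 1ℚ - ρ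
    1-ρ≥0 = subst (0ℚ ≤_) (sym (ρ≤1-slack ρ)) (gap 8ρ≤1 ⊕ ι≥0 7 ⊗ ρ≥0)

    ε : ℚ
    ε = recip e

    bias≥0 : ∀ {q} → ρ + ρ ≤ q → 0ℚ ≤ q
    bias≥0 = ≤-trans (ρ≥0 ⊕ ρ≥0)

    bias≤1 : ∀ {q} → q ≤ ρ + ρ + (ρ + ρ) → q ≤ 1ℚ
    bias≤1 q≤ = ≤-trans q≤ (slack _ (gap 8ρ≤1 ⊕ (ρ≥0 ⊕ ρ≥0 ⊕ (ρ≥0 ⊕ ρ≥0))) (eq ρ))
      where
      eq : ∀ ρ → 1ℚ ≡ ρ + ρ + (ρ + ρ) + (1ℚ - ι 8 * ρ + (ρ + ρ + (ρ + ρ)))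
      eq = solve-∀ ℚring

    module _ {n} (F : Subset n → Bool) (mono : Mono F) where

      private
        f : Subset n → ℚ
        f x = 𝟙 (F x)

        E≤1 : ∀ {q} → 0ℚ ≤ q → q ≤ 1ℚ → E q f ≤ 1ℚ
        E≤1 {q} h k = subst (E q f ≤_) (E-const q {n} 1ℚ) (E-mono h k (λ x → 𝟙≤1 (F x)))

      module _ (q : ℚ) (q≥ : ρ + ρ ≤ q) (q≤ : q ≤ ρ + ρ + (ρ + ρ)) where

        private
          q≥0 = bias≥0 q≥
          q≤1 = bias≤1 q≤

        -- The set of influential coordinates has at most `j` elements, so `junta-or-large` gives d
        -- ε (1 - E) ≤ 8m. Because d ε ρ² = 1 and 4m ρ = 1, this is the bound 2ρ.
        small-influence⇒large : infl q f ≤ ι (4 ℕ.* m) → (∀ J → ∣ J ∣ ℕ.≤ j → ε ≤ Z q J f) → 1ℚ - E q f ≤ ρ + ρ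
        small-influence⇒large bound robust = begin
          1ℚ - E q f ≡⟨ *-identityˡ _ ⟨
          1ℚ * (1ℚ - E q f) ≡⟨ cong (_* (1ℚ - E q f)) scale ⟨
          ι d * ε * (ρ * ρ) * (1ℚ - E q f) ≡⟨ eq₃ (ι d) ε ρ (1ℚ - E q f) ⟩
          ρ * ρ * (ι d * (ε * (1ℚ - E q f))) ≤⟨ mulˡ (ρ * ρ) (square≥0 ρ) (≤-trans
            (mulˡ (ι d) (ι≥0 d) (mulʳ (1ℚ - E q f) (gap (E≤1 q≥0 q≤1)) (robust J J≤j)))
            (junta-or-large F mono d (recip N₀) (ι N₀) (recip≥0 N₀) (ι≥0 N₀) (ι*recip N₀ 1≤N₀) (≤-reflexive βw) J light)) ⟩
          ρ * ρ * (infl q f + infl q f) ≤⟨ mulˡ (ρ * ρ) (square≥0 ρ) (+-mono-≤ bound bound) ⟩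
          ρ * ρ * (ι (4 ℕ.* m) + ι (4 ℕ.* m)) ≡⟨ cong (λ z → ρ * ρ * (z + z)) (ι-* 4 m) ⟩
          ρ * ρ * (ι 4 * ι m + ι 4 * ι m) ≡⟨ eq₄ ρ (ι m) ⟩
          (ρ + ρ) * (ι 4 * ι m * ρ) ≡⟨ cong ((ρ + ρ) *_) 4mρ ⟩
          (ρ + ρ) * 1ℚ ≡⟨ *-identityʳ (ρ + ρ) ⟩
          ρ + ρ ∎
          where
          open ≤-Reasoning
          eq₁ : ∀ ρ → 1ℚ ≡ (1ℚ + 1ℚ + 1ℚ) * (ρ * ρ) + ρ * ρ * ρ + (1ℚ - ι 8 * ρ + ι 3 * ρ * (1ℚ - ρ) + ρ * (1ℚ - ρ) * (1ℚ + ρ) + ι 4 * ρ)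
          eq₁ = solve-∀ ℚring
          eq₂ : ∀ q ρ → q * (1ℚ - q) ≡ (1ℚ + 1ℚ + 1ℚ) * (ρ * ρ * ρ) + ((q - (ρ + ρ)) * (1ℚ - q) + (ρ + ρ) * (ρ + ρ + (ρ + ρ) - q)
            + (ρ + ρ) * (1ℚ - ι 8 * ρ) + (ι 5 * (ρ * ρ) + ι 3 * (ρ * ρ) * (1ℚ - ρ)))
          eq₂ = solve-∀ ℚring
          eq₃ : ∀ d ε ρ x → d * ε * (ρ * ρ) * x ≡ ρ * ρ * (d * (ε * x))
          eq₃ = solve-∀ ℚring
          eq₄ : ∀ ρ m → ρ * ρ * (ι 4 * m + ι 4 * m) ≡ (ρ + ρ) * (ι 4 * m * ρ)
          eq₄ = solve-∀ ℚring
          open Noise q ρ (ι r) q≥0 q≤1 ρ≥0 (ι-mono 1≤r) (trans (*-comm ρ (ι r)) (ι*recip r 1≤r))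
            (slack _ (gap 8ρ≤1 ⊕ ι≥0 3 ⊗ ρ≥0 ⊗ 1-ρ≥0 ⊕ ρ≥0 ⊗ 1-ρ≥0 ⊗ (0≤1 ⊕ ρ≥0) ⊕ ι≥0 4 ⊗ ρ≥0) (eq₁ ρ))
            (slack _ (gap q≥ ⊗ gap q≤1 ⊕ (ρ≥0 ⊕ ρ≥0) ⊗ gap q≤ ⊕ (ρ≥0 ⊕ ρ≥0) ⊗ gap 8ρ≤1
              ⊕ (ι≥0 5 ⊗ square≥0 ρ ⊕ ι≥0 3 ⊗ square≥0 ρ ⊗ 1-ρ≥0)) (eq₂ q ρ))
          scale : ι d * ε * (ρ * ρ) ≡ 1ℚ
          scale = trans (cong (λ z → z * ε * (ρ * ρ)) (trans (ι-* (16 ℕ.* m ℕ.* m) e) (cong (_* ι e) (trans (ι-* (16 ℕ.* m) m) (cong (_* ι m) (ι-* 16 m))))))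
            (trans (eq (ι m) ρ (ι e) ε) (cong₂ _*_ (cong₂ _*_ 4mρ 4mρ) (ι*recip e 1≤e)))
            where
            eq : ∀ m ρ e ε → ι 16 * m * m * e * ε * (ρ * ρ) ≡ ι 4 * m * ρ * (ι 4 * m * ρ) * (e * ε)
            eq = solve-∀ ℚring
          w = recip N₀
          βw : ι d * ι r ^ d * (w + w) ≡ 1ℚ
          βw = trans (cong (λ z → ι d * z * (w + w)) (sym (ι-^ r d))) (trans (cong (_* (w + w)) (sym (ι-* d (r ℕ.^ d))))
            (trans (eq (ι (d ℕ.* r ℕ.^ d)) w) (trans (cong (_* w) (sym (ι-* 2 (d ℕ.* r ℕ.^ d)))) (ι*recip N₀ 1≤N₀))))
            where
            eq : ∀ x w → x * (w + w) ≡ ι 2 * x * w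
            eq = solve-∀ ℚring
          a : Fin n → ℚ
          a i = E q (Δ i f)
          J : Subset n
          J = proj₁ (above (w ^ 4) a)
          light : ∀ i → lookup J i ≡ false → a i ≤ w ^ 4
          light = proj₂ (proj₂ (above (w ^ 4) a))
          heavy : ∀ i → lookup J i ≡ true → w ^ 4 ≤ a i
          heavy = proj₁ (proj₂ (above (w ^ 4) a))
          J≤j : ∣ J ∣ ℕ.≤ j
          J≤j = ι-cancel (begin
            ι ∣ J ∣ ≡⟨ *-identityʳ (ι ∣ J ∣) ⟨
            ι ∣ J ∣ * 1ℚ ≡⟨ cong (ι ∣ J ∣ *_) (trans (cong (_^ 4) (trans (*-comm w (ι N₀)) (ι*recip N₀ 1≤N₀))) (1^ 4)) ⟨
            ι ∣ J ∣ * (w * ι N₀) ^ 4 ≡⟨ cong (ι ∣ J ∣ *_) (^-*ᵈ w (ι N₀) 4) ⟩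
            ι ∣ J ∣ * (w ^ 4 * ι N₀ ^ 4) ≡⟨ *-assoc (ι ∣ J ∣) (w ^ 4) (ι N₀ ^ 4) ⟨
            ι ∣ J ∣ * w ^ 4 * ι N₀ ^ 4 ≤⟨ mulʳ (ι N₀ ^ 4) (^≥0 4 (ι≥0 N₀))
              (≤-trans (heavy-coords (w ^ 4) a J (infl≥0 q≥0 q≤1 F mono) heavy) bound) ⟩
            ι (4 ℕ.* m) * ι N₀ ^ 4 ≡⟨ cong (ι (4 ℕ.* m) *_) (ι-^ N₀ 4) ⟨
            ι (4 ℕ.* m) * ι (N₀ ℕ.^ 4) ≡⟨ ι-* (4 ℕ.* m) (N₀ ℕ.^ 4) ⟨
            ι j ∎)

      -- The measure rises by at most 1 over `suc n` equal steps from 1/2m to 1/m, hence by little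
      -- on one of them, and there the influence is small. Largeness at that bias passes to 1/m by
      -- monotonicity in the bias.
      threshold : (∀ J → ∣ J ∣ ℕ.≤ j → ε ≤ Z (recip (2 ℕ.* m)) J f) → 1ℚ - E (recip m) f ≤ recip (2 ℕ.* m)
      threshold robust = ≤-trans
        (+-monoʳ-≤ 1ℚ (neg-antimono-≤ (subst (λ z → E (q t) f ≤ E z f) (sym q₁≡) (E-bias (bias≥0 (q≥ t)) (q≤ t t≤T) (bias≤1 ≤-refl) increasing))))
        (subst (1ℚ - E (q t) f ≤_) (sym q₀≡)
          (small-influence⇒large (q t) (q≥ t) (q≤ t t≤T) influence
            (λ J J≤j → ≤-trans (subst (λ z → ε ≤ Z z J f) q₀≡ (robust J J≤j)) (Z-bias (ρ≥0 ⊕ ρ≥0) (q≥ t) (bias≤1 (q≤ t t≤T)) J increasing))))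
        where
        -- `h` is the step width and `κ` = 1 - 2h the loss per coordinate in `russo`. As n h ≤ 2ρ,
        -- Bernoulli gives κ^n ≥ 1/2, so an increment of at most `c` means influence at most 2c/h =
        -- 1/ρ = 4m.
        c h κ : ℚ
        c = recip (suc n)
        h = (ρ + ρ) * c
        κ = 1ℚ - (h + h)
        increasing = Increasing-𝟙 F mono
        c≥0 : 0ℚ ≤ c
        c≥0 = recip≥0 (suc n)
        Tc : ι (suc n) * c ≡ 1ℚ
        Tc = ι*recip (suc n) (ℕ.s≤s ℕ.z≤n)
        h≥0 : 0ℚ ≤ h
        h≥0 = (ρ≥0 ⊕ ρ≥0) ⊗ c≥0
        q : ℕ → ℚ
        q t = ρ + ρ + ι t * h
        q≥ : ∀ t → ρ + ρ ≤ q t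
        q≥ t = slack (ι t * h) (ι≥0 t ⊗ h≥0) refl
        ic≤1 : ∀ {t} → t ℕ.≤ suc n → ι t * c ≤ 1ℚ
        ic≤1 {t} t≤ = subst (ι t * c ≤_) Tc (mulʳ c c≥0 (ι-mono t≤))
        q≤ : ∀ t → t ℕ.≤ suc n → q t ≤ ρ + ρ + (ρ + ρ)
        q≤ t t≤ = slack ((ρ + ρ) * (1ℚ - ι t * c)) ((ρ≥0 ⊕ ρ≥0) ⊗ gap (ic≤1 t≤)) (eq ρ (ι t) c)
          where
          eq : ∀ ρ t c → ρ + ρ + (ρ + ρ) ≡ ρ + ρ + t * ((ρ + ρ) * c) + (ρ + ρ) * (1ℚ - t * c)
          eq = solve-∀ ℚring
        step = average-step n (λ t → E (q t) f) c
          (≤-trans (E≤1 (bias≥0 (q≥ (suc n))) (bias≤1 (q≤ (suc n) ℕₚ.≤-refl)))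
            (subst (_≤ E (q 0) f + ι (suc n) * c) (trans (+-identityˡ (ι (suc n) * c)) Tc)
              (+-monoˡ-≤ (ι (suc n) * c) (E≥0 (bias≥0 (q≥ 0)) (bias≤1 (q≤ 0 ℕ.z≤n)) (λ x → 𝟙≥0 (F x))))))
        t = proj₁ step
        t≤n = proj₁ (proj₂ step)
        t≤T = ℕₚ.m≤n⇒m≤1+n t≤n
        Q = q t
        Q' = q (suc t)
        Q'-Q : ∀ x y h → x + (1ℚ + y) * h - (x + y * h) ≡ h
        Q'-Q = solve-∀ ℚring
        h≤ : h + h ≤ 1ℚ
        h≤ = slack _ (gap 8ρ≤1 ⊕ ι≥0 4 ⊗ ρ≥0 ⊕ ι≥0 4 ⊗ ρ≥0 ⊗ gap c≤1) (eq ρ c)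
          where
          c≤1 : c ≤ 1ℚ
          c≤1 = subst₂ _≤_ (*-identityˡ c) Tc (mulʳ c c≥0 (ι-mono {1} {suc n} (ℕ.s≤s ℕ.z≤n)))
          eq : ∀ ρ c → 1ℚ ≡ (ρ + ρ) * c + (ρ + ρ) * c + (1ℚ - ι 8 * ρ + ι 4 * ρ + ι 4 * ρ * (1ℚ - c))
          eq = solve-∀ ℚring
        κ-ratio : κ * (1ℚ - Q) ≤ 1ℚ - Q'
        κ-ratio = slack _ (h≥0 ⊗ (gap 8ρ≤1 ⊕ (gap (q≤ t t≤T) ⊕ gap (q≤ t t≤T)))) (eq ρ (ι t) h)
          where
          eq : ∀ ρ t h → 1ℚ - (ρ + ρ + (1ℚ + t) * h) ≡ (1ℚ - (h + h)) * (1ℚ - (ρ + ρ + t * h))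
            + h * (1ℚ - ι 8 * ρ + (ρ + ρ + (ρ + ρ) - (ρ + ρ + t * h) + (ρ + ρ + (ρ + ρ) - (ρ + ρ + t * h))))
          eq = solve-∀ ℚring
        1≤2κⁿ : 1ℚ ≤ κ ^ n + κ ^ n
        1≤2κⁿ = ≤-trans (slack _ (gap 8ρ≤1 ⊕ ι≥0 8 ⊗ ρ≥0 ⊗ gap (ic≤1 (ℕₚ.n≤1+n n))) (eq ρ (ι n) c))
          (+-mono-≤ bern bern)
          where
          bern : 1ℚ - ι n * (h + h) ≤ κ ^ n
          bern = bernoulli (h + h) n (h≥0 ⊕ h≥0) h≤
          eq : ∀ ρ n c → 1ℚ - n * ((ρ + ρ) * c + (ρ + ρ) * c) + (1ℚ - n * ((ρ + ρ) * c + (ρ + ρ) * c))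
            ≡ 1ℚ + (1ℚ - ι 8 * ρ + ι 8 * ρ * (1ℚ - n * c))
          eq = solve-∀ ℚring
        κ≥0 : 0ℚ ≤ κ
        κ≥0 = gap h≤
        κ≤1 : κ ≤ 1ℚ
        κ≤1 = slack (h + h) (h≥0 ⊕ h≥0) (eq h)
          where
          eq : ∀ h → 1ℚ ≡ 1ℚ - (h + h) + (h + h)
          eq = solve-∀ ℚring
        i = infl Q f
        i≥0 : 0ℚ ≤ i
        i≥0 = Σf≥0 (infl≥0 (bias≥0 (q≥ t)) (bias≤1 (q≤ t t≤T)) F mono)
        increment : h * (κ ^ n * i) ≤ c
        increment = subst₂ _≤_ (trans (eq₁ (E Q f) ((Q' - Q) * (κ ^ n * i))) (cong (_* (κ ^ n * i)) (Q'-Q (ρ + ρ) (ι t) h))) (eq₁ (E Q f) c)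
          (+-monoˡ-≤ (- E Q f) (≤-trans
            (russo (bias≥0 (q≥ t)) (subst (Q ≤_) refl (slack h h≥0 (eq₂ (ρ + ρ) (ι t) h))) (bias≤1 (q≤ (suc t) (ℕ.s≤s t≤n))) κ≥0 κ≤1 κ-ratio f increasing)
            (proj₂ (proj₂ step))))
          where
          eq₁ : ∀ x y → x + y - x ≡ y
          eq₁ = solve-∀ ℚring
          eq₂ : ∀ x y h → x + (1ℚ + y) * h ≡ x + y * h + h
          eq₂ = solve-∀ ℚring
        influence : i ≤ ι (4 ℕ.* m)
        influence = begin
          i ≡⟨ *-identityʳ i ⟨
          i * 1ℚ ≤⟨ mulˡ i i≥0 1≤2κⁿ ⟩
          i * (κ ^ n + κ ^ n) ≡⟨ *-identityʳ _ ⟨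
          i * (κ ^ n + κ ^ n) * (1ℚ * 1ℚ) ≡⟨ cong₂ (λ x y → i * (κ ^ n + κ ^ n) * (x * y)) 4mρ Tc ⟨
          i * (κ ^ n + κ ^ n) * (ι 4 * ι m * ρ * (ι (suc n) * c)) ≡⟨ eq i (κ ^ n) (ι m) ρ (ι (suc n)) c ⟩
          ι 4 * ι m * ι (suc n) * (h * (κ ^ n * i)) ≤⟨ mulˡ _ (ι≥0 4 ⊗ ι≥0 m ⊗ ι≥0 (suc n)) increment ⟩
          ι 4 * ι m * ι (suc n) * c ≡⟨ *-assoc (ι 4 * ι m) (ι (suc n)) c ⟩
          ι 4 * ι m * (ι (suc n) * c) ≡⟨ cong (ι 4 * ι m *_) Tc ⟩
          ι 4 * ι m * 1ℚ ≡⟨ *-identityʳ _ ⟩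
          ι 4 * ι m ≡⟨ ι-* 4 m ⟨
          ι (4 ℕ.* m) ∎
          where
          open ≤-Reasoning
          eq : ∀ i k m ρ T c → i * (k + k) * (ι 4 * m * ρ * (T * c)) ≡ ι 4 * m * T * ((ρ + ρ) * c * (k * i))
          eq = solve-∀ ℚring

-- Counting families of finite sets.

module Count where
  open import Defs using (Family; allSubsets; count)
  open import Data.Nat
  open import Data.Nat.Properties
  open import Data.Nat.Tactic.RingSolver using (solve-∀)
  open import Data.Bool using (Bool; true; false; not; _∧_; _∨_; T)
  open import Data.Bool.Properties using (T?)
  open import Data.Fin using (Fin; zero; suc)
  open import Data.Fin.Subset using (Subset; ∣_∣)
  open import Data.Vec using ([]; _∷_; lookup)
  open import Data.List as List using (List; length; filter; map; _++_)
  open import Data.List.Properties using (length-++; filter-++)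
  open import Data.Product using (_×_; _,_; ∃-syntax)
  open import Data.Sum using (_⊎_; inj₁; inj₂)
  open import Data.Empty using (⊥; ⊥-elim)
  open import Relation.Binary.PropositionalEquality

  bit : Bool → ℕ
  bit true = 1
  bit false = 0

  cnt : ∀ {n} → Family n → ℕ
  cnt {zero} F = bit (F [])
  cnt {suc n} F = cnt (λ A → F (true ∷ A)) + cnt (λ A → F (false ∷ A))

  private
    length-filter-map : ∀ {n m} (F : Family m) (f : Subset n → Subset m) xs →
      length (filter (λ A → T? (F A)) (map f xs)) ≡ length (filter (λ A → T? (F (f A))) xs)
    length-filter-map F f List.[] = refl
    length-filter-map F f (x List.∷ xs) with F (f x)
    ... | true = cong suc (length-filter-map F f xs)
    ... | false = length-filter-map F f xs

  count≡cnt : ∀ {n} (F : Family n) → count F ≡ cnt F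
  count≡cnt {zero} F with F []
  ... | true = refl
  ... | false = refl
  count≡cnt {suc n} F = begin
    count F ≡⟨ cong length (filter-++ (λ A → T? (F A)) (map (true ∷_) (allSubsets n)) _) ⟩
    length (filter P? (map (true ∷_) (allSubsets n)) ++ filter P? (map (false ∷_) (allSubsets n)))
      ≡⟨ length-++ (filter P? (map (true ∷_) (allSubsets n))) ⟩
    length (filter P? (map (true ∷_) (allSubsets n))) + length (filter P? (map (false ∷_) (allSubsets n)))
      ≡⟨ cong₂ _+_ (length-filter-map F (true ∷_) (allSubsets n)) (length-filter-map F (false ∷_) (allSubsets n)) ⟩
    count (λ A → F (true ∷ A)) + count (λ A → F (false ∷ A))
      ≡⟨ cong₂ _+_ (count≡cnt (λ A → F (true ∷ A))) (count≡cnt (λ A → F (false ∷ A))) ⟩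
    cnt F ∎
    where
    open ≡-Reasoning
    P? = λ A → T? (F A)

  _⇒_ : ∀ {n} → Family n → Family n → Set
  F ⇒ G = ∀ A → F A ≡ true → G A ≡ true

  cnt-mono : ∀ {n} {F G : Family n} → F ⇒ G → cnt F ≤ cnt G
  cnt-mono {zero} {F} {G} h with F [] | h []
  ... | false | _ = z≤n
  ... | true | k rewrite k refl = ≤-refl
  cnt-mono {suc n} h = +-mono-≤ (cnt-mono (λ A → h (true ∷ A))) (cnt-mono (λ A → h (false ∷ A)))

  cnt-cong : ∀ {n} {F G : Family n} → (∀ A → F A ≡ G A) → cnt F ≡ cnt G
  cnt-cong {zero} h = cong bit (h [])
  cnt-cong {suc n} h = cong₂ _+_ (cnt-cong (λ A → h (true ∷ A))) (cnt-cong (λ A → h (false ∷ A)))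

  cnt-∨ : ∀ {n} (F G : Family n) → cnt (λ A → F A ∨ G A) ≤ cnt F + cnt G
  cnt-∨ {zero} F G with F [] | G []
  ... | true | _ = s≤s z≤n
  ... | false | true = ≤-refl
  ... | false | false = z≤n
  cnt-∨ {suc n} F G = ≤-trans
    (+-mono-≤ (cnt-∨ (λ A → F (true ∷ A)) (λ A → G (true ∷ A))) (cnt-∨ (λ A → F (false ∷ A)) (λ A → G (false ∷ A))))
    (≤-reflexive (eq (cnt (λ A → F (true ∷ A))) _ _ _))
    where
    eq : ∀ a b c d → a + b + (c + d) ≡ a + c + (b + d)
    eq = solve-∀

  cnt-cover : ∀ {n} (F G₁ G₂ : Family n) → (∀ A → F A ≡ true → (G₁ A ≡ true) ⊎ (G₂ A ≡ true)) → cnt F ≤ cnt G₁ + cnt G₂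
  cnt-cover F G₁ G₂ h = ≤-trans (cnt-mono cover) (cnt-∨ G₁ G₂)
    where
    cover : F ⇒ (λ A → G₁ A ∨ G₂ A)
    cover A f with G₁ A | G₂ A | h A f
    ... | true | _ | _ = refl
    ... | false | true | _ = refl
    ... | false | false | inj₁ ()
    ... | false | false | inj₂ ()

  cnt-false : ∀ n → cnt {n} (λ _ → false) ≡ 0
  cnt-false zero = refl
  cnt-false (suc n) = cong₂ _+_ (cnt-false n) (cnt-false n)

  find : ∀ {n} (F : Family n) → (∃[ A ] F A ≡ true) ⊎ (∀ A → F A ≡ false)
  find {zero} F with F [] in e
  ... | true = inj₁ ([] , e)
  ... | false = inj₂ (λ { [] → e })
  find {suc n} F with find (λ A → F (true ∷ A)) | find (λ A → F (false ∷ A))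
  ... | inj₁ (A , e) | _ = inj₁ (true ∷ A , e)
  ... | inj₂ _ | inj₁ (A , e) = inj₁ (false ∷ A , e)
  ... | inj₂ h | inj₂ k = inj₂ (λ { (true ∷ A) → h A ; (false ∷ A) → k A })

  cnt-pos : ∀ {n} (F : Family n) → 1 ≤ cnt F → ∃[ A ] F A ≡ true
  cnt-pos {n} F h with find F
  ... | inj₁ x = x
  ... | inj₂ k with () ← subst (1 ≤_) (trans (cnt-cong k) (cnt-false n)) h

  choose : ℕ → ℕ → ℕ
  choose n zero = 1
  choose zero (suc k) = 0
  choose (suc n) (suc k) = choose n k + choose n (suc k)

  sized : ∀ {n} → ℕ → Family n
  sized k A = ∣ A ∣ ≡ᵇ k

  sized-cnt : ∀ n k → cnt {n} (sized k) ≡ choose n k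
  sized-cnt zero zero = refl
  sized-cnt zero (suc k) = refl
  sized-cnt (suc n) zero = trans (cong₂ _+_ (cnt-false n) (sized-cnt n zero)) refl
  sized-cnt (suc n) (suc k) = cong₂ _+_ (sized-cnt n k) (sized-cnt n (suc k))

  ≡ᵇ-refl : ∀ k → (k ≡ᵇ k) ≡ true
  ≡ᵇ-refl zero = refl
  ≡ᵇ-refl (suc k) = ≡ᵇ-refl k

  ≡ᵇ-true : ∀ a b → (a ≡ᵇ b) ≡ true → a ≡ b
  ≡ᵇ-true zero zero h = refl
  ≡ᵇ-true (suc a) (suc b) h = cong suc (≡ᵇ-true a b h)

  to-sized : ∀ {n k} {A : Subset n} → ∣ A ∣ ≡ k → sized k A ≡ true
  to-sized {A = A} refl = ≡ᵇ-refl ∣ A ∣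

  -- The additive form avoids the truncated difference n - k in the absorption identity.
  choose-absorb : ∀ n k → suc k * choose n (suc k) + k * choose n k ≡ n * choose n k
  choose-absorb zero zero = refl
  choose-absorb zero (suc k) = cong₂ _+_ (*-zeroʳ k) (*-zeroʳ k)
  choose-absorb (suc n) zero = begin
    1 * (1 + choose n 1) + 0 ≡⟨ eq (choose n 1) ⟩
    1 + (1 * choose n 1 + 0 * 1) ≡⟨ cong suc (choose-absorb n zero) ⟩
    1 + n * 1 ∎
    where
    open ≡-Reasoning
    eq : ∀ x → 1 * (1 + x) + 0 ≡ 1 + (1 * x + 0 * 1)
    eq = solve-∀
  choose-absorb (suc n) (suc k) = begin
    (2 + k) * (b + c) + suc k * (a + b) ≡⟨ eq₁ k a b c ⟩
    (2 + k) * c + suc k * b + (suc k * b + k * a) + (a + b) ≡⟨ cong₂ (λ x y → x + y + (a + b)) (choose-absorb n (suc k)) (choose-absorb n k) ⟩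
    n * b + n * a + (a + b) ≡⟨ eq₂ n a b ⟩
    suc n * (a + b) ∎
    where
    open ≡-Reasoning
    a = choose n k
    b = choose n (suc k)
    c = choose n (suc (suc k))
    eq₁ : ∀ k a b c → (2 + k) * (b + c) + suc k * (a + b) ≡ (2 + k) * c + suc k * b + (suc k * b + k * a) + (a + b)
    eq₁ = solve-∀
    eq₂ : ∀ n a b → n * b + n * a + (a + b) ≡ suc n * (a + b)
    eq₂ = solve-∀

  choose-pos : ∀ n k → k ≤ n → 1 ≤ choose n k
  choose-pos n zero h = ≤-refl
  choose-pos (suc n) (suc k) (s≤s h) = ≤-trans (choose-pos n k h) (m≤m+n _ _)

  choose-big : ∀ n k → n < k → choose n k ≡ 0
  choose-big zero (suc k) h = refl
  choose-big (suc n) (suc k) (s≤s h) = cong₂ _+_ (choose-big n k h) (choose-big n (suc k) (m≤n⇒m≤1+n h))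

  infix 4 _∋_
  _∋_ : ∀ {n} → Subset n → Fin n → Set
  A ∋ x = lookup A x ≡ true

  _⊑_ : ∀ {n} → Subset n → Subset n → Set
  A ⊑ B = ∀ x → A ∋ x → B ∋ x

  ⊑-tail : ∀ {n a b} {A B : Subset n} → (a ∷ A) ⊑ (b ∷ B) → A ⊑ B
  ⊑-tail h x = h (suc x)

  ⊑ᵇ : ∀ {n} → Subset n → Subset n → Bool
  ⊑ᵇ [] [] = true
  ⊑ᵇ (true ∷ A) (b ∷ B) = b ∧ ⊑ᵇ A B
  ⊑ᵇ (false ∷ A) (b ∷ B) = ⊑ᵇ A B

  ⊑ᵇ-sound : ∀ {n} (A B : Subset n) → ⊑ᵇ A B ≡ true → A ⊑ B
  ⊑ᵇ-sound (true ∷ A) (true ∷ B) h zero k = refl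
  ⊑ᵇ-sound (true ∷ A) (true ∷ B) h (suc x) k = ⊑ᵇ-sound A B h x k
  ⊑ᵇ-sound (false ∷ A) (b ∷ B) h (suc x) k = ⊑ᵇ-sound A B h x k

  ⊑ᵇ-complete : ∀ {n} (A B : Subset n) → A ⊑ B → ⊑ᵇ A B ≡ true
  ⊑ᵇ-complete [] [] h = refl
  ⊑ᵇ-complete (true ∷ A) (b ∷ B) h rewrite h zero refl = ⊑ᵇ-complete A B (λ x → h (suc x))
  ⊑ᵇ-complete (false ∷ A) (b ∷ B) h = ⊑ᵇ-complete A B (λ x → h (suc x))

  Disjoint : ∀ {n} → Subset n → Subset n → Set
  Disjoint A B = ∀ x → A ∋ x → B ∋ x → ⊥

  disj : ∀ {n} → Subset n → Subset n → Bool
  disj [] [] = true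
  disj (true ∷ A) (b ∷ B) = not b ∧ disj A B
  disj (false ∷ A) (b ∷ B) = disj A B

  disj-sound : ∀ {n} (A B : Subset n) → disj A B ≡ true → Disjoint A B
  disj-sound (true ∷ A) (false ∷ B) h (suc x) p q = disj-sound A B h x p q
  disj-sound (false ∷ A) (b ∷ B) h (suc x) p q = disj-sound A B h x p q

  disj-complete : ∀ {n} (A B : Subset n) → Disjoint A B → disj A B ≡ true
  disj-complete [] [] h = refl
  disj-complete (true ∷ A) (true ∷ B) h = ⊥-elim (h zero refl refl)
  disj-complete (true ∷ A) (false ∷ B) h = disj-complete A B (λ x → h (suc x))
  disj-complete (false ∷ A) (b ∷ B) h = disj-complete A B (λ x → h (suc x))

  size-mono : ∀ {n} (A B : Subset n) → A ⊑ B → ∣ A ∣ ≤ ∣ B ∣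
  size-mono [] [] h = z≤n
  size-mono (true ∷ A) (true ∷ B) h = s≤s (size-mono A B (⊑-tail {A = A} {B} h))
  size-mono (true ∷ A) (false ∷ B) h with () ← h zero refl
  size-mono (false ∷ A) (true ∷ B) h = m≤n⇒m≤1+n (size-mono A B (⊑-tail {A = A} {B} h))
  size-mono (false ∷ A) (false ∷ B) h = size-mono A B (⊑-tail {A = A} {B} h)

  up : ∀ {n} → Family n → Family n
  up {zero} L [] = L []
  up {suc n} L (true ∷ W) = up (λ A → L (true ∷ A)) W ∨ up (λ A → L (false ∷ A)) W
  up {suc n} L (false ∷ W) = up (λ A → L (false ∷ A)) W

  up-sound : ∀ {n} (L : Family n) W → up L W ≡ true → ∃[ B ] (L B ≡ true × B ⊑ W)
  up-sound {zero} L [] h = [] , h , λ ()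
  up-sound {suc n} L (true ∷ W) h with up (λ A → L (true ∷ A)) W in e
  ... | true = let B , l , s = up-sound (λ A → L (true ∷ A)) W e in true ∷ B , l , λ { zero _ → refl ; (suc x) → s x }
  ... | false = let B , l , s = up-sound (λ A → L (false ∷ A)) W h in false ∷ B , l , λ { zero () ; (suc x) → s x }
  up-sound {suc n} L (false ∷ W) h = let B , l , s = up-sound (λ A → L (false ∷ A)) W h in false ∷ B , l , λ { zero () ; (suc x) → s x }

  ∨-right : ∀ a {b} → b ≡ true → (a ∨ b) ≡ true
  ∨-right true h = refl
  ∨-right false h = h

  ∨-left : ∀ {a} b → a ≡ true → (a ∨ b) ≡ true
  ∨-left b refl = refl

  up-complete : ∀ {n} (L : Family n) B W → L B ≡ true → B ⊑ W → up L W ≡ true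
  up-complete {zero} L [] [] l s = l
  up-complete {suc n} L (true ∷ B) (true ∷ W) l s = ∨-left _ (up-complete (λ A → L (true ∷ A)) B W l (⊑-tail {A = B} {W} s))
  up-complete {suc n} L (true ∷ B) (false ∷ W) l s with () ← s zero refl
  up-complete {suc n} L (false ∷ B) (true ∷ W) l s = ∨-right _ (up-complete (λ A → L (false ∷ A)) B W l (⊑-tail {A = B} {W} s))
  up-complete {suc n} L (false ∷ B) (false ∷ W) l s = up-complete (λ A → L (false ∷ A)) B W l (⊑-tail {A = B} {W} s)

  infixl 6 _∖ˢ_
  _∖ˢ_ : ∀ {n} → Subset n → Subset n → Subset n
  [] ∖ˢ [] = []
  (a ∷ A) ∖ˢ (b ∷ B) = (a ∧ not b) ∷ (A ∖ˢ B)

  ∧-true : ∀ {a b} → (a ∧ b) ≡ true → (a ≡ true) × (b ≡ true)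
  ∧-true {true} h = refl , h

  ∧-intro : ∀ {a b} → a ≡ true → b ≡ true → (a ∧ b) ≡ true
  ∧-intro refl h = h

  lookup-∖ : ∀ {n} (A B : Subset n) x → lookup (A ∖ˢ B) x ≡ (lookup A x ∧ not (lookup B x))
  lookup-∖ (a ∷ A) (b ∷ B) zero = refl
  lookup-∖ (a ∷ A) (b ∷ B) (suc x) = lookup-∖ A B x

  ^-distribʳ-* : ∀ r a b → (a * b) ^ r ≡ a ^ r * b ^ r
  ^-distribʳ-* zero a b = refl
  ^-distribʳ-* (suc r) a b = trans (cong (a * b *_) (^-distribʳ-* r a b)) (eq a b (a ^ r) (b ^ r))
    where
    eq : ∀ a b c d → a * b * (c * d) ≡ a * c * (b * d)
    eq = solve-∀

  false≢true : false ≡ true → ⊥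
  false≢true ()

  T-true : ∀ {b} → T b → b ≡ true
  T-true {true} _ = refl

-- From slices to product measures.

module Transfer where
  open import Defs using (Family)
  open QOrd
  open Cube
  open Count
  open import Data.Nat as ℕ using (ℕ; zero; suc)
  import Data.Nat.Properties as ℕₚ
  import Data.Nat.Tactic.RingSolver as ℕSolver
  open import Data.Bool as Bool using (Bool; true; false; _∧_; _∨_) renaming (_≤_ to _≤𝔹_)
  open import Data.Fin using (zero; suc)
  open import Data.Fin.Subset using (Subset; ∣_∣)
  open import Data.Vec using ([]; _∷_)
  open import Data.Rational hiding (∣_∣; _≟_)
  open import Data.Rational.Properties hiding (_≟_)
  open import Relation.Binary.PropositionalEquality hiding (J)
  open import Relation.Nullary using (yes; no)
  open import Tactic.RingSolver using (solve-∀)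
  open import Data.Product using (_×_; _,_; ∃-syntax; proj₂)
  open import Data.Empty using (⊥; ⊥-elim)
  open import Data.Unit using (tt)

  -- Horner form of Σ_{k ≤ n} a k * p ^ k * (1 - p) ^ (n - k).
  Ev : ℚ → ℕ → (ℕ → ℚ) → ℚ
  Ev p zero a = a 0
  Ev p (suc n) a = (1ℚ - p) ^ suc n * a 0 + p * Ev p n (λ k → a (suc k))

  Ev-last : ∀ p n a → a (suc n) ≡ 0ℚ → Ev p (suc n) a ≡ (1ℚ - p) * Ev p n a
  Ev-last p zero a h = trans (cong (λ z → (1ℚ - p) * 1ℚ * a 0 + p * z) h) (eq p (a 0))
    where
    eq : ∀ p x → (1ℚ - p) * 1ℚ * x + p * 0ℚ ≡ (1ℚ - p) * x
    eq = solve-∀ ℚring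
  Ev-last p (suc n) a h = trans (cong (λ z → (1ℚ - p) ^ suc (suc n) * a 0 + p * z) (Ev-last p n (λ k → a (suc k)) h))
    (eq p ((1ℚ - p) ^ suc n) (a 0) (Ev p n (λ k → a (suc k))))
    where
    eq : ∀ p r x y → (1ℚ - p) * r * x + p * ((1ℚ - p) * y) ≡ (1ℚ - p) * (r * x + p * y)
    eq = solve-∀ ℚring

  Ev-cong : ∀ p n {a b} → (∀ k → a k ≡ b k) → Ev p n a ≡ Ev p n b
  Ev-cong p zero h = h 0
  Ev-cong p (suc n) h = cong₂ (λ x y → (1ℚ - p) ^ suc n * x + p * y) (h 0) (Ev-cong p n (λ k → h (suc k)))

  Ev-lin : ∀ p n x y a b → Ev p n (λ k → x * a k + y * b k) ≡ x * Ev p n a + y * Ev p n b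
  Ev-lin p zero x y a b = refl
  Ev-lin p (suc n) x y a b = trans (cong (λ z → (1ℚ - p) ^ suc n * (x * a 0 + y * b 0) + p * z) (Ev-lin p n x y (λ k → a (suc k)) (λ k → b (suc k))))
    (eq p ((1ℚ - p) ^ suc n) x y (a 0) (b 0) (Ev p n (λ k → a (suc k))) (Ev p n (λ k → b (suc k))))
    where
    eq : ∀ p r x y a b c d → r * (x * a + y * b) + p * (x * c + y * d) ≡ x * (r * a + p * c) + y * (r * b + p * d)
    eq = solve-∀ ℚring

  Ev≥0 : ∀ {p} → 0ℚ ≤ p → p ≤ 1ℚ → ∀ n {a} → (∀ k → 0ℚ ≤ a k) → 0ℚ ≤ Ev p n a
  Ev≥0 h k zero l = l 0
  Ev≥0 h k (suc n) l = ^≥0 (suc n) (gap k) ⊗ l 0 ⊕ h ⊗ Ev≥0 h k n (λ i → l (suc i))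

  level : ∀ {n} → (Subset n → ℚ) → ℕ → ℚ
  level {zero} g zero = g []
  level {zero} g (suc k) = 0ℚ
  level {suc n} g zero = level (λ x → g (false ∷ x)) zero
  level {suc n} g (suc k) = level (λ x → g (true ∷ x)) k + level (λ x → g (false ∷ x)) (suc k)

  level-big : ∀ {n} (g : Subset n → ℚ) k → n ℕ.< k → level g k ≡ 0ℚ
  level-big {zero} g (suc k) h = refl
  level-big {suc n} g (suc k) (ℕ.s≤s h) = cong₂ _+_ (level-big (λ x → g (true ∷ x)) k h) (level-big (λ x → g (false ∷ x)) (suc k) (ℕₚ.m≤n⇒m≤1+n h))

  E-level : ∀ p {n} (g : Subset n → ℚ) → E p g ≡ Ev p n (level g)
  E-level p {zero} g = refl
  E-level p {suc n} g = begin
    p * E p g₁ + (1ℚ - p) * E p g₀ ≡⟨ cong₂ (λ x y → p * x + (1ℚ - p) * y) (E-level p g₁) (E-level p g₀) ⟩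
    p * Ev p n (level g₁) + (1ℚ - p) * Ev p n (level g₀)
      ≡⟨ cong (p * Ev p n (level g₁) +_) (Ev-last p n (level g₀) (level-big g₀ (suc n) ℕₚ.≤-refl)) ⟨
    p * Ev p n (level g₁) + ((1ℚ - p) ^ suc n * level g₀ 0 + p * Ev p n (λ k → level g₀ (suc k)))
      ≡⟨ eq p (Ev p n (level g₁)) ((1ℚ - p) ^ suc n * level g₀ 0) (Ev p n (λ k → level g₀ (suc k))) ⟩
    (1ℚ - p) ^ suc n * level g₀ 0 + p * (1ℚ * Ev p n (level g₁) + 1ℚ * Ev p n (λ k → level g₀ (suc k)))
      ≡⟨ cong (λ z → (1ℚ - p) ^ suc n * level g₀ 0 + p * z) (trans (sym (Ev-lin p n 1ℚ 1ℚ (level g₁) (λ k → level g₀ (suc k))))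
        (Ev-cong p n (λ k → eq₂ (level g₁ k) (level g₀ (suc k))))) ⟩
    Ev p (suc n) (level g) ∎
    where
    open ≡-Reasoning
    g₁ g₀ : Subset n → ℚ
    g₁ x = g (true ∷ x)
    g₀ x = g (false ∷ x)
    eq : ∀ p a b c → p * a + (b + p * c) ≡ b + p * (1ℚ * a + 1ℚ * c)
    eq = solve-∀ ℚring
    eq₂ : ∀ a b → 1ℚ * a + 1ℚ * b ≡ a + b
    eq₂ = solve-∀ ℚring

  lev : ∀ {n} → Family n → ℕ → ℕ
  lev {zero} F zero = bit (F [])
  lev {zero} F (suc k) = 0
  lev {suc n} F zero = lev (λ A → F (false ∷ A)) zero
  lev {suc n} F (suc k) = lev (λ A → F (true ∷ A)) k ℕ.+ lev (λ A → F (false ∷ A)) (suc k)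

  level-𝟙 : ∀ {n} (F : Family n) k → level (λ A → 𝟙 (F A)) k ≡ ι (lev F k)
  level-𝟙 {zero} F zero with F []
  ... | true = refl
  ... | false = refl
  level-𝟙 {zero} F (suc k) = refl
  level-𝟙 {suc n} F zero = level-𝟙 (λ A → F (false ∷ A)) zero
  level-𝟙 {suc n} F (suc k) = trans (cong₂ _+_ (level-𝟙 (λ A → F (true ∷ A)) k) (level-𝟙 (λ A → F (false ∷ A)) (suc k)))
    (sym (ι-+ (lev (λ A → F (true ∷ A)) k) _))

  lev-cnt : ∀ {n} (F : Family n) k → lev F k ≡ cnt (λ A → F A ∧ sized k A)
  lev-cnt {zero} F zero with F []
  ... | true = refl
  ... | false = refl
  lev-cnt {zero} F (suc k) with F []
  ... | true = refl
  ... | false = refl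
  lev-cnt {suc n} F zero = trans (lev-cnt (λ A → F (false ∷ A)) zero)
    (cong (ℕ._+ cnt (λ A → F (false ∷ A) ∧ sized 0 A)) (sym (trans (cnt-cong (λ A → ∧-false (F (true ∷ A)))) (cnt-false n))))
    where
    ∧-false : ∀ b → (b ∧ false) ≡ false
    ∧-false true = refl
    ∧-false false = refl
  lev-cnt {suc n} F (suc k) = cong₂ ℕ._+_ (lev-cnt (λ A → F (true ∷ A)) k) (lev-cnt (λ A → F (false ∷ A)) (suc k))

  lev-mono : ∀ {n} {F G : Family n} → (∀ A → F A ≤𝔹 G A) → ∀ k → lev F k ℕ.≤ lev G k
  lev-mono {zero} {F} {G} h zero with F [] | G [] | h []
  ... | false | _ | _ = ℕ.z≤n
  ... | true | true | _ = ℕₚ.≤-refl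
  lev-mono {zero} h (suc k) = ℕ.z≤n
  lev-mono {suc n} h zero = lev-mono (λ A → h (false ∷ A)) zero
  lev-mono {suc n} h (suc k) = ℕₚ.+-mono-≤ (lev-mono (λ A → h (true ∷ A)) k) (lev-mono (λ A → h (false ∷ A)) (suc k))

  -- Induction on the dimension instead of a double count of covering pairs; the last summand stands
  -- for the difference n - k. What the two restrictions leave over is settled by monotonicity in
  -- the first coordinate.
  local-LYM : ∀ {n} (F : Family n) → Mono F → ∀ k → n ℕ.* lev F k ℕ.≤ suc k ℕ.* lev F (suc k) ℕ.+ k ℕ.* lev F k
  local-LYM {zero} F m k = ℕ.z≤n
  local-LYM {suc n} F (m , mt , mf) zero = ℕₚ.≤-trans
    (ℕₚ.+-mono-≤ (lev-mono m 0) (local-LYM (λ A → F (false ∷ A)) mf 0))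
    (ℕₚ.≤-reflexive (eq (lev (λ A → F (true ∷ A)) 0) (lev (λ A → F (false ∷ A)) 1)))
    where
    eq : ∀ a b → a ℕ.+ (b ℕ.+ 0 ℕ.+ 0) ≡ a ℕ.+ b ℕ.+ 0 ℕ.+ 0
    eq = ℕSolver.solve-∀
  local-LYM {suc n} F (m , mt , mf) (suc k) = begin
    suc n ℕ.* (a ℕ.+ c) ≡⟨ eq₁ n a c ⟩
    n ℕ.* a ℕ.+ n ℕ.* c ℕ.+ a ℕ.+ c
      ≤⟨ ℕₚ.+-monoʳ-≤ _ (lev-mono m (suc k)) ⟩
    n ℕ.* a ℕ.+ n ℕ.* c ℕ.+ a ℕ.+ b
      ≤⟨ ℕₚ.+-monoˡ-≤ b (ℕₚ.+-monoˡ-≤ a (ℕₚ.+-mono-≤ (local-LYM (λ A → F (true ∷ A)) mt k) (local-LYM (λ A → F (false ∷ A)) mf (suc k)))) ⟩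
    suc k ℕ.* b ℕ.+ k ℕ.* a ℕ.+ (suc (suc k) ℕ.* d ℕ.+ suc k ℕ.* c) ℕ.+ a ℕ.+ b ≡⟨ eq₂ k a b c d ⟩
    suc (suc k) ℕ.* (b ℕ.+ d) ℕ.+ suc k ℕ.* (a ℕ.+ c) ∎
    where
    open ℕₚ.≤-Reasoning
    a = lev (λ A → F (true ∷ A)) k
    b = lev (λ A → F (true ∷ A)) (suc k)
    c = lev (λ A → F (false ∷ A)) (suc k)
    d = lev (λ A → F (false ∷ A)) (suc (suc k))
    eq₁ : ∀ n a c → suc n ℕ.* (a ℕ.+ c) ≡ n ℕ.* a ℕ.+ n ℕ.* c ℕ.+ a ℕ.+ c
    eq₁ = ℕSolver.solve-∀
    eq₂ : ∀ k a b c d → suc k ℕ.* b ℕ.+ k ℕ.* a ℕ.+ (suc (suc k) ℕ.* d ℕ.+ suc k ℕ.* c) ℕ.+ a ℕ.+ b ≡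
      suc (suc k) ℕ.* (b ℕ.+ d) ℕ.+ suc k ℕ.* (a ℕ.+ c)
    eq₂ = ℕSolver.solve-∀

  LYM : ∀ {n} (F : Family n) → Mono F → ∀ κ i → lev F κ ℕ.* choose n (i ℕ.+ κ) ℕ.≤ choose n κ ℕ.* lev F (i ℕ.+ κ)
  LYM {n} F m κ zero = ℕₚ.≤-reflexive (ℕₚ.*-comm (lev F κ) (choose n κ))
  LYM {n} F m κ (suc i) = ℕₚ.*-cancelˡ-≤ (suc k) (ℕₚ.+-cancelʳ-≤ (k ℕ.* (N₀ ℕ.* c)) _ _ (begin
    suc k ℕ.* (N₀ ℕ.* c') ℕ.+ k ℕ.* (N₀ ℕ.* c) ≡⟨ eq₁ k N₀ c' c ⟩
    N₀ ℕ.* (suc k ℕ.* c' ℕ.+ k ℕ.* c) ≡⟨ cong (N₀ ℕ.*_) (choose-absorb n k) ⟩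
    N₀ ℕ.* (n ℕ.* c) ≡⟨ eq₂ N₀ n c ⟩
    n ℕ.* (N₀ ℕ.* c) ≤⟨ key ⟩
    suc k ℕ.* (b ℕ.* N') ℕ.+ k ℕ.* (N₀ ℕ.* c) ∎))
    where
    open ℕₚ.≤-Reasoning
    k = i ℕ.+ κ
    N₀ = lev F κ
    N N' b c c' : ℕ
    N = lev F k
    N' = lev F (suc k)
    b = choose n κ
    c = choose n k
    c' = choose n (suc k)
    eq₁ : ∀ k N c' c → suc k ℕ.* (N ℕ.* c') ℕ.+ k ℕ.* (N ℕ.* c) ≡ N ℕ.* (suc k ℕ.* c' ℕ.+ k ℕ.* c)
    eq₁ = ℕSolver.solve-∀
    eq₂ : ∀ N n c → N ℕ.* (n ℕ.* c) ≡ n ℕ.* (N ℕ.* c)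
    eq₂ = ℕSolver.solve-∀
    eq₃ : ∀ b n N → b ℕ.* (n ℕ.* N) ≡ n ℕ.* (b ℕ.* N)
    eq₃ = ℕSolver.solve-∀
    eq₄ : ∀ b k N' N → b ℕ.* (suc k ℕ.* N' ℕ.+ k ℕ.* N) ≡ suc k ℕ.* (b ℕ.* N') ℕ.+ k ℕ.* (b ℕ.* N)
    eq₄ = ℕSolver.solve-∀
    key : n ℕ.* (N₀ ℕ.* c) ℕ.≤ suc k ℕ.* (b ℕ.* N') ℕ.+ k ℕ.* (N₀ ℕ.* c)
    key with k ℕ.≤? n
    ... | no k≰n = subst (λ z → n ℕ.* z ℕ.≤ suc k ℕ.* (b ℕ.* N') ℕ.+ k ℕ.* z)
        (sym (trans (cong (N₀ ℕ.*_) (choose-big n k (ℕₚ.≰⇒> k≰n))) (ℕₚ.*-zeroʳ N₀)))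
        (subst (ℕ._≤ suc k ℕ.* (b ℕ.* N') ℕ.+ k ℕ.* 0) (sym (ℕₚ.*-zeroʳ n)) ℕ.z≤n)
    ... | yes k≤n with ℕₚ.m≤n⇒∃[o]m+o≡n k≤n
    ... | o , refl = begin
      (k ℕ.+ o) ℕ.* (N₀ ℕ.* c) ≡⟨ ℕₚ.*-distribʳ-+ (N₀ ℕ.* c) k o ⟩
      k ℕ.* (N₀ ℕ.* c) ℕ.+ o ℕ.* (N₀ ℕ.* c) ≤⟨ ℕₚ.+-monoʳ-≤ (k ℕ.* (N₀ ℕ.* c)) (ℕₚ.≤-trans (ℕₚ.*-monoʳ-≤ o (LYM F m κ i)) drop) ⟩
      k ℕ.* (N₀ ℕ.* c) ℕ.+ suc k ℕ.* (b ℕ.* N') ≡⟨ ℕₚ.+-comm (k ℕ.* (N₀ ℕ.* c)) _ ⟩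
      suc k ℕ.* (b ℕ.* N') ℕ.+ k ℕ.* (N₀ ℕ.* c) ∎
      where
      drop : o ℕ.* (b ℕ.* N) ℕ.≤ suc k ℕ.* (b ℕ.* N')
      drop = ℕₚ.+-cancelʳ-≤ (k ℕ.* (b ℕ.* N)) _ _ (begin
        o ℕ.* (b ℕ.* N) ℕ.+ k ℕ.* (b ℕ.* N) ≡⟨ eq o b N k ⟩
        b ℕ.* ((k ℕ.+ o) ℕ.* N) ≤⟨ ℕₚ.*-monoʳ-≤ b (local-LYM F m k) ⟩
        b ℕ.* (suc k ℕ.* N' ℕ.+ k ℕ.* N) ≡⟨ eq₄ b k N' N ⟩
        suc k ℕ.* (b ℕ.* N') ℕ.+ k ℕ.* (b ℕ.* N) ∎)
        where
        eq : ∀ o b N k → o ℕ.* (b ℕ.* N) ℕ.+ k ℕ.* (b ℕ.* N) ≡ b ℕ.* ((k ℕ.+ o) ℕ.* N)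
        eq = ℕSolver.solve-∀

  atLeast : ∀ {n} → ℕ → Family n
  atLeast κ A = κ ℕ.≤ᵇ ∣ A ∣

  ≤ᵇ-true : ∀ a b → (a ℕ.≤ᵇ b) ≡ true → a ℕ.≤ b
  ≤ᵇ-true zero b h = ℕ.z≤n
  ≤ᵇ-true (suc a) (suc b) h = ℕₚ.≤ᵇ⇒≤ (suc a) (suc b) (subst (λ z → Bool.T z) (sym h) tt)

  ≤ᵇ-false : ∀ a b → (a ℕ.≤ᵇ b) ≡ false → b ℕ.≤ a
  ≤ᵇ-false a b h with a ℕ.≤? b
  ... | no ¬p = ℕₚ.<⇒≤ (ℕₚ.≰⇒> ¬p)
  ... | yes p = ⊥-elim (subst (λ z → Bool.T z) h (ℕₚ.≤⇒≤ᵇ p))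

  lev-atLeast : ∀ n κ k → lev {n} (atLeast κ) k ℕ.≤ choose n k
  lev-atLeast n κ k = subst₂ ℕ._≤_ (sym (lev-cnt {n} (atLeast κ) k)) (sized-cnt n k) (cnt-mono {n} {λ A → atLeast κ A ∧ sized k A} {sized k} (λ A h → proj₂ (∧-true {atLeast κ A} h)))

  lev-atLeast-small : ∀ n κ k → k ℕ.< κ → lev {n} (atLeast κ) k ≡ 0
  lev-atLeast-small n κ k k<κ = trans (lev-cnt {n} (atLeast κ) k) (trans (cnt-cong {n} none) (cnt-false n))
    where
    none : ∀ (A : Subset n) → (atLeast κ A ∧ sized k A) ≡ false
    none A with atLeast κ A in e₁ | sized k A in e₂
    ... | false | _ = refl
    ... | true | false = refl
    ... | true | true = ⊥-elim (ℕₚ.<⇒≱ k<κ (subst (κ ℕ.≤_) (≡ᵇ-true ∣ A ∣ k e₂) (≤ᵇ-true κ ∣ A ∣ e₁)))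

  module _ {p : ℚ} (p≥0 : 0ℚ ≤ p) (p≤1 : p ≤ 1ℚ) where

    -- Compared level by level: below κ the left side vanishes, and from κ on the normalised level
    -- sizes of an increasing family do not decrease.
    E-LYM : ∀ {n} (F : Family n) → Mono F → ∀ κ →
      ι (lev F κ) * E p (λ A → 𝟙 (atLeast {n} κ A)) ≤ ι (choose n κ) * E p (λ A → 𝟙 (F A))
    E-LYM {n} F m κ = ungap (subst (0ℚ ≤_) expand (Ev≥0 p≥0 p≤1 n termwise))
      where
      a b : ℕ → ℚ
      a k = ι (lev F k)
      b k = ι (lev {n} (atLeast κ) k)
      termwise : ∀ k → 0ℚ ≤ ι (choose n κ) * a k + (- ι (lev F κ)) * b k
      termwise k = subst (0ℚ ≤_) (eq (ι (choose n κ)) (a k) (ι (lev F κ)) (b k)) (gap (subst₂ _≤_ (ι-* (lev F κ) (lev {n} (atLeast κ) k)) (ι-* (choose n κ) (lev F k)) (ι-mono bound)))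
        where
        eq : ∀ c a l b → c * a - l * b ≡ c * a + (- l) * b
        eq = solve-∀ ℚring
        bound : lev F κ ℕ.* lev {n} (atLeast κ) k ℕ.≤ choose n κ ℕ.* lev F k
        bound with κ ℕ.≤? k
        ... | yes κ≤k = ℕₚ.≤-trans (ℕₚ.*-monoʳ-≤ (lev F κ) (lev-atLeast n κ k))
          (subst (λ z → lev F κ ℕ.* choose n z ℕ.≤ choose n κ ℕ.* lev F z) (ℕₚ.m∸n+n≡m κ≤k) (LYM F m κ (k ℕ.∸ κ)))
        ... | no κ≰k rewrite lev-atLeast-small n κ k (ℕₚ.≰⇒> κ≰k) | ℕₚ.*-zeroʳ (lev F κ) = ℕ.z≤n
      expand : Ev p n (λ k → ι (choose n κ) * a k + (- ι (lev F κ)) * b k) ≡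
        ι (choose n κ) * E p (λ A → 𝟙 (F A)) - ι (lev F κ) * E p (λ A → 𝟙 (atLeast {n} κ A))
      expand = trans (Ev-lin p n (ι (choose n κ)) (- ι (lev F κ)) a b)
        (trans (cong₂ (λ x y → ι (choose n κ) * x + (- ι (lev F κ)) * y)
          (sym (trans (E-level p {n} _) (Ev-cong p n (level-𝟙 F)))) (sym (trans (E-level p {n} _) (Ev-cong p n (level-𝟙 {n} (atLeast κ))))))
        (eq (ι (choose n κ)) (E p (λ A → 𝟙 (F A))) (ι (lev F κ)) (E p (λ A → 𝟙 (atLeast {n} κ A)))))
        where
        eq : ∀ c a l b → c * a + (- l) * b ≡ c * a - l * b
        eq = solve-∀ ℚring

    -- The shift `c` carries the induction, since a present first point replaces it by 1 + c. At c =
    -- - n p this is the variance.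
    second-moment : ∀ n c → E p {n} (λ A → (ι ∣ A ∣ + c) * (ι ∣ A ∣ + c)) ≡ (ι n * p + c) * (ι n * p + c) + ι n * (p * (1ℚ - p))
    second-moment zero c = eq p c
      where
      eq : ∀ p c → (0ℚ + c) * (0ℚ + c) ≡ (0ℚ * p + c) * (0ℚ * p + c) + 0ℚ * (p * (1ℚ - p))
      eq = solve-∀ ℚring
    second-moment (suc n) c = trans
      (cong₂ (λ x y → p * x + (1ℚ - p) * y)
        (trans (E-cong p {n} (λ A → eq₁ (ι ∣ A ∣) c)) (second-moment n (1ℚ + c))) (second-moment n c))
      (eq p (ι n) c)
      where
      eq₁ : ∀ x c → (1ℚ + x + c) * (1ℚ + x + c) ≡ (x + (1ℚ + c)) * (x + (1ℚ + c))
      eq₁ = solve-∀ ℚring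
      eq : ∀ p n c → p * ((n * p + (1ℚ + c)) * (n * p + (1ℚ + c)) + n * (p * (1ℚ - p)))
        + (1ℚ - p) * ((n * p + c) * (n * p + c) + n * (p * (1ℚ - p)))
        ≡ ((1ℚ + n) * p + c) * ((1ℚ + n) * p + c) + (1ℚ + n) * (p * (1ℚ - p))
      eq = solve-∀ ℚring

    -- Chebyshev's inequality.
    atLeast-likely : ∀ n κ → 1 ℕ.≤ κ → ι 8 * ι κ ≤ ι n * p → 1ℚ ≤ ι 2 * E p {n} (λ A → 𝟙 (atLeast κ A))
    atLeast-likely n κ 1≤κ h = div-cancel μ μ>0 (slack _ (gap bound ⊕ gap 2μ≤ ⊗ gap P≤1) (eq μ P (μ - k)))
      where
      μ k P : ℚ
      μ = ι n * p
      k = ι κ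
      P = E p {n} (λ A → 𝟙 (atLeast κ A))
      1≤k : 1ℚ ≤ k
      1≤k = ι-mono {1} 1≤κ
      k≥0 : 0ℚ ≤ k
      k≥0 = ι≥0 κ
      μ>0 : 0ℚ < μ
      μ>0 = <-≤-trans 0<1 (≤-trans 1≤k (≤-trans (slack (ι 7 * k) (ι≥0 7 ⊗ k≥0) (eqk k)) h))
        where
        eqk : ∀ k → ι 8 * k ≡ k + ι 7 * k
        eqk = solve-∀ ℚring
      P≤1 : P ≤ 1ℚ
      P≤1 = subst (P ≤_) (E-const p {n} 1ℚ) (E-mono p≥0 p≤1 {n} {λ A → 𝟙 (atLeast κ A)} {λ _ → 1ℚ} (λ A → 𝟙≤1 (atLeast κ A)))
      2μ≤ : ι 2 * μ ≤ (μ - k) * (μ - k)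
      2μ≤ = slack _ ((k≥0 ⊗ (ι≥0 16 ⊗ gap 1≤k ⊕ ι≥0 33 ⊗ k≥0)) ⊕ gap h ⊗ (ι≥0 2 ⊗ gap 1≤k ⊕ ι≥0 12 ⊗ k≥0) ⊕ square≥0 (μ - ι 8 * k)) (eqm μ k)
        where
        eqm : ∀ μ k → (μ - k) * (μ - k) ≡ ι 2 * μ + (k * (ι 16 * (k - 1ℚ) + ι 33 * k) + (μ - ι 8 * k) * (ι 2 * (k - 1ℚ) + ι 12 * k) + (μ - ι 8 * k) * (μ - ι 8 * k))
        eqm = solve-∀ ℚring
      k≤μ : k ≤ μ
      k≤μ = ≤-trans (slack (ι 7 * k) (ι≥0 7 ⊗ k≥0) (eqk k)) h
        where
        eqk : ∀ k → ι 8 * k ≡ k + ι 7 * k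
        eqk = solve-∀ ℚring
      bound : (μ - k) * (μ - k) * (1ℚ - P) ≤ μ
      bound = begin
        (μ - k) * (μ - k) * (1ℚ - P) ≡⟨ eq₁ ((μ - k) * (μ - k)) P ⟩
        (μ - k) * (μ - k) * 1ℚ + (- ((μ - k) * (μ - k))) * P ≡⟨ cong (λ z → (μ - k) * (μ - k) * z + (- ((μ - k) * (μ - k))) * P) (E-const p {n} 1ℚ) ⟨
        (μ - k) * (μ - k) * E p {n} (λ _ → 1ℚ) + (- ((μ - k) * (μ - k))) * P ≡⟨ E-lin p {n} ((μ - k) * (μ - k)) (- ((μ - k) * (μ - k))) (λ _ → 1ℚ) (λ A → 𝟙 (atLeast κ A)) ⟨
        E p {n} (λ A → (μ - k) * (μ - k) * 1ℚ + (- ((μ - k) * (μ - k))) * 𝟙 (atLeast κ A)) ≤⟨ E-mono p≥0 p≤1 (λ A → pointwise A (atLeast κ A) refl) ⟩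
        E p {n} (λ A → (ι ∣ A ∣ + (- μ)) * (ι ∣ A ∣ + (- μ))) ≡⟨ second-moment n (- μ) ⟩
        (ι n * p + (- μ)) * (ι n * p + (- μ)) + ι n * (p * (1ℚ - p)) ≤⟨ slack (ι n * (p * p)) (ι≥0 n ⊗ (p≥0 ⊗ p≥0)) (eq₂ (ι n) p) ⟩
        μ ∎
        where
        open ≤-Reasoning
        eq₁ : ∀ s P → s * (1ℚ - P) ≡ s * 1ℚ + (- s) * P
        eq₁ = solve-∀ ℚring
        eq₂ : ∀ n p → n * p ≡ (n * p + (- (n * p))) * (n * p + (- (n * p))) + n * (p * (1ℚ - p)) + n * (p * p)
        eq₂ = solve-∀ ℚring
        pointwise : ∀ (A : Subset n) b → atLeast κ A ≡ b → (μ - k) * (μ - k) * 1ℚ + (- ((μ - k) * (μ - k))) * 𝟙 b ≤ (ι ∣ A ∣ + (- μ)) * (ι ∣ A ∣ + (- μ))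
        pointwise A true e = slack _ (square≥0 (ι ∣ A ∣ + (- μ))) (eqt ((μ - k) * (μ - k)) ((ι ∣ A ∣ + (- μ)) * (ι ∣ A ∣ + (- μ))))
          where
          eqt : ∀ s t → t ≡ s * 1ℚ + (- s) * 1ℚ + t
          eqt = solve-∀ ℚring
        pointwise A false e = slack _ (gap k≤μ ⊗ gap small ⊕ gap k≤μ ⊗ gap small ⊕ square≥0 (k - ι ∣ A ∣)) (eqf μ k (ι ∣ A ∣))
          where
          small : ι ∣ A ∣ ≤ k
          small = ι-mono (≤ᵇ-false κ ∣ A ∣ e)
          eqf : ∀ μ k x → (x + (- μ)) * (x + (- μ)) ≡ (μ - k) * (μ - k) * 1ℚ + (- ((μ - k) * (μ - k))) * 0ℚ + ((μ - k) * (k - x) + (μ - k) * (k - x) + (k - x) * (k - x))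
          eqf = solve-∀ ℚring
      eq : ∀ μ P s → μ * (ι 2 * P) ≡ μ * 1ℚ + (μ - s * s * (1ℚ - P) + (s * s - ι 2 * μ) * (1ℚ - P))
      eq = solve-∀ ℚring

  -- The intersection of random sets of biases a and b has bias a * b.
  E-product : ∀ {a b} → 0ℚ ≤ a → a ≤ 1ℚ → 0ℚ ≤ b → b ≤ 1ℚ → ∀ {n} (F : Family n) → Mono F →
    E (a * b) (λ A → 𝟙 (F A)) ≤ E a (λ A → 𝟙 (F A)) * E b (λ A → 𝟙 (F A))
  E-product a≥0 a≤1 b≥0 b≤1 {zero} F m with F []
  ... | true = ≤-refl
  ... | false = ≤-refl
  E-product {a} {b} a≥0 a≤1 b≥0 b≤1 {suc n} F (m , mt , mf) = slack _
    (a≥0 ⊗ b≥0 ⊗ gap (E-product a≥0 a≤1 b≥0 b≤1 _ mt)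
      ⊕ (a≥0 ⊗ gap b≤1 ⊕ gap a≤1 ⊗ b≥0 ⊕ gap a≤1 ⊗ gap b≤1) ⊗ gap (E-product a≥0 a≤1 b≥0 b≤1 _ mf)
      ⊕ a≥0 ⊗ gap b≤1 ⊗ gap (E-mono a≥0 a≤1 (λ A → 𝟙-mono (m A))) ⊗ E≥0 b≥0 b≤1 (λ A → 𝟙≥0 (F (false ∷ A)))
      ⊕ gap a≤1 ⊗ b≥0 ⊗ E≥0 a≥0 a≤1 (λ A → 𝟙≥0 (F (false ∷ A))) ⊗ gap (E-mono b≥0 b≤1 (λ A → 𝟙-mono (m A))))
    (eq a b (E (a * b) (λ A → 𝟙 (F (true ∷ A)))) (E (a * b) (λ A → 𝟙 (F (false ∷ A))))
      (E a (λ A → 𝟙 (F (true ∷ A)))) (E a (λ A → 𝟙 (F (false ∷ A)))) (E b (λ A → 𝟙 (F (true ∷ A)))) (E b (λ A → 𝟙 (F (false ∷ A)))))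
    where
    eq : ∀ a b t f x₁ x₀ y₁ y₀ → (a * x₁ + (1ℚ - a) * x₀) * (b * y₁ + (1ℚ - b) * y₀) ≡ a * b * t + (1ℚ - a * b) * f
      + (a * b * (x₁ * y₁ - t) + (a * (1ℚ - b) + (1ℚ - a) * b + (1ℚ - a) * (1ℚ - b)) * (x₀ * y₀ - f)
        + a * (1ℚ - b) * (x₁ - x₀) * y₀ + (1ℚ - a) * b * x₀ * (y₁ - y₀))
    eq = solve-∀ ℚring

  ^≤1 : ∀ {q} t → 0ℚ ≤ q → q ≤ 1ℚ → q ^ t ≤ 1ℚ
  ^≤1 {q} t h k = subst (q ^ t ≤_) (1^ t) (^-mono t h k)

  E-power : ∀ {q} → 0ℚ ≤ q → q ≤ 1ℚ → ∀ {n} (F : Family n) → Mono F → ∀ t →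
    E (q ^ t) (λ A → 𝟙 (F A)) ≤ E q (λ A → 𝟙 (F A)) ^ t
  E-power {q} h k {n} F m zero = subst (E 1ℚ (λ A → 𝟙 (F A)) ≤_) (E-const 1ℚ {n} 1ℚ) (E-mono 0≤1 ≤-refl (λ A → 𝟙≤1 (F A)))
  E-power {q} h k F m (suc t) = ≤-trans (E-product h k (^≥0 t h) (^≤1 t h k) F m)
    (mulˡ _ (E≥0 h k (λ A → 𝟙≥0 (F A))) (E-power h k F m t))

  -- t is the integer part of the logarithm of y / x to base `B`.
  log-floor : ∀ B → 2 ℕ.≤ B → ∀ x y → 1 ℕ.≤ x → x ℕ.≤ y → ∃[ t ] (B ℕ.^ t ℕ.* x ℕ.≤ y × y ℕ.< B ℕ.^ suc t ℕ.* x)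
  log-floor B 2≤B x y 1≤x x≤y = go y 0 (subst (ℕ._≤ y) (sym (ℕₚ.+-identityʳ x)) x≤y) (ℕₚ.≤-trans (ℕₚ.≤-reflexive (sym (ℕₚ.+-identityʳ (suc y)))) (grow y 0))
    where
    1≤B : 1 ℕ.≤ B
    1≤B = ℕₚ.≤-trans (ℕ.s≤s ℕ.z≤n) 2≤B
    grow : ∀ f s → suc f ℕ.+ s ℕ.≤ B ℕ.^ (f ℕ.+ s) ℕ.* x
    grow zero zero = ℕₚ.≤-trans 1≤x (ℕₚ.≤-reflexive (sym (ℕₚ.+-identityʳ x)))
    grow zero (suc s) = ℕₚ.≤-trans (ℕₚ.+-mono-≤ {1} {suc s} (ℕ.s≤s ℕ.z≤n) (grow zero s))
      (ℕₚ.≤-trans (ℕₚ.+-mono-≤ (grow zero s) (ℕₚ.≤-refl {B ℕ.^ s ℕ.* x}))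
      (ℕₚ.≤-trans (ℕₚ.≤-reflexive (eq (B ℕ.^ s ℕ.* x))) (ℕₚ.≤-trans (ℕₚ.*-monoˡ-≤ (B ℕ.^ s ℕ.* x) 2≤B) (ℕₚ.≤-reflexive (sym (ℕₚ.*-assoc B (B ℕ.^ s) x))))))
      where
      eq : ∀ z → z ℕ.+ z ≡ 2 ℕ.* z
      eq = ℕSolver.solve-∀
    grow (suc f) s = subst (λ z → suc z ℕ.≤ B ℕ.^ z ℕ.* x) (ℕₚ.+-suc f s) (subst (ℕ._≤ B ℕ.^ (f ℕ.+ suc s) ℕ.* x) refl (grow f (suc s)))
    go : ∀ f t → B ℕ.^ t ℕ.* x ℕ.≤ y → suc y ℕ.≤ B ℕ.^ (f ℕ.+ t) ℕ.* x → ∃[ t ] (B ℕ.^ t ℕ.* x ℕ.≤ y × y ℕ.< B ℕ.^ suc t ℕ.* x)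
    go zero t h k = ⊥-elim (ℕₚ.<⇒≱ k h)
    go (suc f) t h k with B ℕ.^ suc t ℕ.* x ℕ.≤? y
    ... | yes p = go f (suc t) p (subst (λ z → suc y ℕ.≤ B ℕ.^ z ℕ.* x) (sym (ℕₚ.+-suc f t)) k)
    ... | no ¬p = t , h , ℕₚ.≰⇒> ¬p

  up-mono : ∀ {n} (L : Family n) → Mono (up L)
  up-mono {zero} L = tt
  up-mono {suc n} L = (λ A → b≤a∨b (up (λ A → L (true ∷ A)) A) (up (λ A → L (false ∷ A)) A)) ,
    Mono-∨ (up-mono (λ A → L (true ∷ A))) (up-mono (λ A → L (false ∷ A))) , up-mono (λ A → L (false ∷ A))
    where
    b≤a∨b : ∀ a b → b ≤𝔹 (a ∨ b)
    b≤a∨b true true = Bool.b≤b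
    b≤a∨b true false = Bool.f≤t
    b≤a∨b false b = Bool.b≤b
    ∨-mono : ∀ {a b c d} → a ≤𝔹 b → c ≤𝔹 d → (a ∨ c) ≤𝔹 (b ∨ d)
    ∨-mono {true} Bool.b≤b k = Bool.b≤b
    ∨-mono {false} Bool.b≤b k = k
    ∨-mono {c = true} Bool.f≤t k = Bool.b≤b
    ∨-mono {c = false} Bool.f≤t k = Bool.f≤t
    Mono-∨ : ∀ {n} {F G : Family n} → Mono F → Mono G → Mono (λ A → F A ∨ G A)
    Mono-∨ {zero} _ _ = tt
    Mono-∨ {suc n} (h , ht , hf) (k , kt , kf) = (λ A → ∨-mono (h A) (k A)) , Mono-∨ ht kt , Mono-∨ hf kf

  -- At bias q^t, which is at least 8κ/n, a random set has κ points with probability at least 1/2,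
  -- so by LYM the closure has at least half the density of `L`. By `E-power` this is at most the
  -- t-th power of its measure at q = 1/2m, while (κ/n)^r is itself at least a t-th power of a
  -- constant. Taking t-th roots removes n.
  up-dense-at : ∀ (m r n κ t : ℕ) → 2 ℕ.≤ m → 1 ℕ.≤ κ → 8 ℕ.* κ ℕ.≤ n → 1 ℕ.≤ t →
    (2 ℕ.* m) ℕ.^ t ℕ.* (8 ℕ.* κ) ℕ.≤ n → n ℕ.< (2 ℕ.* m) ℕ.^ suc t ℕ.* (8 ℕ.* κ) → (L : Family n) →
    (∀ A → L A ≡ true → ∣ A ∣ ≡ κ) → κ ℕ.^ r ℕ.* choose n κ ℕ.≤ n ℕ.^ r ℕ.* cnt L →
    recip (2 ℕ.* 8 ℕ.^ r ℕ.* (2 ℕ.* m) ℕ.^ (2 ℕ.* r)) ≤ E (recip (2 ℕ.* m)) (λ A → 𝟙 (up L A))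
  up-dense-at m r n κ t 2≤m 1≤κ 8κ≤n 1≤t Bᵗ≤ <Bᵗ L uniform dense = div-cancel (ι e) e>0 (subst (_≤ ι e * x) (sym (ι*recip e 1≤e)) 1≤ex)
    where
    open ≤-Reasoning
    B e : ℕ
    B = 2 ℕ.* m
    e = 2 ℕ.* 8 ℕ.^ r ℕ.* B ℕ.^ (2 ℕ.* r)
    1≤m : 1 ℕ.≤ m
    1≤m = ℕₚ.≤-trans (ℕ.s≤s ℕ.z≤n) 2≤m
    1≤B : 1 ℕ.≤ B
    1≤B = ℕₚ.*-mono-≤ {1} {2} (ℕ.s≤s ℕ.z≤n) 1≤m
    1≤e : 1 ℕ.≤ e
    1≤e = ℕₚ.*-mono-≤ {1} {2 ℕ.* 8 ℕ.^ r} (ℕₚ.*-mono-≤ {1} {2} (ℕ.s≤s ℕ.z≤n) (ℕₚ.m^n>0 8 r)) (ℕₚ.m^n>0 B {{ℕ.>-nonZero 1≤B}} (2 ℕ.* r))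
    e>0 : 0ℚ < ι e
    e>0 = <-≤-trans 0<1 (ι-mono {1} 1≤e)
    q x : ℚ
    q = recip B
    x = E q (λ A → 𝟙 (up L A))
    q≥0 : 0ℚ ≤ q
    q≥0 = recip≥0 B
    Bq : ι B * q ≡ 1ℚ
    Bq = ι*recip B 1≤B
    q≤1 : q ≤ 1ℚ
    q≤1 = subst₂ _≤_ (*-identityˡ q) Bq (mulʳ q q≥0 (ι-mono {1} 1≤B))
    x≥0 : 0ℚ ≤ x
    x≥0 = E≥0 q≥0 q≤1 (λ A → 𝟙≥0 (up L A))
    Bᵗqᵗ : ι (B ℕ.^ t) * q ^ t ≡ 1ℚ
    Bᵗqᵗ = trans (cong (_* q ^ t) (ι-^ B t)) (trans (sym (^-*ᵈ (ι B) q t)) (trans (cong (_^ t) Bq) (1^ t)))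
    likely : 1ℚ ≤ ι 2 * E (q ^ t) {n} (λ A → 𝟙 (atLeast κ A))
    likely = atLeast-likely (^≥0 t q≥0) (^≤1 t q≥0 q≤1) n κ 1≤κ (begin
      ι 8 * ι κ ≡⟨ ι-* 8 κ ⟨
      ι (8 ℕ.* κ) ≡⟨ *-identityʳ _ ⟨
      ι (8 ℕ.* κ) * 1ℚ ≡⟨ cong (ι (8 ℕ.* κ) *_) Bᵗqᵗ ⟨
      ι (8 ℕ.* κ) * (ι (B ℕ.^ t) * q ^ t) ≡⟨ eq (ι (8 ℕ.* κ)) (ι (B ℕ.^ t)) (q ^ t) ⟩
      ι (B ℕ.^ t) * ι (8 ℕ.* κ) * q ^ t ≡⟨ cong (_* q ^ t) (ι-* (B ℕ.^ t) (8 ℕ.* κ)) ⟨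
      ι (B ℕ.^ t ℕ.* (8 ℕ.* κ)) * q ^ t ≤⟨ mulʳ (q ^ t) (^≥0 t q≥0) (ι-mono Bᵗ≤) ⟩
      ι n * q ^ t ∎)
      where
      eq : ∀ a b c → a * (b * c) ≡ b * a * c
      eq = solve-∀ ℚring
    b = choose n κ
    1≤b : 1 ℕ.≤ b
    1≤b = choose-pos n κ (ℕₚ.≤-trans (ℕₚ.m≤n*m κ 8) 8κ≤n)
    |L|≤lev : cnt L ℕ.≤ lev (up L) κ
    |L|≤lev = subst (cnt L ℕ.≤_) (sym (lev-cnt (up L) κ)) (cnt-mono (λ A l → ∧-intro (up-complete L A A l (λ _ h → h)) (to-sized {A = A} (uniform A l))))
    cnt≤ : ι (cnt L) ≤ ι 2 * ι b * x ^ t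
    cnt≤ = begin
      ι (cnt L) ≡⟨ *-identityʳ _ ⟨
      ι (cnt L) * 1ℚ ≤⟨ mulˡ _ (ι≥0 (cnt L)) likely ⟩
      ι (cnt L) * (ι 2 * P) ≤⟨ mulʳ (ι 2 * P) (ι≥0 2 ⊗ P≥0) (ι-mono |L|≤lev) ⟩
      ι (lev (up L) κ) * (ι 2 * P) ≡⟨ eq (ι (lev (up L) κ)) P ⟩
      ι 2 * (ι (lev (up L) κ) * P) ≤⟨ mulˡ (ι 2) (ι≥0 2) (≤-trans (E-LYM (^≥0 t q≥0) (^≤1 t q≥0 q≤1) (up L) (up-mono L) κ)
          (mulˡ (ι b) (ι≥0 b) (E-power q≥0 q≤1 (up L) (up-mono L) t))) ⟩
      ι 2 * (ι b * x ^ t) ≡⟨ *-assoc (ι 2) (ι b) (x ^ t) ⟨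
      ι 2 * ι b * x ^ t ∎
      where
      P = E (q ^ t) {n} (λ A → 𝟙 (atLeast κ A))
      P≥0 : 0ℚ ≤ P
      P≥0 = E≥0 (^≥0 t q≥0) (^≤1 t q≥0 q≤1) {n} {λ A → 𝟙 (atLeast κ A)} (λ A → 𝟙≥0 (atLeast κ A))
      eq : ∀ l P → l * (ι 2 * P) ≡ ι 2 * (l * P)
      eq = solve-∀ ℚring
    powers : n ℕ.^ r ℕ.≤ (8 ℕ.^ r ℕ.* B ℕ.^ (2 ℕ.* r)) ℕ.^ t ℕ.* κ ℕ.^ r
    powers = ℕₚ.≤-trans (ℕₚ.^-monoˡ-≤ r (ℕₚ.<⇒≤ <Bᵗ)) (ℕₚ.≤-trans (ℕₚ.≤-reflexive (eqᵣ)) (ℕₚ.*-monoˡ-≤ (κ ℕ.^ r) compare))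
      where
      eqᵣ : (B ℕ.^ suc t ℕ.* (8 ℕ.* κ)) ℕ.^ r ≡ B ℕ.^ (suc t ℕ.* r) ℕ.* 8 ℕ.^ r ℕ.* κ ℕ.^ r
      eqᵣ = trans (^-distribʳ-* r (B ℕ.^ suc t) (8 ℕ.* κ)) (trans (cong₂ ℕ._*_ (ℕₚ.^-*-assoc B (suc t) r) (^-distribʳ-* r 8 κ))
        (sym (ℕₚ.*-assoc (B ℕ.^ (suc t ℕ.* r)) (8 ℕ.^ r) (κ ℕ.^ r))))
      compare : B ℕ.^ (suc t ℕ.* r) ℕ.* 8 ℕ.^ r ℕ.≤ (8 ℕ.^ r ℕ.* B ℕ.^ (2 ℕ.* r)) ℕ.^ t
      compare = ℕₚ.≤-trans (ℕₚ.*-mono-≤ (ℕₚ.^-monoʳ-≤ B {{ℕ.>-nonZero 1≤B}} exponents) (ℕₚ.^-monoʳ-≤ 8 (ℕₚ.m≤m*n r t {{ℕ.>-nonZero 1≤t}})))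
        (ℕₚ.≤-reflexive (trans (ℕₚ.*-comm _ (8 ℕ.^ (r ℕ.* t))) (trans (cong₂ ℕ._*_ (sym (ℕₚ.^-*-assoc 8 r t)) (sym (ℕₚ.^-*-assoc B (2 ℕ.* r) t)))
          (sym (^-distribʳ-* t (8 ℕ.^ r) (B ℕ.^ (2 ℕ.* r)))))))
        where
        exponents : suc t ℕ.* r ℕ.≤ 2 ℕ.* r ℕ.* t
        exponents = ℕₚ.≤-trans (ℕₚ.*-monoˡ-≤ r (ℕₚ.+-monoˡ-≤ t 1≤t)) (ℕₚ.≤-reflexive (eq t r))
          where
          eq : ∀ t r → (t ℕ.+ t) ℕ.* r ≡ 2 ℕ.* r ℕ.* t
          eq = ℕSolver.solve-∀
    1≤eᵗxᵗ : 1ℚ ≤ (ι e * x) ^ t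
    1≤eᵗxᵗ = div-cancel (ι (κ ℕ.^ r ℕ.* b)) (<-≤-trans 0<1 (ι-mono {1} (ℕₚ.*-mono-≤ {1} {κ ℕ.^ r} (ℕₚ.m^n>0 κ {{ℕ.>-nonZero 1≤κ}} r) 1≤b))) (begin
      ι (κ ℕ.^ r ℕ.* b) * 1ℚ ≡⟨ *-identityʳ _ ⟩
      ι (κ ℕ.^ r ℕ.* b) ≤⟨ ι-mono dense ⟩
      ι (n ℕ.^ r ℕ.* cnt L) ≡⟨ ι-* (n ℕ.^ r) (cnt L) ⟩
      ι (n ℕ.^ r) * ι (cnt L) ≤⟨ mul-mono (ι≥0 (n ℕ.^ r)) (ι≥0 2 ⊗ ι≥0 b ⊗ ^≥0 t x≥0) (ι-mono powers) cnt≤ ⟩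
      ι (D ℕ.^ t ℕ.* κ ℕ.^ r) * (ι 2 * ι b * x ^ t) ≡⟨ cong (_* (ι 2 * ι b * x ^ t)) (ι-* (D ℕ.^ t) (κ ℕ.^ r)) ⟩
      ι (D ℕ.^ t) * ι (κ ℕ.^ r) * (ι 2 * ι b * x ^ t) ≤⟨ mulˡ _ (ι≥0 (D ℕ.^ t) ⊗ ι≥0 (κ ℕ.^ r)) (mulʳ (x ^ t) (^≥0 t x≥0) (mulʳ (ι b) (ι≥0 b) 2≤2ᵗ)) ⟩
      ι (D ℕ.^ t) * ι (κ ℕ.^ r) * (ι (2 ℕ.^ t) * ι b * x ^ t) ≡⟨ eq (ι (D ℕ.^ t)) (ι (κ ℕ.^ r)) (ι (2 ℕ.^ t)) (ι b) (x ^ t) ⟩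
      ι (κ ℕ.^ r) * ι b * (ι (2 ℕ.^ t) * ι (D ℕ.^ t) * x ^ t) ≡⟨ cong₂ _*_ (ι-* (κ ℕ.^ r) b) refl ⟨
      ι (κ ℕ.^ r ℕ.* b) * (ι (2 ℕ.^ t) * ι (D ℕ.^ t) * x ^ t) ≡⟨ cong (λ z → ι (κ ℕ.^ r ℕ.* b) * (z * x ^ t)) e^t ⟨
      ι (κ ℕ.^ r ℕ.* b) * (ι e ^ t * x ^ t) ≡⟨ cong (ι (κ ℕ.^ r ℕ.* b) *_) (^-*ᵈ (ι e) x t) ⟨
      ι (κ ℕ.^ r ℕ.* b) * (ι e * x) ^ t ∎)
      where
      D = 8 ℕ.^ r ℕ.* B ℕ.^ (2 ℕ.* r)
      2≤2ᵗ : ι 2 ≤ ι (2 ℕ.^ t)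
      2≤2ᵗ = ι-mono (ℕₚ.^-monoʳ-≤ 2 1≤t)
      e^t : ι e ^ t ≡ ι (2 ℕ.^ t) * ι (D ℕ.^ t)
      e^t = trans (cong (_^ t) (trans (cong ι (ℕₚ.*-assoc 2 (8 ℕ.^ r) (B ℕ.^ (2 ℕ.* r)))) (ι-* 2 D))) (trans (^-*ᵈ (ι 2) (ι D) t) (cong₂ _*_ (sym (ι-^ 2 t)) (sym (ι-^ D t))))
      eq : ∀ d k t b x → d * k * (t * b * x) ≡ k * b * (t * d * x)
      eq = solve-∀ ℚring
    -- The t-th root: a number in [0, 1) has its t-th power below 1 for t ≥ 1.
    1≤ex : 1ℚ ≤ ι e * x
    1≤ex with 1ℚ ≤? ι e * x
    ... | yes p = p
    ... | no ¬p = ⊥-elim (ex≱1 t 1≤t 1≤eᵗxᵗ)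
      where
      ex<1 : ι e * x < 1ℚ
      ex<1 = ≰⇒> ¬p
      ex≱1 : ∀ t → 1 ℕ.≤ t → 1ℚ ≤ (ι e * x) ^ t → ⊥
      ex≱1 (suc t) _ h = <-irrefl refl (<-≤-trans ex<1 (≤-trans h
        (≤-trans (mulˡ (ι e * x) (ι≥0 e ⊗ x≥0) (^≤1 t (ι≥0 e ⊗ x≥0) (<⇒≤ ex<1))) (≤-reflexive (*-identityʳ _)))))

  up-dense : ∀ (m r n κ : ℕ) → 2 ℕ.≤ m → 1 ℕ.≤ κ → 16 ℕ.* m ℕ.* κ ℕ.≤ n → (L : Family n) →
    (∀ A → L A ≡ true → ∣ A ∣ ≡ κ) → κ ℕ.^ r ℕ.* choose n κ ℕ.≤ n ℕ.^ r ℕ.* cnt L →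
    recip (2 ℕ.* 8 ℕ.^ r ℕ.* (2 ℕ.* m) ℕ.^ (2 ℕ.* r)) ≤ E (recip (2 ℕ.* m)) (λ A → 𝟙 (up L A))
  up-dense m r n κ 2≤m 1≤κ n-big L uniform dense =
    at (log-floor (2 ℕ.* m) (ℕₚ.*-mono-≤ {2} {2} {1} ℕₚ.≤-refl 1≤m) (8 ℕ.* κ) n (ℕₚ.*-mono-≤ {1} {8} (ℕ.s≤s ℕ.z≤n) 1≤κ) 8κ≤n)
    where
    1≤m : 1 ℕ.≤ m
    1≤m = ℕₚ.≤-trans (ℕ.s≤s ℕ.z≤n) 2≤m
    1≤B : 1 ℕ.≤ 2 ℕ.* m
    1≤B = ℕₚ.*-mono-≤ {1} {2} (ℕ.s≤s ℕ.z≤n) 1≤m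
    8κ≤n : 8 ℕ.* κ ℕ.≤ n
    8κ≤n = ℕₚ.≤-trans (ℕₚ.*-monoˡ-≤ κ (ℕₚ.≤-trans (ℕₚ.m≤m*n 8 (2 ℕ.* m) {{ℕ.>-nonZero 1≤B}}) (ℕₚ.≤-reflexive (eq m)))) n-big
      where
      eq : ∀ m → 8 ℕ.* (2 ℕ.* m) ≡ 16 ℕ.* m
      eq = ℕSolver.solve-∀
    -- The bound 16 m κ ≤ n excludes t = 0; t ≥ 1 is what allows (t + 1) r ≤ 2 r t, and the t-th
    -- root.
    exponent>0 : ∀ t → n ℕ.< (2 ℕ.* m) ℕ.^ suc t ℕ.* (8 ℕ.* κ) → 1 ℕ.≤ t
    exponent>0 (suc t) h = ℕ.s≤s ℕ.z≤n
    exponent>0 zero h = ⊥-elim (ℕₚ.<⇒≱ h (ℕₚ.≤-trans (ℕₚ.≤-reflexive (eq m κ)) n-big))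
      where
      eq : ∀ m κ → 2 ℕ.* m ℕ.* 1 ℕ.* (8 ℕ.* κ) ≡ 16 ℕ.* m ℕ.* κ
      eq = ℕSolver.solve-∀
    at : _ → _
    at (t , lower , upper) = up-dense-at m r n κ t 2≤m 1≤κ 8κ≤n (exponent>0 t upper) lower upper L uniform dense

-- Rainbow matchings by random colouring.

module Matching where
  open import Defs using (Family)
  open QOrd
  open Cube
  open Count
  open Transfer
  open Russo using (module Threshold)
  open import Data.Nat as ℕ using (ℕ; zero; suc)
  import Data.Nat.Properties as ℕₚ
  open import Data.Bool using (Bool; true; false; not; _∧_; if_then_else_)
  open import Data.Fin using (Fin; zero; suc; _≟_)
  open import Data.Fin.Subset using (Subset; ∣_∣)
  open import Data.Vec using ([]; _∷_)
  open import Data.Rational hiding (∣_∣; _≟_)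
  open import Data.Rational.Properties hiding (_≟_)
  open import Relation.Binary.PropositionalEquality hiding (J)
  open import Relation.Nullary using (yes; no; does)
  open import Relation.Nullary.Decidable using (toWitness)
  open import Tactic.RingSolver using (solve-∀)
  open import Data.Product using (_×_; _,_; Σ; ∃-syntax; proj₁; proj₂)
  open import Data.Unit using (tt)
  open import Data.Empty using (⊥; ⊥-elim)

  Z-E : ∀ q {n} J (f : Subset n → ℚ) → Z q J f ≡ E q (λ x → f (x ∖ˢ J))
  Z-E q [] f = refl
  Z-E q (true ∷ J) f = trans (Z-E q J (λ x → f (false ∷ x))) (sym (eq q _))
    where
    eq : ∀ q x → q * x + (1ℚ - q) * x ≡ x
    eq = solve-∀ ℚring
  Z-E q (false ∷ J) f = cong₂ (λ x y → q * x + (1ℚ - q) * y) (Z-E q J (λ x → f (true ∷ x))) (Z-E q J (λ x → f (false ∷ x)))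

  below-average : ∀ m (a : Fin (suc m) → ℚ) s → Σf a ≤ ι (suc m) * s → ∃[ i ] a i ≤ s
  below-average zero a s h = zero , subst₂ _≤_ (+-identityʳ (a zero)) (eq s) h
    where
    eq : ∀ s → (1ℚ + 0ℚ) * s ≡ s
    eq = solve-∀ ℚring
  below-average (suc m) a s h with a zero ≤? s
  ... | yes p = zero , p
  ... | no ¬p = let i , k = below-average m (λ i → a (suc i)) s rest in suc i , k
    where
    eq₁ : ∀ x y → y ≡ x + y - x
    eq₁ = solve-∀ ℚring
    eq₂ : ∀ s m → (1ℚ + (1ℚ + m)) * s - s ≡ (1ℚ + m) * s
    eq₂ = solve-∀ ℚring
    rest : Σf (λ i → a (suc i)) ≤ ι (suc m) * s
    rest = subst₂ _≤_ (sym (eq₁ (a zero) (Σf (λ i → a (suc i))))) (eq₂ s (ι m))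
      (+-mono-≤ h (neg-antimono-≤ (<⇒≤ (≰⇒> ¬p))))

  pick : ∀ {m} → Fin m → (Fin m → ℚ) → (Fin m → ℚ) → Fin m → ℚ
  pick i x y e = if does (e ≟ i) then x e else y e

  Σ-pick : ∀ {m} (i : Fin m) x y → Σf (pick i x y) ≡ Σf y + (x i - y i)
  Σ-pick {suc m} zero x y = trans (cong (x zero +_) (Σf-cong {m} (λ e → refl))) (eq (x zero) (y zero) (Σf (λ e → y (suc e))))
    where
    eq : ∀ x y s → x + s ≡ y + s + (x - y)
    eq = solve-∀ ℚring
  Σ-pick {suc m} (suc i) x y = trans (cong (y zero +_) (trans (Σf-cong shift) (Σ-pick i (λ e → x (suc e)) (λ e → y (suc e)))))
    (sym (+-assoc (y zero) _ _))
    where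
    shift : ∀ e → pick (suc i) x y (suc e) ≡ pick i (λ e → x (suc e)) (λ e → y (suc e)) e
    shift e with e ≟ i
    ... | yes _ = refl
    ... | no _ = refl

  Σf-const : ∀ m c → Σf {m} (λ _ → c) ≡ ι m * c
  Σf-const zero c = sym (*-zeroˡ c)
  Σf-const (suc m) c = trans (cong (c +_) (Σf-const m c)) (eq c (ι m))
    where
    eq : ∀ c m → c + m * c ≡ (1ℚ + m) * c
    eq = solve-∀ ℚring

  Σ-pick-avg : ∀ {m} (x y : Fin m → ℚ) → Σf (λ i → Σf (pick i x y)) ≡ ι m * Σf y + (Σf x - Σf y)
  Σ-pick-avg {m} x y = begin
    Σf (λ i → Σf (pick i x y)) ≡⟨ Σf-cong (λ i → trans (Σ-pick i x y) (eq₁ (Σf y) (x i) (y i))) ⟩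
    Σf (λ i → 1ℚ * Σf y + 1ℚ * (1ℚ * x i + (- 1ℚ) * y i)) ≡⟨ Σf-lin {m} 1ℚ 1ℚ (λ _ → Σf y) (λ i → 1ℚ * x i + (- 1ℚ) * y i) ⟩
    1ℚ * Σf {m} (λ _ → Σf y) + 1ℚ * Σf (λ i → 1ℚ * x i + (- 1ℚ) * y i) ≡⟨ cong₂ (λ s t → 1ℚ * s + 1ℚ * t) (Σf-const m (Σf y)) (Σf-lin 1ℚ (- 1ℚ) x y) ⟩
    1ℚ * (ι m * Σf y) + 1ℚ * (1ℚ * Σf x + (- 1ℚ) * Σf y) ≡⟨ eq₂ (ι m * Σf y) (Σf x) (Σf y) ⟩
    ι m * Σf y + (Σf x - Σf y) ∎
    where
    open ≡-Reasoning
    eq₁ : ∀ s x y → s + (x - y) ≡ 1ℚ * s + 1ℚ * (1ℚ * x + (- 1ℚ) * y)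
    eq₁ = solve-∀ ℚring
    eq₂ : ∀ s x y → 1ℚ * s + 1ℚ * (1ℚ * x + (- 1ℚ) * y) ≡ s + (x - y)
    eq₂ = solve-∀ ℚring

  PairwiseDisjoint : ∀ {m n} → (Fin m → Subset n) → Set
  PairwiseDisjoint W = ∀ e e' → (e ≡ e' → ⊥) → Disjoint (W e) (W e')

  Splitting : ∀ {m n} → (Fin m → Subset n → ℚ) → Set
  Splitting {m} {n} g = Σ (Fin m → Subset n) λ W → PairwiseDisjoint W × Σf (λ e → g e (W e)) ≤ Σf (λ e → E (recip m) (g e))

  -- Colour the points one by one with m colours, keeping the conditional expectation
  -- of the sum below its initial value.
  colouring : ∀ {m} → 1 ℕ.≤ m → ∀ {n} (g : Fin m → Subset n → ℚ) → Splitting g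
  colouring 1≤m {zero} g = (λ _ → []) , (λ _ _ _ ()) , ≤-refl
  colouring {m@(suc m')} 1≤m {suc n} g = extended (below-average m' (λ i → Σf (pick i x y)) s (≤-reflexive average))
    where
    μ = recip m
    x y : Fin m → ℚ
    x e = E μ (λ A → g e (true ∷ A))
    y e = E μ (λ A → g e (false ∷ A))
    s = Σf (λ e → E μ (g e))
    average : Σf (λ i → Σf (pick i x y)) ≡ ι m * s
    average = trans (Σ-pick-avg x y) (sym (trans (cong (ι m *_) (Σf-lin μ (1ℚ - μ) x y))
      (trans (eq (ι m) μ (Σf x) (Σf y)) (trans (cong (λ z → ι m * Σf y + z * (Σf x - Σf y)) (ι*recip m 1≤m)) (cong (ι m * Σf y +_) (*-identityˡ _))))))
      where
      eq : ∀ m μ x y → m * (μ * x + (1ℚ - μ) * y) ≡ m * y + (m * μ) * (x - y)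
      eq = solve-∀ ℚring
    extended : ∃[ i ] Σf (pick i x y) ≤ s → Splitting g
    extended (i , h) = extend (colouring 1≤m (λ e A → g e (does (e ≟ i) ∷ A)))
      where
      E-pick : ∀ e → E μ (λ A → g e (does (e ≟ i) ∷ A)) ≡ pick i x y e
      E-pick e with does (e ≟ i)
      ... | true = refl
      ... | false = refl
      extend : Splitting (λ e A → g e (does (e ≟ i) ∷ A)) → Splitting g
      extend (W , dis , bound) = (λ e → does (e ≟ i) ∷ W e) , disjoint ,
        ≤-trans bound (≤-trans (≤-reflexive (Σf-cong E-pick)) h)
        where
        disjoint : ∀ e e' → (e ≡ e' → ⊥) → Disjoint (does (e ≟ i) ∷ W e) (does (e' ≟ i) ∷ W e')
        disjoint e e' e≢e' zero p q with e ≟ i | e' ≟ i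
        ... | yes refl | yes refl = e≢e' refl
        disjoint e e' e≢e' zero p () | yes _ | no _
        disjoint e e' e≢e' zero () q | no _ | _
        disjoint e e' e≢e' (suc z) p q = dis e e' e≢e' z p q

  Σf-member : ∀ {m} (a : Fin m → ℚ) → (∀ i → 0ℚ ≤ a i) → ∀ i → a i ≤ Σf a
  Σf-member {suc m} a h zero = slack _ (Σf≥0 (λ i → h (suc i))) refl
  Σf-member {suc m} a h (suc i) = ≤-trans (Σf-member (λ i → a (suc i)) (λ i → h (suc i)) i) (slack (a zero) (h zero) (+-comm (a zero) _))

  module Cross (m r : ℕ) (2≤m : 2 ℕ.≤ m) where

    private
      1≤m : 1 ℕ.≤ m
      1≤m = ℕₚ.≤-trans (ℕ.s≤s ℕ.z≤n) 2≤m
      1≤2m : 1 ℕ.≤ 2 ℕ.* m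
      1≤2m = ℕₚ.*-mono-≤ {1} {2} (ℕ.s≤s ℕ.z≤n) 1≤m

    -- The reciprocal of the measure that `up-dense` guarantees at bias 1/2m. It determines
    -- `capture`, the number of points whose deletion each family has to survive.
    e₀ : ℕ
    e₀ = 2 ℕ.* 8 ℕ.^ r ℕ.* (2 ℕ.* m) ℕ.^ (2 ℕ.* r)

    1≤e₀ : 1 ℕ.≤ e₀
    1≤e₀ = ℕₚ.*-mono-≤ {1} {2 ℕ.* 8 ℕ.^ r} (ℕₚ.*-mono-≤ {1} {2} (ℕ.s≤s ℕ.z≤n) (ℕₚ.m^n>0 8 r)) (ℕₚ.m^n>0 (2 ℕ.* m) {{ℕ.>-nonZero 1≤2m}} (2 ℕ.* r))

    open Threshold m 2≤m e₀ 1≤e₀ using (threshold) renaming (j to capture) public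

    -- If a random set contains a member avoiding `J`, it still does after `J` is removed from it.
    -- So density of the members avoiding `J`, through `up-dense`, is the robustness that
    -- `threshold` asks for.
    up-likely : ∀ {n κ} → 1 ℕ.≤ κ → 16 ℕ.* m ℕ.* κ ℕ.≤ n → (L : Family n) → (∀ A → L A ≡ true → ∣ A ∣ ≡ κ) →
      (∀ J → ∣ J ∣ ℕ.≤ capture → κ ℕ.^ r ℕ.* choose n κ ℕ.≤ n ℕ.^ r ℕ.* cnt (λ A → L A ∧ disj A J)) →
      1ℚ - E (recip m) (λ A → 𝟙 (up L A)) ≤ recip (2 ℕ.* m)
    up-likely {n} {κ} 1≤κ n-big L uniform dense = threshold (up L) (up-mono L) (λ J J≤ → ≤-trans
      (up-dense m r n κ 2≤m 1≤κ n-big (λ A → L A ∧ disj A J) (λ A h → uniform A (proj₁ (∧-true h))) (dense J J≤))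
      (subst (E (recip (2 ℕ.* m)) (λ A → 𝟙 (up (λ A → L A ∧ disj A J) A)) ≤_) (sym (Z-E (recip (2 ℕ.* m)) J (λ A → 𝟙 (up L A))))
        (E-mono (recip≥0 (2 ℕ.* m)) q≤1 (λ W → 𝟙-mono (avoid J W (up (λ A → L A ∧ disj A J) W) refl)))))
      where
      q≤1 : recip (2 ℕ.* m) ≤ 1ℚ
      q≤1 = subst₂ _≤_ (*-identityˡ (recip (2 ℕ.* m))) (ι*recip (2 ℕ.* m) 1≤2m) (mulʳ (recip (2 ℕ.* m)) (recip≥0 (2 ℕ.* m)) (ι-mono {1} 1≤2m))
      avoid : ∀ J W b → up (λ A → L A ∧ disj A J) W ≡ b → b Data.Bool.≤ up L (W ∖ˢ J)
      avoid J W false e with up L (W ∖ˢ J)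
      ... | true = Data.Bool.f≤t
      ... | false = Data.Bool.b≤b
      avoid J W true e = let B , h , B⊑W = up-sound (λ A → L A ∧ disj A J) W e
                             l , d = ∧-true h in
        subst (true Data.Bool.≤_) (sym (up-complete L B (W ∖ˢ J) l (λ x p → trans (lookup-∖ W J x)
          (∧-intro (B⊑W x p) (not-in (disj-sound B J d x p)))))) Data.Bool.b≤b
        where
        not-in : ∀ {b} → (b ≡ true → ⊥) → not b ≡ true
        not-in {true} h = ⊥-elim (h refl)
        not-in {false} h = refl

    -- Under a random colouring each class misses its family with probability at most 1/2m, so the
    -- expected number of misses is at most 1/2. A colouring with no more misses than expected has
    -- none, and members inside distinct classes are disjoint.
    rainbow-matching : ∀ {n} (κ : Fin m → ℕ) (L : Fin m → Family n) → (∀ e → 1 ℕ.≤ κ e) → (∀ e → 16 ℕ.* m ℕ.* κ e ℕ.≤ n) →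
      (∀ e A → L e A ≡ true → ∣ A ∣ ≡ κ e) →
      (∀ e J → ∣ J ∣ ℕ.≤ capture → κ e ℕ.^ r ℕ.* choose n (κ e) ℕ.≤ n ℕ.^ r ℕ.* cnt (λ A → L e A ∧ disj A J)) →
      Σ (Fin m → Subset n) λ B → (∀ e → L e (B e) ≡ true) × PairwiseDisjoint B
    rainbow-matching {n} κ L 1≤κ n-big uniform dense = found (colouring 1≤m g)
      where
      g : Fin m → Subset n → ℚ
      g e A = 1ℚ - 𝟙 (up (L e) A)
      g≥0 : ∀ e A → 0ℚ ≤ g e A
      g≥0 e A = gap (𝟙≤1 (up (L e) A))
      E-g : ∀ e → E (recip m) (g e) ≡ 1ℚ - E (recip m) (λ A → 𝟙 (up (L e) A))
      E-g e = trans (E-cong (recip m) (λ A → eq 1ℚ (𝟙 (up (L e) A)))) (trans (E-lin (recip m) {n} 1ℚ (- 1ℚ) (λ _ → 1ℚ) (λ A → 𝟙 (up (L e) A)))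
        (trans (cong (λ z → 1ℚ * z + (- 1ℚ) * E (recip m) (λ A → 𝟙 (up (L e) A))) (E-const (recip m) {n} 1ℚ)) (sym (eq 1ℚ (E (recip m) (λ A → 𝟙 (up (L e) A)))))))
        where
        eq : ∀ x y → x - y ≡ 1ℚ * x + (- 1ℚ) * y
        eq = solve-∀ ℚring
      total : ι 2 * Σf (λ e → E (recip m) (g e)) ≤ 1ℚ
      total = ≤-trans (mulˡ (ι 2) (ι≥0 2) (Σf-mono (λ e → subst (_≤ recip (2 ℕ.* m)) (sym (E-g e)) (up-likely (1≤κ e) (n-big e) (L e) (uniform e) (dense e)))))
        (≤-reflexive (trans (cong (ι 2 *_) (Σf-const m (recip (2 ℕ.* m)))) (trans (sym (*-assoc (ι 2) (ι m) _)) (trans (cong (_* recip (2 ℕ.* m)) (sym (ι-* 2 m))) (ι*recip (2 ℕ.* m) 1≤2m)))))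
      found : Splitting g → Σ (Fin m → Subset n) λ B → (∀ e → L e (B e) ≡ true) × PairwiseDisjoint B
      found (W , disjoint , bound) = B , (λ e → proj₁ (proj₂ (inside e))) ,
        λ e e' e≢e' x p q → disjoint e e' e≢e' x (proj₂ (proj₂ (inside e)) x p) (proj₂ (proj₂ (inside e')) x q)
        where
        hit : ∀ e b → up (L e) (W e) ≡ b → b ≡ true
        hit e true h = refl
        hit e false h = ⊥-elim (<-irrefl refl (<-≤-trans (toWitness {a? = 1ℚ <? ι 2 * 1ℚ} tt)
          (≤-trans (mulˡ (ι 2) (ι≥0 2) (≤-trans g≡1 (≤-trans (Σf-member (λ e → g e (W e)) (λ e → g≥0 e (W e)) e) bound))) total)))
          where
          g≡1 : 1ℚ ≤ g e (W e)
          g≡1 = ≤-reflexive (sym (cong (λ b → 1ℚ - 𝟙 b) h))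
        inside : ∀ e → ∃[ B ] (L e B ≡ true × B ⊑ W e)
        inside e = up-sound (L e) (W e) (hit e (up (L e) (W e)) refl)
        B : Fin m → Subset n
        B e = proj₁ (inside e)

-- Points met in about the expected proportion.

module Fair where
  open import Defs using (Family)
  open Count
  open import Data.Nat
  open import Data.Nat.Properties
  open import Data.Nat.DivMod using (m/n*n≤m; m*n/n≡m; /-monoˡ-≤)
  open import Data.Nat.Tactic.RingSolver using (solve-∀)
  open import Data.Bool using (Bool; true; false; _∧_)
  open import Data.Fin using (Fin; zero; suc)
  open import Data.Fin.Subset using (Subset; ∣_∣; _∩_)
  open import Data.Vec using ([]; _∷_; lookup)
  open import Data.Product using (_,_; ∃-syntax)
  open import Data.Empty using (⊥; ⊥-elim)
  open import Relation.Nullary using (yes; no)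
  open import Relation.Binary.PropositionalEquality

  choose-up : ∀ n k → suc k * choose n (suc k) ≤ n * choose n k
  choose-up n k = ≤-trans (m≤m+n _ (k * choose n k)) (≤-reflexive (choose-absorb n k))

  -- Below the middle, n - k in the absorption identity is at least n / 2.
  choose-down₁ : ∀ n k → 2 * suc k ≤ n → n * choose n k ≤ 2 * suc k * choose n (suc k)
  choose-down₁ n k h with m≤n⇒∃[o]m+o≡n h
  ... | o , refl = +-cancelʳ-≤ (n' * c + 2 * (k * c)) _ _ (begin
      n' * c + (n' * c + 2 * (k * c)) ≤⟨ m≤m+n _ ((2 + o) * c) ⟩
      n' * c + (n' * c + 2 * (k * c)) + (2 + o) * c ≡⟨ eq k o c ⟩
      2 * (n' * c) + n' * c ≡⟨ cong (λ z → 2 * z + n' * c) (choose-absorb n' k) ⟨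
      2 * (suc k * c' + k * c) + n' * c ≡⟨ eq₂ k c c' (n' * c) ⟩
      2 * suc k * c' + (n' * c + 2 * (k * c)) ∎)
    where
    open ≤-Reasoning
    n' = 2 * suc k + o
    c = choose n' k
    c' = choose n' (suc k)
    eq : ∀ k o c → (2 * suc k + o) * c + ((2 * suc k + o) * c + 2 * (k * c)) + (2 + o) * c ≡ 2 * ((2 * suc k + o) * c) + (2 * suc k + o) * c
    eq = solve-∀
    eq₂ : ∀ k c c' x → 2 * (suc k * c' + k * c) + x ≡ 2 * suc k * c' + (x + 2 * (k * c))
    eq₂ = solve-∀

  choose-down : ∀ n u k → 2 * (u + k) ≤ n → n ^ u * choose n k ≤ (2 * (u + k)) ^ u * choose n (u + k)
  choose-down n zero k h = ≤-refl
  choose-down n (suc u) k h = begin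
    n * n ^ u * choose n k ≡⟨ *-assoc n (n ^ u) _ ⟩
    n * (n ^ u * choose n k) ≤⟨ *-monoʳ-≤ n (choose-down n u k (≤-trans (*-monoʳ-≤ 2 (n≤1+n (u + k))) h)) ⟩
    n * ((2 * (u + k)) ^ u * choose n (u + k)) ≡⟨ eq n ((2 * (u + k)) ^ u) (choose n (u + k)) ⟩
    (2 * (u + k)) ^ u * (n * choose n (u + k)) ≤⟨ *-mono-≤ (^-monoˡ-≤ u (*-monoʳ-≤ 2 (n≤1+n (u + k)))) (choose-down₁ n (u + k) h) ⟩
    (2 * (suc u + k)) ^ u * (2 * (suc u + k) * choose n (suc u + k)) ≡⟨ eq₂ ((2 * (suc u + k)) ^ u) (2 * (suc u + k)) (choose n (suc u + k)) ⟩
    (2 * (suc u + k)) ^ suc u * choose n (suc u + k) ∎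
    where
    open ≤-Reasoning
    eq : ∀ n a b → n * (a * b) ≡ a * (n * b)
    eq = solve-∀
    eq₂ : ∀ a b c → a * (b * c) ≡ b * a * c
    eq₂ = solve-∀

  choose-factorial : ∀ k o → o ^ k ≤ choose (o + k) k * k !
  choose-factorial zero o = ≤-refl
  choose-factorial (suc k) o = begin
    o ^ suc k ≤⟨ ^-monoˡ-≤ (suc k) (n≤1+n o) ⟩
    suc o * suc o ^ k ≤⟨ *-monoʳ-≤ (suc o) (choose-factorial k (suc o)) ⟩
    suc o * (choose (suc o + k) k * k !) ≡⟨ cong (λ z → suc o * (choose z k * k !)) (sym (+-suc o k)) ⟩
    suc o * (c * k !) ≡⟨ eq (suc o) c (k !) ⟩
    suc o * c * k ! ≡⟨ cong (_* k !) step ⟩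
    suc k * choose (o + suc k) (suc k) * k ! ≡⟨ eq₂ (suc k) (choose (o + suc k) (suc k)) (k !) ⟩
    choose (o + suc k) (suc k) * suc k ! ∎
    where
    open ≤-Reasoning
    c = choose (o + suc k) k
    eq : ∀ a b c → a * (b * c) ≡ a * b * c
    eq = solve-∀
    eq₂ : ∀ a b c → a * b * c ≡ b * (a * c)
    eq₂ = solve-∀
    eq₃ : ∀ o k c → suc o * c + k * c ≡ (o + suc k) * c
    eq₃ = solve-∀
    step : suc o * c ≡ suc k * choose (o + suc k) (suc k)
    step = +-cancelʳ-≡ (k * c) _ _ (trans (eq₃ o k c) (sym (choose-absorb (o + suc k) k)))

  Σˢ : ∀ {n} → (Subset n → ℕ) → ℕ
  Σˢ {zero} h = h []
  Σˢ {suc n} h = Σˢ (λ A → h (true ∷ A)) + Σˢ (λ A → h (false ∷ A))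

  Σˢ-mono : ∀ {n} {f g : Subset n → ℕ} → (∀ A → f A ≤ g A) → Σˢ f ≤ Σˢ g
  Σˢ-mono {zero} h = h []
  Σˢ-mono {suc n} h = +-mono-≤ (Σˢ-mono (λ A → h (true ∷ A))) (Σˢ-mono (λ A → h (false ∷ A)))

  Σˢ-cong : ∀ {n} {f g : Subset n → ℕ} → (∀ A → f A ≡ g A) → Σˢ f ≡ Σˢ g
  Σˢ-cong {zero} h = h []
  Σˢ-cong {suc n} h = cong₂ _+_ (Σˢ-cong (λ A → h (true ∷ A))) (Σˢ-cong (λ A → h (false ∷ A)))

  Σˢ-lin : ∀ {n} x y (f g : Subset n → ℕ) → Σˢ (λ A → x * f A + y * g A) ≡ x * Σˢ f + y * Σˢ g
  Σˢ-lin {zero} x y f g = refl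
  Σˢ-lin {suc n} x y f g = trans (cong₂ _+_ (Σˢ-lin x y (λ A → f (true ∷ A)) (λ A → g (true ∷ A))) (Σˢ-lin x y (λ A → f (false ∷ A)) (λ A → g (false ∷ A))))
    (eq x y (Σˢ (λ A → f (true ∷ A))) _ _ _)
    where
    eq : ∀ x y a b c d → x * a + y * b + (x * c + y * d) ≡ x * (a + c) + y * (b + d)
    eq = solve-∀

  Σˢ-add : ∀ {n} (f g : Subset n → ℕ) → Σˢ (λ A → f A + g A) ≡ Σˢ f + Σˢ g
  Σˢ-add {zero} f g = refl
  Σˢ-add {suc n} f g = trans (cong₂ _+_ (Σˢ-add (λ A → f (true ∷ A)) (λ A → g (true ∷ A))) (Σˢ-add (λ A → f (false ∷ A)) (λ A → g (false ∷ A))))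
    (eq (Σˢ (λ A → f (true ∷ A))) _ _ _)
    where
    eq : ∀ a b c d → a + b + (c + d) ≡ a + c + (b + d)
    eq = solve-∀

  Σˢ-bit : ∀ {n} (F : Family n) → Σˢ (λ A → bit (F A)) ≡ cnt F
  Σˢ-bit {zero} F = refl
  Σˢ-bit {suc n} F = cong₂ _+_ (Σˢ-bit (λ A → F (true ∷ A))) (Σˢ-bit (λ A → F (false ∷ A)))

  Σˢ-zero : ∀ n → Σˢ {n} (λ _ → 0) ≡ 0
  Σˢ-zero zero = refl
  Σˢ-zero (suc n) = cong₂ _+_ (Σˢ-zero n) (Σˢ-zero n)

  Σˢ-∋ : ∀ {n} → (Subset n → ℕ) → Fin n → ℕ
  Σˢ-∋ h y = Σˢ (λ A → bit (lookup A y) * h A)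

  meet-sum : ∀ {n} u c (Y : Subset n) (h : Subset n → ℕ) → (∀ y → Y ∋ y → Σˢ-∋ h y * u ≤ c) →
    Σˢ (λ A → h A * ∣ A ∩ Y ∣) * u ≤ ∣ Y ∣ * c
  meet-sum u c [] h d = ≤-reflexive (cong (_* u) (*-zeroʳ (h [])))
  meet-sum {suc n} u c (b ∷ Y) h d = subst (λ z → z * u ≤ ∣ b ∷ Y ∣ * c) (sym (split b)) (bound b d)
    where
    h₁ h₀ : Subset n → ℕ
    h₁ A = h (true ∷ A)
    h₀ A = h (false ∷ A)
    T = Σˢ (λ A → (h₁ A + h₀ A) * ∣ A ∩ Y ∣)
    eqt : ∀ x y t → x * suc t + y * t ≡ x + (x + y) * t
    eqt = solve-∀
    eqf : ∀ x y t → x * t + y * t ≡ (x + y) * t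
    eqf = solve-∀
    split : ∀ b → Σˢ (λ A → h A * ∣ A ∩ (b ∷ Y) ∣) ≡ bit b * Σˢ h₁ + T
    split true = trans (sym (Σˢ-add {n} _ _)) (trans (Σˢ-cong (λ A → eqt (h₁ A) (h₀ A) ∣ A ∩ Y ∣)) (trans (Σˢ-add h₁ _) (cong (_+ T) (sym (+-identityʳ (Σˢ h₁))))))
    split false = trans (sym (Σˢ-add {n} _ _)) (Σˢ-cong (λ A → eqf (h₁ A) (h₀ A) ∣ A ∩ Y ∣))
    IH : ∀ b → (∀ y → (b ∷ Y) ∋ y → Σˢ-∋ h y * u ≤ c) → T * u ≤ ∣ Y ∣ * c
    IH b d = meet-sum u c Y (λ A → h₁ A + h₀ A) (λ y p → subst (λ z → z * u ≤ c)
      (sym (trans (Σˢ-cong (λ A → *-distribˡ-+ (bit (lookup A y)) (h₁ A) (h₀ A))) (Σˢ-add {n} _ _))) (d (suc y) p))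
    bound : ∀ b → (∀ y → (b ∷ Y) ∋ y → Σˢ-∋ h y * u ≤ c) → (bit b * Σˢ h₁ + T) * u ≤ ∣ b ∷ Y ∣ * c
    bound false d = IH false d
    bound true d = ≤-trans (≤-reflexive (*-distribʳ-+ u (1 * Σˢ h₁) T)) (+-mono-≤ (subst (λ z → z * u ≤ c) first (d zero refl)) (IH true d))
      where
      first : Σˢ-∋ h zero ≡ 1 * Σˢ h₁
      first = trans (cong₂ _+_ (Σˢ-cong (λ A → +-identityʳ (h₁ A))) (Σˢ-zero n)) refl

  weight : ∀ {n} → Subset n → ℕ
  weight [] = 0
  weight (true ∷ Y) = 1 + weight Y
  weight (false ∷ Y) = 2 + weight Y

  weight-size : ∀ {n} (Y : Subset n) → weight Y + ∣ Y ∣ ≡ 2 * n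
  weight-size [] = refl
  weight-size {suc n} (true ∷ Y) = trans (cong suc (+-suc (weight Y) ∣ Y ∣)) (trans (cong (2 +_) (weight-size Y)) (eq n))
    where
    eq : ∀ n → 2 + 2 * n ≡ 2 * suc n
    eq = solve-∀
  weight-size {suc n} (false ∷ Y) = trans (cong (2 +_) (weight-size Y)) (eq n)
    where
    eq : ∀ n → 2 + 2 * n ≡ 2 * suc n
    eq = solve-∀

  binomial₂ : ∀ w s k → suc k * (w * s ^ k) + s ^ suc k ≤ (w + s) ^ suc k
  binomial₂ w s zero = ≤-reflexive (eq w s)
    where
    eq : ∀ w s → 1 * (w * 1) + s * 1 ≡ (w + s) * 1
    eq = solve-∀
  binomial₂ w s (suc k) = ≤-trans (≤-trans (m≤m+n _ (suc k * (w * (w * s ^ k)))) (≤-reflexive (eq w s k (s ^ k)))) (*-monoʳ-≤ (w + s) (binomial₂ w s k))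
    where
    eq : ∀ w s k x → suc (suc k) * (w * (s * x)) + s * (s * x) + suc k * (w * (w * x)) ≡ (w + s) * (suc k * (w * x) + s * x)
    eq = solve-∀

  -- The sum is the elementary symmetric polynomial of degree κ in the weights 1 on `Y` and 2 off
  -- `Y`; κ! times it is at most the κ-th power of the sum of all weights.
  weighted-count : ∀ {n} κ (Y : Subset n) → Σˢ (λ A → bit (sized κ A) * 2 ^ ∣ A ∖ˢ Y ∣) * κ ! ≤ weight Y ^ κ
  weighted-count zero [] = ≤-refl
  weighted-count (suc κ) [] = z≤n
  weighted-count {suc n} zero (b ∷ Y) = ≤-trans (≤-reflexive (cong (λ z → z * 1) (cong₂ _+_
      (Σˢ-zero n) (Σˢ-cong (λ A → cong (λ z → bit (sized 0 A) * 2 ^ z) (false-∖ b Y A))))))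
    (weighted-count zero Y)
    where
    false-∖ : ∀ {n} b (Y A : Subset n) → ∣ (false ∷ A) ∖ˢ (b ∷ Y) ∣ ≡ ∣ A ∖ˢ Y ∣
    false-∖ b Y A = refl
  weighted-count {suc n} (suc κ) (b ∷ Y) = ≤-trans (≤-reflexive (split b)) (≤-trans (+-mono-≤ (*-monoʳ-≤ (suc κ) (*-monoʳ-≤ (w b) (weighted-count κ Y))) (weighted-count (suc κ) Y)) (bound b))
    where
    w : Bool → ℕ
    w true = 1
    w false = 2
    s = weight Y
    e₁ = Σˢ (λ A → bit (sized κ A) * 2 ^ ∣ A ∖ˢ Y ∣)
    e₀ = Σˢ (λ A → bit (sized (suc κ) A) * 2 ^ ∣ A ∖ˢ Y ∣)
    scale : ∀ x y → x * (2 * y) ≡ 2 * (x * y) + 0 * (x * y)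
    scale = solve-∀
    eq₁ : ∀ a b c d → (1 * a + b) * (suc c * d) ≡ suc c * (1 * (a * d)) + b * (suc c * d)
    eq₁ = solve-∀
    eq₂ : ∀ a b c d → (2 * a + 0 * a + b) * (suc c * d) ≡ suc c * (2 * (a * d)) + b * (suc c * d)
    eq₂ = solve-∀
    split : ∀ b → Σˢ (λ A → bit (sized (suc κ) A) * 2 ^ ∣ A ∖ˢ (b ∷ Y) ∣) * suc κ ! ≡ suc κ * (w b * (e₁ * κ !)) + e₀ * suc κ !
    split true = trans (cong (λ z → (z + e₀) * suc κ !) (sym (*-identityˡ e₁))) (eq₁ e₁ e₀ κ (κ !))
    split false = trans (cong (λ z → (z + e₀) * suc κ !) (trans (Σˢ-cong (λ A → scale (bit (sized κ A)) (2 ^ ∣ A ∖ˢ Y ∣))) (Σˢ-lin 2 0 _ (λ A → bit (sized κ A) * 2 ^ ∣ A ∖ˢ Y ∣)))) (eq₂ e₁ e₀ κ (κ !))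
    bound : ∀ b → suc κ * (w b * s ^ κ) + s ^ suc κ ≤ weight (b ∷ Y) ^ suc κ
    bound true = binomial₂ 1 s κ
    bound false = binomial₂ 2 s κ

  ∖-∩-size : ∀ {n} (A Y : Subset n) → ∣ A ∖ˢ Y ∣ + ∣ A ∩ Y ∣ ≡ ∣ A ∣
  ∖-∩-size [] [] = refl
  ∖-∩-size (true ∷ A) (true ∷ Y) = trans (+-suc _ _) (cong suc (∖-∩-size A Y))
  ∖-∩-size (true ∷ A) (false ∷ Y) = cong suc (∖-∩-size A Y)
  ∖-∩-size (false ∷ A) (b ∷ Y) = ∖-∩-size A Y

  bernoulli-ℕ : ∀ x t → x ^ suc t + suc t * x ^ t ≤ suc x ^ suc t
  bernoulli-ℕ x t = ≤-trans (≤-reflexive (eq (x ^ suc t) t (x ^ t))) (binomial₂ 1 x t)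
    where
    eq : ∀ a t b → a + suc t * b ≡ suc t * (1 * b) + a
    eq = solve-∀

  bit-∧ : ∀ a b → bit a * bit b ≡ bit (a ∧ b)
  bit-∧ true b = +-identityʳ (bit b)
  bit-∧ false b = refl

  bit-mono : ∀ {a b} → (a ≡ true → b ≡ true) → bit a ≤ bit b
  bit-mono {false} h = z≤n
  bit-mono {true} h rewrite h refl = ≤-refl

  size≤n : ∀ {n} (A : Subset n) → ∣ A ∣ ≤ n
  size≤n [] = z≤n
  size≤n (true ∷ A) = s≤s (size≤n A)
  size≤n (false ∷ A) = m≤n⇒m≤1+n (size≤n A)

  n<[1+n/d]*d : ∀ n d .{{_ : NonZero d}} → n ≤ suc (n / d) * d
  n<[1+n/d]*d n d = ≮⇒≥ (λ lt → 1+n≰n (≤-trans (≤-reflexive (sym (m*n/n≡m (suc (n / d)) d))) (/-monoˡ-≤ d (<⇒≤ lt))))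

  *-cancelʳ-pos : ∀ c {a b} → 1 ≤ c → a * c ≤ b * c → a ≤ b
  *-cancelʳ-pos c {a} {b} h k = *-cancelʳ-≤ a b c {{>-nonZero h}} k

  *-cancelˡ-pos : ∀ c {a b} → 1 ≤ c → c * a ≤ c * b → a ≤ b
  *-cancelˡ-pos c {a} {b} h k = *-cancelˡ-≤ {a} {b} c {{>-nonZero h}} k

  pow-pos : ∀ {a} k → 1 ≤ a → 1 ≤ a ^ k
  pow-pos {a} k h = m^n>0 a {{>-nonZero h}} k

  -- By Bernoulli (1 + 1/a)^(a + 2) ≥ 2, and the exponent contains 4x such blocks.
  doubling : ∀ a x r → 2 ^ (4 * x) * a ^ (4 * x * (2 + a) + r) ≤ suc a ^ (4 * x * (2 + a) + r)
  doubling a x r = begin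
    2 ^ (4 * x) * a ^ (4 * x * (2 + a) + r) ≡⟨ cong (2 ^ (4 * x) *_) (^-distribˡ-+-* a (4 * x * (2 + a)) r) ⟩
    2 ^ (4 * x) * (a ^ (4 * x * (2 + a)) * a ^ r) ≡⟨ *-assoc (2 ^ (4 * x)) _ _ ⟨
    2 ^ (4 * x) * a ^ (4 * x * (2 + a)) * a ^ r ≡⟨ cong (λ z → 2 ^ (4 * x) * a ^ z * a ^ r) (*-comm (4 * x) (2 + a)) ⟩
    2 ^ (4 * x) * a ^ ((2 + a) * (4 * x)) * a ^ r ≡⟨ cong (λ z → 2 ^ (4 * x) * z * a ^ r) (^-*-assoc a (2 + a) (4 * x)) ⟨
    2 ^ (4 * x) * (a ^ (2 + a)) ^ (4 * x) * a ^ r ≡⟨ cong (_* a ^ r) (^-distribʳ-* (4 * x) 2 (a ^ (2 + a))) ⟨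
    (2 * a ^ (2 + a)) ^ (4 * x) * a ^ r ≤⟨ *-mono-≤ (^-monoˡ-≤ (4 * x) twice) (^-monoˡ-≤ r (n≤1+n a)) ⟩
    (suc a ^ (2 + a)) ^ (4 * x) * suc a ^ r ≡⟨ cong (_* suc a ^ r) (^-*-assoc (suc a) (2 + a) (4 * x)) ⟩
    suc a ^ ((2 + a) * (4 * x)) * suc a ^ r ≡⟨ cong (λ z → suc a ^ z * suc a ^ r) (*-comm (2 + a) (4 * x)) ⟩
    suc a ^ (4 * x * (2 + a)) * suc a ^ r ≡⟨ ^-distribˡ-+-* (suc a) (4 * x * (2 + a)) r ⟨
    suc a ^ (4 * x * (2 + a) + r) ∎
    where
    open ≤-Reasoning
    eq : ∀ z → 2 * z ≡ z + z
    eq = solve-∀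
    twice : 2 * a ^ (2 + a) ≤ suc a ^ (2 + a)
    twice = ≤-trans (≤-trans (≤-reflexive (eq (a ^ (2 + a)))) (+-monoʳ-≤ (a ^ (2 + a)) (*-monoˡ-≤ (a ^ suc a) (m≤n+m a 2)))) (bernoulli-ℕ a (suc a))

  deg : ∀ {n} → Family n → Fin n → ℕ
  deg G y = cnt (λ A → lookup A y ∧ G A)

  private
    -- Most members of a dense family meet a large set Y in about ∣ Y ∣ κ / n points,
    -- because Σ 2 ^ ∣ A ∖ Y ∣ over all κ-sets A is exponentially smaller than 2 ^ κ * choose n κ.
    light-set-small : ∀ μ o x d r {n κ} → n ≡ o + κ → κ ≡ x + d → κ ≡ 4 * x * (4 + 4 * μ) + r → 1 ≤ x → κ ≤ suc x * (16 * suc μ) →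
      4 * suc μ * κ ≤ n → (G : Family n) → (∀ A → G A ≡ true → ∣ A ∣ ≡ κ) → choose n κ ≤ 2 ^ x * cnt G →
      (Y : Subset n) → (∀ y → Y ∋ y → deg G y * (32 * suc μ * n) ≤ κ * cnt G) → n < ∣ Y ∣ * suc μ → ⊥
    light-set-small μ o x d r {n} {κ} n≡ κ≡x+d κ≡ 1≤x κ≤ n-big G uniform dense Y light big =
      -- `upper` says ((a + 1)/a)^κ ≤ 2^(1 + 2x), while `doubling` makes the left side at least
      -- 2^(4x). Here a = 4M - 2: n - κ is at least (a + 1) n / 4M, and a set Y above n / M points
      -- would have weight at most 2 a n / 4M.
      contradiction (*-cancelʳ-pos (a ^ κ) (pow-pos κ (s≤s z≤n)) (≤-trans (subst (λ z → 2 ^ (4 * x) * a ^ z ≤ suc a ^ z) (sym κ≡')  (doubling a x r)) upper))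
      where
      open ≤-Reasoning
      M g S w b : ℕ
      M = suc μ
      g = cnt G
      S = Σˢ (λ A → bit (G A) * ∣ A ∩ Y ∣)
      w = weight Y
      b = ∣ Y ∣
      a = 2 + 4 * μ
      κ≡' : κ ≡ 4 * x * (2 + a) + r
      κ≡' = κ≡
      1≤κ : 1 ≤ κ
      1≤κ = subst (1 ≤_) (sym κ≡x+d) (≤-trans 1≤x (m≤m+n x d))
      1≤n : 1 ≤ n
      1≤n = ≤-trans (*-mono-≤ {1} {4 * M} (s≤s z≤n) 1≤κ) n-big
      contradiction : 2 ^ (4 * x) ≤ 2 ^ (1 + 2 * x) → ⊥
      contradiction h = 1+n≰n (≤-trans (+-monoˡ-≤ (2 ^ (1 + 2 * x)) (pow-pos {2} (1 + 2 * x) (s≤s z≤n)))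
        (≤-trans (≤-reflexive (eq (2 ^ (1 + 2 * x)))) (≤-trans (^-monoʳ-≤ 2 (≤-trans (≤-reflexive (eq₂ x)) (≤-trans (+-monoˡ-≤ (2 * x) (*-monoʳ-≤ 2 1≤x)) (≤-reflexive (eq₃ x))))) h)))
        where
        eq : ∀ z → z + z ≡ 2 * z
        eq = solve-∀
        eq₂ : ∀ x → suc (1 + 2 * x) ≡ 2 * 1 + 2 * x
        eq₂ = solve-∀
        eq₃ : ∀ x → 2 * x + 2 * x ≡ 4 * x
        eq₃ = solve-∀
      -- Light degrees keep the average of ∣ A ∩ Y ∣ over `G` at or below (x + 1) / 2.
      S-small : 2 * S ≤ suc x * g
      S-small = *-cancelʳ-pos (n * (16 * M)) (*-mono-≤ 1≤n (s≤s z≤n)) (begin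
        2 * S * (n * (16 * M)) ≡⟨ eq S n M ⟩
        S * (32 * M * n) ≤⟨ meet-sum (32 * M * n) (κ * g) Y (λ A → bit (G A)) (λ y p → subst (λ z → z * (32 * M * n) ≤ κ * g)
          (sym (trans (Σˢ-cong (λ A → bit-∧ (lookup A y) (G A))) (Σˢ-bit (λ A → lookup A y ∧ G A)))) (light y p)) ⟩
        b * (κ * g) ≤⟨ *-mono-≤ (size≤n Y) (*-monoˡ-≤ g κ≤) ⟩
        n * (suc x * (16 * M) * g) ≡⟨ eq₂ n (suc x) M g ⟩
        suc x * g * (n * (16 * M)) ∎)
        where
        eq : ∀ S n M → 2 * S * (n * (16 * M)) ≡ S * (32 * M * n)
        eq = solve-∀
        eq₂ : ∀ n y M g → n * (y * (16 * M) * g) ≡ y * g * (n * (16 * M))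
        eq₂ = solve-∀
      W V : ℕ
      W = Σˢ (λ A → bit (sized κ A) * 2 ^ ∣ A ∖ˢ Y ∣)
      V = Σˢ (λ A → bit (G A) * 2 ^ ∣ A ∖ˢ Y ∣)
      V≤W : V ≤ W
      V≤W = Σˢ-mono (λ A → *-monoˡ-≤ (2 ^ ∣ A ∖ˢ Y ∣) (bit-mono (λ h → to-sized {A = A} (uniform A h))))
      pointwise : ∀ A → 2 ^ d * suc x * bit (G A) + 0 * bit (G A) ≤ suc x * (bit (G A) * 2 ^ ∣ A ∖ˢ Y ∣) + 2 ^ d * (bit (G A) * ∣ A ∩ Y ∣)
      pointwise A with G A in e
      ... | false = ≤-trans (≤-reflexive (eq (2 ^ d * suc x))) z≤n
        where
        eq : ∀ y → y * 0 + 0 * 0 ≡ 0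
        eq = solve-∀
      ... | true with ∣ A ∩ Y ∣ ≤? x
      ... | yes p = ≤-trans (≤-reflexive (eq (2 ^ d) (suc x))) (≤-trans (*-monoʳ-≤ (suc x) (≤-trans (^-monoʳ-≤ 2 d≤) (≤-reflexive (sym (+-identityʳ _))))) (m≤m+n _ _))
        where
        eq : ∀ y z → y * z * 1 + 0 * 1 ≡ z * y
        eq = solve-∀
        d≤ : d ≤ ∣ A ∖ˢ Y ∣
        d≤ = +-cancelˡ-≤ x d _ (≤-trans (≤-reflexive (trans (sym κ≡x+d) (trans (sym (uniform A e)) (trans (sym (∖-∩-size A Y)) (+-comm _ ∣ A ∩ Y ∣))))) (+-monoˡ-≤ _ p))
      ... | no ¬p = ≤-trans (≤-reflexive (eq (2 ^ d) (suc x))) (≤-trans (*-monoʳ-≤ (2 ^ d) (≤-trans (≰⇒> ¬p) (≤-reflexive (sym (+-identityʳ _))))) (m≤n+m _ _))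
        where
        eq : ∀ y z → y * z * 1 + 0 * 1 ≡ y * z
        eq = solve-∀
      -- Markov's inequality: at least half of `G` meets `Y` in at most x points, and each such
      -- member weighs at least 2^d.
      W-large : 2 ^ d * g ≤ 2 * W
      W-large = *-cancelˡ-pos (suc x) (s≤s z≤n) (+-cancelʳ-≤ (2 ^ d * (suc x * g)) _ _ (begin
        suc x * (2 ^ d * g) + 2 ^ d * (suc x * g) ≡⟨ eq (suc x) (2 ^ d) g ⟩
        2 * (2 ^ d * suc x * g + 0 * g) ≡⟨ cong (2 *_) (cong₂ (λ y z → 2 ^ d * suc x * y + 0 * z) (Σˢ-bit G) (Σˢ-bit G)) ⟨
        2 * (2 ^ d * suc x * Σˢ (λ A → bit (G A)) + 0 * Σˢ (λ A → bit (G A))) ≡⟨ cong (2 *_) (Σˢ-lin (2 ^ d * suc x) 0 (λ A → bit (G A)) (λ A → bit (G A))) ⟨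
        2 * Σˢ (λ A → 2 ^ d * suc x * bit (G A) + 0 * bit (G A)) ≤⟨ *-monoʳ-≤ 2 (Σˢ-mono pointwise) ⟩
        2 * Σˢ (λ A → suc x * (bit (G A) * 2 ^ ∣ A ∖ˢ Y ∣) + 2 ^ d * (bit (G A) * ∣ A ∩ Y ∣)) ≡⟨ cong (2 *_) (Σˢ-lin (suc x) (2 ^ d) (λ A → bit (G A) * 2 ^ ∣ A ∖ˢ Y ∣) (λ A → bit (G A) * ∣ A ∩ Y ∣)) ⟩
        2 * (suc x * V + 2 ^ d * S) ≤⟨ *-monoʳ-≤ 2 (+-monoˡ-≤ (2 ^ d * S) (*-monoʳ-≤ (suc x) V≤W)) ⟩
        2 * (suc x * W + 2 ^ d * S) ≡⟨ eq₂ (suc x) W (2 ^ d) S ⟩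
        suc x * (2 * W) + 2 ^ d * (2 * S) ≤⟨ +-monoʳ-≤ (suc x * (2 * W)) (*-monoʳ-≤ (2 ^ d) S-small) ⟩
        suc x * (2 * W) + 2 ^ d * (suc x * g) ∎))
        where
        eq : ∀ y z g → y * (z * g) + z * (y * g) ≡ 2 * (z * y * g + 0 * g)
        eq = solve-∀
        eq₂ : ∀ y W z S → 2 * (y * W + z * S) ≡ y * (2 * W) + z * (2 * S)
        eq₂ = solve-∀
      core : 2 ^ κ * o ^ κ ≤ 2 ^ (1 + 2 * x) * w ^ κ
      core = begin
        2 ^ κ * o ^ κ ≡⟨ cong (λ z → 2 ^ z * o ^ κ) κ≡x+d ⟩
        2 ^ (x + d) * o ^ κ ≡⟨ cong (_* o ^ κ) (^-distribˡ-+-* 2 x d) ⟩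
        2 ^ x * 2 ^ d * o ^ κ ≤⟨ *-monoʳ-≤ (2 ^ x * 2 ^ d) (choose-factorial κ o) ⟩
        2 ^ x * 2 ^ d * (choose (o + κ) κ * κ !) ≤⟨ *-monoʳ-≤ (2 ^ x * 2 ^ d) (*-monoˡ-≤ (κ !) (subst (λ z → choose z κ ≤ 2 ^ x * g) n≡ dense)) ⟩
        2 ^ x * 2 ^ d * (2 ^ x * g * κ !) ≡⟨ eq (2 ^ x) (2 ^ d) g (κ !) ⟩
        2 ^ x * 2 ^ x * (2 ^ d * g) * κ ! ≤⟨ *-monoˡ-≤ (κ !) (*-monoʳ-≤ (2 ^ x * 2 ^ x) W-large) ⟩
        2 ^ x * 2 ^ x * (2 * W) * κ ! ≡⟨ eq₂ (2 ^ x) W (κ !) ⟩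
        2 * (2 ^ x * 2 ^ x) * (W * κ !) ≤⟨ *-monoʳ-≤ (2 * (2 ^ x * 2 ^ x)) (weighted-count κ Y) ⟩
        2 * (2 ^ x * 2 ^ x) * w ^ κ ≡⟨ cong (λ z → 2 * z * w ^ κ) (trans (sym (^-distribˡ-+-* 2 x x)) (cong (2 ^_) (eq₃ x))) ⟩
        2 ^ (1 + 2 * x) * w ^ κ ∎
        where
        eq : ∀ p q g f → p * q * (p * g * f) ≡ p * p * (q * g) * f
        eq = solve-∀
        eq₂ : ∀ p W f → p * p * (2 * W) * f ≡ 2 * (p * p) * (W * f)
        eq₂ = solve-∀
        eq₃ : ∀ x → x + x ≡ 2 * x
        eq₃ = solve-∀
      o-large : suc a * n ≤ 4 * M * o
      o-large = +-cancelʳ-≤ n _ _ (begin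
        suc a * n + n ≡⟨ eq μ n ⟩
        4 * M * n ≡⟨ cong (4 * M *_) n≡ ⟩
        4 * M * (o + κ) ≡⟨ *-distribˡ-+ (4 * M) o κ ⟩
        4 * M * o + 4 * M * κ ≤⟨ +-monoʳ-≤ (4 * M * o) n-big ⟩
        4 * M * o + n ∎)
        where
        eq : ∀ μ n → suc (2 + 4 * μ) * n + n ≡ 4 * suc μ * n
        eq = solve-∀
      w-small : 4 * M * w ≤ 2 * a * n
      w-small = +-cancelʳ-≤ (4 * n) _ _ (begin
        4 * M * w + 4 * n ≤⟨ +-monoʳ-≤ (4 * M * w) (*-monoʳ-≤ 4 (<⇒≤ big)) ⟩
        4 * M * w + 4 * (b * M) ≡⟨ eq M w b ⟩
        4 * M * (w + b) ≡⟨ cong (4 * M *_) (weight-size Y) ⟩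
        4 * M * (2 * n) ≡⟨ eq₂ μ n ⟩
        2 * a * n + 4 * n ∎)
        where
        eq : ∀ M w b → 4 * M * w + 4 * (b * M) ≡ 4 * M * (w + b)
        eq = solve-∀
        eq₂ : ∀ μ n → 4 * suc μ * (2 * n) ≡ 2 * (2 + 4 * μ) * n + 4 * n
        eq₂ = solve-∀
      upper : suc a ^ κ ≤ 2 ^ (1 + 2 * x) * a ^ κ
      upper = *-cancelʳ-pos ((2 * n) ^ κ) (pow-pos κ (*-mono-≤ {1} {2} (s≤s z≤n) 1≤n)) (begin
        suc a ^ κ * (2 * n) ^ κ ≡⟨ ^-distribʳ-* κ (suc a) (2 * n) ⟨
        (suc a * (2 * n)) ^ κ ≡⟨ cong (_^ κ) (eq (suc a) n) ⟩
        (2 * (suc a * n)) ^ κ ≤⟨ ^-monoˡ-≤ κ (*-monoʳ-≤ 2 o-large) ⟩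
        (2 * (4 * M * o)) ^ κ ≡⟨ trans (^-distribʳ-* κ 2 (4 * M * o)) (trans (cong (2 ^ κ *_) (^-distribʳ-* κ (4 * M) o)) (eq₃ (2 ^ κ) ((4 * M) ^ κ) (o ^ κ))) ⟩
        (4 * M) ^ κ * (2 ^ κ * o ^ κ) ≤⟨ *-monoʳ-≤ ((4 * M) ^ κ) core ⟩
        (4 * M) ^ κ * (2 ^ (1 + 2 * x) * w ^ κ) ≡⟨ trans (eq₄ ((4 * M) ^ κ) (2 ^ (1 + 2 * x)) (w ^ κ)) (cong (2 ^ (1 + 2 * x) *_) (sym (^-distribʳ-* κ (4 * M) w))) ⟩
        2 ^ (1 + 2 * x) * (4 * M * w) ^ κ ≤⟨ *-monoʳ-≤ (2 ^ (1 + 2 * x)) (^-monoˡ-≤ κ w-small) ⟩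
        2 ^ (1 + 2 * x) * (2 * a * n) ^ κ ≡⟨ cong (λ z → 2 ^ (1 + 2 * x) * z) (trans (cong (_^ κ) (eq₅ a n)) (^-distribʳ-* κ a (2 * n))) ⟩
        2 ^ (1 + 2 * x) * (a ^ κ * (2 * n) ^ κ) ≡⟨ *-assoc (2 ^ (1 + 2 * x)) _ _ ⟨
        2 ^ (1 + 2 * x) * a ^ κ * (2 * n) ^ κ ∎)
        where
        eq : ∀ a n → a * (2 * n) ≡ 2 * (a * n)
        eq = solve-∀
        eq₃ : ∀ a b c → a * (b * c) ≡ b * (a * c)
        eq₃ = solve-∀
        eq₄ : ∀ a b c → a * (b * c) ≡ b * (a * c)
        eq₄ = solve-∀
        eq₅ : ∀ a n → 2 * a * n ≡ a * (2 * n)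
        eq₅ = solve-∀

  -- The number κ / 16M plays two roles: densities down to 2 to the minus this power are tolerated,
  -- and four times as many blocks of length 4M fit into κ, each of them doubling the contradictory
  -- quotient.
  fairness : ∀ M .{{_ : NonZero M}} {n κ} → 16 * M ≤ κ → 4 * M * κ ≤ n → (G : Family n) → (∀ A → G A ≡ true → ∣ A ∣ ≡ κ) →
    choose n κ ≤ 2 ^ (_/_ κ (16 * M) {{m*n≢0 16 M}}) * cnt G →
    (Y : Subset n) → (∀ y → Y ∋ y → deg G y * (32 * M * n) ≤ κ * cnt G) → ∣ Y ∣ * M ≤ n
  fairness (suc μ) {n} {κ} κ-big n-big G uniform dense Y light with ∣ Y ∣ * suc μ ≤? n
  ... | yes p = p
  ... | no ¬p = ⊥-elim (light-set-small μ (n ∸ κ) x (κ ∸ x) (κ ∸ 4 * x * (4 + 4 * μ)) (sym (m∸n+n≡m κ≤n)) (sym (m+[n∸m]≡n x≤κ)) (sym (m+[n∸m]≡n blocks))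
      1≤x (n<[1+n/d]*d κ (16 * suc μ)) n-big G uniform dense Y light (≰⇒> ¬p))
    where
    x = κ / (16 * suc μ)
    1≤x : 1 ≤ x
    1≤x = subst (_≤ x) (Data.Nat.DivMod.n/n≡1 (16 * suc μ)) (/-monoˡ-≤ (16 * suc μ) κ-big)
    κ≤n : κ ≤ n
    κ≤n = ≤-trans (m≤n*m κ (4 * suc μ)) n-big
    blocks : 4 * x * (4 + 4 * μ) ≤ κ
    blocks = ≤-trans (≤-reflexive (eq x μ)) (m/n*n≤m κ (16 * suc μ))
      where
      eq : ∀ x μ → 4 * x * (4 + 4 * μ) ≡ x * (16 * suc μ)
      eq = solve-∀
    x≤κ : x ≤ κ
    x≤κ = ≤-trans (≤-trans (m≤m*n x (16 * suc μ)) ≤-refl) (m/n*n≤m κ (16 * suc μ))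

-- Finite sets, links, and copies of expansions.

module Sets where
  open import Defs using (Family; FinHypergraph; Hypergraph; expansion; ContainsCopy)
  open Count
  open Fair
  open import Data.Nat
  open import Data.Nat.Properties hiding (suc-injective)
  open import Data.Bool using (true; false; not; _∧_; _∨_)
  open import Data.Fin as Fin using (Fin; zero; suc; cast)
  open import Data.Fin.Properties using (suc-injective; cast-is-id)
  open import Data.Fin.Subset using (Subset; ∣_∣; _∩_; _∪_; _∈_)
  open import Data.Vec using ([]; _∷_; lookup; replicate)
  open import Data.Vec.Properties using ([]=⇒lookup; lookup⇒[]=; lookup-zipWith)
  open import Data.Product using (_×_; _,_; Σ; ∃-syntax; proj₁; proj₂)
  open import Data.Sum using (_⊎_; inj₁; inj₂)
  open import Data.Sum.Properties using (inj₁-injective)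
  open import Data.Empty using (⊥; ⊥-elim)
  open import Function using (mk⇔; _∘_; Equivalence)
  open import Function.Definitions using (Injective)
  open import Relation.Nullary using (yes; no)
  open import Relation.Binary.PropositionalEquality

  ∨-true : ∀ {a b} → (a ∨ b) ≡ true → (a ≡ true) ⊎ (b ≡ true)
  ∨-true {true} h = inj₁ refl
  ∨-true {false} h = inj₂ h

  bool-case : ∀ b → (b ≡ true) ⊎ (b ≡ false)
  bool-case true = inj₁ refl
  bool-case false = inj₂ refl

  ∪-∋ : ∀ {n} (A B : Subset n) x → A ∪ B ∋ x → (A ∋ x) ⊎ (B ∋ x)
  ∪-∋ A B x h = ∨-true (trans (sym (lookup-zipWith _∨_ x A B)) h)

  ∪-∋ˡ : ∀ {n} (A B : Subset n) x → A ∋ x → A ∪ B ∋ x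
  ∪-∋ˡ A B x h = trans (lookup-zipWith _∨_ x A B) (∨-left _ h)

  ∪-∋ʳ : ∀ {n} (A B : Subset n) x → B ∋ x → A ∪ B ∋ x
  ∪-∋ʳ A B x h = trans (lookup-zipWith _∨_ x A B) (∨-right _ h)

  ∪-size : ∀ {n} (A B : Subset n) → ∣ A ∪ B ∣ ≤ ∣ A ∣ + ∣ B ∣
  ∪-size [] [] = z≤n
  ∪-size (true ∷ A) (true ∷ B) = s≤s (≤-trans (∪-size A B) (+-monoʳ-≤ ∣ A ∣ (n≤1+n ∣ B ∣)))
  ∪-size (true ∷ A) (false ∷ B) = s≤s (∪-size A B)
  ∪-size (false ∷ A) (true ∷ B) = ≤-trans (s≤s (∪-size A B)) (≤-reflexive (sym (+-suc ∣ A ∣ ∣ B ∣)))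
  ∪-size (false ∷ A) (false ∷ B) = ∪-size A B

  ∪-disjoint-size : ∀ {n} (A B : Subset n) → Disjoint A B → ∣ A ∪ B ∣ ≡ ∣ A ∣ + ∣ B ∣
  ∪-disjoint-size [] [] h = refl
  ∪-disjoint-size (true ∷ A) (true ∷ B) h = ⊥-elim (h zero refl refl)
  ∪-disjoint-size (true ∷ A) (false ∷ B) h = cong suc (∪-disjoint-size A B (λ x → h (suc x)))
  ∪-disjoint-size (false ∷ A) (true ∷ B) h = trans (cong suc (∪-disjoint-size A B (λ x → h (suc x)))) (sym (+-suc ∣ A ∣ ∣ B ∣))
  ∪-disjoint-size (false ∷ A) (false ∷ B) h = ∪-disjoint-size A B (λ x → h (suc x))

  ∅ : ∀ {n} → Subset n
  ∅ {n} = replicate n false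

  ∅-∌ : ∀ {n} (x : Fin n) → ∅ ∋ x → ⊥
  ∅-∌ (suc x) h = ∅-∌ x h

  ∅-size : ∀ n → ∣ ∅ {n} ∣ ≡ 0
  ∅-size zero = refl
  ∅-size (suc n) = ∅-size n

  single : ∀ {n} → Fin n → Subset n
  single zero = true ∷ ∅
  single (suc y) = false ∷ single y

  single-∋ : ∀ {n} (y : Fin n) → single y ∋ y
  single-∋ zero = refl
  single-∋ (suc y) = single-∋ y

  single-≡ : ∀ {n} (y x : Fin n) → single y ∋ x → x ≡ y
  single-≡ zero zero h = refl
  single-≡ zero (suc x) h = ⊥-elim (∅-∌ x h)
  single-≡ (suc y) (suc x) h = cong suc (single-≡ y x h)

  single-size : ∀ {n} (y : Fin n) → ∣ single y ∣ ≡ 1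
  single-size (zero {n}) = cong suc (∅-size n)
  single-size (suc y) = single-size y

  add-size : ∀ {n} (B : Subset n) z → (B ∋ z → ⊥) → ∣ B ∪ single z ∣ ≡ suc ∣ B ∣
  add-size B z z∉B = trans (∪-disjoint-size B (single z) (λ x p q → z∉B (subst (B ∋_) (single-≡ z x q) p)))
    (trans (cong (∣ B ∣ +_) (single-size z)) (+-comm (∣ B ∣) 1))

  meeting-point : ∀ {n} (A B : Subset n) → (Disjoint A B → ⊥) → ∃[ z ] (A ∋ z × B ∋ z)
  meeting-point [] [] h = ⊥-elim (h λ ())
  meeting-point (true ∷ A) (true ∷ B) h = zero , refl , refl
  meeting-point (true ∷ A) (false ∷ B) h = let z , p , q = meeting-point A B (λ d → h λ { (suc x) → d x }) in suc z , p , q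
  meeting-point (false ∷ A) (b ∷ B) h = let z , p , q = meeting-point A B (λ d → h λ { (suc x) → d x }) in suc z , p , q

  full : ∀ {n} → Subset n
  full {n} = replicate n true

  full-∋ : ∀ {n} (x : Fin n) → full ∋ x
  full-∋ zero = refl
  full-∋ (suc x) = full-∋ x

  full-size : ∀ n → ∣ full {n} ∣ ≡ n
  full-size zero = refl
  full-size (suc n) = cong suc (full-size n)

  ⋃ : ∀ {m n} → (Fin m → Subset n) → Subset n
  ⋃ {zero} A = ∅
  ⋃ {suc m} A = A zero ∪ ⋃ (A ∘ suc)

  ⋃-∋ : ∀ {m n} (A : Fin m → Subset n) x → ⋃ A ∋ x → ∃[ e ] (A e ∋ x)
  ⋃-∋ {zero} A x h = ⊥-elim (∅-∌ x h)
  ⋃-∋ {suc m} A x h with ∪-∋ (A zero) (⋃ (A ∘ suc)) x h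
  ... | inj₁ k = zero , k
  ... | inj₂ k = let e , l = ⋃-∋ (A ∘ suc) x k in suc e , l

  ∋-⋃ : ∀ {m n} (A : Fin m → Subset n) e x → A e ∋ x → ⋃ A ∋ x
  ∋-⋃ A zero x h = ∪-∋ˡ (A zero) (⋃ (A ∘ suc)) x h
  ∋-⋃ A (suc e) x h = ∪-∋ʳ (A zero) (⋃ (A ∘ suc)) x (∋-⋃ (A ∘ suc) e x h)

  ⋃-size : ∀ {m n} q (A : Fin m → Subset n) → (∀ e → ∣ A e ∣ ≤ q) → ∣ ⋃ A ∣ ≤ m * q
  ⋃-size {zero} {n} q A h = ≤-reflexive (∅-size n)
  ⋃-size {suc m} q A h = ≤-trans (∪-size (A zero) (⋃ (A ∘ suc))) (+-mono-≤ (h zero) (⋃-size q (A ∘ suc) (h ∘ suc)))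

  outside : ∀ {n} (A : Subset n) → ∣ A ∣ < n → ∃[ y ] (lookup A y ≡ false)
  outside (true ∷ A) (s≤s h) = let y , k = outside A h in suc y , k
  outside (false ∷ A) h = zero , refl

  ∌ : ∀ {n} {A : Subset n} {x} → lookup A x ≡ false → A ∋ x → ⊥
  ∌ h k with () ← trans (sym h) k

  ∖-∋ : ∀ {n} (A B : Subset n) x → A ∖ˢ B ∋ x → (A ∋ x) × (B ∋ x → ⊥)
  ∖-∋ A B x h with ∧-true (trans (sym (lookup-∖ A B x)) h)
  ... | a , b = a , λ k → not-both (trans (sym (cong not k)) b)
    where
    not-both : not true ≡ true → ⊥
    not-both ()

  ∋-∖ : ∀ {n} (A B : Subset n) x → A ∋ x → (B ∋ x → ⊥) → A ∖ˢ B ∋ x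
  ∋-∖ A B x a ¬b = trans (lookup-∖ A B x) (∧-intro a (lemma (lookup B x) ¬b))
    where
    lemma : ∀ b → (b ≡ true → ⊥) → not b ≡ true
    lemma true h = ⊥-elim (h refl)
    lemma false h = refl

  ∖-size : ∀ {n} (A B : Subset n) → B ⊑ A → ∣ A ∖ˢ B ∣ + ∣ B ∣ ≡ ∣ A ∣
  ∖-size [] [] h = refl
  ∖-size (true ∷ A) (true ∷ B) h = trans (+-suc _ _) (cong suc (∖-size A B (⊑-tail {A = B} {A} h)))
  ∖-size (true ∷ A) (false ∷ B) h = cong suc (∖-size A B (⊑-tail {A = B} {A} h))
  ∖-size (false ∷ A) (true ∷ B) h with () ← h zero refl
  ∖-size (false ∷ A) (false ∷ B) h = ∖-size A B (⊑-tail {A = B} {A} h)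

  ⊑-antisym : ∀ {n} (A B : Subset n) → A ⊑ B → B ⊑ A → A ≡ B
  ⊑-antisym [] [] h k = refl
  ⊑-antisym (a ∷ A) (b ∷ B) h k = cong₂ _∷_ (head a b (h zero) (k zero)) (⊑-antisym A B (h ∘ suc) (k ∘ suc))
    where
    head : ∀ a b → (a ≡ true → b ≡ true) → (b ≡ true → a ≡ true) → a ≡ b
    head true b h k = sym (h refl)
    head false true h k = k refl
    head false false h k = refl

  link : ∀ {n} → Family n → Subset n → Family n
  link F S B = disj S B ∧ F (S ∪ B)

  cnt-link : ∀ {n} (P : Family n) (S : Subset n) → cnt (λ A → ⊑ᵇ S A ∧ P A) ≤ cnt (link P S)
  cnt-link P [] = ≤-refl
  cnt-link {suc n} P (true ∷ S) = ≤-trans (≤-reflexive (trans (cong (cnt (λ A → ⊑ᵇ S A ∧ P (true ∷ A)) +_) (cnt-false n)) (+-identityʳ _)))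
    (≤-trans (cnt-link (λ A → P (true ∷ A)) S) (m≤n+m _ _))
  cnt-link {suc n} P (false ∷ S) = +-mono-≤ (cnt-link (λ A → P (true ∷ A)) S) (cnt-link (λ A → P (false ∷ A)) S)

  link-cnt : ∀ {n} (P : Family n) (S : Subset n) → cnt (link P S) ≤ cnt (λ A → ⊑ᵇ S A ∧ P A)
  link-cnt P [] = ≤-refl
  link-cnt {suc n} P (true ∷ S) = ≤-trans (≤-reflexive (cong (_+ cnt (λ B → disj S B ∧ P (true ∷ (S ∪ B)))) (cnt-false n)))
    (≤-trans (link-cnt (λ A → P (true ∷ A)) S) (m≤m+n _ _))
  link-cnt {suc n} P (false ∷ S) = +-mono-≤ (link-cnt (λ A → P (true ∷ A)) S) (link-cnt (λ A → P (false ∷ A)) S)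

  disj-∪ : ∀ {n} (A B C : Subset n) → Disjoint A (B ∪ C) → Disjoint B C → Disjoint (A ∪ B) C
  disj-∪ A B C h k x p q with ∪-∋ A B x p
  ... | inj₁ a = h x a (∪-∋ʳ B C x q)
  ... | inj₂ b = k x b q

  link-link : ∀ {n} (G : Family n) (U V : Subset n) → link (link G U) V ⇒ link G (U ∪ V)
  link-link G U V B h with ∧-true {disj V B} h
  ... | d , h' with ∧-true {disj U (V ∪ B)} h'
  ... | d' , g = ∧-intro (disj-complete (U ∪ V) B (disj-∪ U V B (disj-sound U (V ∪ B) d') (disj-sound V B d)))
    (subst (λ z → G z ≡ true) (⊑-antisym _ _ to from) g)
    where
    to : (U ∪ (V ∪ B)) ⊑ ((U ∪ V) ∪ B)
    to x p with ∪-∋ U (V ∪ B) x p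
    ... | inj₁ u = ∪-∋ˡ (U ∪ V) B x (∪-∋ˡ U V x u)
    ... | inj₂ q with ∪-∋ V B x q
    ... | inj₁ v = ∪-∋ˡ (U ∪ V) B x (∪-∋ʳ U V x v)
    ... | inj₂ b = ∪-∋ʳ (U ∪ V) B x b
    from : ((U ∪ V) ∪ B) ⊑ (U ∪ (V ∪ B))
    from x p with ∪-∋ (U ∪ V) B x p
    ... | inj₂ b = ∪-∋ʳ U (V ∪ B) x (∪-∋ʳ V B x b)
    ... | inj₁ q with ∪-∋ U V x q
    ... | inj₁ u = ∪-∋ˡ U (V ∪ B) x u
    ... | inj₂ v = ∪-∋ʳ U (V ∪ B) x (∪-∋ˡ V B x v)

  deg-link : ∀ {n} (G : Family n) U y → deg (link G U) y ≤ cnt (link G (U ∪ single y))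
  deg-link G U y = ≤-trans (cnt-mono step) (≤-trans (cnt-link (link G U) (single y)) (cnt-mono (link-link G U (single y))))
    where
    step : (λ A → lookup A y ∧ link G U A) ⇒ (λ A → ⊑ᵇ (single y) A ∧ link G U A)
    step A h = let a , b = ∧-true {lookup A y} h in
      ∧-intro (⊑ᵇ-complete (single y) A (λ x p → subst (A ∋_) (sym (single-≡ y x p)) a)) b

  -- Union bound: a member that meets `J` is charged to its incidences with `J`.
  avoid-cnt : ∀ {n} (L : Family n) (J : Subset n) K c → (∀ x → J ∋ x → deg L x * K ≤ c) →
    cnt L * K ≤ cnt (λ A → L A ∧ disj A J) * K + ∣ J ∣ * c
  avoid-cnt L J K c h = begin
    cnt L * K ≤⟨ *-monoˡ-≤ K (≤-trans (≤-reflexive (sym (Σˢ-bit L))) (≤-trans (Σˢ-mono pointwise) (≤-reflexive (trans (Σˢ-add _ (λ A → bit (L A) * ∣ A ∩ J ∣)) (cong (_+ S) (Σˢ-bit (λ A → L A ∧ disj A J))))))) ⟩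
    (cnt (λ A → L A ∧ disj A J) + S) * K ≡⟨ *-distribʳ-+ K (cnt (λ A → L A ∧ disj A J)) S ⟩
    cnt (λ A → L A ∧ disj A J) * K + S * K ≤⟨ +-monoʳ-≤ (cnt (λ A → L A ∧ disj A J) * K)
      (meet-sum K c J (λ A → bit (L A)) (λ y p → subst (λ z → z * K ≤ c) (sym (trans (Σˢ-cong (λ A → bit-∧ (lookup A y) (L A))) (Σˢ-bit (λ A → lookup A y ∧ L A)))) (h y p))) ⟩
    cnt (λ A → L A ∧ disj A J) * K + ∣ J ∣ * c ∎
    where
    open ≤-Reasoning
    S = Σˢ (λ A → bit (L A) * ∣ A ∩ J ∣)
    meets : ∀ {n} (A J : Subset n) → disj A J ≡ false → 1 ≤ ∣ A ∩ J ∣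
    meets [] [] ()
    meets (true ∷ A) (true ∷ J) h = s≤s z≤n
    meets (true ∷ A) (false ∷ J) h = meets A J h
    meets (false ∷ A) (b ∷ J) h = meets A J h
    pointwise : ∀ A → bit (L A) ≤ bit (L A ∧ disj A J) + bit (L A) * ∣ A ∩ J ∣
    pointwise A with L A | disj A J in e
    ... | false | _ = z≤n
    ... | true | true = s≤s z≤n
    ... | true | false = ≤-trans (meets A J e) (≤-reflexive (sym (+-identityʳ _)))

  enum : ∀ {n} (R : Subset n) → Fin ∣ R ∣ → Fin n
  enum (true ∷ R) zero = zero
  enum (true ∷ R) (suc i) = suc (enum R i)
  enum (false ∷ R) i = suc (enum R i)

  enum-∋ : ∀ {n} (R : Subset n) i → R ∋ enum R i
  enum-∋ (true ∷ R) zero = refl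
  enum-∋ (true ∷ R) (suc i) = enum-∋ R i
  enum-∋ (false ∷ R) i = enum-∋ R i

  enum-injective : ∀ {n} (R : Subset n) i j → enum R i ≡ enum R j → i ≡ j
  enum-injective (true ∷ R) zero zero h = refl
  enum-injective (true ∷ R) (suc i) (suc j) h = cong suc (enum-injective R i j (suc-injective h))
  enum-injective (false ∷ R) i j h = enum-injective R i j (suc-injective h)

  enum-onto : ∀ {n} (R : Subset n) x → R ∋ x → ∃[ i ] (enum R i ≡ x)
  enum-onto (true ∷ R) zero h = zero , refl
  enum-onto (true ∷ R) (suc x) h = let i , e = enum-onto R x h in suc i , cong suc e
  enum-onto (false ∷ R) (suc x) h = let i , e = enum-onto R x h in i , cong suc e

  image : ∀ {v n} → (Fin v → Fin n) → Subset v → Subset n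
  image φ [] = ∅
  image φ (true ∷ E) = single (φ zero) ∪ image (φ ∘ suc) E
  image φ (false ∷ E) = image (φ ∘ suc) E

  image-∋ : ∀ {v n} (φ : Fin v → Fin n) E z → image φ E ∋ z → ∃[ x ] (E ∋ x × φ x ≡ z)
  image-∋ φ [] z h = ⊥-elim (∅-∌ z h)
  image-∋ φ (true ∷ E) z h with ∪-∋ (single (φ zero)) (image (φ ∘ suc) E) z h
  ... | inj₁ k = zero , refl , sym (single-≡ (φ zero) z k)
  ... | inj₂ k = let x , l , e = image-∋ (φ ∘ suc) E z k in suc x , l , e
  image-∋ φ (false ∷ E) z h = let x , l , e = image-∋ (φ ∘ suc) E z h in suc x , l , e

  ∋-image : ∀ {v n} (φ : Fin v → Fin n) E x → E ∋ x → image φ E ∋ φ x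
  ∋-image φ (true ∷ E) zero h = ∪-∋ˡ (single (φ zero)) (image (φ ∘ suc) E) (φ zero) (single-∋ (φ zero))
  ∋-image φ (true ∷ E) (suc x) h = ∪-∋ʳ (single (φ zero)) (image (φ ∘ suc) E) (φ (suc x)) (∋-image (φ ∘ suc) E x h)
  ∋-image φ (false ∷ E) (suc x) h = ∋-image (φ ∘ suc) E x h

  image-size : ∀ {v n} (φ : Fin v → Fin n) → (∀ x y → φ x ≡ φ y → x ≡ y) → ∀ E → ∣ image φ E ∣ ≡ ∣ E ∣
  image-size {n = n} φ inj [] = ∅-size n
  image-size φ inj (true ∷ E) = trans (∪-disjoint-size (single (φ zero)) (image (φ ∘ suc) E) apart)
    (cong₂ _+_ (single-size (φ zero)) (image-size (φ ∘ suc) (λ x y h → suc-injective (inj _ _ h)) E))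
    where
    apart : Disjoint (single (φ zero)) (image (φ ∘ suc) E)
    apart z p q with image-∋ (φ ∘ suc) E z q
    ... | x , _ , e with () ← inj (suc x) zero (trans e (single-≡ (φ zero) z p))
  image-size φ inj (false ∷ E) = image-size (φ ∘ suc) (λ x y h → suc-injective (inj _ _ h)) E

  image-size≤ : ∀ {v n} (φ : Fin v → Fin n) E → ∣ image φ E ∣ ≤ ∣ E ∣
  image-size≤ {n = n} φ [] = ≤-reflexive (∅-size n)
  image-size≤ φ (true ∷ E) = ≤-trans (∪-size (single (φ zero)) (image (φ ∘ suc) E)) (+-mono-≤ (≤-reflexive (single-size (φ zero))) (image-size≤ (φ ∘ suc) E))
  image-size≤ φ (false ∷ E) = image-size≤ (φ ∘ suc) E

  module _ (H : FinHypergraph) (k : ℕ) {n : ℕ} (F : Family n) where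
    open FinHypergraph H

    -- A copy of the expansion without names for its new vertices: they are the points of `A e`
    -- outside the image of `φ`. `shared` makes them private to e, and `A-size` forces their number.
    record Kernel : Set where
      field
        φ : Fin v → Fin n
        φ-injective : ∀ x y → φ x ≡ φ y → x ≡ y
        A : Fin m → Subset n
        A∈F : ∀ e → F (A e) ≡ true
        A-size : ∀ e → ∣ A e ∣ ≡ k
        φ∈A : ∀ e x → edge e ∋ x → A e ∋ φ x
        A∋φ : ∀ e x → A e ∋ φ x → edge e ∋ x
        shared : ∀ e e' z → (e ≡ e' → ⊥) → A e ∋ z → A e' ∋ z → ∃[ x ] (φ x ≡ z)

    kernel-copy : Kernel → ContainsCopy (expansion H k) F
    kernel-copy K = ψ , ψ-injective , A , A∈F , λ e x → mk⇔ (to e x) (from e x)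
      where
      open Kernel K
      R : Fin m → Subset n
      R e = A e ∖ˢ image φ (edge e)
      im⊑A : ∀ e → image φ (edge e) ⊑ A e
      im⊑A e z h = let x , l , eq = image-∋ φ (edge e) z h in subst (A e ∋_) eq (φ∈A e x l)
      R-size : ∀ e → k ∸ ∣ edge e ∣ ≡ ∣ R e ∣
      R-size e = trans (cong₂ _∸_ (trans (sym (A-size e)) (sym (∖-size (A e) (image φ (edge e)) (im⊑A e)))) (sym (image-size φ φ-injective (edge e)))) (m+n∸n≡m ∣ R e ∣ ∣ image φ (edge e) ∣)
      r : ∀ e → Fin (k ∸ ∣ edge e ∣) → Fin n
      r e i = enum (R e) (cast (R-size e) i)
      r∈R : ∀ e i → R e ∋ r e i
      r∈R e i = enum-∋ (R e) _
      r∈A : ∀ e i → A e ∋ r e i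
      r∈A e i = proj₁ (∖-∋ (A e) _ _ (r∈R e i))
      r≢φ : ∀ e i x → r e i ≡ φ x → ⊥
      r≢φ e i x h = proj₂ (∖-∋ (A e) (image φ (edge e)) (r e i) (r∈R e i))
        (subst (image φ (edge e) ∋_) (sym h) (∋-image φ (edge e) x (A∋φ e x (subst (A e ∋_) h (r∈A e i)))))
      cast-injective : ∀ {a b} (p : a ≡ b) i j → cast p i ≡ cast p j → i ≡ j
      cast-injective refl i j h = trans (sym (cast-is-id refl i)) (trans h (cast-is-id refl j))
      ψ : Fin v ⊎ Σ (Fin m) (λ e → Fin (k ∸ ∣ edge e ∣)) → Fin n
      ψ (inj₁ x) = φ x
      ψ (inj₂ (e , i)) = r e i
      ψ-injective : Injective _≡_ _≡_ ψ
      ψ-injective {inj₁ x} {inj₁ y} h = cong inj₁ (φ-injective x y h)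
      ψ-injective {inj₁ x} {inj₂ (e , i)} h = ⊥-elim (r≢φ e i x (sym h))
      ψ-injective {inj₂ (e , i)} {inj₁ x} h = ⊥-elim (r≢φ e i x h)
      ψ-injective {inj₂ (e , i)} {inj₂ (e' , i')} h with e Fin.≟ e'
      ... | yes refl = cong (λ j → inj₂ (e , j)) (cast-injective (R-size e) i i' (enum-injective (R e) _ _ h))
      ... | no e≢e' = let x , eq = shared e e' (r e i) e≢e' (r∈A e i) (subst (A e' ∋_) (sym h) (r∈A e' i')) in ⊥-elim (r≢φ e i x (sym eq))
      open Hypergraph (expansion H k) using (mem)
      to : ∀ e x → x ∈ A e → ∃[ u ] (mem e u × ψ u ≡ x)
      to e x h with bool-case (lookup (image φ (edge e)) x)
      ... | inj₁ p = let y , l , eq = image-∋ φ (edge e) x p in inj₁ y , lookup⇒[]= y (edge e) l , eq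
      ... | inj₂ p = let i , eq = enum-onto (R e) x (∋-∖ (A e) _ x ([]=⇒lookup h) (∌ {A = image φ (edge e)} p)) in
        inj₂ (e , cast (sym (R-size e)) i) , refl , trans (cong (enum (R e)) (cast-inverse (R-size e) i)) eq
        where
        cast-inverse : ∀ {a b} (p : a ≡ b) i → cast p (cast (sym p) i) ≡ i
        cast-inverse refl i = trans (cast-is-id refl _) (cast-is-id refl i)
      from : ∀ e x → ∃[ u ] (mem e u × ψ u ≡ x) → x ∈ A e
      from e x (inj₁ y , l , eq) = lookup⇒[]= x (A e) (subst (A e ∋_) eq (φ∈A e y ([]=⇒lookup l)))
      from e x (inj₂ (e , i) , refl , eq) = lookup⇒[]= x (A e) (subst (A e ∋_) eq (r∈A e i))

  module _ (H : FinHypergraph) (k : ℕ) {n : ℕ} (F : Family n) (uniform : ∀ A → F A ≡ true → ∣ A ∣ ≡ k) where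
    open FinHypergraph H

    copy-kernel : ContainsCopy (expansion H k) F → Kernel H k F
    copy-kernel (ψ , ψ-injective , A , A∈F , incidence) = record
      { φ = ψ ∘ inj₁
      ; φ-injective = λ x y h → inj₁-injective (ψ-injective h)
      ; A = A ; A∈F = A∈F ; A-size = λ e → uniform (A e) (A∈F e)
      ; φ∈A = λ e x h → []=⇒lookup (from (incidence e (ψ (inj₁ x))) (inj₁ x , lookup⇒[]= x (edge e) h , refl))
      ; A∋φ = λ e x h → old e x (to (incidence e (ψ (inj₁ x))) (lookup⇒[]= _ (A e) h))
      ; shared = λ e e' z e≢e' p q → both e e' z e≢e' (to (incidence e z) (lookup⇒[]= z (A e) p)) (to (incidence e' z) (lookup⇒[]= z (A e') q)) }
      where
      open Equivalence
      open Hypergraph (expansion H k) using (mem)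
      old : ∀ e x → ∃[ u ] (mem e u × ψ u ≡ ψ (inj₁ x)) → edge e ∋ x
      old e x (u , l , eq) with ψ-injective eq
      ... | refl = []=⇒lookup l
      both : ∀ e e' z → (e ≡ e' → ⊥) → ∃[ u ] (mem e u × ψ u ≡ z) → ∃[ u ] (mem e' u × ψ u ≡ z) → ∃[ x ] (ψ (inj₁ x) ≡ z)
      both e e' z e≢e' (inj₁ x , _ , eq) _ = x , eq
      both e e' z e≢e' (inj₂ _ , _ , _) (inj₁ x , _ , eq) = x , eq
      both e e' z e≢e' (inj₂ u , refl , eq) (inj₂ u' , refl , eq') with ψ-injective (trans eq (sym eq'))
      ... | refl = ⊥-elim (e≢e' refl)

-- A copy of the expansion from spread petals.

module Copy where
  open import Defs using (Family; FinHypergraph)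
  open Count
  open Fair
  open Sets
  open Matching using (module Cross; PairwiseDisjoint)
  open import Data.Nat
  open import Data.Nat.Properties
  open import Data.Nat.DivMod using (m/n*n≤m; m*n/n≡m; /-monoˡ-≤)
  open import Data.Nat.Tactic.RingSolver using (solve-∀)
  open import Data.Bool using (Bool; true; false; _∧_; if_then_else_)
  open import Data.Fin as Fin using (Fin; zero; suc)
  open import Data.Fin.Subset using (Subset; ∣_∣; _∪_)
  open import Data.Vec using ([]; _∷_; lookup; tabulate)
  open import Data.Vec.Properties using (lookup∘tabulate)
  open import Data.List as List using (List; length; allFin)
  open import Data.List.Properties using (length-tabulate)
  open import Data.List.Membership.Propositional using (_∈_)
  open import Data.List.Membership.Propositional.Properties using (∈-allFin)
  open import Data.List.Relation.Unary.Any using (here; there)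
  open import Data.Maybe using (Maybe; just; nothing)
  open import Data.Maybe.Properties using (just-injective)
  open import Data.Product using (_×_; _,_; Σ; ∃-syntax; proj₁; proj₂)
  open import Data.Sum using (_⊎_; inj₁; inj₂)
  open import Data.Empty using (⊥; ⊥-elim)
  open import Function using (_∘_)
  open import Relation.Nullary using (yes; no; does)
  open import Relation.Nullary.Decidable using (dec-true)
  open import Relation.Binary.PropositionalEquality

  n≤2^n : ∀ n → n ≤ 2 ^ n
  n≤2^n zero = z≤n
  n≤2^n (suc n) = ≤-trans (+-mono-≤ (pow-pos {2} n (s≤s z≤n)) (n≤2^n n)) (≤-reflexive (eq (2 ^ n)))
    where
    eq : ∀ z → z + z ≡ 2 * z
    eq = solve-∀

  a^v≤2^av : ∀ a v → a ^ v ≤ 2 ^ (a * v)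
  a^v≤2^av a v = ≤-trans (^-monoˡ-≤ v (n≤2^n a)) (≤-reflexive (^-*-assoc 2 a v))

  -- The powers of κ/n cancel. Passing to the slice of κ - u gains (2κ/n)^u, the link keeps at least
  -- (κ̲ / g n)^u of the family, and κ ≤ 2κ̲; so attaching u points costs only (4g)^u in density.
  descend : ∀ n κ κ̲ u g X Y cG cL → 1 ≤ n → 2 * κ ≤ n → u ≤ κ → κ ≤ 2 * κ̲ → κ̲ ^ u * cG ≤ (g * n) ^ u * cL →
    X * choose n κ ≤ Y * cG → X * choose n (κ ∸ u) ≤ (4 * g) ^ u * Y * cL
  descend n κ κ̲ u g X Y cG cL 1≤n 2κ≤n u≤κ κ≤ big dense = *-cancelˡ-pos (n ^ u) (pow-pos u 1≤n) (begin
    n ^ u * (X * choose n (κ ∸ u)) ≡⟨ eq₁ (n ^ u) X (choose n (κ ∸ u)) ⟩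
    X * (n ^ u * choose n (κ ∸ u)) ≤⟨ *-monoʳ-≤ X (choose-down n u (κ ∸ u) (subst (λ z → 2 * z ≤ n) (sym κ≡) 2κ≤n)) ⟩
    X * ((2 * (u + (κ ∸ u))) ^ u * choose n (u + (κ ∸ u))) ≡⟨ cong (λ z → X * ((2 * z) ^ u * choose n z)) κ≡ ⟩
    X * ((2 * κ) ^ u * choose n κ) ≡⟨ eq₁ X ((2 * κ) ^ u) (choose n κ) ⟩
    (2 * κ) ^ u * (X * choose n κ) ≤⟨ *-mono-≤ (^-monoˡ-≤ u (*-monoʳ-≤ 2 κ≤)) dense ⟩
    (2 * (2 * κ̲)) ^ u * (Y * cG) ≡⟨ cong (_* (Y * cG)) (trans (cong (_^ u) (eq₂ κ̲)) (^-distribʳ-* u 4 κ̲)) ⟩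
    4 ^ u * κ̲ ^ u * (Y * cG) ≡⟨ eq₃ (4 ^ u) (κ̲ ^ u) Y cG ⟩
    4 ^ u * Y * (κ̲ ^ u * cG) ≤⟨ *-monoʳ-≤ (4 ^ u * Y) big ⟩
    4 ^ u * Y * ((g * n) ^ u * cL) ≡⟨ cong (λ z → 4 ^ u * Y * (z * cL)) (^-distribʳ-* u g n) ⟩
    4 ^ u * Y * (g ^ u * n ^ u * cL) ≡⟨ eq₄ (4 ^ u) Y (g ^ u) (n ^ u) cL ⟩
    n ^ u * (4 ^ u * g ^ u * Y * cL) ≡⟨ cong (λ z → n ^ u * (z * Y * cL)) (^-distribʳ-* u 4 g) ⟨
    n ^ u * ((4 * g) ^ u * Y * cL) ∎)
    where
    open ≤-Reasoning
    κ≡ : u + (κ ∸ u) ≡ κ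
    κ≡ = m+[n∸m]≡n u≤κ
    eq₁ : ∀ a b c → a * (b * c) ≡ b * (a * c)
    eq₁ = solve-∀
    eq₂ : ∀ a → 2 * (2 * a) ≡ 4 * a
    eq₂ = solve-∀
    eq₃ : ∀ a b c d → a * b * (c * d) ≡ a * c * (b * d)
    eq₃ = solve-∀
    eq₄ : ∀ a y g n c → a * y * (g * n * c) ≡ n * (a * g * y * c)
    eq₄ = solve-∀

  select : ∀ {n} → (Fin n → Bool) → Subset n
  select = tabulate

  select-∋ : ∀ {n} (f : Fin n → Bool) x → select f ∋ x → f x ≡ true
  select-∋ f x h = trans (sym (lookup∘tabulate f x)) h

  ∋-select : ∀ {n} (f : Fin n → Bool) x → f x ≡ true → select f ∋ x
  ∋-select f x h = trans (lookup∘tabulate f x) h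

  ⊔-size-sum : ∀ {m n} M (A : Fin m → Subset n) → (∀ e → ∣ A e ∣ * M ≤ n) → ∣ ⋃ A ∣ * M ≤ m * n
  ⊔-size-sum {zero} {n} M A h = ≤-reflexive (cong (_* M) (∅-size n))
  ⊔-size-sum {suc m} M A h = ≤-trans (*-monoˡ-≤ M (∪-size (A zero) (⋃ (A ∘ suc))))
    (≤-trans (≤-reflexive (*-distribʳ-+ M ∣ A zero ∣ _)) (+-mono-≤ (h zero) (⊔-size-sum M (A ∘ suc) (h ∘ suc))))

  update : ∀ {v} {X : Set} → (Fin v → X) → Fin v → X → Fin v → X
  update f x y z = if does (z Fin.≟ x) then y else f z

  update-at : ∀ {v} {X : Set} (f : Fin v → X) x y → update f x y x ≡ y
  update-at f x y rewrite dec-true (x Fin.≟ x) refl = refl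

  -- Placing the vertex `x` at `y` adds `y` to just those `U e` whose edge contains `x`. All
  -- invariants survive because `y` is new.
  module Assign {m v n : ℕ} (edge : Fin m → Subset v) (S U : Fin m → Subset n) (σ : Fin v → Maybe (Fin n))
    (σ-injective : ∀ x x' y → σ x ≡ just y → σ x' ≡ just y → x ≡ x')
    (inside : ∀ e x y → σ x ≡ just y → S e ∪ U e ∋ y → edge e ∋ x)
    (covers : ∀ e x y → σ x ≡ just y → edge e ∋ x → S e ∪ U e ∋ y)
    (U-kernel : ∀ e z → U e ∋ z → ∃[ x ] (σ x ≡ just z))
    (x : Fin v) (σx : σ x ≡ nothing) (y : Fin n) (y∉SU : ∀ e → S e ∪ U e ∋ y → ⊥) (y∉σ : ∀ x → σ x ≡ just y → ⊥) where

    σ' : Fin v → Maybe (Fin n)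
    σ' = update σ x (just y)
    grow : Bool → Subset n → Subset n
    grow true A = A ∪ single y
    grow false A = A
    U' : Fin m → Subset n
    U' e = grow (lookup (edge e) x) (U e)
    keeps : ∀ z w → σ z ≡ just w → σ' z ≡ just w
    keeps z w h with z Fin.≟ x
    ... | yes refl with () ← trans (sym σx) h
    ... | no z≢x = h
    σ'-cases : ∀ z w → σ' z ≡ just w → ((z ≡ x) × (w ≡ y)) ⊎ (σ z ≡ just w)
    σ'-cases z w h with z Fin.≟ x
    ... | yes z≡x = inj₁ (z≡x , sym (just-injective h))
    ... | no _ = inj₂ h
    grow-∋ : ∀ b A z → grow b A ∋ z → (A ∋ z) ⊎ ((b ≡ true) × (z ≡ y))
    grow-∋ false A z h = inj₁ h
    grow-∋ true A z h with ∪-∋ A (single y) z h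
    ... | inj₁ a = inj₁ a
    ... | inj₂ s = inj₂ (refl , single-≡ y z s)
    ∋-grow : ∀ b A z → A ∋ z → grow b A ∋ z
    ∋-grow true A z h = ∪-∋ˡ A (single y) z h
    ∋-grow false A z h = h
    SU'-cases : ∀ e z → S e ∪ U' e ∋ z → (S e ∪ U e ∋ z) ⊎ ((edge e ∋ x) × (z ≡ y))
    SU'-cases e z h with ∪-∋ (S e) (U' e) z h
    ... | inj₁ s = inj₁ (∪-∋ˡ (S e) (U e) z s)
    ... | inj₂ u with grow-∋ (lookup (edge e) x) (U e) z u
    ... | inj₁ u' = inj₁ (∪-∋ʳ (S e) (U e) z u')
    ... | inj₂ p = inj₂ p
    SU⊑SU' : ∀ e z → S e ∪ U e ∋ z → S e ∪ U' e ∋ z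
    SU⊑SU' e z h with ∪-∋ (S e) (U e) z h
    ... | inj₁ s = ∪-∋ˡ (S e) (U' e) z s
    ... | inj₂ u = ∪-∋ʳ (S e) (U' e) z (∋-grow (lookup (edge e) x) (U e) z u)
    inj' : ∀ a b w → σ' a ≡ just w → σ' b ≡ just w → a ≡ b
    inj' a b w p q with σ'-cases a w p | σ'-cases b w q
    ... | inj₁ (a≡x , _) | inj₁ (b≡x , _) = trans a≡x (sym b≡x)
    ... | inj₁ (_ , refl) | inj₂ q' = ⊥-elim (y∉σ b q')
    ... | inj₂ p' | inj₁ (_ , refl) = ⊥-elim (y∉σ a p')
    ... | inj₂ p' | inj₂ q' = σ-injective a b w p' q'
    inside' : ∀ e a w → σ' a ≡ just w → S e ∪ U' e ∋ w → edge e ∋ a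
    inside' e a w p h with σ'-cases a w p | SU'-cases e w h
    ... | inj₁ (refl , refl) | inj₁ su = ⊥-elim (y∉SU e su)
    ... | inj₁ (refl , refl) | inj₂ (q , _) = q
    ... | inj₂ p' | inj₁ su = inside e a w p' su
    ... | inj₂ p' | inj₂ (_ , refl) = ⊥-elim (y∉σ a p')
    covers' : ∀ e a w → σ' a ≡ just w → edge e ∋ a → S e ∪ U' e ∋ w
    covers' e a w p h with σ'-cases a w p
    ... | inj₂ p' = SU⊑SU' e w (covers e a w p' h)
    ... | inj₁ (refl , refl) = ∪-∋ʳ (S e) (U' e) y (subst (λ b → grow b (U e) ∋ y) (sym h) (∪-∋ʳ (U e) (single y) y (single-∋ y)))
    kernel' : ∀ e z → U' e ∋ z → ∃[ a ] (σ' a ≡ just z)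
    kernel' e z h with grow-∋ (lookup (edge e) x) (U e) z h
    ... | inj₁ u = let a , p = U-kernel e z u in a , keeps a z p
    ... | inj₂ (_ , refl) = x , update-at σ x (just y)

  module Embedding (H : FinHypergraph) (2≤m : 2 ≤ FinHypergraph.m H) (q₀ r₀ : ℕ) where
    open FinHypergraph H
    open Cross m (suc r₀) 2≤m using (capture; rainbow-matching)

    -- With `M` = 2m the m exceptional sets of n / M points cover at most half of everything; `g` is
    -- the loss in `fairness` per attached point. `j₁` counts the deletions to survive, `capture`
    -- for the matching and the rest for points in use, and `P` makes them cost at most half of a
    -- link. 2^lg is at least (4g)^v. With `D` = 128m, twice k / D still fits into κ̲ / 16M, as κ̲ ≥
    -- k/2.
    M g j₁ P K lg D : ℕ
    M = 2 * m
    g = 32 * M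
    j₁ = capture + (m * (q₀ + v) + v)
    P = suc j₁ * (2 * g) ^ v
    K = 2 * P
    lg = 4 * g * v
    D = 128 * m

    1≤m : 1 ≤ m
    1≤m = ≤-trans (s≤s z≤n) 2≤m
    1≤M : 1 ≤ M
    1≤M = *-mono-≤ {1} {2} (s≤s z≤n) 1≤m
    1≤g : 1 ≤ g
    1≤g = *-mono-≤ {1} {32} (s≤s z≤n) 1≤M

    instance
      D≢0 : NonZero D
      D≢0 = >-nonZero (*-mono-≤ {1} {128} (s≤s z≤n) 1≤m)
      M≢0 : NonZero M
      M≢0 = >-nonZero 1≤M

    k-min n-min : ℕ
    k-min = D * suc lg + 2 * (q₀ + v)
    n-min = 4 * M + 16 * m + 2 * (4 * g) ^ v + (2 + 2 * (m * (q₀ + v) + v))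

    -- `G` may be any part of the link of `S`. `dense` serves `fairness`, `dense′` the matching, and
    -- `spread` bounds degrees once up to v points are attached. The expected share of a link on u +
    -- 1 points is about (κ/n)^(u + 1), so an excess of n / (K κ) is allowed.
    record Spread (k : ℕ) {n : ℕ} (F : Family n) (S : Subset n) : Set where
      κ : ℕ
      κ = k ∸ ∣ S ∣
      field
        G : Family n
        size : ∣ S ∣ ≤ q₀
        uniform : ∀ B → G B ≡ true → ∣ S ∣ + ∣ B ∣ ≡ k
        apart : ∀ B → G B ≡ true → Disjoint S B
        within : ∀ B → G B ≡ true → F (S ∪ B) ≡ true
        dense : choose n κ ≤ 2 ^ (k / D) * cnt G
        dense′ : κ ^ r₀ * choose n κ ≤ n ^ r₀ * cnt G
        spread : ∀ U u → ∣ U ∣ ≡ suc u → u ≤ v → cnt (link G U) * (K * n ^ u) ≤ κ ^ u * cnt G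

    module _ {k n : ℕ} (k-big : k-min ≤ k) (n-big : n-min * k ≤ n) (F : Family n) where

      -- A lower bound for the uniformity of every link that occurs, whatever the sizes of `S` and
      -- `U`.
      κ̲ : ℕ
      κ̲ = k ∸ (q₀ + v)

      q₀+v≤k : 2 * (q₀ + v) ≤ k
      q₀+v≤k = ≤-trans (m≤n+m (2 * (q₀ + v)) (D * suc lg)) k-big
      κ̲-half : k ≤ 2 * κ̲
      κ̲-half = +-cancelʳ-≤ (2 * (q₀ + v)) k (2 * κ̲) (≤-trans (+-monoʳ-≤ k q₀+v≤k) (≤-reflexive (trans (eq k) (trans (cong (2 *_) (sym (m∸n+n≡m {k} {q₀ + v} (≤-trans (m≤m+n (q₀ + v) (q₀ + v + 0)) q₀+v≤k)))) (*-distribˡ-+ 2 κ̲ (q₀ + v))))))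
        where
        eq : ∀ k → k + k ≡ 2 * k
        eq = solve-∀
      1≤k : 1 ≤ k
      1≤k = ≤-trans (≤-trans (*-mono-≤ {1} {D} (>-nonZero⁻¹ D) (s≤s z≤n)) (m≤m+n (D * suc lg) (2 * (q₀ + v)))) k-big
      n-part : ∀ {a} → a ≤ n-min → a * k ≤ n
      n-part h = ≤-trans (*-monoˡ-≤ k h) n-big
      4Mk≤n : 4 * M * k ≤ n
      4Mk≤n = n-part (≤-trans (m≤m+n (4 * M) (16 * m)) (≤-trans (m≤m+n _ (2 * (4 * g) ^ v)) (m≤m+n _ _)))
      16mk≤n : 16 * m * k ≤ n
      16mk≤n = n-part (≤-trans (m≤n+m (16 * m) (4 * M)) (≤-trans (m≤m+n _ (2 * (4 * g) ^ v)) (m≤m+n _ _)))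
      gk≤n : 2 * (4 * g) ^ v * k ≤ n
      gk≤n = n-part (≤-trans (m≤n+m (2 * (4 * g) ^ v) (4 * M + 16 * m)) (m≤m+n _ _))
      rest≤n : 2 + 2 * (m * (q₀ + v) + v) ≤ n
      rest≤n = ≤-trans (m≤m*n _ k {{>-nonZero 1≤k}}) (n-part (m≤n+m _ (4 * M + 16 * m + 2 * (4 * g) ^ v)))
      1≤n : 1 ≤ n
      1≤n = ≤-trans (s≤s z≤n) rest≤n
      2k≤n : 2 * k ≤ n
      2k≤n = n-part (≤-trans (m≤m+n 2 _) (m≤n+m (2 + 2 * (m * (q₀ + v) + v)) (4 * M + 16 * m + 2 * (4 * g) ^ v)))

      -- One family together with the part U of the kernel which has already been attached to it.
      module Attached {S : Subset n} (sp : Spread k F S) (U : Subset n) (u≤v : ∣ U ∣ ≤ v)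
        (big : κ̲ ^ ∣ U ∣ * cnt (Spread.G sp) ≤ (g * n) ^ ∣ U ∣ * cnt (link (Spread.G sp) U)) where
        open Spread sp

        u κL : ℕ
        u = ∣ U ∣
        κL = κ ∸ u
        L : Family n
        L = link G U

        κ≤k : κ ≤ k
        κ≤k = m∸n≤m k ∣ S ∣
        κ̲≤κL : κ̲ ≤ κL
        κ̲≤κL = ≤-trans (∸-monoʳ-≤ k (+-mono-≤ size u≤v)) (≤-reflexive (sym (∸-+-assoc k (∣ S ∣) u)))
        u≤κ : u ≤ κ
        u≤κ = ≤-trans u≤v (+-cancelʳ-≤ q₀ v κ (≤-trans (≤-reflexive (+-comm v q₀)) (≤-trans (≤-trans (≤-trans (m≤m+n (q₀ + v) (q₀ + v + 0)) q₀+v≤k)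
          (≤-reflexive (sym (m∸n+n≡m (≤-trans size (≤-trans (m≤m+n q₀ v) (≤-trans (m≤m+n (q₀ + v) (q₀ + v + 0)) q₀+v≤k))))))) (+-monoʳ-≤ κ size))))
        κ≤2κ̲ : κ ≤ 2 * κ̲
        κ≤2κ̲ = ≤-trans κ≤k κ̲-half
        16M≤κ̲ : 16 * M ≤ κ̲
        16M≤κ̲ = *-cancelˡ-pos 2 (s≤s z≤n) (≤-trans (≤-trans (≤-trans (≤-reflexive (eq m)) (*-monoˡ-≤ m {64} {128} (m≤m+n 64 64))) (m≤m*n D (suc lg))) (≤-trans (≤-trans (m≤m+n (D * suc lg) (2 * (q₀ + v))) k-big) κ̲-half))
          where
          eq : ∀ m → 2 * (16 * (2 * m)) ≡ 64 * m
          eq = solve-∀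

        L-uniform : ∀ B → L B ≡ true → ∣ B ∣ ≡ κL
        L-uniform B h = let d , h' = ∧-true {disj U B} h in
          trans (sym (m+n∸m≡n (∣ S ∣ + u) ∣ B ∣)) (trans (cong (_∸ (∣ S ∣ + u)) (trans (+-assoc (∣ S ∣) u (∣ B ∣))
            (trans (cong (∣ S ∣ +_) (sym (∪-disjoint-size U B (disj-sound U B d)))) (uniform (U ∪ B) h')))) (sym (∸-+-assoc k (∣ S ∣) u)))

        4gᵘ≤ : (4 * g) ^ u ≤ (4 * g) ^ v
        4gᵘ≤ = ^-monoʳ-≤ (4 * g) {{>-nonZero (*-mono-≤ {1} {4} (s≤s z≤n) 1≤g)}} u≤v

        L-dense : choose n κL ≤ 2 ^ (_/_ κL (16 * M) {{m*n≢0 16 M}}) * cnt L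
        L-dense = begin
          choose n κL ≡⟨ *-identityˡ _ ⟨
          1 * choose n κL ≤⟨ descend n κ κ̲ u g 1 (2 ^ (k / D)) (cnt G) (cnt L) 1≤n (≤-trans (*-monoʳ-≤ 2 κ≤k) 2k≤n) u≤κ κ≤2κ̲ big
            (≤-trans (≤-reflexive (*-identityˡ _)) dense) ⟩
          (4 * g) ^ u * 2 ^ (k / D) * cnt L ≤⟨ *-monoˡ-≤ (cnt L) (*-monoˡ-≤ (2 ^ (k / D)) (≤-trans 4gᵘ≤ (a^v≤2^av (4 * g) v))) ⟩
          2 ^ lg * 2 ^ (k / D) * cnt L ≡⟨ cong (_* cnt L) (^-distribˡ-+-* 2 lg (k / D)) ⟨
          2 ^ (lg + k / D) * cnt L ≤⟨ *-monoˡ-≤ (cnt L) (^-monoʳ-≤ 2 exponent) ⟩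
          2 ^ (κL / (16 * M)) * cnt L ∎
          where
          open ≤-Reasoning
          instance
            16M≢0 : NonZero (16 * M)
            16M≢0 = m*n≢0 16 M
          a = k / D
          lg≤a : lg ≤ a
          lg≤a = ≤-trans (n≤1+n lg) (subst (_≤ a) (m*n/n≡m (suc lg) D) (/-monoˡ-≤ D (≤-trans (≤-reflexive (*-comm (suc lg) D)) (≤-trans (m≤m+n (D * suc lg) (2 * (q₀ + v))) k-big))))
          exponent : lg + a ≤ κL / (16 * M)
          exponent = ≤-trans (+-monoˡ-≤ a lg≤a) (subst (_≤ κL / (16 * M)) (m*n/n≡m (a + a) (16 * M)) (/-monoˡ-≤ (16 * M)
            (≤-trans (*-cancelˡ-pos 2 (s≤s z≤n) (≤-trans (≤-reflexive (eq a m)) (≤-trans (m/n*n≤m k D) κ̲-half))) κ̲≤κL)))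
            where
            eq : ∀ a m → 2 * ((a + a) * (16 * (2 * m))) ≡ a * (128 * m)
            eq = solve-∀

        bad : Subset n
        bad = select (λ y → deg L y * (32 * M * n) ≤ᵇ κL * cnt L)

        bad-small : ∣ bad ∣ * M ≤ n
        bad-small = fairness M (≤-trans 16M≤κ̲ κ̲≤κL) (≤-trans (*-monoʳ-≤ (4 * M) (≤-trans (m∸n≤m κ u) κ≤k)) 4Mk≤n) L L-uniform L-dense bad
          (λ y h → ≤ᵇ⇒≤ _ _ (subst Data.Bool.T (sym (select-∋ (λ y → deg L y * (32 * M * n) ≤ᵇ κL * cnt L) y h)) _))

        -- A point outside `bad` has degree at least κL / (g n) times the size of the link, which is
        -- the one further factor that the invariant `big` needs.
        big-step : ∀ y → (bad ∋ y → ⊥) → κ̲ ^ suc u * cnt G ≤ (g * n) ^ suc u * cnt (link G (U ∪ single y))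
        big-step y fair = begin
          κ̲ * κ̲ ^ u * cnt G ≡⟨ *-assoc κ̲ (κ̲ ^ u) (cnt G) ⟩
          κ̲ * (κ̲ ^ u * cnt G) ≤⟨ *-mono-≤ κ̲≤κL big ⟩
          κL * ((g * n) ^ u * cnt L) ≡⟨ eq κL ((g * n) ^ u) (cnt L) ⟩
          (g * n) ^ u * (κL * cnt L) ≤⟨ *-monoʳ-≤ ((g * n) ^ u) (<⇒≤ (≰⇒> (λ h → fair (∋-select (λ y → deg L y * (32 * M * n) ≤ᵇ κL * cnt L) y (T-true (≤⇒≤ᵇ h)))))) ⟩
          (g * n) ^ u * (deg L y * (g * n)) ≤⟨ *-monoʳ-≤ ((g * n) ^ u) (*-monoˡ-≤ (g * n) (deg-link G U y)) ⟩
          (g * n) ^ u * (cnt (link G (U ∪ single y)) * (g * n)) ≡⟨ eq₂ ((g * n) ^ u) (cnt (link G (U ∪ single y))) (g * n) ⟩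
          (g * n) ^ suc u * cnt (link G (U ∪ single y)) ∎
          where
          open ≤-Reasoning
          eq : ∀ a b c → a * (b * c) ≡ b * (a * c)
          eq = solve-∀
          eq₂ : ∀ a b c → a * (b * c) ≡ c * a * b
          eq₂ = solve-∀

        -- `spread` for `U ∪ single x` bounds the degree by (κ/n)^u / K of `G`, and `big` bounds the
        -- link of `U` below by (κ̲ / g n)^u of `G`. The powers of n cancel, so a constant fraction
        -- remains. For x in `U` the degree is 0.
        L-deg : ∀ x → deg L x * K ≤ (2 * g) ^ v * cnt L
        L-deg x with bool-case (lookup U x)
        ... | inj₁ x∈U = ≤-trans (*-monoˡ-≤ K (≤-trans (cnt-mono none) (≤-reflexive (cnt-false n)))) z≤n
          where
          none : (λ A → lookup A x ∧ L A) ⇒ (λ _ → false)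
          none A h = let a , h' = ∧-true {lookup A x} h in ⊥-elim (disj-sound U A (proj₁ (∧-true {disj U A} h')) x x∈U a)
        ... | inj₂ x∉U = *-cancelʳ-pos (n ^ u) (pow-pos u 1≤n) (begin
          deg L x * K * n ^ u ≤⟨ *-monoˡ-≤ (n ^ u) (*-monoˡ-≤ K (deg-link G U x)) ⟩
          cnt (link G (U ∪ single x)) * K * n ^ u ≡⟨ *-assoc (cnt (link G (U ∪ single x))) K (n ^ u) ⟩
          cnt (link G (U ∪ single x)) * (K * n ^ u) ≤⟨ spread (U ∪ single x) u sizes u≤v ⟩
          κ ^ u * cnt G ≤⟨ *-monoˡ-≤ (cnt G) (^-monoˡ-≤ u κ≤2κ̲) ⟩
          (2 * κ̲) ^ u * cnt G ≡⟨ trans (cong (_* cnt G) (^-distribʳ-* u 2 κ̲)) (*-assoc (2 ^ u) (κ̲ ^ u) (cnt G)) ⟩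
          2 ^ u * (κ̲ ^ u * cnt G) ≤⟨ *-monoʳ-≤ (2 ^ u) big ⟩
          2 ^ u * ((g * n) ^ u * cnt L) ≡⟨ trans (cong (λ z → 2 ^ u * (z * cnt L)) (^-distribʳ-* u g n)) (eq (2 ^ u) (g ^ u) (n ^ u) (cnt L)) ⟩
          2 ^ u * g ^ u * cnt L * n ^ u ≡⟨ cong (λ z → z * cnt L * n ^ u) (^-distribʳ-* u 2 g) ⟨
          (2 * g) ^ u * cnt L * n ^ u ≤⟨ *-monoˡ-≤ (n ^ u) (*-monoˡ-≤ (cnt L) (^-monoʳ-≤ (2 * g) {{>-nonZero (*-mono-≤ {1} {2} (s≤s z≤n) 1≤g)}} u≤v)) ⟩
          (2 * g) ^ v * cnt L * n ^ u ∎)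
          where
          open ≤-Reasoning
          eq : ∀ a b c d → a * (b * c * d) ≡ a * b * d * c
          eq = solve-∀
          sizes : ∣ U ∪ single x ∣ ≡ suc u
          sizes = trans (∪-disjoint-size U (single x) (λ z p q → ∌ {A = U} x∉U (subst (U ∋_) (single-≡ x z q) p)))
            (trans (cong (u +_) (single-size x)) (+-comm u 1))

        -- Deleting `J` loses at most half of the link by `L-deg`. The constant 2 (4g)^v is absorbed
        -- by one additional factor k/n, hence the exponent `suc r₀`.
        L-robust : ∀ J → ∣ J ∣ ≤ j₁ → κL ^ suc r₀ * choose n κL ≤ n ^ suc r₀ * cnt (λ A → L A ∧ disj A J)
        L-robust J J≤ = begin
          κL ^ suc r₀ * choose n κL ≤⟨ *-monoˡ-≤ (choose n κL) (^-monoˡ-≤ (suc r₀) (m∸n≤m κ u)) ⟩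
          κ * κ ^ r₀ * choose n κL ≡⟨ *-assoc κ (κ ^ r₀) _ ⟩
          κ * (κ ^ r₀ * choose n κL) ≤⟨ *-mono-≤ κ≤k (descend n κ κ̲ u g (κ ^ r₀) (n ^ r₀) (cnt G) (cnt L) 1≤n (≤-trans (*-monoʳ-≤ 2 κ≤k) 2k≤n) u≤κ κ≤2κ̲ big dense′) ⟩
          k * ((4 * g) ^ u * n ^ r₀ * cnt L) ≤⟨ *-monoʳ-≤ k (*-mono-≤ (*-monoˡ-≤ (n ^ r₀) 4gᵘ≤) half) ⟩
          k * ((4 * g) ^ v * n ^ r₀ * (2 * avoiding)) ≡⟨ eq k ((4 * g) ^ v) (n ^ r₀) avoiding ⟩
          2 * (4 * g) ^ v * k * n ^ r₀ * avoiding ≤⟨ *-monoˡ-≤ avoiding (*-monoˡ-≤ (n ^ r₀) gk≤n) ⟩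
          n ^ suc r₀ * avoiding ∎
          where
          open ≤-Reasoning
          avoiding = cnt (λ A → L A ∧ disj A J)
          eq : ∀ k a b c → k * (a * b * (2 * c)) ≡ 2 * a * k * b * c
          eq = solve-∀
          1≤P : 1 ≤ P
          1≤P = *-mono-≤ {1} {suc j₁} (s≤s z≤n) (pow-pos v (*-mono-≤ {1} {2} (s≤s z≤n) 1≤g))
          half : cnt L ≤ 2 * avoiding
          half = *-cancelʳ-pos P 1≤P (+-cancelʳ-≤ (P * cnt L) _ _ (begin
            cnt L * P + P * cnt L ≡⟨ eq₁ (cnt L) P ⟩
            cnt L * K ≤⟨ avoid-cnt L J K ((2 * g) ^ v * cnt L) (λ x _ → L-deg x) ⟩
            avoiding * K + ∣ J ∣ * ((2 * g) ^ v * cnt L) ≤⟨ +-monoʳ-≤ (avoiding * K) (*-monoˡ-≤ ((2 * g) ^ v * cnt L) (m≤n⇒m≤1+n J≤)) ⟩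
            avoiding * K + suc j₁ * ((2 * g) ^ v * cnt L) ≡⟨ cong₂ _+_ (eq₂ avoiding P) (sym (*-assoc (suc j₁) ((2 * g) ^ v) (cnt L))) ⟩
            2 * avoiding * P + P * cnt L ∎))
            where
            eq₁ : ∀ c P → c * P + P * c ≡ c * (2 * P)
            eq₁ = solve-∀
            eq₂ : ∀ a P → a * (2 * P) ≡ 2 * a * P
            eq₂ = solve-∀

      -- The state of the vertex-by-vertex placement: `σ` is the part of the kernel placed so far,
      -- and `U e` the points attached to petal e on top of `S e`. `inside` and `covers` together
      -- say that petal e holds exactly the placed vertices of edge e.
      record Partial {S : Fin m → Subset n} (sp : ∀ e → Spread k F (S e)) (t : ℕ) : Set where
        field
          σ : Fin v → Maybe (Fin n)
          U : Fin m → Subset n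
          σ-injective : ∀ x x' y → σ x ≡ just y → σ x' ≡ just y → x ≡ x'
          inside : ∀ e x y → σ x ≡ just y → S e ∪ U e ∋ y → edge e ∋ x
          covers : ∀ e x y → σ x ≡ just y → edge e ∋ x → S e ∪ U e ∋ y
          U-kernel : ∀ e z → U e ∋ z → ∃[ x ] (σ x ≡ just z)
          meet : ∀ e e' z → (e ≡ e' → ⊥) → S e ∋ z → S e' ∋ z → ∃[ x ] (σ x ≡ just z)
          U-size : ∀ e → ∣ U e ∣ ≤ t
          large : ∀ e → κ̲ ^ ∣ U e ∣ * cnt (Spread.G (sp e)) ≤ (g * n) ^ ∣ U e ∣ * cnt (link (Spread.G (sp e)) (U e))

      module _ {S : Fin m → Subset n} (sp : ∀ e → Spread k F (S e)) where

        maybe-single : Maybe (Fin n) → Subset n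
        maybe-single (just y) = single y
        maybe-single nothing = ∅

        maybe-single-size : ∀ y → ∣ maybe-single y ∣ ≤ 1
        maybe-single-size (just y) = ≤-reflexive (single-size y)
        maybe-single-size nothing = ≤-trans (≤-reflexive (∅-size n)) z≤n

        module _ {t : ℕ} (st : Partial sp t) (t≤v : t ≤ v) where
          open Partial st

          used : Subset n
          used = ⋃ (λ e → S e ∪ U e) ∪ ⋃ (λ x → maybe-single (σ x))

          used-size : ∣ used ∣ ≤ m * (q₀ + v) + v
          used-size = ≤-trans (∪-size (⋃ (λ e → S e ∪ U e)) (⋃ (λ x → maybe-single (σ x))))
            (+-mono-≤ (⋃-size (q₀ + v) (λ e → S e ∪ U e) (λ e → ≤-trans (∪-size (S e) (U e)) (+-mono-≤ (Spread.size (sp e)) (≤-trans (U-size e) t≤v))))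
              (≤-trans (⋃-size 1 (λ x → maybe-single (σ x)) (λ x → maybe-single-size (σ x))) (≤-reflexive (*-identityʳ v))))

          used-SU : ∀ e z → S e ∪ U e ∋ z → used ∋ z
          used-SU e z h = ∪-∋ˡ (⋃ (λ e → S e ∪ U e)) (⋃ (λ x → maybe-single (σ x))) z (∋-⋃ (λ e → S e ∪ U e) e z h)

          used-σ : ∀ x z → σ x ≡ just z → used ∋ z
          used-σ x z h = ∪-∋ʳ (⋃ (λ e → S e ∪ U e)) (⋃ (λ x → maybe-single (σ x))) z
            (∋-⋃ (λ x → maybe-single (σ x)) x z (subst (λ w → maybe-single w ∋ z) (sym h) (single-∋ z)))

          module At e = Attached (sp e) (U e) (≤-trans (U-size e) t≤v) (large e)

          extend : ∀ x → σ x ≡ nothing → Σ (Partial sp (suc t)) λ st' → (∃[ y ] Partial.σ st' x ≡ just y) × (∀ z y → σ z ≡ just y → Partial.σ st' z ≡ just y)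
          extend x σx = st' , (y , update-at σ x (just y)) , keeps
            where
            -- The bad points of all m families are at most n/2 in number because M = 2m, and the
            -- points in use are fewer than n/2, so a point remains which is new and fair to every
            -- family.
            forbidden : Subset n
            forbidden = ⋃ (λ e → At.bad e) ∪ used
            forbidden-size : ∣ forbidden ∣ < n
            forbidden-size = *-cancelˡ-< 2 _ _ (*-cancelˡ-< m _ _ bound)
              where
              b = ∣ ⋃ (λ e → At.bad e) ∣
              w = m * (q₀ + v) + v
              eq₁ : ∀ m b w → suc (m * (2 * (b + w))) ≡ b * (2 * m) + (1 + m * (2 * w))
              eq₁ = solve-∀
              bound : suc (m * (2 * ∣ forbidden ∣)) ≤ m * (2 * n)
              bound = begin
                suc (m * (2 * ∣ forbidden ∣)) ≤⟨ s≤s (*-monoʳ-≤ m (*-monoʳ-≤ 2 (≤-trans (∪-size (⋃ (λ e → At.bad e)) used) (+-monoʳ-≤ b used-size)))) ⟩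
                suc (m * (2 * (b + w))) ≡⟨ eq₁ m b w ⟩
                b * (2 * m) + (1 + m * (2 * w)) ≤⟨ +-mono-≤ (⊔-size-sum M (λ e → At.bad e) (λ e → At.bad-small e)) (+-monoˡ-≤ (m * (2 * w)) 1≤m) ⟩
                m * n + (m + m * (2 * w)) ≤⟨ +-monoʳ-≤ (m * n) (≤-trans (m≤n+m _ m) (≤-reflexive (eq₃ m w))) ⟩
                m * n + m * (2 + 2 * w) ≤⟨ +-monoʳ-≤ (m * n) (*-monoʳ-≤ m rest≤n) ⟩
                m * n + m * n ≡⟨ eq₄ m n ⟩
                m * (2 * n) ∎
                where
                open ≤-Reasoning
                eq₃ : ∀ m w → m + (m + m * (2 * w)) ≡ m * (2 + 2 * w)
                eq₃ = solve-∀
                eq₄ : ∀ m n → m * n + m * n ≡ m * (2 * n)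
                eq₄ = solve-∀
            choice = outside forbidden forbidden-size
            y = proj₁ choice
            y∉forbidden : forbidden ∋ y → ⊥
            y∉forbidden = ∌ {A = forbidden} (proj₂ choice)
            y∉used : used ∋ y → ⊥
            y∉used h = y∉forbidden (∪-∋ʳ (⋃ (λ e → At.bad e)) used y h)
            y-fair : ∀ e → At.bad e ∋ y → ⊥
            y-fair e h = y∉forbidden (∪-∋ˡ (⋃ (λ e → At.bad e)) used y (∋-⋃ (λ e → At.bad e) e y h))
            y∉SU : ∀ e → S e ∪ U e ∋ y → ⊥
            y∉SU e h = y∉used (used-SU e y h)
            open Assign edge S U σ σ-injective inside covers U-kernel x σx y y∉SU (λ a h → y∉used (used-σ a y h))
            y∉U : ∀ e → Disjoint (U e) (single y)
            y∉U e z p q = y∉SU e (∪-∋ʳ (S e) (U e) y (subst (U e ∋_) (single-≡ y z q) p))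
            sizes : ∀ e b → ∣ grow b (U e) ∣ ≤ suc t
            sizes e false = m≤n⇒m≤1+n (U-size e)
            sizes e true = ≤-trans (∪-size (U e) (single y)) (≤-trans (+-mono-≤ (U-size e) (≤-reflexive (single-size y))) (≤-reflexive (+-comm t 1)))
            large' : ∀ e b → κ̲ ^ ∣ grow b (U e) ∣ * cnt (Spread.G (sp e)) ≤ (g * n) ^ ∣ grow b (U e) ∣ * cnt (link (Spread.G (sp e)) (grow b (U e)))
            large' e false = large e
            large' e true = subst (λ z → κ̲ ^ z * cnt (Spread.G (sp e)) ≤ (g * n) ^ z * cnt (link (Spread.G (sp e)) (U e ∪ single y)))
              (sym (trans (∪-disjoint-size (U e) (single y) (y∉U e)) (trans (cong (∣ U e ∣ +_) (single-size y)) (+-comm (∣ U e ∣) 1))))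
              (At.big-step e y (y-fair e))
            st' : Partial sp (suc t)
            st' = record
              { σ = σ' ; U = U' ; σ-injective = inj' ; inside = inside' ; covers = covers' ; U-kernel = kernel'
              ; meet = λ e e' z e≢e' p q → let a , r = meet e e' z e≢e' p q in a , keeps a z r
              ; U-size = λ e → sizes e (lookup (edge e) x) ; large = λ e → large' e (lookup (edge e) x) }

        record Completion {t : ℕ} (xs : List (Fin v)) (st : Partial sp t) : Set where
          constructor completed
          field
            {steps} : ℕ
            steps≤v : steps ≤ v
            final : Partial sp steps
            total : ∀ x → x ∈ xs → ∃[ y ] Partial.σ final x ≡ just y
            keeps : ∀ z y → Partial.σ st z ≡ just y → Partial.σ final z ≡ just y

        complete : ∀ {t} (xs : List (Fin v)) (st : Partial sp t) → length xs + t ≤ v → Completion xs st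
        complete List.[] st h = completed h st (λ x ()) (λ z y p → p)
        complete {t} (x List.∷ xs) st h = go (Partial.σ st x) refl
          where
          go : ∀ w → Partial.σ st x ≡ w → Completion (x List.∷ xs) st
          go (just y) σx = completed steps≤v final (λ { .x (here refl) → y , keeps x y σx ; z (there p) → total z p }) keeps
            where open Completion (complete xs st (≤-trans (n≤1+n _) h))
          go nothing σx = completed C.steps≤v C.final
            (λ { .x (here refl) → proj₁ (proj₁ (proj₂ ext)) , C.keeps x _ (proj₂ (proj₁ (proj₂ ext))) ; z (there p) → C.total z p })
            (λ z w p → C.keeps z w (proj₂ (proj₂ ext) z w p))
            where
            ext = extend st (≤-trans (m≤n+m t (suc (length xs))) h) x σx
            module C = Completion (complete xs (proj₁ ext) (≤-trans (≤-reflexive (+-suc (length xs) t)) h))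

        module Finish {t : ℕ} (t≤v : t ≤ v) (st : Partial sp t) (total : ∀ x → ∃[ y ] Partial.σ st x ≡ just y) where
          open Partial st
          module At′ e = Attached (sp e) (U e) (≤-trans (U-size e) t≤v) (large e)

          blocked : Subset n
          blocked = used st t≤v
          L′ : Fin m → Family n
          L′ e A = At′.L e A ∧ disj A blocked

          -- All points in use are deleted beforehand, so that the matched sets meet neither the
          -- kernel nor one another. `j₁` leaves `capture` deletions to the matching theorem itself.
          matching : Σ (Fin m → Subset n) λ B → (∀ e → L′ e (B e) ≡ true) × PairwiseDisjoint B
          matching = rainbow-matching (λ e → At′.κL e) L′
            (λ e → ≤-trans (*-cancelˡ-pos 2 {1} (s≤s z≤n) (≤-trans (q2) κ̲-half)) (At′.κ̲≤κL e))
            (λ e → ≤-trans (*-monoʳ-≤ (16 * m) (≤-trans (m∸n≤m (Spread.κ (sp e)) (∣ U e ∣)) (At′.κ≤k e))) 16mk≤n)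
            (λ e A h → At′.L-uniform e A (proj₁ (∧-true {At′.L e A} h)))
            (λ e J J≤ → ≤-trans (At′.L-robust e (blocked ∪ J) (≤-trans (∪-size blocked J) (≤-trans (+-mono-≤ (used-size st t≤v) J≤) (≤-reflexive (+-comm _ capture)))))
              (*-monoʳ-≤ (n ^ suc r₀) (cnt-mono (split e J))))
            where
            q2 : 2 * 1 ≤ k
            q2 = ≤-trans (≤-trans (≤-trans (m≤m+n 2 126) (m≤m*n 128 m {{>-nonZero 1≤m}})) (≤-trans (m≤m*n D (suc lg)) (m≤m+n (D * suc lg) (2 * (q₀ + v))))) k-big
            split : ∀ e J → (λ A → At′.L e A ∧ disj A (blocked ∪ J)) ⇒ (λ A → L′ e A ∧ disj A J)
            split e J A h = let l , d = ∧-true {At′.L e A} h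
                                avoid = disj-sound A (blocked ∪ J) d in
              ∧-intro (∧-intro l (disj-complete A blocked (λ x p q → avoid x p (∪-∋ˡ blocked J x q)))) (disj-complete A J (λ x p q → avoid x p (∪-∋ʳ blocked J x q)))

          B : Fin m → Subset n
          B = proj₁ matching
          φ : Fin v → Fin n
          φ x = proj₁ (total x)
          σφ : ∀ x → σ x ≡ just (φ x)
          σφ x = proj₂ (total x)
          A : Fin m → Subset n
          A e = S e ∪ (U e ∪ B e)
          B-facts : ∀ e → (Disjoint (U e) (B e) × Spread.G (sp e) (U e ∪ B e) ≡ true) × Disjoint (B e) blocked
          B-facts e = let h , d = ∧-true {At′.L e (B e)} (proj₁ (proj₂ matching) e)
                          d' , g' = ∧-true {disj (U e) (B e)} h in
            (disj-sound (U e) (B e) d' , g') , disj-sound (B e) blocked d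
          A-cases : ∀ e z → A e ∋ z → (S e ∪ U e ∋ z) ⊎ (B e ∋ z)
          A-cases e z h = go (∪-∋ (S e) (U e ∪ B e) z h)
            where
            go₂ : (U e ∋ z) ⊎ (B e ∋ z) → (S e ∪ U e ∋ z) ⊎ (B e ∋ z)
            go₂ (inj₁ u) = inj₁ (∪-∋ʳ (S e) (U e) z u)
            go₂ (inj₂ b) = inj₂ b
            go : (S e ∋ z) ⊎ (U e ∪ B e ∋ z) → (S e ∪ U e ∋ z) ⊎ (B e ∋ z)
            go (inj₁ s) = inj₁ (∪-∋ˡ (S e) (U e) z s)
            go (inj₂ ub) = go₂ (∪-∋ (U e) (B e) z ub)
          SU⊑A : ∀ e z → S e ∪ U e ∋ z → A e ∋ z
          SU⊑A e z h = go (∪-∋ (S e) (U e) z h)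
            where
            go : (S e ∋ z) ⊎ (U e ∋ z) → A e ∋ z
            go (inj₁ s) = ∪-∋ˡ (S e) (U e ∪ B e) z s
            go (inj₂ u) = ∪-∋ʳ (S e) (U e ∪ B e) z (∪-∋ˡ (U e) (B e) z u)

          kernel : Kernel H k F
          kernel = record
            { φ = φ
            ; φ-injective = λ x y h → σ-injective x y (φ x) (σφ x) (trans (σφ y) (cong just (sym h)))
            ; A = A
            ; A∈F = λ e → Spread.within (sp e) (U e ∪ B e) (proj₂ (proj₁ (B-facts e)))
            ; A-size = λ e → trans (∪-disjoint-size (S e) (U e ∪ B e) (Spread.apart (sp e) (U e ∪ B e) (proj₂ (proj₁ (B-facts e))))) (Spread.uniform (sp e) (U e ∪ B e) (proj₂ (proj₁ (B-facts e))))
            ; φ∈A = λ e x h → SU⊑A e (φ x) (covers e x (φ x) (σφ x) h)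
            ; A∋φ = λ e x h → φ-inside e x (A-cases e (φ x) h)
            ; shared = λ e e' z e≢e' p q → in-kernel e e' z e≢e' (A-cases e z p) (A-cases e' z q) }
            where
            φ-inside : ∀ e x → (S e ∪ U e ∋ φ x) ⊎ (B e ∋ φ x) → edge e ∋ x
            φ-inside e x (inj₁ h) = inside e x (φ x) (σφ x) h
            φ-inside e x (inj₂ b) = ⊥-elim (proj₂ (B-facts e) (φ x) b (used-σ st t≤v x (φ x) (σφ x)))
            to-φ : ∀ z → ∃[ x ] (σ x ≡ just z) → ∃[ x ] (φ x ≡ z)
            to-φ z (x , p) = x , just-injective (trans (sym (σφ x)) p)
            meets : ∀ e e' z → (e ≡ e' → ⊥) → (S e ∋ z) ⊎ (U e ∋ z) → (S e' ∋ z) ⊎ (U e' ∋ z) → ∃[ x ] (σ x ≡ just z)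
            meets e e' z e≢e' (inj₁ s) (inj₁ s') = meet e e' z e≢e' s s'
            meets e e' z e≢e' (inj₂ u) _ = U-kernel e z u
            meets e e' z e≢e' _ (inj₂ u) = U-kernel e' z u
            in-kernel : ∀ e e' z → (e ≡ e' → ⊥) → (S e ∪ U e ∋ z) ⊎ (B e ∋ z) → (S e' ∪ U e' ∋ z) ⊎ (B e' ∋ z) → ∃[ x ] (φ x ≡ z)
            in-kernel e e' z e≢e' (inj₁ h) (inj₁ h') = to-φ z (meets e e' z e≢e' (∪-∋ (S e) (U e) z h) (∪-∋ (S e') (U e') z h'))
            in-kernel e e' z e≢e' (inj₂ b) (inj₂ b') = ⊥-elim (proj₂ (proj₂ matching) e e' e≢e' z b b')
            in-kernel e e' z e≢e' (inj₁ h) (inj₂ b') = ⊥-elim (proj₂ (B-facts e') z b' (used-SU st t≤v e z h))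
            in-kernel e e' z e≢e' (inj₂ b) (inj₁ h') = ⊥-elim (proj₂ (B-facts e) z b (used-SU st t≤v e' z h'))

      -- The sets `S e` are required to look like traces of the edges on the vertices that `σ` has
      -- placed. The other vertices are then placed fairly, and a matching in the remaining links
      -- completes the edges.
      spread-kernel : (S : Fin m → Subset n) (sp : ∀ e → Spread k F (S e)) (σ : Fin v → Maybe (Fin n)) →
        (∀ x x' y → σ x ≡ just y → σ x' ≡ just y → x ≡ x') →
        (∀ e x y → σ x ≡ just y → S e ∋ y → edge e ∋ x) → (∀ e x y → σ x ≡ just y → edge e ∋ x → S e ∋ y) →
        (∀ e e' z → (e ≡ e' → ⊥) → S e ∋ z → S e' ∋ z → ∃[ x ] (σ x ≡ just z)) → Kernel H k F
      spread-kernel S sp σ σ-injective inside covers meet = Finish.kernel sp steps≤v final (λ x → total x (∈-allFin x))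
        where
        G₀ : Fin m → Family n
        G₀ e = Spread.G (sp e)
        S∪∅ : ∀ e z → S e ∪ ∅ ∋ z → S e ∋ z
        S∪∅ e z h = go (∪-∋ (S e) ∅ z h)
          where
          go : (S e ∋ z) ⊎ (∅ ∋ z) → S e ∋ z
          go (inj₁ s) = s
          go (inj₂ n) = ⊥-elim (∅-∌ z n)
        ∅⇒ : ∀ e A → G₀ e A ≡ true → link (G₀ e) ∅ A ≡ true
        ∅⇒ e A h = ∧-intro (disj-complete ∅ A (λ x p _ → ∅-∌ x p)) (subst (λ z → G₀ e z ≡ true) (∅∪ A) h)
          where
          ∅∪ : ∀ {n} (A : Subset n) → A ≡ ∅ ∪ A
          ∅∪ [] = refl
          ∅∪ (a ∷ A) = cong (a ∷_) (∅∪ A)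
        start : Partial sp 0
        start = record
          { σ = σ ; U = λ _ → ∅ ; σ-injective = σ-injective
          ; inside = λ e x y p h → inside e x y p (S∪∅ e y h)
          ; covers = λ e x y p h → ∪-∋ˡ (S e) ∅ y (covers e x y p h)
          ; U-kernel = λ e z h → ⊥-elim (∅-∌ z h)
          ; meet = meet
          ; U-size = λ e → ≤-reflexive (∅-size n)
          ; large = λ e → subst (λ u → κ̲ ^ u * cnt (G₀ e) ≤ (g * n) ^ u * cnt (link (G₀ e) ∅)) (sym (∅-size n)) (*-monoʳ-≤ 1 (cnt-mono (∅⇒ e))) }
        open Completion (complete sp (allFin v) start (≤-reflexive (trans (+-identityʳ _) (length-tabulate (λ x → x)))))

-- Blocking trees and the juntas they produce.

module Tree where
  open import Defs using (Family; FinHypergraph)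
  open Count
  open Fair
  open Sets
  open import Data.Nat
  open import Data.Nat.Properties
  open import Data.Nat.Tactic.RingSolver using (solve-∀)
  open import Data.Bool using (Bool; true; false; not; _∧_; _∨_; if_then_else_)
  open import Data.Fin using (Fin; zero; suc; toℕ; fromℕ<; inject≤)
  open import Data.Fin.Properties using (toℕ-injective; toℕ-fromℕ<; fromℕ<-injective; toℕ<n; toℕ-inject≤; fromℕ<-toℕ)
  open import Data.Fin.Subset using (Subset; ∣_∣; _∪_; _∩_)
  open import Data.Vec using ([]; _∷_; lookup; tabulate)
  open import Data.Vec.Properties using (lookup∘tabulate; lookup-zipWith)
  open import Data.List as List using (List; length; allFin; concatMap; map)
  open import Data.List.Properties using (length-tabulate; length-map; length-++)
  open import Data.List.Membership.Propositional using (_∈_)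
  open import Data.List.Membership.Propositional.Properties using (∈-allFin; ∈-map⁺; ∈-map⁻; ∈-++⁺ˡ; ∈-++⁺ʳ; ∈-++⁻)
  open import Data.List.Relation.Unary.Any using (here; there)
  open import Data.Maybe using (Maybe; just; nothing)
  open import Data.Maybe.Properties using (just-injective)
  open import Data.Product using (_×_; _,_; Σ; ∃-syntax; proj₁; proj₂)
  open import Data.Sum using (_⊎_; inj₁; inj₂)
  open import Data.Empty using (⊥; ⊥-elim)
  open import Function using (_∘_)
  open import Relation.Nullary using (yes; no)
  open import Relation.Binary.PropositionalEquality hiding (J)

  any : ∀ {n} → List (Subset n) → (Subset n → Bool) → Bool
  any List.[] p = false
  any (W List.∷ Ws) p = p W ∨ any Ws p

  any-∈ : ∀ {n} (Ws : List (Subset n)) p → any Ws p ≡ true → ∃[ W ] (W ∈ Ws × p W ≡ true)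
  any-∈ (W List.∷ Ws) p h with ∨-true {p W} h
  ... | inj₁ k = W , here refl , k
  ... | inj₂ k = let V , i , l = any-∈ Ws p k in V , there i , l

  ∈-any : ∀ {n} (Ws : List (Subset n)) p W → W ∈ Ws → p W ≡ true → any Ws p ≡ true
  ∈-any (V List.∷ Ws) p W (here refl) h = ∨-left _ h
  ∈-any (V List.∷ Ws) p W (there i) h = ∨-right (p V) (∈-any Ws p W i h)

  cnt-any : ∀ {n} (F : Family n) (Ws : List (Subset n)) (p : Subset n → Subset n → Bool) c →
    (∀ W → W ∈ Ws → cnt (λ A → p W A ∧ F A) ≤ c) → cnt (λ A → any Ws (λ W → p W A) ∧ F A) ≤ length Ws * c
  cnt-any {n} F List.[] p c h = ≤-reflexive (cnt-false n)
  cnt-any F (W List.∷ Ws) p c h = ≤-trans (cnt-cover _ (λ A → p W A ∧ F A) (λ A → any Ws (λ W → p W A) ∧ F A) split)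
    (+-mono-≤ (h W (here refl)) (cnt-any F Ws p c (λ V i → h V (there i))))
    where
    split : ∀ A → ((p W A ∨ any Ws (λ W → p W A)) ∧ F A) ≡ true → ((p W A ∧ F A) ≡ true) ⊎ ((any Ws (λ W → p W A) ∧ F A) ≡ true)
    split A h with p W A
    ... | true = inj₁ h
    ... | false = inj₂ h

  keep : ∀ {n} → (Subset n → Bool) → List (Subset n) → List (Subset n)
  keep p List.[] = List.[]
  keep p (W List.∷ Ws) = if p W then W List.∷ keep p Ws else keep p Ws

  keep-∈ : ∀ {n} (p : Subset n → Bool) Ws W → W ∈ keep p Ws → W ∈ Ws × p W ≡ true
  keep-∈ p (V List.∷ Ws) W h with p V in e
  ... | false = let i , q = keep-∈ p Ws W h in there i , q
  keep-∈ p (V List.∷ Ws) .V (here refl) | true = here refl , e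
  keep-∈ p (V List.∷ Ws) W (there h) | true = let i , q = keep-∈ p Ws W h in there i , q

  ∈-keep : ∀ {n} (p : Subset n → Bool) Ws W → W ∈ Ws → p W ≡ true → W ∈ keep p Ws
  ∈-keep p (V List.∷ Ws) .V (here refl) h rewrite h = here refl
  ∈-keep p (V List.∷ Ws) W (there i) h with p V
  ... | true = there (∈-keep p Ws W i h)
  ... | false = ∈-keep p Ws W i h

  keep-length : ∀ {n} (p : Subset n → Bool) Ws → length (keep p Ws) ≤ length Ws
  keep-length p List.[] = z≤n
  keep-length p (V List.∷ Ws) with p V
  ... | true = s≤s (keep-length p Ws)
  ... | false = m≤n⇒m≤1+n (keep-length p Ws)

  elements : ∀ {n} → Subset n → List (Fin n)
  elements X = map (enum X) (allFin ∣ X ∣)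

  ∈-elements : ∀ {n} (X : Subset n) z → X ∋ z → z ∈ elements X
  ∈-elements X z h = let i , e = enum-onto X z h in subst (_∈ elements X) e (∈-map⁺ (enum X) (∈-allFin i))

  elements-∋ : ∀ {n} (X : Subset n) z → z ∈ elements X → X ∋ z
  elements-∋ X z h = let i , _ , e = ∈-map⁻ (enum X) h in subst (X ∋_) (sym e) (enum-∋ X i)

  elements-length : ∀ {n} (X : Subset n) → length (elements X) ≡ ∣ X ∣
  elements-length X = trans (length-map (enum X) (allFin ∣ X ∣)) (length-tabulate (λ x → x))

  module _ {A B : Set} where

    concatMap-length : ∀ (f : A → List B) c xs → (∀ x → x ∈ xs → length (f x) ≤ c) → length (concatMap f xs) ≤ length xs * c
    concatMap-length f c List.[] h = z≤n
    concatMap-length f c (x List.∷ xs) h = ≤-trans (≤-reflexive (length-++ (f x))) (+-mono-≤ (h x (here refl)) (concatMap-length f c xs (λ y i → h y (there i))))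

    ∈-concatMap : ∀ (f : A → List B) xs x y → x ∈ xs → y ∈ f x → y ∈ concatMap f xs
    ∈-concatMap f (x List.∷ xs) .x y (here refl) k = ∈-++⁺ˡ k
    ∈-concatMap f (x List.∷ xs) z y (there i) k = ∈-++⁺ʳ (f x) (∈-concatMap f xs z y i k)

    concatMap-∈ : ∀ (f : A → List B) xs y → y ∈ concatMap f xs → ∃[ x ] (x ∈ xs × y ∈ f x)
    concatMap-∈ f (x List.∷ xs) y h with ∈-++⁻ (f x) h
    ... | inj₁ k = x , here refl , k
    ... | inj₂ k = let z , i , l = concatMap-∈ f xs y k in z , there i , l

  ⋃ᴸ : ∀ {n} → List (Subset n) → Subset n
  ⋃ᴸ List.[] = ∅
  ⋃ᴸ (W List.∷ Ws) = W ∪ ⋃ᴸ Ws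

  ⊑-⋃ᴸ : ∀ {n} (Ws : List (Subset n)) W → W ∈ Ws → W ⊑ ⋃ᴸ Ws
  ⊑-⋃ᴸ (W List.∷ Ws) .W (here refl) x h = ∪-∋ˡ W (⋃ᴸ Ws) x h
  ⊑-⋃ᴸ (V List.∷ Ws) W (there i) x h = ∪-∋ʳ V (⋃ᴸ Ws) x (⊑-⋃ᴸ Ws W i x h)

  ⋃ᴸ-size : ∀ {n} q (Ws : List (Subset n)) → (∀ W → W ∈ Ws → ∣ W ∣ ≤ q) → ∣ ⋃ᴸ Ws ∣ ≤ length Ws * q
  ⋃ᴸ-size {n} q List.[] h = ≤-reflexive (∅-size n)
  ⋃ᴸ-size q (W List.∷ Ws) h = ≤-trans (∪-size W (⋃ᴸ Ws)) (+-mono-≤ (h W (here refl)) (⋃ᴸ-size q Ws (λ V i → h V (there i))))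

  private
    allᵇ : ∀ {m} → (Fin m → Bool) → Bool
    allᵇ {zero} p = true
    allᵇ {suc m} p = p zero ∧ allᵇ (p ∘ suc)

    allᵇ-sound : ∀ {m} (p : Fin m → Bool) → allᵇ p ≡ true → ∀ e → p e ≡ true
    allᵇ-sound p h zero = proj₁ (∧-true h)
    allᵇ-sound p h (suc e) = allᵇ-sound (p ∘ suc) (proj₂ (∧-true {p zero} h)) e

    allᵇ-complete : ∀ {m} (p : Fin m → Bool) → (∀ e → p e ≡ true) → allᵇ p ≡ true
    allᵇ-complete {zero} p h = refl
    allᵇ-complete {suc m} p h = ∧-intro (h zero) (allᵇ-complete (p ∘ suc) (h ∘ suc))

  common : (H : FinHypergraph) → Subset (FinHypergraph.v H)
  common H = tabulate (λ x → allᵇ (λ e → lookup (FinHypergraph.edge H e) x))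

  common-edge : ∀ H x → common H ∋ x → ∀ e → FinHypergraph.edge H e ∋ x
  common-edge H x h = allᵇ-sound _ (trans (sym (lookup∘tabulate _ x)) h)

  edge-common : ∀ H x → (∀ e → FinHypergraph.edge H e ∋ x) → common H ∋ x
  edge-common H x h = trans (lookup∘tabulate _ x) (allᵇ-complete _ h)

  -- place C B sends the i-th element of C to the i-th element of B, as long as there is one.
  module Place {v n : ℕ} (C : Subset v) (B : Subset n) where

    nth : ℕ → Maybe (Fin n)
    nth i with i <? ∣ B ∣
    ... | yes p = just (enum B (fromℕ< p))
    ... | no _ = nothing

    nth-∋ : ∀ i y → nth i ≡ just y → B ∋ y
    nth-∋ i y h with i <? ∣ B ∣
    nth-∋ i y refl | yes p = enum-∋ B (fromℕ< p)

    nth-injective : ∀ i j y → nth i ≡ just y → nth j ≡ just y → i ≡ j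
    nth-injective i j y h k with i <? ∣ B ∣ | j <? ∣ B ∣
    nth-injective i j y refl k | yes p | yes q =
      fromℕ<-injective _ _ p q (enum-injective B _ _ (sym (just-injective k)))

    nth-toℕ : ∀ (i : Fin ∣ B ∣) → nth (toℕ i) ≡ just (enum B i)
    nth-toℕ i with toℕ i <? ∣ B ∣
    ... | yes p = cong (just ∘ enum B) (fromℕ<-toℕ i p)
    ... | no ¬p = ⊥-elim (¬p (toℕ<n i))

    place-at : ∀ x b → lookup C x ≡ b → Maybe (Fin n)
    place-at x true h = nth (toℕ (proj₁ (enum-onto C x h)))
    place-at x false h = nothing

    place : Fin v → Maybe (Fin n)
    place x = place-at x (lookup C x) refl

    place-at-just : ∀ x b h y → place-at x b h ≡ just y → Σ (C ∋ x) λ c → nth (toℕ (proj₁ (enum-onto C x c))) ≡ just y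
    place-at-just x true h y k = h , k

    place-just : ∀ x y → place x ≡ just y → Σ (C ∋ x) λ c → nth (toℕ (proj₁ (enum-onto C x c))) ≡ just y
    place-just x y = place-at-just x (lookup C x) refl y

    place-∋ : ∀ x y → place x ≡ just y → (C ∋ x) × (B ∋ y)
    place-∋ x y h = let c , k = place-just x y h in c , nth-∋ _ y k

    place-injective : ∀ x x' y → place x ≡ just y → place x' ≡ just y → x ≡ x'
    place-injective x x' y h h' =
      let c , k = place-just x y h
          c' , k' = place-just x' y h' in
      trans (sym (proj₂ (enum-onto C x c))) (trans (cong (enum C) (toℕ-injective (nth-injective _ _ y k k'))) (proj₂ (enum-onto C x' c')))

    place-at-true : ∀ x b h y → C ∋ x → (∀ c → nth (toℕ (proj₁ (enum-onto C x c))) ≡ just y) → place-at x b h ≡ just y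
    place-at-true x true h y c k = k h
    place-at-true x false h y c k with () ← trans (sym h) c

    place-onto : ∣ B ∣ ≤ ∣ C ∣ → ∀ z → B ∋ z → ∃[ x ] (place x ≡ just z)
    place-onto B≤C z h = x , place-at-true x (lookup C x) refl z (enum-∋ C i') (λ c → trans (cong nth (index c)) (trans (nth-toℕ i) (cong just (proj₂ (enum-onto B z h)))))
      where
      i = proj₁ (enum-onto B z h)
      i' = inject≤ i B≤C
      x = enum C i'
      index : ∀ c → toℕ (proj₁ (enum-onto C x c)) ≡ toℕ i
      index c = trans (cong toℕ (enum-injective C _ i' (proj₂ (enum-onto C x c)))) (toℕ-inject≤ i B≤C)

  -- Greedy choice: each petal is told to avoid `Y` and all earlier petals outside its own centre,
  -- at most ∣ Y ∣ + m q points.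
  disjoint-petals : ∀ {n} m (Q : Subset n → Set) q (T : Fin m → Subset n) (Y : Subset n) →
    (∀ e X → Disjoint X (T e) → ∣ X ∣ ≤ ∣ Y ∣ + m * q → ∃[ S ] (Q S × T e ⊑ S × Disjoint S X × ∣ S ∣ ≤ q)) →
    Σ (Fin m → Subset n) λ S → (∀ e → Q (S e)) × (∀ e → T e ⊑ S e) × (∀ e z → S e ∋ z → Y ∋ z → T e ∋ z) ×
      (∀ e e' z → (e ≡ e' → ⊥) → S e ∋ z → S e' ∋ z → (T e ∋ z) ⊎ (T e' ∋ z))
  disjoint-petals zero Q q T Y choice = (λ ()) , (λ ()) , (λ ()) , (λ ()) , (λ ())
  disjoint-petals {n} (suc m) Q q T Y choice = combine (choice zero (Y ∖ˢ T zero) (λ x p t → proj₂ (∖-∋ Y (T zero) x p) t) (≤-trans (size-mono (Y ∖ˢ T zero) Y (λ x p → proj₁ (∖-∋ Y (T zero) x p))) (m≤m+n ∣ Y ∣ (suc m * q))))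
    where
    Goal = Σ (Fin (suc m) → Subset n) λ S → (∀ e → Q (S e)) × (∀ e → T e ⊑ S e) × (∀ e z → S e ∋ z → Y ∋ z → T e ∋ z) ×
      (∀ e e' z → (e ≡ e' → ⊥) → S e ∋ z → S e' ∋ z → (T e ∋ z) ⊎ (T e' ∋ z))
    combine : ∃[ S ] (Q S × T zero ⊑ S × Disjoint S (Y ∖ˢ T zero) × ∣ S ∣ ≤ q) → Goal
    combine (S₀ , Q₀ , T⊑₀ , dis₀ , size₀) = S , Q' , T⊑ , outer , inner
      where
      rest = disjoint-petals m Q q (T ∘ suc) (Y ∪ S₀) (λ e X d l → choice (suc e) X d (≤-trans l (≤-trans (+-monoˡ-≤ (m * q) (∪-size Y S₀))
        (≤-trans (≤-reflexive (+-assoc ∣ Y ∣ (∣ S₀ ∣) (m * q))) (+-monoʳ-≤ ∣ Y ∣ (+-monoˡ-≤ (m * q) size₀))))))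
      S : Fin (suc m) → Subset n
      S zero = S₀
      S (suc e) = proj₁ rest e
      Q' : ∀ e → Q (S e)
      Q' zero = Q₀
      Q' (suc e) = proj₁ (proj₂ rest) e
      T⊑ : ∀ e → T e ⊑ S e
      T⊑ zero = T⊑₀
      T⊑ (suc e) = proj₁ (proj₂ (proj₂ rest)) e
      first : ∀ z → S₀ ∋ z → Y ∋ z → T zero ∋ z
      first z s y with bool-case (lookup (T zero) z)
      ... | inj₁ t = t
      ... | inj₂ ¬t = ⊥-elim (dis₀ z s (∋-∖ Y (T zero) z y (∌ {A = T zero} ¬t)))
      later : ∀ e z → S (suc e) ∋ z → Y ∪ S₀ ∋ z → T (suc e) ∋ z
      later = proj₁ (proj₂ (proj₂ (proj₂ rest)))
      outer : ∀ e z → S e ∋ z → Y ∋ z → T e ∋ z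
      outer zero = first
      outer (suc e) z s y = later e z s (∪-∋ˡ Y S₀ z y)
      inner : ∀ e e' z → (e ≡ e' → ⊥) → S e ∋ z → S e' ∋ z → (T e ∋ z) ⊎ (T e' ∋ z)
      inner zero zero z h _ _ = ⊥-elim (h refl)
      inner zero (suc e') z h p q = inj₂ (later e' z q (∪-∋ʳ Y S₀ z p))
      inner (suc e) zero z h p q = inj₁ (later e z p (∪-∋ʳ Y S₀ z q))
      inner (suc e) (suc e') z h p q = proj₂ (proj₂ (proj₂ (proj₂ rest))) e e' z (λ eq → h (cong suc eq)) p q

  -- A petal has to avoid m centres of c + 1 points, v placed vertices and m petals of q points;
  -- this is the size allowed to blocking sets. The tree branches that much for c + 1 levels, one
  -- more star is reserved as a substitute, and the remainder consists of leaves with one further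
  -- point from a blocking set or the junta's coordinates.
  blocking-bound junta-bound remainder-bound : (m v c q : ℕ) → ℕ
  blocking-bound m v c q = (m * suc c + v) + m * q
  junta-bound m v c q = blocking-bound m v c q ^ suc c * suc c + suc c
  remainder-bound m v c q = blocking-bound m v c q ^ suc c * (blocking-bound m v c q + junta-bound m v c q)

  -- `Q` abstracts being spread: only the bound on sizes and the extension of consistent petals to a
  -- copy are used.
  module Juntas (H : FinHypergraph) {k n : ℕ} (F : Family n) (free : Kernel H k F → ⊥)
    (Q : Subset n → Set) (q : ℕ) (Q-size : ∀ S → Q S → ∣ S ∣ ≤ q)
    (extend : (S : Fin (FinHypergraph.m H) → Subset n) → (∀ e → Q (S e)) → (σ : Fin (FinHypergraph.v H) → Maybe (Fin n)) →
      (∀ x x' y → σ x ≡ just y → σ x' ≡ just y → x ≡ x') →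
      (∀ e x y → σ x ≡ just y → S e ∋ y → FinHypergraph.edge H e ∋ x) →
      (∀ e x y → σ x ≡ just y → FinHypergraph.edge H e ∋ x → S e ∋ y) →
      (∀ e e' z → (e ≡ e' → ⊥) → S e ∋ z → S e' ∋ z → ∃[ x ] (σ x ≡ just z)) → Kernel H k F)
    (𝒮 : List (Subset n)) (𝒮-Q : ∀ S → S ∈ 𝒮 → Q S) where
    open FinHypergraph H

    c τ x₁ : ℕ
    c = ∣ common H ∣
    τ = suc c
    x₁ = blocking-bound m v c q

    -- It takes the place of being the centre of a large sunflower of petals from `𝒮`: no few points
    -- outside `T` meet all petals through `T`.
    Rich : Subset n → Set
    Rich T = ∀ X → Disjoint X T → ∣ X ∣ ≤ x₁ → ∃[ S ] (S ∈ 𝒮 × T ⊑ S × Disjoint S X)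

    Blocking : Subset n → Subset n → Set
    Blocking T X = Disjoint X T × ∣ X ∣ ≤ x₁ × (∀ S → S ∈ 𝒮 → T ⊑ S → Disjoint S X → ⊥)

    rich? : ∀ T → (∃[ X ] Blocking T X) ⊎ Rich T
    rich? T with find (λ X → (disj X T ∧ (∣ X ∣ ≤ᵇ x₁)) ∧ not (any 𝒮 (λ S → ⊑ᵇ T S ∧ disj S X)))
    ... | inj₁ (X , h) = inj₁ (X , disj-sound X T (proj₁ (∧-true (proj₁ (∧-true h)))) ,
        ≤ᵇ⇒≤ _ _ (subst Data.Bool.T (sym (proj₂ (∧-true {disj X T} (proj₁ (∧-true h))))) _) ,
        λ S i t d → clash (∈-any 𝒮 _ S i (∧-intro (⊑ᵇ-complete T S t) (disj-complete S X d))) (proj₂ (∧-true {disj X T ∧ (∣ X ∣ ≤ᵇ x₁)} h)))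
      where
      clash : ∀ {b} → b ≡ true → not b ≡ true → ⊥
      clash refl ()
    ... | inj₂ none = inj₂ λ X d l → hit X d l (none X)
      where
      hit : ∀ X → Disjoint X T → ∣ X ∣ ≤ x₁ → ((disj X T ∧ (∣ X ∣ ≤ᵇ x₁)) ∧ not (any 𝒮 (λ S → ⊑ᵇ T S ∧ disj S X))) ≡ false → ∃[ S ] (S ∈ 𝒮 × T ⊑ S × Disjoint S X)
      hit X d l e with any 𝒮 (λ S → ⊑ᵇ T S ∧ disj S X) in found
      ... | true = let S , i , p = any-∈ 𝒮 _ found
                       t , d' = ∧-true {⊑ᵇ T S} p in S , i , ⊑ᵇ-sound T S t , disj-sound S X d'
      ... | false with () ← trans (sym e) (∧-intro (∧-intro (disj-complete X T d) (T-true (≤⇒≤ᵇ l))) refl)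

    -- Greedily chosen petals meet one another, and the points already placed, only inside the
    -- centres. A placement consistent with the centres is then consistent with the petals, and
    -- `extend` completes the copy.
    rich-kernel : (T : Fin m → Subset n) → (∀ e → ∣ T e ∣ ≤ τ) → (∀ e → Rich (T e)) → (σ : Fin v → Maybe (Fin n)) →
      (∀ x x' y → σ x ≡ just y → σ x' ≡ just y → x ≡ x') →
      (∀ e x y → σ x ≡ just y → T e ∋ y → edge e ∋ x) → (∀ e x y → σ x ≡ just y → edge e ∋ x → T e ∋ y) →
      (∀ e e' z → (e ≡ e' → ⊥) → T e ∋ z → T e' ∋ z → ∃[ x ] (σ x ≡ just z)) → ⊥
    rich-kernel T T-size rich σ σ-injective inside covers meet = free (extend S S-Q σ σ-injective
        (λ e x y p h → inside e x y p (outer e y h (Y-σ x y p)))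
        (λ e x y p h → T⊑S e y (covers e x y p h))
        (λ e e' z e≢e' p q → both e e' z e≢e' p q (inner e e' z e≢e' p q)))
      where
      image-of : Maybe (Fin n) → Subset n
      image-of (just y) = single y
      image-of nothing = ∅
      image-of-size : ∀ y → ∣ image-of y ∣ ≤ 1
      image-of-size (just y) = ≤-reflexive (single-size y)
      image-of-size nothing = ≤-trans (≤-reflexive (∅-size n)) z≤n
      Y : Subset n
      Y = ⋃ T ∪ ⋃ (λ x → image-of (σ x))
      Y-size : ∣ Y ∣ ≤ m * τ + v
      Y-size = ≤-trans (∪-size (⋃ T) _) (+-mono-≤ (⋃-size τ T T-size) (≤-trans (⋃-size 1 (λ x → image-of (σ x)) (λ x → image-of-size (σ x))) (≤-reflexive (*-identityʳ v))))
      Y-T : ∀ e z → T e ∋ z → Y ∋ z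
      Y-T e z h = ∪-∋ˡ (⋃ T) (⋃ (λ x → image-of (σ x))) z (∋-⋃ T e z h)
      Y-σ : ∀ x z → σ x ≡ just z → Y ∋ z
      Y-σ x z h = ∪-∋ʳ (⋃ T) (⋃ (λ x → image-of (σ x))) z (∋-⋃ (λ x → image-of (σ x)) x z (subst (λ w → image-of w ∋ z) (sym h) (single-∋ z)))
      petals = disjoint-petals m Q q T Y (λ e X d l → let S , i , t , d' = rich e X d (≤-trans l (+-monoˡ-≤ (m * q) Y-size)) in
        S , 𝒮-Q S i , t , d' , Q-size S (𝒮-Q S i))
      S = proj₁ petals
      S-Q = proj₁ (proj₂ petals)
      T⊑S = proj₁ (proj₂ (proj₂ petals))
      outer = proj₁ (proj₂ (proj₂ (proj₂ petals)))
      inner = proj₂ (proj₂ (proj₂ (proj₂ petals)))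
      both : ∀ e e' z → (e ≡ e' → ⊥) → S e ∋ z → S e' ∋ z → (T e ∋ z) ⊎ (T e' ∋ z) → ∃[ x ] (σ x ≡ just z)
      both e e' z e≢e' p q (inj₁ t) = meet e e' z e≢e' t (outer e' z q (Y-T e z t))
      both e e' z e≢e' p q (inj₂ t) = meet e e' z e≢e' (outer e z p (Y-T e' z t)) t

    -- One set `B` would serve as the centre of all m petals: its at most c points can be placed on
    -- vertices common to all edges.
    small-not-rich : ∀ B → ∣ B ∣ ≤ c → Rich B → ⊥
    small-not-rich B B≤c rich = rich-kernel (λ _ → B) (λ _ → m≤n⇒m≤1+n B≤c) (λ _ → rich) place place-injective
      (λ e x y p _ → common-edge H x (proj₁ (place-∋ x y p)) e) (λ e x y p _ → proj₂ (place-∋ x y p)) (λ e e' z _ p _ → place-onto B≤c z p)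
      where open Place (common H) B

    -- For rich sets the default ∅ adds nothing. Sets of at most c points are never rich, so
    -- branching always uses a genuine blocking set.
    block : Subset n → Subset n
    block T with rich? T
    ... | inj₁ (X , _) = X
    ... | inj₂ _ = ∅

    block-size : ∀ T → ∣ block T ∣ ≤ x₁
    block-size T with rich? T
    ... | inj₁ (X , _ , l , _) = l
    ... | inj₂ _ = ≤-trans (≤-reflexive (∅-size n)) z≤n

    block-apart : ∀ T → Disjoint (block T) T
    block-apart T with rich? T
    ... | inj₁ (X , d , _) = d
    ... | inj₂ _ = λ x p _ → ∅-∌ x p

    Met : Subset n → Set
    Met T = ∀ S → S ∈ 𝒮 → T ⊑ S → ∃[ z ] (S ∋ z × block T ∋ z)

    met-or-rich : ∀ T → Met T ⊎ Rich T
    met-or-rich T with rich? T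
    ... | inj₁ (X , _ , _ , hits) = inj₁ λ S i t → meeting-point S X (hits S i t)
    ... | inj₂ r = inj₂ r

    met : ∀ B → ∣ B ∣ ≤ c → Met B
    met B B≤c with met-or-rich B
    ... | inj₁ b = b
    ... | inj₂ r = ⊥-elim (small-not-rich B B≤c r)

    -- A node is extended by each point of its blocking set. A petal through the node meets that set
    -- and so contains a child, whence every petal contains some leaf.
    leaves : ℕ → Subset n → List (Subset n)
    leaves zero B = B List.∷ List.[]
    leaves (suc d) B = concatMap (λ z → leaves d (B ∪ single z)) (elements (block B))

    leaves-size : ∀ d B T → T ∈ leaves d B → ∣ T ∣ ≡ d + ∣ B ∣
    leaves-size zero B .B (here refl) = refl
    leaves-size (suc d) B T h = let z , i , l = concatMap-∈ (λ z → leaves d (B ∪ single z)) _ T h in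
      trans (leaves-size d (B ∪ single z) T l) (trans (cong (d +_) (add-size B z (block-apart B z (elements-∋ (block B) z i)))) (+-suc d (∣ B ∣)))

    leaves-length : ∀ d B → length (leaves d B) ≤ x₁ ^ d
    leaves-length zero B = ≤-refl
    leaves-length (suc d) B = ≤-trans (concatMap-length (λ z → leaves d (B ∪ single z)) (x₁ ^ d) (elements (block B)) (λ z _ → leaves-length d (B ∪ single z)))
      (*-monoˡ-≤ (x₁ ^ d) (≤-trans (≤-reflexive (elements-length (block B))) (block-size B)))

    leaves-cover : ∀ d B → d + ∣ B ∣ ≤ τ → ∀ S → S ∈ 𝒮 → B ⊑ S → ∃[ T ] (T ∈ leaves d B × T ⊑ S)
    leaves-cover zero B h S i b = B , here refl , b
    leaves-cover (suc d) B h S i b = T , ∈-concatMap (λ z → leaves d (B ∪ single z)) _ z T (∈-elements (block B) z z∈X) (proj₁ (proj₂ deeper)) , proj₂ (proj₂ deeper)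
      where
      hit = met B (≤-trans (m≤n+m (∣ B ∣) d) (≤-pred h)) S i b
      z = proj₁ hit
      p = proj₁ (proj₂ hit)
      z∈X = proj₂ (proj₂ hit)
      within : (B ∪ single z) ⊑ S
      within x r = go (∪-∋ B (single z) x r)
        where
        go : (B ∋ x) ⊎ (single z ∋ x) → S ∋ x
        go (inj₁ b') = b x b'
        go (inj₂ s) = subst (S ∋_) (sym (single-≡ z x s)) p
      deeper = leaves-cover d (B ∪ single z) (≤-trans (≤-reflexive (trans (cong (d +_) (add-size B z (block-apart B z z∈X))) (+-suc d (∣ B ∣)))) h) S i within
      T = proj₁ deeper

    richᵇ : Subset n → Bool
    richᵇ T with rich? T
    ... | inj₁ _ = false
    ... | inj₂ _ = true

    richᵇ-true : ∀ T → richᵇ T ≡ true → Rich T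
    richᵇ-true T h with rich? T
    ... | inj₂ r = r

    richᵇ-false : ∀ T → richᵇ T ≡ false → Met T
    richᵇ-false T h with rich? T
    ... | inj₁ (X , _ , _ , hits) = λ S i t → meeting-point S X (hits S i t)

    𝒯 : List (Subset n)
    𝒯 = leaves τ ∅

    𝒯-size : ∀ T → T ∈ 𝒯 → ∣ T ∣ ≡ τ
    𝒯-size T i = trans (leaves-size τ ∅ T i) (trans (cong (τ +_) (∅-size n)) (+-identityʳ τ))

    𝒯-cover : ∀ S → S ∈ 𝒮 → ∃[ T ] (T ∈ 𝒯 × T ⊑ S)
    𝒯-cover S i = leaves-cover τ ∅ (≤-reflexive (trans (cong (τ +_) (∅-size n)) (+-identityʳ τ))) S i (λ x p → ⊥-elim (∅-∌ x p))

    j : ℕ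
    j = junta-bound m v c q

    module Junta (𝒲 : List (Subset n)) (𝒲-size : ∀ T → T ∈ 𝒲 → ∣ T ∣ ≡ τ) (𝒲-length : length 𝒲 ≤ x₁ ^ τ + 1) where

      J : Subset n
      J = ⋃ᴸ 𝒲

      J-size : ∣ J ∣ ≤ j
      J-size = ≤-trans (⋃ᴸ-size τ 𝒲 (λ T i → ≤-reflexive (𝒲-size T i))) (≤-trans (*-monoˡ-≤ τ 𝒲-length) (≤-reflexive (eq (x₁ ^ τ) τ)))
        where
        eq : ∀ a t → (a + 1) * t ≡ a * t + t
        eq = solve-∀

      same : Subset n → Subset n → Bool
      same A T = ⊑ᵇ T A ∧ ⊑ᵇ A T

      same-≡ : ∀ A T → same A T ≡ true → A ≡ T
      same-≡ A T h = let p , r = ∧-true {⊑ᵇ T A} h in ⊑-antisym A T (⊑ᵇ-sound A T r) (⊑ᵇ-sound T A p)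

      -- The trace on `J` has to equal a centre, not merely contain one: the edges of a copy inside
      -- the junta then have centres as traces.
      𝓙 : Family n
      𝓙 A = sized k A ∧ any 𝒲 (same (A ∩ J))

      𝓙-uniform : ∀ A → 𝓙 A ≡ true → ∣ A ∣ ≡ k
      𝓙-uniform A h = ≡ᵇ-true ∣ A ∣ k (proj₁ (∧-true {sized k A} h))

      𝓙-trace : ∀ A → 𝓙 A ≡ true → (A ∩ J) ∈ 𝒲
      𝓙-trace A h = let T , i , p = any-∈ 𝒲 (same (A ∩ J)) (proj₂ (∧-true {sized k A} h)) in subst (_∈ 𝒲) (sym (same-≡ (A ∩ J) T p)) i

      𝓙-depends : ∀ A B → ∣ A ∣ ≡ k → ∣ B ∣ ≡ k → A ∩ J ≡ B ∩ J → 𝓙 A ≡ 𝓙 B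
      𝓙-depends A B p r e = cong₂ _∧_ (trans (to-sized {A = A} p) (sym (to-sized {A = B} r))) (cong (λ X → any 𝒲 (same X)) e)

      ∩-∋ : ∀ A z → A ∩ J ∋ z → (A ∋ z) × (J ∋ z)
      ∩-∋ A z h = ∧-true {lookup A z} (trans (sym (lookup-zipWith _∧_ z A J)) h)

      ∋-∩ : ∀ A z → A ∋ z → J ∋ z → A ∩ J ∋ z
      ∋-∩ A z p r = trans (lookup-zipWith _∧_ z A J) (∧-intro p r)

      𝓙-∌ : ∀ A T → T ∈ 𝒲 → ∣ A ∣ ≡ k → 𝓙 A ≡ false → T ⊑ A → ∃[ z ] (A ∋ z × J ∖ˢ T ∋ z)
      𝓙-∌ A T i p h t = meeting-point A (J ∖ˢ T) (λ d → false≢true (trans (sym h) (∧-intro (to-sized {A = A} p) (∈-any 𝒲 (same (A ∩ J)) T i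
          (∧-intro (⊑ᵇ-complete T (A ∩ J) (λ x q → ∋-∩ A x (t x q) (⊑-⋃ᴸ 𝒲 T i x q)))
            (⊑ᵇ-complete (A ∩ J) T (λ x q → inside d x (∩-∋ A x q))))))))
        where
        inside : Disjoint A (J ∖ˢ T) → ∀ x → (A ∋ x) × (J ∋ x) → T ∋ x
        inside d x (a , jx) with bool-case (lookup T x)
        ... | inj₁ t = t
        ... | inj₂ ¬t = ⊥-elim (d x a (∋-∖ J T x jx (∌ {A = T} ¬t)))

      -- The sets containing T and meeting J only in T already make the junta large.
      𝓙-large : ∀ T → T ∈ 𝒲 → 2 * k ≤ n → 4 * j * k ≤ n → 1 ≤ n → τ < k → choose n (k ∸ τ) ≤ 2 * cnt 𝓙
      𝓙-large T i 2k≤n 4jk≤n 1≤n τ<k = ≤-trans half (*-monoʳ-≤ 2 (≤-trans (≤-trans (cnt-mono into) (link-cnt 𝓙 T)) (cnt-mono (λ A h → proj₂ (∧-true {⊑ᵇ T A} h)))))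
        where
        κ = k ∸ suc τ
        κ+1 : suc κ ≡ k ∸ τ
        κ+1 = sym (+-∸-assoc 1 τ<k)
        L : Family n
        L = sized (k ∸ τ)
        deg-L : ∀ x → deg L x * n ≤ 2 * k * choose n (k ∸ τ)
        deg-L x = begin
          deg L x * n ≤⟨ *-monoˡ-≤ n (≤-trans (cnt-mono to-link) (≤-trans (cnt-link L (single x)) (≤-trans (cnt-mono smaller) (≤-reflexive (sized-cnt n κ))))) ⟩
          choose n κ * n ≡⟨ *-comm (choose n κ) n ⟩
          n * choose n κ ≤⟨ choose-down₁ n κ (≤-trans (*-monoʳ-≤ 2 (≤-trans (≤-reflexive κ+1) (m∸n≤m k τ))) 2k≤n) ⟩
          2 * suc κ * choose n (suc κ) ≡⟨ cong (λ z → 2 * z * choose n z) κ+1 ⟩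
          2 * (k ∸ τ) * choose n (k ∸ τ) ≤⟨ *-monoˡ-≤ (choose n (k ∸ τ)) (*-monoʳ-≤ 2 (m∸n≤m k τ)) ⟩
          2 * k * choose n (k ∸ τ) ∎
          where
          open ≤-Reasoning
          to-link : (λ A → lookup A x ∧ L A) ⇒ (λ A → ⊑ᵇ (single x) A ∧ L A)
          to-link A h = let a , b = ∧-true {lookup A x} h in ∧-intro (⊑ᵇ-complete (single x) A (λ y p → subst (A ∋_) (sym (single-≡ x y p)) a)) b
          smaller : link L (single x) ⇒ sized κ
          smaller B h = let d , b = ∧-true {disj (single x) B} h in to-sized {A = B} (suc-inj (trans (sym (trans (∪-disjoint-size (single x) B (disj-sound (single x) B d)) (cong (_+ ∣ B ∣) (single-size x))))
            (trans (≡ᵇ-true ∣ single x ∪ B ∣ (k ∸ τ) b) (sym κ+1))))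
            where
            suc-inj : ∀ {a b} → suc a ≡ suc b → a ≡ b
            suc-inj refl = refl
        avoiding = cnt (λ A → L A ∧ disj A J)
        half : choose n (k ∸ τ) ≤ 2 * avoiding
        half = *-cancelʳ-pos n 1≤n (+-cancelʳ-≤ (choose n (k ∸ τ) * n) _ _ (begin
          C * n + C * n ≡⟨ eq₁ C n ⟩
          2 * (C * n) ≡⟨ cong (λ z → 2 * (z * n)) (sized-cnt n (k ∸ τ)) ⟨
          2 * (cnt L * n) ≤⟨ *-monoʳ-≤ 2 (avoid-cnt L J n (2 * k * C) (λ x _ → deg-L x)) ⟩
          2 * (avoiding * n + ∣ J ∣ * (2 * k * C)) ≤⟨ *-monoʳ-≤ 2 (+-monoʳ-≤ (avoiding * n) (*-monoˡ-≤ (2 * k * C) J-size)) ⟩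
          2 * (avoiding * n + j * (2 * k * C)) ≡⟨ eq₂ avoiding n j k C ⟩
          2 * avoiding * n + 4 * j * k * C ≤⟨ +-monoʳ-≤ (2 * avoiding * n) (≤-trans (*-monoˡ-≤ C 4jk≤n) (≤-reflexive (*-comm n C))) ⟩
          2 * avoiding * n + C * n ∎))
          where
          open ≤-Reasoning
          C = choose n (k ∸ τ)
          eq₁ : ∀ C n → C * n + C * n ≡ 2 * (C * n)
          eq₁ = solve-∀
          eq₂ : ∀ a n j k C → 2 * (a * n + j * (2 * k * C)) ≡ 2 * a * n + 4 * j * k * C
          eq₂ = solve-∀
        into : (λ A → L A ∧ disj A J) ⇒ link 𝓙 T
        into B h = ∧-intro (disj-complete T B (λ x p r → d x r (⊑-⋃ᴸ 𝒲 T i x p)))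
          (∧-intro (to-sized {A = T ∪ B} size) (∈-any 𝒲 (same ((T ∪ B) ∩ J)) T i (∧-intro
            (⊑ᵇ-complete T ((T ∪ B) ∩ J) (λ x p → ∋-∩ (T ∪ B) x (∪-∋ˡ T B x p) (⊑-⋃ᴸ 𝒲 T i x p)))
            (⊑ᵇ-complete ((T ∪ B) ∩ J) T (λ x p → only x (∩-∋ (T ∪ B) x p))))))
          where
          d : Disjoint B J
          d = disj-sound B J (proj₂ (∧-true {L B} h))
          only : ∀ x → (T ∪ B ∋ x) × (J ∋ x) → T ∋ x
          only x (p , jx) with ∪-∋ T B x p
          ... | inj₁ t = t
          ... | inj₂ b = ⊥-elim (d x b jx)
          size : ∣ T ∪ B ∣ ≡ k
          size = trans (∪-disjoint-size T B (λ x p r → d x r (⊑-⋃ᴸ 𝒲 T i x p)))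
            (trans (cong₂ _+_ (𝒲-size T i) (≡ᵇ-true ∣ B ∣ (k ∸ τ) (proj₁ (∧-true {L B} h)))) (m+[n∸m]≡n (<⇒≤ τ<k)))

      -- Cut down to `J`, a copy in the junta has rich centres as edges, and `σ` places just the
      -- vertices that lie in `J`. From this `rich-kernel` would build a copy in `F`.
      𝓙-free-rich : (∀ T → T ∈ 𝒲 → Rich T) → Kernel H k 𝓙 → ⊥
      𝓙-free-rich rich K = rich-kernel T (λ e → ≤-reflexive (𝒲-size (T e) (𝓙-trace (A e) (A∈F e)))) (λ e → rich (T e) (𝓙-trace (A e) (A∈F e))) σ
          (λ x x' y p r → φ-injective x x' (trans (proj₁ (σ-just x y p)) (sym (proj₁ (σ-just x' y r)))))
          (λ e x y p h → A∋φ e x (subst (A e ∋_) (sym (proj₁ (σ-just x y p))) (proj₁ (∩-∋ (A e) y h))))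
          (λ e x y p h → ∋-∩ (A e) y (subst (A e ∋_) (proj₁ (σ-just x y p)) (φ∈A e x h)) (proj₂ (σ-just x y p)))
          (λ e e' z e≢e' p r → let x , h = shared e e' z e≢e' (proj₁ (∩-∋ (A e) z p)) (proj₁ (∩-∋ (A e') z r)) in
            x , σ-defined x z h (proj₂ (∩-∋ (A e) z p)))
        where
        open Kernel K
        T : Fin m → Subset n
        T e = A e ∩ J
        only-if : Bool → Fin n → Maybe (Fin n)
        only-if true y = just y
        only-if false y = nothing
        σ : Fin v → Maybe (Fin n)
        σ x = only-if (lookup J (φ x)) (φ x)
        only-if-just : ∀ b y z → only-if b y ≡ just z → (y ≡ z) × (b ≡ true)
        only-if-just true y z h = just-injective h , refl
        σ-just : ∀ x y → σ x ≡ just y → (φ x ≡ y) × (J ∋ y)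
        σ-just x y h = let e , b = only-if-just (lookup J (φ x)) (φ x) y h in e , subst (J ∋_) e b
        σ-defined : ∀ x z → φ x ≡ z → J ∋ z → σ x ≡ just z
        σ-defined x z refl h = cong (λ b → only-if b (φ x)) h

      -- All members of a star with centre T share T, but the edges of the expansion have only c common vertices.
      𝓙-free-star : ∀ T → (∀ W → W ∈ 𝒲 → W ≡ T) → (e e' : Fin m) → (e ≡ e' → ⊥) → Kernel H k 𝓙 → ⊥
      𝓙-free-star T all e e' e≢e' K = 1+n≰n (≤-trans (≤-reflexive (sym (trans (cong ∣_∣ (sym (all _ (𝓙-trace (A e) (A∈F e))))) (𝒲-size _ (𝓙-trace (A e) (A∈F e))))))
          (≤-trans (size-mono T (image φ (common H)) inside) (image-size≤ φ (common H))))
        where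
        open Kernel K
        T⊑A : ∀ e → T ⊑ A e
        T⊑A e x h = proj₁ (∩-∋ (A e) x (subst (_∋ x) (sym (all _ (𝓙-trace (A e) (A∈F e)))) h))
        inside : T ⊑ image φ (common H)
        inside z h = let x , eq = shared e e' z e≢e' (T⊑A e z h) (T⊑A e' z h) in
          subst (image φ (common H) ∋_) eq (∋-image φ (common H) x (edge-common H x (λ e'' → A∋φ e'' x (subst (A e'' ∋_) (sym eq) (T⊑A e'' z h)))))

      𝒱 : List (Subset n)
      𝒱 = concatMap (λ T → map (λ z → T ∪ single z) (elements ((block T ∪ J) ∖ˢ T))) 𝒯

      𝒱-length : length 𝒱 ≤ x₁ ^ τ * (x₁ + j)
      𝒱-length = ≤-trans (concatMap-length (λ T → map (λ z → T ∪ single z) (elements ((block T ∪ J) ∖ˢ T))) (x₁ + j) 𝒯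
        (λ T _ → ≤-trans (≤-reflexive (trans (length-map _ (elements ((block T ∪ J) ∖ˢ T))) (elements-length ((block T ∪ J) ∖ˢ T))))
          (≤-trans (size-mono ((block T ∪ J) ∖ˢ T) (block T ∪ J) (λ x p → proj₁ (∖-∋ (block T ∪ J) T x p))) (≤-trans (∪-size (block T) J) (+-mono-≤ (block-size T) J-size)))))
        (*-monoˡ-≤ (x₁ + j) (leaves-length τ ∅))

      𝒱-size : ∀ V → V ∈ 𝒱 → ∣ V ∣ ≡ suc τ
      𝒱-size V i = via (concatMap-∈ (λ T → map (λ z → T ∪ single z) (elements ((block T ∪ J) ∖ˢ T))) 𝒯 V i)
        where
        via : ∃[ T ] (T ∈ 𝒯 × V ∈ map (λ z → T ∪ single z) (elements ((block T ∪ J) ∖ˢ T))) → ∣ V ∣ ≡ suc τ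
        via (T , iT , iV) with ∈-map⁻ (λ z → T ∪ single z) iV
        ... | z , iz , refl = trans (add-size T z (proj₂ (∖-∋ (block T ∪ J) T z (elements-∋ ((block T ∪ J) ∖ˢ T) z iz)))) (cong suc (𝒯-size T iT))

      ∈-𝒱 : ∀ T z A → T ∈ 𝒯 → T ⊑ A → A ∋ z → (block T ∪ J) ∖ˢ T ∋ z → any 𝒱 (λ V → ⊑ᵇ V A) ≡ true
      ∈-𝒱 T z A i t a h = ∈-any 𝒱 (λ V → ⊑ᵇ V A) (T ∪ single z)
        (∈-concatMap (λ T → map (λ z → T ∪ single z) (elements ((block T ∪ J) ∖ˢ T))) 𝒯 T (T ∪ single z) i
          (∈-map⁺ (λ z → T ∪ single z) (∈-elements ((block T ∪ J) ∖ˢ T) z h)))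
        (⊑ᵇ-complete (T ∪ single z) A (λ x p → go x (∪-∋ T (single z) x p)))
        where
        go : ∀ x → (T ∋ x) ⊎ (single z ∋ x) → A ∋ x
        go x (inj₁ p) = t x p
        go x (inj₂ s) = subst (A ∋_) (sym (single-≡ z x s)) a

      star-bound : (∀ A → F A ≡ true → ∣ A ∣ ≡ k) → ∀ V → cnt (λ A → ⊑ᵇ V A ∧ F A) ≤ choose n (k ∸ ∣ V ∣)
      star-bound uniform V = ≤-trans (cnt-link F V) (≤-trans (cnt-mono sizes) (≤-reflexive (sized-cnt n (k ∸ ∣ V ∣))))
        where
        sizes : link F V ⇒ sized (k ∸ ∣ V ∣)
        sizes B h = let d , f = ∧-true {disj V B} h in to-sized {A = B} (trans (sym (m+n∸m≡n (∣ V ∣) (∣ B ∣)))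
          (cong (_∸ ∣ V ∣) (trans (sym (∪-disjoint-size V B (disj-sound V B d))) (uniform (V ∪ B) f))))

      -- A member of `F` above a petal contains a leaf `T`. If `T` is rich, the member lies outside
      -- the junta only by meeting `J` outside `T`; if not, the petal meets the blocking set of `T`.
      -- In both cases it contains one of the few sets of c + 2 points in `𝒱`.
      uncovered : (∀ A → F A ≡ true → ∣ A ∣ ≡ k) → (∀ T → T ∈ 𝒯 → richᵇ T ≡ true → T ∈ 𝒲) → ∀ err →
        cnt (λ A → F A ∧ not (any 𝒮 (λ S → ⊑ᵇ S A))) ≤ err →
        cnt (λ A → F A ∧ not (𝓙 A)) ≤ err + x₁ ^ τ * (x₁ + j) * choose n (k ∸ suc τ)
      uncovered uniform rich∈ err h = ≤-trans (cnt-cover _ (λ A → F A ∧ not (any 𝒮 (λ S → ⊑ᵇ S A))) (λ A → any 𝒱 (λ V → ⊑ᵇ V A) ∧ F A) cases)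
        (+-mono-≤ h (≤-trans (cnt-any F 𝒱 ⊑ᵇ (choose n (k ∸ suc τ)) (λ V i → subst (λ z → cnt (λ A → ⊑ᵇ V A ∧ F A) ≤ choose n (k ∸ z)) (𝒱-size V i) (star-bound uniform V)))
          (*-monoˡ-≤ (choose n (k ∸ suc τ)) 𝒱-length)))
        where
        not-true : ∀ {b} → not b ≡ true → b ≡ false
        not-true {false} _ = refl
        cases : ∀ A → (F A ∧ not (𝓙 A)) ≡ true → ((F A ∧ not (any 𝒮 (λ S → ⊑ᵇ S A))) ≡ true) ⊎ ((any 𝒱 (λ V → ⊑ᵇ V A) ∧ F A) ≡ true)
        cases A p = go (any 𝒮 (λ S → ⊑ᵇ S A)) refl
          where
          fA = proj₁ (∧-true {F A} p)
          A∉𝓙 = not-true (proj₂ (∧-true {F A} p))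
          go : ∀ b → any 𝒮 (λ S → ⊑ᵇ S A) ≡ b → ((F A ∧ not (any 𝒮 (λ S → ⊑ᵇ S A))) ≡ true) ⊎ ((any 𝒱 (λ V → ⊑ᵇ V A) ∧ F A) ≡ true)
          go false e = inj₁ (∧-intro fA (cong not e))
          go true e = inj₂ (∧-intro (caught (richᵇ T) refl) fA)
            where
            pS = any-∈ 𝒮 (λ S → ⊑ᵇ S A) e
            S = proj₁ pS
            iS = proj₁ (proj₂ pS)
            S⊑A = ⊑ᵇ-sound S A (proj₂ (proj₂ pS))
            pT = 𝒯-cover S iS
            T = proj₁ pT
            iT = proj₁ (proj₂ pT)
            T⊑S = proj₂ (proj₂ pT)
            T⊑A : T ⊑ A
            T⊑A x t = S⊑A x (T⊑S x t)
            caught : ∀ b → richᵇ T ≡ b → any 𝒱 (λ V → ⊑ᵇ V A) ≡ true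
            caught true r = let z , a , l = 𝓙-∌ A T (rich∈ T iT r) (uniform A fA) A∉𝓙 T⊑A
                                jz , ¬t = ∖-∋ J T z l in
              ∈-𝒱 T z A iT T⊑A a (∋-∖ (block T ∪ J) T z (∪-∋ʳ (block T) J z jz) ¬t)
            caught false r = let z , s , x = richᵇ-false T r S iS T⊑S in
              ∈-𝒱 T z A iT T⊑A (S⊑A z s) (∋-∖ (block T ∪ J) T z (∪-∋ˡ (block T) J z x) (block-apart T z x))

    record Outcome (err : ℕ) : Set where
      field
        junta : Family n
        junta-uniform : ∀ A → junta A ≡ true → ∣ A ∣ ≡ k
        junta-free : Kernel H k junta → ⊥
        core : Subset n
        core-size : ∣ core ∣ ≤ j
        depends : ∀ A B → ∣ A ∣ ≡ k → ∣ B ∣ ≡ k → A ∩ core ≡ B ∩ core → junta A ≡ junta B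
        remainder : cnt (λ A → F A ∧ not (junta A)) ≤ err + remainder-bound m v c q * choose n (k ∸ suc τ)
        large : choose n (k ∸ τ) ≤ 2 * cnt junta

    outcome : 2 ≤ m → (∀ A → F A ≡ true → ∣ A ∣ ≡ k) → 2 * k ≤ n → 4 * j * k ≤ n → τ < k → ∀ err →
      cnt (λ A → F A ∧ not (any 𝒮 (λ S → ⊑ᵇ S A))) ≤ err → Outcome err
    outcome 2≤m uniform 2k≤n 4jk≤n τ<k err bound = choose-juntas (keep richᵇ 𝒯) refl
      where
      1≤n : 1 ≤ n
      1≤n = ≤-trans (≤-trans (s≤s z≤n) τ<k) (≤-trans (m≤m+n k (k + 0)) 2k≤n)
      make : (𝒲 : List (Subset n)) (size : ∀ T → T ∈ 𝒲 → ∣ T ∣ ≡ τ) (len : length 𝒲 ≤ x₁ ^ τ + 1) → (∀ T → T ∈ 𝒯 → richᵇ T ≡ true → T ∈ 𝒲) →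
        ∀ T → T ∈ 𝒲 → (Kernel H k (Junta.𝓙 𝒲 size len) → ⊥) → Outcome err
      make 𝒲 size len rich∈ T i free′ = record
        { junta = 𝓙 ; junta-uniform = 𝓙-uniform ; junta-free = free′ ; core = J ; core-size = J-size ; depends = 𝓙-depends
        ; remainder = uncovered uniform rich∈ err bound ; large = 𝓙-large T i 2k≤n 4jk≤n 1≤n τ<k }
        where open Junta 𝒲 size len
      choose-juntas : ∀ 𝒲 → keep richᵇ 𝒯 ≡ 𝒲 → Outcome err
      choose-juntas 𝒲@(T List.∷ _) e = make 𝒲 size len (λ T i r → subst (T ∈_) e (∈-keep richᵇ 𝒯 T i r)) T (here refl)
          (Junta.𝓙-free-rich 𝒲 size len (λ T i → richᵇ-true T (proj₂ (keep-∈ richᵇ 𝒯 T (subst (T ∈_) (sym e) i)))))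
        where
        size : ∀ T → T ∈ 𝒲 → ∣ T ∣ ≡ τ
        size T i = 𝒯-size T (proj₁ (keep-∈ richᵇ 𝒯 T (subst (T ∈_) (sym e) i)))
        len : length 𝒲 ≤ x₁ ^ τ + 1
        len = subst (λ z → length z ≤ x₁ ^ τ + 1) e (≤-trans (keep-length richᵇ 𝒯) (≤-trans (leaves-length τ ∅) (m≤m+n _ 1)))
      -- With no rich leaf an arbitrary star on c + 1 points is taken, because an empty junta would
      -- violate `large`; two distinct edges make it free of copies.
      choose-juntas List.[] e = make 𝒲 size (m≤n+m 1 _) (λ T i r → ⊥-elim (empty T (subst (T ∈_) e (∈-keep richᵇ 𝒯 T i r)))) T₀ (here refl)
          (Junta.𝓙-free-star 𝒲 size (m≤n+m 1 _) T₀ (λ { W (here eq) → eq }) (fromℕ< {0} (≤-trans (s≤s z≤n) 2≤m)) (fromℕ< {1} 2≤m)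
            (λ eq → 0≢1 (trans (sym (toℕ-fromℕ< (≤-trans (s≤s z≤n) 2≤m))) (trans (cong toℕ eq) (toℕ-fromℕ< 2≤m)))))
        where
        0≢1 : 0 ≡ 1 → ⊥
        0≢1 ()
        pick = cnt-pos (sized {n} τ) (subst (1 ≤_) (sym (sized-cnt n τ)) (choose-pos n τ (≤-trans (<⇒≤ τ<k) (≤-trans (m≤m+n k (k + 0)) 2k≤n))))
        T₀ = proj₁ pick
        𝒲 = T₀ List.∷ List.[]
        size : ∀ T → T ∈ 𝒲 → ∣ T ∣ ≡ τ
        size T (here refl) = ≡ᵇ-true ∣ T₀ ∣ τ (proj₂ pick)
        empty : ∀ (T : Subset n) → T ∈ List.[] → ⊥
        empty T ()

-- Density increments and exhaustion by spread sets.

module Raise where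
  open import Defs using (Family)
  open Count
  open Fair
  open Sets
  open Tree using (any)
  open import Data.Nat
  open import Data.Nat.Properties
  open import Data.Nat.Tactic.RingSolver using (solve-∀)
  open import Data.Bool using (Bool; true; false; not; _∧_; _∨_)
  open import Data.Fin.Subset using (Subset; ∣_∣; _∪_)
  open import Data.Fin.Subset.Properties using (∪-assoc)
  open import Data.List as List using (List)
  open import Data.List.Membership.Propositional using (_∈_)
  open import Data.List.Relation.Unary.Any using (here; there)
  open import Data.Product using (_×_; _,_; Σ; ∃-syntax; proj₁; proj₂)
  open import Data.Sum using (_⊎_; inj₁; inj₂)
  open import Data.Empty using (⊥; ⊥-elim)
  open import Relation.Nullary using (yes; no)
  open import Relation.Binary.PropositionalEquality

  square-cancel : ∀ {x y} → x * x ≤ y * y → x ≤ y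
  square-cancel {x} {y} h with x ≤? y
  ... | yes p = p
  ... | no ¬p = ⊥-elim (<⇒≱ (*-mono-< (≰⇒> ¬p) (≰⇒> ¬p)) h)

  module _ (n k v K : ℕ) (1≤k : 1 ≤ k) (2k≤n : 2 * k ≤ n) (gain : 4 ^ suc v * (K * K) * k ≤ n) where

    private
      1≤n : 1 ≤ n
      1≤n = ≤-trans 1≤k (≤-trans (m≤m+n k (k + 0)) 2k≤n)

      k<n : k < n
      k<n = ≤-trans (≤-trans (≤-reflexive (+-comm 1 k)) (≤-trans (+-monoʳ-≤ k 1≤k) (≤-reflexive (cong (k +_) (sym (+-identityʳ k)))))) 2k≤n

    -- A violation multiplies the density by at least n / (2^(u + 1) K κ), and by `gain` the square
    -- of this is at least n/k. Squared densities are compared since only the square root of n/k is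
    -- gained.
    density-step : ∀ e κ u b b' G L → suc u ≤ κ → κ ≤ k → u ≤ v → n ^ suc u * b' ≤ (2 * κ) ^ suc u * b →
      b * b * k ^ e ≤ n ^ e * (G * G) → κ ^ u * G ≤ L * (K * n ^ u) → n * (b' * b' * k ^ e) ≤ k * (n ^ e * (L * L))
    density-step e κ u b b' G L u<κ κ≤k u≤v down inv violation = *-cancelˡ-pos (n * (N * N)) (*-mono-≤ 1≤n (*-mono-≤ (pow-pos u 1≤n) (pow-pos u 1≤n))) (begin
      n * (N * N) * (n * (b' * b' * k ^ e)) ≡⟨ eq₁ n N b' (k ^ e) ⟩
      (n * N * b') * (n * N * b') * k ^ e ≤⟨ *-monoˡ-≤ (k ^ e) (*-mono-≤ down down) ⟩
      ((2 * κ) ^ suc u * b) * ((2 * κ) ^ suc u * b) * k ^ e ≡⟨ eq₂ ((2 * κ) ^ suc u) b (k ^ e) ⟩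
      (2 * κ) ^ suc u * (2 * κ) ^ suc u * (b * b * k ^ e) ≤⟨ *-monoʳ-≤ ((2 * κ) ^ suc u * (2 * κ) ^ suc u) inv ⟩
      (2 * κ) ^ suc u * (2 * κ) ^ suc u * (n ^ e * (G * G)) ≡⟨ cong (λ z → z * z * (n ^ e * (G * G))) (^-distribʳ-* (suc u) 2 κ) ⟩
      2 ^ suc u * (κ * κ ^ u) * (2 ^ suc u * (κ * κ ^ u)) * (n ^ e * (G * G)) ≡⟨ eq₃ (2 ^ suc u) κ (κ ^ u) (n ^ e) G ⟩
      2 ^ suc u * 2 ^ suc u * (κ * κ) * n ^ e * ((κ ^ u * G) * (κ ^ u * G)) ≡⟨ cong (λ z → z * (κ * κ) * n ^ e * ((κ ^ u * G) * (κ ^ u * G))) (sym (^-distribʳ-* (suc u) 2 2)) ⟩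
      4 ^ suc u * (κ * κ) * n ^ e * ((κ ^ u * G) * (κ ^ u * G)) ≤⟨ *-monoʳ-≤ (4 ^ suc u * (κ * κ) * n ^ e) (*-mono-≤ violation violation) ⟩
      4 ^ suc u * (κ * κ) * n ^ e * ((L * (K * N)) * (L * (K * N))) ≤⟨ *-monoˡ-≤ _ (*-monoˡ-≤ (n ^ e) (*-mono-≤ (^-monoʳ-≤ 4 (s≤s u≤v)) (*-mono-≤ κ≤k κ≤k))) ⟩
      4 ^ suc v * (k * k) * n ^ e * ((L * (K * N)) * (L * (K * N))) ≡⟨ eq₄ (4 ^ suc v) k (n ^ e) L K N ⟩
      4 ^ suc v * (K * K) * k * ((N * N) * (k * (n ^ e * (L * L)))) ≤⟨ *-monoˡ-≤ ((N * N) * (k * (n ^ e * (L * L)))) gain ⟩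
      n * ((N * N) * (k * (n ^ e * (L * L)))) ≡⟨ *-assoc n (N * N) _ ⟨
      n * (N * N) * (k * (n ^ e * (L * L))) ∎)
      where
      open ≤-Reasoning
      N = n ^ u
      eq₁ : ∀ n N b k → n * (N * N) * (n * (b * b * k)) ≡ (n * N * b) * (n * N * b) * k
      eq₁ = solve-∀
      eq₂ : ∀ x b k → (x * b) * (x * b) * k ≡ x * x * (b * b * k)
      eq₂ = solve-∀
      eq₃ : ∀ t κ p n G → t * (κ * p) * (t * (κ * p)) * (n * (G * G)) ≡ t * t * (κ * κ) * n * ((p * G) * (p * G))
      eq₃ = solve-∀
      eq₄ : ∀ t k n L K N → t * (k * k) * n * ((L * (K * N)) * (L * (K * N))) ≡ t * (K * K) * k * ((N * N) * (k * (n * (L * L))))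
      eq₄ = solve-∀

    record Raised (F : Family n) (q e : ℕ) : Set where
      field
        S : Subset n
        G : Family n
        size : ∣ S ∣ ≤ q
        uniform : ∀ B → G B ≡ true → ∣ S ∣ + ∣ B ∣ ≡ k
        apart : ∀ B → G B ≡ true → Disjoint S B
        within : ∀ B → G B ≡ true → F (S ∪ B) ≡ true
        inhabited : 1 ≤ cnt G
        density : choose n (k ∸ ∣ S ∣) * choose n (k ∸ ∣ S ∣) * k ^ e ≤ n ^ e * (cnt G * cnt G)
        spread : ∀ U u → ∣ U ∣ ≡ suc u → u ≤ v → cnt (link G U) * (K * n ^ u) ≤ (k ∸ ∣ S ∣) ^ u * cnt G

    RaiseAt : Family n → ℕ → Set
    RaiseAt F e = ∀ (S : Subset n) (G : Family n) → (∀ B → G B ≡ true → ∣ S ∣ + ∣ B ∣ ≡ k) → (∀ B → G B ≡ true → Disjoint S B) →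
      (∀ B → G B ≡ true → F (S ∪ B) ≡ true) → 1 ≤ cnt G →
      choose n (k ∸ ∣ S ∣) * choose n (k ∸ ∣ S ∣) * k ^ e ≤ n ^ e * (cnt G * cnt G) → Raised F (∣ S ∣ + e * suc v) e

    private
     raise-step : ∀ (F : Family n) e → (∀ e₁ → e ≡ suc e₁ → RaiseAt F e₁) → RaiseAt F e
     raise-step F e recurse S G uniform apart within inhabited density = decide (find violates)
       where
       κ = k ∸ ∣ S ∣
       violates : Subset n → Bool
       violates U = ((1 ≤ᵇ ∣ U ∣) ∧ (∣ U ∣ ≤ᵇ suc v)) ∧ (κ ^ pred ∣ U ∣ * cnt G <ᵇ cnt (link G U) * (K * n ^ pred ∣ U ∣))
       true-T : ∀ {b} → b ≡ true → Data.Bool.T b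
       true-T refl = _
       decide : (∃[ U ] violates U ≡ true) ⊎ (∀ U → violates U ≡ false) → Raised F (∣ S ∣ + e * suc v) e
       decide (inj₂ none) = record
         { S = S ; G = G ; size = m≤m+n _ _ ; uniform = uniform ; apart = apart ; within = within ; inhabited = inhabited ; density = density
         ; spread = λ U u eq u≤v → ≮⇒≥ (λ lt → clash U u eq u≤v lt (none U)) }
         where
         clash : ∀ U u → ∣ U ∣ ≡ suc u → u ≤ v → κ ^ u * cnt G < cnt (link G U) * (K * n ^ u) → violates U ≡ false → ⊥
         clash U u eq u≤v lt h = false≢true (trans (sym h) (∧-intro (∧-intro (T-true (≤⇒≤ᵇ (subst (1 ≤_) (sym eq) (s≤s z≤n)))) (T-true (≤⇒≤ᵇ (subst (_≤ suc v) (sym eq) (s≤s u≤v)))))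
           (T-true (<⇒<ᵇ (subst (λ z → κ ^ pred z * cnt G < cnt (link G U) * (K * n ^ pred z)) (sym eq) lt)))))
       decide (inj₁ (U , h)) = step (∣ U ∣) refl (≤ᵇ⇒≤ 1 _ (true-T (proj₁ (∧-true {1 ≤ᵇ ∣ U ∣} sizes)))) (≤ᵇ⇒≤ _ _ (true-T (proj₂ (∧-true {1 ≤ᵇ ∣ U ∣} sizes))))
           (<ᵇ⇒< _ _ (true-T (proj₂ (∧-true {(1 ≤ᵇ ∣ U ∣) ∧ (∣ U ∣ ≤ᵇ suc v)} h))))
         where
         sizes = proj₁ (∧-true {(1 ≤ᵇ ∣ U ∣) ∧ (∣ U ∣ ≤ᵇ suc v)} h)
         step : ∀ u₁ → ∣ U ∣ ≡ u₁ → 1 ≤ u₁ → u₁ ≤ suc v → κ ^ pred ∣ U ∣ * cnt G < cnt (link G U) * (K * n ^ pred ∣ U ∣) → Raised F (∣ S ∣ + e * suc v) e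
         step (suc u) eq _ (s≤s u≤v) lt = advance e refl (density-step e κ u (choose n κ) (choose n κ') (cnt G) (cnt L) u<κ (m∸n≤m k (∣ S ∣)) u≤v down density (<⇒≤ lt'))
           where
           L : Family n
           L = link G U
           κ' = κ ∸ suc u
           lt' : κ ^ u * cnt G < cnt L * (K * n ^ u)
           lt' = subst (λ z → κ ^ pred z * cnt G < cnt L * (K * n ^ pred z)) eq lt
           1≤L : 1 ≤ cnt L
           1≤L = go (cnt L) refl
             where
             go : ∀ c → cnt L ≡ c → 1 ≤ c
             go (suc c) _ = s≤s z≤n
             go zero e = ⊥-elim (n≮0 (subst (λ z → κ ^ u * cnt G < z * (K * n ^ u)) e lt'))
           split : ∀ B → L B ≡ true → Disjoint U B × G (U ∪ B) ≡ true
           split B l = let d , g = ∧-true {disj U B} l in disj-sound U B d , g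
           SU-apart : Disjoint S U
           SU-apart x s p = let B , l = cnt-pos L 1≤L in apart (U ∪ B) (proj₂ (split B l)) x s (∪-∋ˡ U B x p)
           SU-size : ∣ S ∪ U ∣ ≡ ∣ S ∣ + suc u
           SU-size = trans (∪-disjoint-size S U SU-apart) (cong (∣ S ∣ +_) eq)
           total : ∀ B → L B ≡ true → ∣ S ∣ + (suc u + ∣ B ∣) ≡ k
           total B l = trans (cong (∣ S ∣ +_) (sym (trans (∪-disjoint-size U B (proj₁ (split B l))) (cong (_+ ∣ B ∣) eq)))) (uniform (U ∪ B) (proj₂ (split B l)))
           u<κ : suc u ≤ κ
           u<κ = let B , l = cnt-pos L 1≤L in
             ≤-trans (m≤m+n (suc u) (∣ B ∣)) (≤-reflexive (trans (sym (m+n∸m≡n (∣ S ∣) (suc u + ∣ B ∣))) (cong (_∸ ∣ S ∣) (total B l))))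
           κ≡ : suc u + κ' ≡ κ
           κ≡ = m+[n∸m]≡n u<κ
           down : n ^ suc u * choose n κ' ≤ (2 * κ) ^ suc u * choose n κ
           down = subst (λ z → n ^ suc u * choose n κ' ≤ (2 * z) ^ suc u * choose n z) κ≡
             (choose-down n (suc u) κ' (≤-trans (*-monoʳ-≤ 2 (≤-trans (≤-reflexive κ≡) (m∸n≤m k (∣ S ∣)))) 2k≤n))
           L≤b : cnt L ≤ choose n κ'
           L≤b = ≤-trans (cnt-mono {F = L} {G = sized κ'} (λ B l → to-sized {A = B} (trans (sym (m+n∸m≡n (suc u) (∣ B ∣))) (cong (_∸ suc u) (trans (sym (m+n∸m≡n (∣ S ∣) (suc u + ∣ B ∣))) (cong (_∸ ∣ S ∣) (total B l))))))) (≤-reflexive (sized-cnt n κ'))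
           κ'≡ : κ' ≡ k ∸ ∣ S ∪ U ∣
           κ'≡ = trans (∸-+-assoc k (∣ S ∣) (suc u)) (cong (k ∸_) (sym SU-size))
           assoc : ∀ B → S ∪ (U ∪ B) ≡ (S ∪ U) ∪ B
           assoc B = sym (∪-assoc S U B)
           advance : ∀ e₁ → e ≡ e₁ → n * (choose n κ' * choose n κ' * k ^ e) ≤ k * (n ^ e * (cnt L * cnt L)) → Raised F (∣ S ∣ + e * suc v) e
           -- No exponent is left to trade: the link would have squared density at least n/k, which
           -- exceeds 1.
           advance zero refl h = ⊥-elim (<⇒≱ k<n (*-cancelʳ-pos (choose n κ' * choose n κ') (*-mono-≤ (≤-trans 1≤L L≤b) (≤-trans 1≤L L≤b))
             (≤-trans (≤-reflexive (cong (n *_) (sym (*-identityʳ _)))) (≤-trans h (*-monoʳ-≤ k (≤-trans (≤-reflexive (*-identityˡ _)) (*-mono-≤ L≤b L≤b)))))))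
           advance (suc e₁) refl h = record
             { S = R.S ; G = R.G ; size = ≤-trans R.size (≤-trans (+-monoˡ-≤ (e₁ * suc v) (≤-trans (≤-reflexive SU-size) (+-monoʳ-≤ (∣ S ∣) (s≤s u≤v)))) (≤-reflexive (+-assoc (∣ S ∣) (suc v) (e₁ * suc v))))
             ; uniform = R.uniform ; apart = R.apart ; within = R.within ; inhabited = R.inhabited
             ; density = ≤-trans (≤-reflexive (eqa (choose n (k ∸ ∣ R.S ∣) * choose n (k ∸ ∣ R.S ∣)) k (k ^ e₁))) (≤-trans (*-mono-≤ (<⇒≤ k<n) R.density) (≤-reflexive (sym (*-assoc n (n ^ e₁) _)))) ; spread = R.spread }
             where
             eqa : ∀ b k x → b * (k * x) ≡ k * (b * x)
             eqa = solve-∀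
             eqb : ∀ n k b x → n * k * (b * x) ≡ n * (b * (k * x))
             eqb = solve-∀
             eqc : ∀ n k x y → k * (n * x * y) ≡ n * k * (x * y)
             eqc = solve-∀
             module R = Raised (recurse e₁ refl (S ∪ U) L
               (λ B l → trans (cong (_+ ∣ B ∣) SU-size) (trans (+-assoc (∣ S ∣) (suc u) (∣ B ∣)) (total B l)))
               (λ B l → disj-∪ S U B (apart (U ∪ B) (proj₂ (split B l))) (proj₁ (split B l)))
               (λ B l → subst (λ z → F z ≡ true) (assoc B) (within (U ∪ B) (proj₂ (split B l))))
               1≤L
               (subst (λ z → choose n z * choose n z * k ^ e₁ ≤ n ^ e₁ * (cnt L * cnt L)) κ'≡
                 (*-cancelˡ-pos (n * k) (*-mono-≤ 1≤n 1≤k) (≤-trans (≤-reflexive (eqb n k (choose n κ' * choose n κ') (k ^ e₁))) (≤-trans h (≤-reflexive (eqc n k (n ^ e₁) (cnt L * cnt L))))))))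

    raise : ∀ F e → RaiseAt F e
    raise F zero = raise-step F zero (λ _ ())
    raise F (suc e) = raise-step F (suc e) (λ { _ refl → raise F e })

    -- As long as more than `err` members are uncovered, their family itself yields a further set
    -- `S`. Its star contains an uncovered member, so the number of uncovered members serves as
    -- fuel.
    exhaust : (F : Family n) → ∀ q e err (P : Subset n → Set) →
      (∀ (F₀ : Family n) → F₀ ⇒ F → err < cnt F₀ → Raised F₀ q e) → (∀ (F₀ : Family n) → F₀ ⇒ F → (R : Raised F₀ q e) → P (Raised.S R)) →
      Σ (List (Subset n)) λ 𝒮 → (∀ S → S ∈ 𝒮 → P S) × cnt (λ A → F A ∧ not (any 𝒮 (λ S → ⊑ᵇ S A))) ≤ err
    exhaust F q e err P start good = go (cnt (rest List.[])) List.[] ≤-refl (λ S ())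
      where
      rest : List (Subset n) → Family n
      rest 𝒮 A = F A ∧ not (any 𝒮 (λ S → ⊑ᵇ S A))
      rest⇒F : ∀ 𝒮 → rest 𝒮 ⇒ F
      rest⇒F 𝒮 A h = proj₁ (∧-true {F A} h)
      go : ∀ fuel 𝒮 → cnt (rest 𝒮) ≤ fuel → (∀ S → S ∈ 𝒮 → P S) → Σ (List (Subset n)) λ 𝒮 → (∀ S → S ∈ 𝒮 → P S) × cnt (rest 𝒮) ≤ err
      go fuel 𝒮 h p with cnt (rest 𝒮) ≤? err
      ... | yes q = 𝒮 , p , q
      go zero 𝒮 h p | no ¬q = 𝒮 , p , ≤-trans h z≤n
      go (suc fuel) 𝒮 h p | no ¬q = go fuel (R.S List.∷ 𝒮) (≤-pred (≤-trans shrink h)) (λ { .(R.S) (here refl) → good (rest 𝒮) (rest⇒F 𝒮) r ; S (there i) → p S i })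
        where
        r = start (rest 𝒮) (rest⇒F 𝒮) (≰⇒> ¬q)
        module R = Raised r
        star : Family n
        star A = ⊑ᵇ R.S A ∧ rest 𝒮 A
        1≤star : 1 ≤ cnt star
        1≤star = ≤-trans (≤-trans R.inhabited (cnt-mono (λ B g → ∧-intro (disj-complete R.S B (R.apart B g)) (R.within B g)))) (link-cnt (rest 𝒮) R.S)
        shrink : suc (cnt (rest (R.S List.∷ 𝒮))) ≤ cnt (rest 𝒮)
        shrink = ≤-trans (+-monoˡ-≤ (cnt (rest (R.S List.∷ 𝒮))) 1≤star) cnt-mono-parts
          where
          disjoint-sum : ∀ {n} (X Y Z : Family n) → (∀ A → bit (X A) + bit (Y A) ≤ bit (Z A)) → cnt X + cnt Y ≤ cnt Z
          disjoint-sum X Y Z h = subst₂ _≤_ (trans (Σˢ-add (λ A → bit (X A)) (λ A → bit (Y A))) (cong₂ _+_ (Σˢ-bit X) (Σˢ-bit Y))) (Σˢ-bit Z) (Σˢ-mono h)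
          cnt-mono-parts : cnt star + cnt (rest (R.S List.∷ 𝒮)) ≤ cnt (rest 𝒮)
          cnt-mono-parts = disjoint-sum star (rest (R.S List.∷ 𝒮)) (rest 𝒮) (λ A → parts (⊑ᵇ R.S A) (F A) (any 𝒮 (λ S → ⊑ᵇ S A)))
            where
            parts : ∀ s f a → bit (s ∧ (f ∧ not a)) + bit (f ∧ not (s ∨ a)) ≤ bit (f ∧ not a)
            parts true true true = z≤n
            parts true true false = ≤-refl
            parts true false a = z≤n
            parts false true true = z≤n
            parts false true false = ≤-refl
            parts false false a = z≤n

-- Covering by spread sets when n is at most 4^X k.

module DenseCover where
  open import Defs using (Family; FinHypergraph)
  open Count
  open Fair
  open Sets
  open Tree using (any)
  open Copy using (module Embedding)
  open Raise
  open import Data.Nat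
  open import Data.Nat.Properties
  open import Data.Nat.Tactic.RingSolver using (solve-∀)
  open import Data.Bool using (true; not; _∧_)
  open import Data.Fin.Subset using (Subset; ∣_∣; _∪_)
  open import Data.List using (List)
  open import Data.List.Membership.Propositional using (_∈_)
  open import Data.Sum using (_⊎_; inj₁; inj₂)
  open import Data.Empty using (⊥-elim)
  open import Data.Product using (_×_; Σ)
  open import Relation.Binary.PropositionalEquality

  choose-up* : ∀ n s κ → suc κ ^ s * choose n (s + κ) ≤ n ^ s * choose n κ
  choose-up* n zero κ = ≤-refl
  choose-up* n (suc s) κ = begin
    suc κ * suc κ ^ s * choose n (suc (s + κ)) ≡⟨ eq (suc κ) (suc κ ^ s) (choose n (suc (s + κ))) ⟩
    suc κ ^ s * (suc κ * choose n (suc (s + κ))) ≤⟨ *-monoʳ-≤ (suc κ ^ s) (≤-trans (*-monoˡ-≤ (choose n (suc (s + κ))) (s≤s (m≤n+m κ s))) (choose-up n (s + κ))) ⟩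
    suc κ ^ s * (n * choose n (s + κ)) ≡⟨ eq₂ (suc κ ^ s) n (choose n (s + κ)) ⟩
    n * (suc κ ^ s * choose n (s + κ)) ≤⟨ *-monoʳ-≤ n (choose-up* n s κ) ⟩
    n * (n ^ s * choose n κ) ≡⟨ *-assoc n (n ^ s) (choose n κ) ⟨
    n ^ suc s * choose n κ ∎
    where
    open ≤-Reasoning
    eq : ∀ a b c → a * b * c ≡ b * (a * c)
    eq = solve-∀
    eq₂ : ∀ a b c → a * (b * c) ≡ b * (a * c)
    eq₂ = solve-∀

  -- A full star on s points has density about (k/n)^s; the constant 2^s is paid for by one more
  -- factor k/n, hence the exponent `suc s`.
  ratio-start : ∀ n k s g → s ≤ k → k ≤ 2 * suc (k ∸ s) → 2 ^ s * k ≤ n → choose n (k ∸ s) ≤ g → k ^ suc s * choose n k ≤ n ^ suc s * g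
  ratio-start n k s g s≤k k≤ big dense = begin
    k * k ^ s * b ≡⟨ *-assoc k (k ^ s) b ⟩
    k * (k ^ s * b) ≤⟨ *-monoʳ-≤ k (*-monoˡ-≤ b (≤-trans (^-monoˡ-≤ s k≤) (≤-reflexive (^-distribʳ-* s 2 (suc κ))))) ⟩
    k * (2 ^ s * suc κ ^ s * b) ≡⟨ eq k (2 ^ s) (suc κ ^ s) b ⟩
    2 ^ s * k * (suc κ ^ s * b) ≡⟨ cong (λ z → 2 ^ s * k * (suc κ ^ s * choose n z)) (m+[n∸m]≡n s≤k) ⟨
    2 ^ s * k * (suc κ ^ s * choose n (s + κ)) ≤⟨ *-mono-≤ big (choose-up* n s κ) ⟩
    n * (n ^ s * choose n κ) ≡⟨ *-assoc n (n ^ s) _ ⟨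
    n ^ suc s * choose n κ ≤⟨ *-monoʳ-≤ (n ^ suc s) dense ⟩
    n ^ suc s * g ∎
    where
    open ≤-Reasoning
    κ = k ∸ s
    b = choose n k
    eq : ∀ k t p b → k * (t * p * b) ≡ t * k * (p * b)
    eq = solve-∀

  square-ratio : ∀ n k r b g → k ^ r * b ≤ n ^ r * g → b * b * k ^ (2 * r) ≤ n ^ (2 * r) * (g * g)
  square-ratio n k r b g h = ≤-trans (≤-reflexive (trans (cong (b * b *_) (double k)) (eq₁ b (k ^ r)))) (≤-trans (*-mono-≤ h h)
    (≤-reflexive (trans (eq₂ (n ^ r) g) (cong (_* (g * g)) (sym (double n))))))
    where
    double : ∀ x → x ^ (2 * r) ≡ x ^ r * x ^ r
    double x = trans (cong (x ^_) (cong (r +_) (+-identityʳ r))) (^-distribˡ-+-* x r r)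
    eq₁ : ∀ b x → b * b * (x * x) ≡ x * b * (x * b)
    eq₁ = solve-∀
    eq₂ : ∀ x g → x * g * (x * g) ≡ x * x * (g * g)
    eq₂ = solve-∀

  unsquare-ratio : ∀ n k r b g → b * b * k ^ (2 * r) ≤ n ^ (2 * r) * (g * g) → k ^ r * b ≤ n ^ r * g
  unsquare-ratio n k r b g h = square-cancel (≤-trans (≤-reflexive (trans (eq₁ b (k ^ r)) (cong (b * b *_) (sym (double k))))) (≤-trans h
    (≤-reflexive (trans (cong (_* (g * g)) (double n)) (eq₂ (n ^ r) g)))))
    where
    double : ∀ x → x ^ (2 * r) ≡ x ^ r * x ^ r
    double x = trans (cong (x ^_) (cong (r +_) (+-identityʳ r))) (^-distribˡ-+-* x r r)
    eq₁ : ∀ b x → x * b * (x * b) ≡ b * b * (x * x)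
    eq₁ = solve-∀
    eq₂ : ∀ x g → x * x * (g * g) ≡ x * g * (x * g)
    eq₂ = solve-∀

  module _ (H : FinHypergraph) (2≤m : 2 ≤ FinHypergraph.m H) (q₀ s : ℕ) (q₀-big : 2 * suc s * suc (FinHypergraph.v H) ≤ q₀) where
    open FinHypergraph H using (v)
    open Embedding H 2≤m q₀ (suc s)

    -- For these n a density of (k / n) ^ s is not below 2 ^ (- k / D).
    dense-cover : ∀ {k n} X → 1 ≤ k → s ≤ k → k ≤ 2 * suc (k ∸ s) → 2 * k ≤ n → 2 ^ s * k ≤ n → 4 ^ suc v * (K * K) * k ≤ n →
      X * (2 * suc s) ≤ k / D → n ≤ 2 ^ X * 2 ^ X * k →
      (F : Family n) → (∀ A → F A ≡ true → ∣ A ∣ ≡ k) →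
      Σ (List (Subset n)) λ 𝒮 → (∀ S → S ∈ 𝒮 → Spread k F S) × cnt (λ A → F A ∧ not (any 𝒮 (λ S → ⊑ᵇ S A))) ≤ choose n (k ∸ s)
    dense-cover {k} {n} X 1≤k s≤k k≤ 2k≤n 2ˢk≤n gain X≤ n≤ F uniform =
      exhaust n k v K 1≤k 2k≤n gain F q₀ e (choose n (k ∸ s)) (Spread k F) start good
      where
      e = 2 * suc s
      start : (F₀ : Family n) → F₀ ⇒ F → choose n (k ∸ s) < cnt F₀ → Raised n k v K 1≤k 2k≤n gain F₀ q₀ e
      start F₀ F₀⇒F big = record { Raised R ; size = ≤-trans (Raised.size R) (≤-trans (≤-reflexive (cong (_+ e * suc v) (∅-size n))) q₀-big) }
        where
        ∅∪ : ∀ {n} (A : Subset n) → ∅ ∪ A ≡ A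
        ∅∪ A = ⊑-antisym (∅ ∪ A) A (λ x p → go A x (∪-∋ ∅ A x p)) (λ x p → ∪-∋ʳ ∅ A x p)
          where
          go : ∀ {n} (A : Subset n) x → (∅ ∋ x) ⊎ (A ∋ x) → A ∋ x
          go A x (inj₁ h) = ⊥-elim (∅-∌ x h)
          go A x (inj₂ h) = h
        R = raise n k v K 1≤k 2k≤n gain F₀ e ∅ F₀ (λ B h → trans (cong (_+ ∣ B ∣) (∅-size n)) (uniform B (F₀⇒F B h)))
          (λ B h x p _ → ∅-∌ x p) (λ B h → subst (λ z → F₀ z ≡ true) (sym (∅∪ B)) h) (≤-trans (s≤s z≤n) big)
          (subst (λ z → choose n (k ∸ z) * choose n (k ∸ z) * k ^ e ≤ n ^ e * (cnt F₀ * cnt F₀)) (sym (∅-size n))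
            (square-ratio n k (suc s) (choose n k) (cnt F₀) (ratio-start n k s (cnt F₀) s≤k k≤ 2ˢk≤n (<⇒≤ big))))
      good : (F₀ : Family n) → F₀ ⇒ F → (R : Raised n k v K 1≤k 2k≤n gain F₀ q₀ e) → Spread k F (Raised.S R)
      good F₀ F₀⇒F R = record
        { G = G ; size = size ; uniform = uniform′ ; apart = apart ; within = λ B g → F₀⇒F _ (within B g)
        -- Both density conditions come from the squared density by taking roots; for the first, n ≤
        -- 4^X k gives n^e ≤ 4^(k/D) k^e.
        ; dense = square-cancel (*-cancelʳ-pos (k ^ e) (pow-pos e 1≤k) squared)
        ; dense′ = ≤-trans (*-monoˡ-≤ b (^-monoˡ-≤ (suc s) (m∸n≤m k (∣ S ∣)))) (unsquare-ratio n k (suc s) b (cnt G) density)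
        ; spread = spread }
        where
        open Raised R renaming (uniform to uniform′)
        open ≤-Reasoning
        b = choose n (k ∸ ∣ S ∣)
        powers : n ^ e ≤ 2 ^ (k / D) * 2 ^ (k / D) * k ^ e
        powers = begin
          n ^ e ≤⟨ ^-monoˡ-≤ e n≤ ⟩
          (2 ^ X * 2 ^ X * k) ^ e ≡⟨ trans (^-distribʳ-* e (2 ^ X * 2 ^ X) k) (cong (_* k ^ e) (trans (^-distribʳ-* e (2 ^ X) (2 ^ X)) (cong (λ z → z * z) (^-*-assoc 2 X e)))) ⟩
          2 ^ (X * e) * 2 ^ (X * e) * k ^ e ≤⟨ *-monoˡ-≤ (k ^ e) (*-mono-≤ (^-monoʳ-≤ 2 X≤) (^-monoʳ-≤ 2 X≤)) ⟩
          2 ^ (k / D) * 2 ^ (k / D) * k ^ e ∎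
        squared : b * b * k ^ e ≤ 2 ^ (k / D) * cnt G * (2 ^ (k / D) * cnt G) * k ^ e
        squared = begin
          b * b * k ^ e ≤⟨ density ⟩
          n ^ e * (cnt G * cnt G) ≤⟨ *-monoˡ-≤ (cnt G * cnt G) powers ⟩
          2 ^ (k / D) * 2 ^ (k / D) * k ^ e * (cnt G * cnt G) ≡⟨ eq (2 ^ (k / D)) (k ^ e) (cnt G) ⟩
          2 ^ (k / D) * cnt G * (2 ^ (k / D) * cnt G) * k ^ e ∎
          where
          eq : ∀ a k g → a * a * k * (g * g) ≡ a * g * (a * g) * k
          eq = solve-∀

-- Decoding the members of a sparse family from few data.

module Peel where
  open import Defs using (Family; FinHypergraph)
  open Count
  open Fair
  open Sets
  open Tree using (keep; keep-∈; ∈-keep; keep-length; elements; ∈-elements; elements-length; concatMap-length; ∈-concatMap; concatMap-∈; common; common-edge; module Place; disjoint-petals; ⋃ᴸ; ⊑-⋃ᴸ; ⋃ᴸ-size; any; cnt-any; ∈-any)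
  open import Data.Nat
  open import Data.Nat.Properties hiding (suc-injective)
  open import Data.Nat.Tactic.RingSolver using (solve-∀)
  open import Data.Nat.DivMod using (m*n/n≡m; /-monoˡ-≤)
  open import Data.Bool using (Bool; true; false; not; _∧_; _∨_; if_then_else_)
  open import Data.Fin using (Fin; zero; suc; combine; inject≤)
  open import Data.Fin.Properties using (combine-injective; inject≤-injective; suc-injective)
  open import Data.Fin.Subset using (Subset; ∣_∣; _∪_)
  open import Data.Vec using ([]; _∷_; lookup; tabulate; Vec)
  open import Data.Vec.Properties using (lookup∘tabulate)
  open import Data.List as List using (List; length; allFin; concatMap; map; _++_)
  open import Data.List.Properties using (length-map; length-++; length-tabulate)
  open import Data.List.Membership.Propositional using (_∈_)
  open import Data.List.Membership.Propositional.Properties using (∈-allFin; ∈-map⁺; ∈-map⁻; ∈-++⁺ˡ; ∈-++⁺ʳ; ∈-++⁻)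
  open import Data.List.Relation.Unary.Any using (here; there)
  open import Data.Maybe using (just; nothing; fromMaybe)
  open import Data.Product using (_×_; _,_; Σ; ∃-syntax; proj₁; proj₂)
  open import Data.Sum using (_⊎_; inj₁; inj₂)
  open import Data.Empty using (⊥; ⊥-elim)
  open import Function using (_∘_)
  open import Relation.Nullary using (Dec; ¬_; yes; no)
  open import Relation.Binary.PropositionalEquality hiding (J)

  same : ∀ {n} → Subset n → Subset n → Bool
  same A B = ⊑ᵇ A B ∧ ⊑ᵇ B A

  cnt-same : ∀ {n} (W : Subset n) → cnt (same W) ≤ 1
  cnt-same [] = ≤-refl
  cnt-same {suc n} (true ∷ W) = ≤-trans (+-mono-≤ (cnt-same W) (≤-reflexive (cnt-false n))) ≤-refl
  cnt-same {suc n} (false ∷ W) = ≤-trans (+-monoˡ-≤ _ (≤-trans (cnt-mono never) (≤-reflexive (cnt-false n)))) (cnt-same W)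
    where
    never : (λ A → ⊑ᵇ W A ∧ false) ⇒ (λ _ → false)
    never A h = proj₂ (∧-true {⊑ᵇ W A} h)

  levels : ∀ n → ℕ → List (Subset n)
  levels zero zero = [] List.∷ List.[]
  levels zero (suc κ) = List.[]
  levels (suc n) zero = map (false ∷_) (levels n zero)
  levels (suc n) (suc κ) = map (true ∷_) (levels n κ) ++ map (false ∷_) (levels n (suc κ))

  levels-length : ∀ n κ → length (levels n κ) ≡ choose n κ
  levels-length zero zero = refl
  levels-length zero (suc κ) = refl
  levels-length (suc n) zero = trans (length-map (false ∷_) (levels n zero)) (levels-length n zero)
  levels-length (suc n) (suc κ) = trans (length-++ (map (true ∷_) (levels n κ)))
    (cong₂ _+_ (trans (length-map (true ∷_) (levels n κ)) (levels-length n κ)) (trans (length-map (false ∷_) (levels n (suc κ))) (levels-length n (suc κ))))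

  ∈-levels : ∀ {n} κ (A : Subset n) → ∣ A ∣ ≡ κ → A ∈ levels n κ
  ∈-levels zero [] h = here refl
  ∈-levels zero (false ∷ A) h = ∈-map⁺ (false ∷_) (∈-levels zero A h)
  ∈-levels (suc κ) (true ∷ A) h = ∈-++⁺ˡ (∈-map⁺ (true ∷_) (∈-levels κ A (cong pred h)))
  ∈-levels {suc n} (suc κ) (false ∷ A) h = ∈-++⁺ʳ (map (true ∷_) (levels n κ)) (∈-map⁺ (false ∷_) (∈-levels (suc κ) A h))

  levels-∈ : ∀ {n} κ (A : Subset n) → A ∈ levels n κ → ∣ A ∣ ≡ κ
  levels-∈ {zero} zero .[] (here refl) = refl
  levels-∈ {suc n} zero A h with ∈-map⁻ (false ∷_) h
  ... | A' , i , refl = levels-∈ zero A' i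
  levels-∈ {suc n} (suc κ) A h with ∈-++⁻ (map (true ∷_) (levels n κ)) h
  ... | inj₁ i with ∈-map⁻ (true ∷_) i
  ... | A' , i' , refl = cong suc (levels-∈ κ A' i')
  levels-∈ {suc n} (suc κ) A h | inj₂ i with ∈-map⁻ (false ∷_) i
  ... | A' , i' , refl = levels-∈ (suc κ) A' i'

  -- Repetitions are harmless, since only the length matters. Keeping `Y` itself in each round lets
  -- the smaller sets through.
  smalls : ∀ {n} → ℕ → Subset n → List (Subset n)
  smalls zero R = ∅ List.∷ List.[]
  smalls (suc i) R = concatMap (λ Y → Y List.∷ map (λ x → Y ∪ single x) (elements R)) (smalls i R)

  smalls-length : ∀ {n} i (R : Subset n) → length (smalls i R) ≤ suc ∣ R ∣ ^ i
  smalls-length zero R = ≤-refl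
  smalls-length (suc i) R = ≤-trans (concatMap-length (λ Y → Y List.∷ map (λ x → Y ∪ single x) (elements R)) (suc ∣ R ∣) (smalls i R)
      (λ Y _ → ≤-reflexive (cong suc (trans (length-map (λ x → Y ∪ single x) (elements R)) (elements-length R)))))
    (≤-trans (*-monoˡ-≤ (suc ∣ R ∣) (smalls-length i R)) (≤-reflexive (*-comm (suc ∣ R ∣ ^ i) (suc ∣ R ∣))))

  remove-last : ∀ {n} (Y : Subset n) → (∃[ x ] (Y ∋ x × Y ≡ (Y ∖ˢ single x) ∪ single x × ∣ Y ∣ ≡ suc ∣ Y ∖ˢ single x ∣)) ⊎ (Y ≡ ∅)
  remove-last {n} Y = go (∣ Y ∣) refl
    where
    minus : ∀ x → Y ∋ x → Y ≡ (Y ∖ˢ single x) ∪ single x × ∣ Y ∣ ≡ suc ∣ Y ∖ˢ single x ∣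
    minus x h = ⊑-antisym Y ((Y ∖ˢ single x) ∪ single x) to from ,
        trans (sym (∖-size Y (single x) sub)) (trans (cong (∣ Y ∖ˢ single x ∣ +_) (single-size x)) (+-comm _ 1))
      where
      sub : single x ⊑ Y
      sub z p = subst (Y ∋_) (sym (single-≡ x z p)) h
      to : Y ⊑ ((Y ∖ˢ single x) ∪ single x)
      to z p with bool-case (lookup (single x) z)
      ... | inj₁ s = ∪-∋ʳ (Y ∖ˢ single x) (single x) z s
      ... | inj₂ ¬s = ∪-∋ˡ (Y ∖ˢ single x) (single x) z (∋-∖ Y (single x) z p (∌ {A = single x} ¬s))
      from : ((Y ∖ˢ single x) ∪ single x) ⊑ Y
      from z p with ∪-∋ (Y ∖ˢ single x) (single x) z p
      ... | inj₁ q = proj₁ (∖-∋ Y (single x) z q)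
      ... | inj₂ s = sub z s
    empty : ∀ {n} (Y : Subset n) → ∣ Y ∣ ≡ 0 → Y ≡ ∅
    empty [] h = refl
    empty (false ∷ Y) h = cong (false ∷_) (empty Y h)
    go : ∀ s → ∣ Y ∣ ≡ s → (∃[ x ] (Y ∋ x × Y ≡ (Y ∖ˢ single x) ∪ single x × ∣ Y ∣ ≡ suc ∣ Y ∖ˢ single x ∣)) ⊎ (Y ≡ ∅)
    go zero e = inj₂ (empty Y e)
    go (suc s) e = let x = enum Y (subst Fin (sym e) zero)
                       h = enum-∋ Y (subst Fin (sym e) zero) in inj₁ (x , h , minus x h)

  ∈-smalls : ∀ {n} i (R Y : Subset n) → Y ⊑ R → ∣ Y ∣ ≤ i → Y ∈ smalls i R
  ∈-smalls i R Y h l with remove-last Y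
  ∈-smalls zero R Y h l | inj₂ e = here e
  ∈-smalls {n} (suc i) R Y h l | inj₂ e = ∈-concatMap (λ Y → Y List.∷ map (λ x → Y ∪ single x) (elements R)) (smalls i R) Y Y
    (∈-smalls i R Y h (≤-trans (≤-reflexive (trans (cong ∣_∣ e) (∅-size n))) z≤n)) (here refl)
  ∈-smalls zero R Y h l | inj₁ (x , p , e , s) with () ← ≤-trans (≤-reflexive (sym s)) l
  ∈-smalls (suc i) R Y h l | inj₁ (x , p , e , s) = ∈-concatMap (λ Y → Y List.∷ map (λ x → Y ∪ single x) (elements R)) (smalls i R) (Y ∖ˢ single x) Y
    (∈-smalls i R (Y ∖ˢ single x) (λ z q → h z (proj₁ (∖-∋ Y (single x) z q))) (≤-pred (≤-trans (≤-reflexive (sym s)) l)))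
    (there (subst (_∈ map (λ z → (Y ∖ˢ single x) ∪ single z) (elements R)) (sym e) (∈-map⁺ (λ z → (Y ∖ˢ single x) ∪ single z) (∈-elements R x (h x p)))))

  capture? : ∀ {n} (P : Family n) (T : Subset n) x →
    (∃[ X ] (Disjoint X T × ∣ X ∣ ≤ x × (∀ S → P S ≡ true → T ⊑ S → Disjoint S X → ⊥))) ⊎
    (∀ X → Disjoint X T → ∣ X ∣ ≤ x → ∃[ S ] (P S ≡ true × T ⊑ S × Disjoint S X))
  capture? {n} P T x = go (find (λ X → (disj X T ∧ (∣ X ∣ ≤ᵇ x)) ∧ isNone X))
    where
    search : ∀ X → (∃[ S ] ((P S ∧ (⊑ᵇ T S ∧ disj S X)) ≡ true)) ⊎ (∀ S → (P S ∧ (⊑ᵇ T S ∧ disj S X)) ≡ false)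
    search X = find (λ S → P S ∧ (⊑ᵇ T S ∧ disj S X))
    isNone : Subset n → Bool
    isNone X with search X
    ... | inj₁ _ = false
    ... | inj₂ _ = true
    none : ∀ X → isNone X ≡ true → ∀ S → (P S ∧ (⊑ᵇ T S ∧ disj S X)) ≡ false
    none X h with search X
    ... | inj₂ k = k
    some : ∀ X → isNone X ≡ false → ∃[ S ] ((P S ∧ (⊑ᵇ T S ∧ disj S X)) ≡ true)
    some X h with search X
    ... | inj₁ s = s
    not-true : ∀ a {b} → (a ∧ b) ≡ false → a ≡ true → b ≡ false
    not-true true h _ = h
    go : _ → _
    go (inj₁ (X , h)) = inj₁ (X , disj-sound X T (proj₁ (∧-true (proj₁ (∧-true h)))) ,
      ≤ᵇ⇒≤ _ _ (subst Data.Bool.T (sym (proj₂ (∧-true {disj X T} (proj₁ (∧-true h))))) _) ,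
      λ S p t d → false≢true (trans (sym (none X (proj₂ (∧-true {disj X T ∧ (∣ X ∣ ≤ᵇ x)} h)) S)) (∧-intro p (∧-intro (⊑ᵇ-complete T S t) (disj-complete S X d)))))
    go (inj₂ h) = inj₂ λ X d l → let S , p = some X (not-true _ (h X) (∧-intro (disj-complete X T d) (T-true (≤⇒≤ᵇ l))))
                                     a , b = ∧-true {P S} p
                                     t , e = ∧-true {⊑ᵇ T S} b in S , a , ⊑ᵇ-sound T S t , disj-sound S X e

  -- Disjoint v-tuples of points, each a candidate placement of all vertices of `H`.
  record Blocks (K v : ℕ) {n : ℕ} (R : Subset n) : Set where
    field
      block : Fin K → Fin v → Fin n
      block-injective : ∀ i j x y → block i x ≡ block j y → (i ≡ j) × (x ≡ y)
      block-∋ : ∀ i x → R ∋ block i x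

  cut : ∀ {n} K v (R : Subset n) → K * v ≤ ∣ R ∣ → Blocks K v R
  cut K v R h = record
    { block = λ i x → enum R (inject≤ (combine i x) h)
    ; block-injective = λ i j x y e → combine-injective i x j y (inject≤-injective h h (combine i x) (combine j y) (enum-injective R _ _ e))
    ; block-∋ = λ i x → enum-∋ R _ }

  at-most-one : ∀ {n} (I : Subset n) → (∀ i j → I ∋ i → I ∋ j → i ≡ j) → ∣ I ∣ ≤ 1
  at-most-one [] h = z≤n
  at-most-one (false ∷ I) h = at-most-one I (λ i j p q → suc-injective (h (suc i) (suc j) p q))
  at-most-one {suc n} (true ∷ I) h = s≤s (≤-trans (size-mono I ∅ none) (≤-reflexive (∅-size n)))
    where
    none : I ⊑ ∅
    none i p with () ← h zero (suc i) refl p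

  good-indices : ∀ K {N} (I : Subset N) → K + ∣ I ∣ ≤ N → Σ (Fin K → Fin N) λ ι → (∀ a b → ι a ≡ ι b → a ≡ b) × (∀ a → I ∋ ι a → ⊥)
  good-indices K {N} I h = (λ a → enum C (inject≤ a K≤)) , (λ a b e → inject≤-injective K≤ K≤ a b (enum-injective C _ _ e)) ,
      λ a → proj₂ (∖-∋ full I _ (enum-∋ C (inject≤ a K≤)))
    where
    C = full ∖ˢ I
    K≤ : K ≤ ∣ C ∣
    K≤ = +-cancelʳ-≤ (∣ I ∣) K (∣ C ∣) (≤-trans h (≤-reflexive (sym (trans (∖-size full I (λ x _ → full-∋ x)) (full-size N)))))

  module _ {N v n : ℕ} {R : Subset n} (b : Blocks N v R) where
    open Blocks b

    meeting : Fin n → Subset N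
    meeting z = tabulate (λ i → lookup (image (block i) full) z)

    meeting-∋ : ∀ z i → meeting z ∋ i → ∃[ x ] block i x ≡ z
    meeting-∋ z i h = let x , _ , e = image-∋ (block i) full z (trans (sym (lookup∘tabulate _ i)) h) in x , e

    ∋-meeting : ∀ i x → meeting (block i x) ∋ i
    ∋-meeting i x = trans (lookup∘tabulate _ i) (∋-image (block i) full x (full-∋ x))

    meeting-size : ∀ z → ∣ meeting z ∣ ≤ 1
    meeting-size z = at-most-one (meeting z) (λ i j p q → let x , e = meeting-∋ z i p
                                                              y , e' = meeting-∋ z j q in proj₁ (block-injective i j x y (trans e (sym e'))))

    touching : Subset n → Subset N
    touching X = ⋃ᴸ (map meeting (elements X))

    touching-size : ∀ X → ∣ touching X ∣ ≤ ∣ X ∣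
    touching-size X = ≤-trans (⋃ᴸ-size 1 (map meeting (elements X)) (λ W i → let z , _ , e = ∈-map⁻ meeting i in subst (λ W → ∣ W ∣ ≤ 1) (sym e) (meeting-size z)))
      (≤-reflexive (trans (*-identityʳ _) (trans (length-map meeting (elements X)) (elements-length X))))

    touching-complete : ∀ X i x → X ∋ block i x → touching X ∋ i
    touching-complete X i x h = ⊑-⋃ᴸ (map meeting (elements X)) (meeting (block i x)) (∈-map⁺ meeting (∈-elements X (block i x) h)) i (∋-meeting i x)

    select-blocks : ∀ K (I : Subset N) → K + ∣ I ∣ ≤ N → (X : Subset n) → (∀ i x → X ∋ block i x → I ∋ i) →
      Σ (Blocks K v (R ∖ˢ X)) λ b' → Σ (Fin K → Fin N) λ ι → (∀ a → Blocks.block b' a ≡ block (ι a)) × (∀ a → I ∋ ι a → ⊥)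
    select-blocks K I h X bad = let ι , ι-inj , out = good-indices K I h in
      record { block = block ∘ ι ; block-injective = λ i j x y e → let p , q = block-injective (ι i) (ι j) x y e in ι-inj i j p , q
             ; block-∋ = λ i x → ∋-∖ R X (block (ι i) x) (block-∋ (ι i) x) (λ h → out i (bad (ι i) x h)) } , ι , (λ a → refl) , out

  module Sparse (H : FinHypergraph) {k n : ℕ} (F : Family n) (uniform : ∀ A → F A ≡ true → ∣ A ∣ ≡ k) (free : Kernel H k F → ⊥) where
    open FinHypergraph H

    -- Here the petals are whole members of `F`, so `jc` allows for v placed vertices and m sets of
    -- k points. Blocking sets are thus only polynomially bounded in k.
    c τ jc : ℕ
    c = ∣ common H ∣
    τ = suc c
    jc = v + m * k

    hitset : Subset n → Subset n
    hitset Y with capture? F Y jc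
    ... | inj₁ (X , _) = X
    ... | inj₂ _ = ∅

    hitset-size : ∀ Y → ∣ hitset Y ∣ ≤ jc
    hitset-size Y with capture? F Y jc
    ... | inj₁ (X , _ , l , _) = l
    ... | inj₂ _ = ≤-trans (≤-reflexive (∅-size n)) z≤n

    hitset-apart : ∀ Y → Disjoint (hitset Y) Y
    hitset-apart Y with capture? F Y jc
    ... | inj₁ (X , d , _) = d
    ... | inj₂ _ = λ x p _ → ∅-∌ x p

    Blocked Open : Subset n → Set
    Blocked Y = ∀ A → F A ≡ true → Y ⊑ A → ∃[ z ] (A ∋ z × hitset Y ∋ z)
    Open Y = ∀ X → Disjoint X Y → ∣ X ∣ ≤ jc → ∃[ S ] (F S ≡ true × Y ⊑ S × Disjoint S X)

    status : ∀ Y → Blocked Y ⊎ Open Y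
    status Y with capture? F Y jc
    ... | inj₁ (X , _ , _ , hits) = inj₁ λ A f y → meeting-point A X (hits A f y)
    ... | inj₂ r = inj₂ r

    open-kernel : (φ : Fin v → Fin n) → (∀ x y → φ x ≡ φ y → x ≡ y) → (∀ e → Open (image φ (edge e))) → ⊥
    open-kernel φ φ-injective opens = free record
      { φ = φ ; φ-injective = φ-injective ; A = A ; A∈F = A∈F ; A-size = λ e → uniform (A e) (A∈F e)
      ; φ∈A = λ e x h → T⊑A e (φ x) (∋-image φ (edge e) x h)
      ; A∋φ = λ e x h → let y , l , eq = image-∋ φ (edge e) (φ x) (outer e (φ x) h (∋-image φ full x (full-∋ x))) in subst (edge e ∋_) (φ-injective y x eq) l
      ; shared = λ e e' z e≢e' p q → both e e' z (inner e e' z e≢e' p q) }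
      where
      petals = disjoint-petals m (λ S → F S ≡ true) k (λ e → image φ (edge e)) (image φ full)
        (λ e X d l → let S , f , t , d' = opens e X d (≤-trans l (+-monoˡ-≤ (m * k) (≤-trans (image-size≤ φ full) (≤-reflexive (full-size v))))) in
          S , f , t , d' , ≤-reflexive (uniform S f))
      A = proj₁ petals
      A∈F = proj₁ (proj₂ petals)
      T⊑A = proj₁ (proj₂ (proj₂ petals))
      outer = proj₁ (proj₂ (proj₂ (proj₂ petals)))
      inner = proj₂ (proj₂ (proj₂ (proj₂ petals)))
      both : ∀ e e' z → (image φ (edge e) ∋ z) ⊎ (image φ (edge e') ∋ z) → ∃[ x ] φ x ≡ z
      both e e' z (inj₁ h) = let x , _ , eq = image-∋ φ (edge e) z h in x , eq
      both e e' z (inj₂ h) = let x , _ , eq = image-∋ φ (edge e') z h in x , eq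

    -- If the images of all edges were open, members of `F` through them could be chosen greedily to
    -- meet only in the kernel, and would form a copy.
    some-blocked : (φ : Fin v → Fin n) → (∀ x y → φ x ≡ φ y → x ≡ y) → ∃[ e ] Blocked (image φ (edge e))
    some-blocked φ φ-injective = go (scan (λ e → status (image φ (edge e))))
      where
      scan : ∀ {m} {P Q : Fin m → Set} → (∀ e → P e ⊎ Q e) → (∃[ e ] P e) ⊎ (∀ e → Q e)
      scan {zero} h = inj₂ λ ()
      scan {suc m} h with h zero | scan (λ e → h (suc e))
      ... | inj₁ p | _ = inj₁ (zero , p)
      ... | inj₂ q | inj₁ (e , p) = inj₁ (suc e , p)
      ... | inj₂ q | inj₂ r = inj₂ λ { zero → q ; (suc e) → r e }
      go : _ → _
      go (inj₁ r) = r
      go (inj₂ o) = ⊥-elim (open-kernel φ φ-injective o)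

    -- The kernel whose common vertices are first used for the points of B, and the others for t.
    ϕ : Subset n → (Fin v → Fin n) → Fin v → Fin n
    ϕ B t x = fromMaybe (t x) (Place.place (common H) B x)

    ϕ-cases : ∀ B t x → (B ∋ ϕ B t x × Place.place (common H) B x ≡ just (ϕ B t x)) ⊎ (ϕ B t x ≡ t x)
    ϕ-cases B t x = go (Place.place (common H) B x) refl
      where
      go : ∀ w → Place.place (common H) B x ≡ w → (B ∋ fromMaybe (t x) w × w ≡ just (fromMaybe (t x) w)) ⊎ (fromMaybe (t x) w ≡ t x)
      go (just y) e = inj₁ (proj₂ (Place.place-∋ (common H) B x y e) , refl)
      go nothing e = inj₂ refl

    petal : Subset n → (Fin v → Fin n) → Fin m → Subset n
    petal B t e = image (ϕ B t) (edge e)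

    -- The points for which the tuple `t` can vote in the presence of `B`. They are at most m jc,
    -- and `B` and `t` determine them without knowledge of the member.
    V : Subset n → (Fin v → Fin n) → Subset n
    V B t = ⋃ (λ e → hitset (petal B t e))

    V-size : ∀ B t → ∣ V B t ∣ ≤ m * jc
    V-size B t = ⋃-size jc (λ e → hitset (petal B t e)) (λ e → hitset-size (petal B t e))

    petal-⊑ : ∀ B t e z → petal B t e ∋ z → (B ∋ z) ⊎ (∃[ x ] t x ≡ z)
    petal-⊑ B t e z h = let x , _ , eq = image-∋ (ϕ B t) (edge e) z h in go x eq (ϕ-cases B t x)
      where
      go : ∀ x → ϕ B t x ≡ z → (B ∋ ϕ B t x × Place.place (common H) B x ≡ just (ϕ B t x)) ⊎ (ϕ B t x ≡ t x) → (B ∋ z) ⊎ (∃[ x ] t x ≡ z)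
      go x eq (inj₁ (b , _)) = inj₁ (subst (B ∋_) eq b)
      go x eq (inj₂ e) = inj₂ (x , trans (sym e) eq)

    petal-size : ∀ B t e → ∣ petal B t e ∣ ≤ v
    petal-size B t e = ≤-trans (image-size≤ (ϕ B t) (edge e)) (size≤n (edge e))

    B⊑petal : ∀ B t e → ∣ B ∣ ≤ c → B ⊑ petal B t e
    B⊑petal B t e B≤c z h = let x , p = Place.place-onto (common H) B B≤c z h in
      subst (petal B t e ∋_) (cong (fromMaybe (t x)) p) (∋-image (ϕ B t) (edge e) x (common-edge H x (proj₁ (Place.place-∋ (common H) B x z p)) e))

    -- The member contains `B` and `t`, hence the image of the blocked edge, and so it must meet the
    -- set blocking that image.
    vote : ∀ A → F A ≡ true → ∀ B → B ⊑ A → ∀ t → (∀ x y → t x ≡ t y → x ≡ y) → (∀ x → A ∖ˢ B ∋ t x) →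
      ∃[ z ] (A ∋ z × ∃[ e ] (hitset (petal B t e) ∋ z))
    vote A f B B⊑A t t-injective t-in = let z , a , h = proj₂ blocked A f within in z , a , proj₁ blocked , h
      where
      ϕ-injective : ∀ x y → ϕ B t x ≡ ϕ B t y → x ≡ y
      ϕ-injective x y eq = go (ϕ-cases B t x) (ϕ-cases B t y)
        where
        go : _ → _ → x ≡ y
        go (inj₁ (_ , p)) (inj₁ (_ , q)) = Place.place-injective (common H) B x y (ϕ B t x) p (trans q (cong just (sym eq)))
        go (inj₁ (b , _)) (inj₂ q) = ⊥-elim (proj₂ (∖-∋ A B (t y) (t-in y)) (subst (B ∋_) (trans eq q) b))
        go (inj₂ p) (inj₁ (b , _)) = ⊥-elim (proj₂ (∖-∋ A B (t x) (t-in x)) (subst (B ∋_) (trans (sym eq) p) b))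
        go (inj₂ p) (inj₂ q) = t-injective x y (trans (sym p) (trans eq q))
      blocked = some-blocked (ϕ B t) ϕ-injective
      within : petal B t (proj₁ blocked) ⊑ A
      within z h = go (petal-⊑ B t (proj₁ blocked) z h)
        where
        go : (B ∋ z) ⊎ (∃[ x ] t x ≡ z) → A ∋ z
        go (inj₁ b) = B⊑A z b
        go (inj₂ (x , e)) = subst (A ∋_) e (proj₁ (∖-∋ A B (t x) (t-in x)))

    -- Every removed point `z` lies in the blocking set of some `Y` of at most v remaining points,
    -- since by `hitset-apart` z is not in `Y`. So `A` can be recovered from `R` with polynomially
    -- many choices in k for each point.
    data Peel : ℕ → Subset n → Subset n → Set where
      done : ∀ {A} → Peel 0 A A
      peel : ∀ {s A R} z Y → A ∋ z → Y ⊑ A → ∣ Y ∣ ≤ v → hitset Y ∋ z → Peel s (A ∖ˢ single z) R → Peel (suc s) A R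

    restore : ∀ (A : Subset n) z → A ∋ z → (A ∖ˢ single z) ∪ single z ≡ A
    restore A z h = ⊑-antisym ((A ∖ˢ single z) ∪ single z) A (λ x p → to x (∪-∋ (A ∖ˢ single z) (single z) x p)) (λ x p → from x p (bool-case (lookup (single z) x)))
      where
      to : ∀ x → (A ∖ˢ single z ∋ x) ⊎ (single z ∋ x) → A ∋ x
      to x (inj₁ p) = proj₁ (∖-∋ A (single z) x p)
      to x (inj₂ s) = subst (A ∋_) (sym (single-≡ z x s)) h
      from : ∀ x → A ∋ x → _ → (A ∖ˢ single z) ∪ single z ∋ x
      from x p (inj₁ s) = ∪-∋ʳ (A ∖ˢ single z) (single z) x s
      from x p (inj₂ ¬s) = ∪-∋ˡ (A ∖ˢ single z) (single z) x (∋-∖ A (single z) x p (∌ {A = single z} ¬s))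

    remove-size : ∀ (A : Subset n) z → A ∋ z → suc ∣ A ∖ˢ single z ∣ ≡ ∣ A ∣
    remove-size A z h = trans (trans (+-comm 1 _) (cong (∣ A ∖ˢ single z ∣ +_) (sym (single-size z)))) (∖-size A (single z) (λ x s → subst (A ∋_) (sym (single-≡ z x s)) h))

    Peel-size : ∀ {s A R} → Peel s A R → s + ∣ R ∣ ≡ ∣ A ∣
    Peel-size done = refl
    Peel-size {A = A} (peel z Y a _ _ _ p) = trans (cong suc (Peel-size p)) (remove-size A z a)

    ext : Subset n → List (Subset n)
    ext R = concatMap (λ Y → map (λ z → R ∪ single z) (elements (hitset Y))) (smalls v R)

    extAll : ℕ → List (Subset n) → List (Subset n)
    extAll zero L = L
    extAll (suc s) L = concatMap ext (extAll s L)

    ext-length : ∀ R → length (ext R) ≤ suc ∣ R ∣ ^ v * jc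
    ext-length R = ≤-trans (concatMap-length (λ Y → map (λ z → R ∪ single z) (elements (hitset Y))) jc (smalls v R)
      (λ Y _ → ≤-trans (≤-reflexive (trans (length-map _ (elements (hitset Y))) (elements-length (hitset Y)))) (hitset-size Y)))
      (*-monoˡ-≤ jc (smalls-length v R))

    ext-size : ∀ R A → A ∈ ext R → ∣ A ∣ ≤ suc ∣ R ∣
    ext-size R A i with concatMap-∈ (λ Y → map (λ z → R ∪ single z) (elements (hitset Y))) (smalls v R) A i
    ... | Y , _ , j with ∈-map⁻ (λ z → R ∪ single z) j
    ... | z , _ , refl = ≤-trans (∪-size R (single z)) (≤-reflexive (trans (cong (∣ R ∣ +_) (single-size z)) (+-comm _ 1)))

    extAll-size : ∀ s κ L → (∀ R → R ∈ L → ∣ R ∣ ≤ κ) → ∀ A → A ∈ extAll s L → ∣ A ∣ ≤ s + κ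
    extAll-size zero κ L h A i = h A i
    extAll-size (suc s) κ L h A i with concatMap-∈ ext (extAll s L) A i
    ... | R , j , l = ≤-trans (ext-size R A l) (s≤s (extAll-size s κ L h R j))

    extAll-length : ∀ s κ L → (∀ R → R ∈ L → ∣ R ∣ ≤ κ) → s + κ ≤ k → length (extAll s L) ≤ (suc k ^ v * jc) ^ s * length L
    extAll-length zero κ L h l = ≤-reflexive (sym (+-identityʳ (length L)))
    extAll-length (suc s) κ L h l = ≤-trans (concatMap-length ext (suc k ^ v * jc) (extAll s L)
        (λ R i → ≤-trans (ext-length R) (*-monoˡ-≤ jc (^-monoˡ-≤ v (s≤s (≤-trans (extAll-size s κ L h R i) (≤-trans (n≤1+n _) l)))))))
      (≤-trans (*-monoˡ-≤ (suc k ^ v * jc) (extAll-length s κ L h (≤-trans (n≤1+n _) l))) (≤-reflexive (eq ((suc k ^ v * jc) ^ s) (length L) (suc k ^ v * jc))))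
      where
      eq : ∀ a b c → a * b * c ≡ c * a * b
      eq = solve-∀

    Peel-∈ : ∀ {s A R} L → Peel s A R → R ∈ L → A ∈ extAll s L
    Peel-∈ L done i = i
    Peel-∈ {suc s} {A} L (peel z Y a y l h p) i = ∈-concatMap ext (extAll s L) (A ∖ˢ single z) A (Peel-∈ L p i)
      (∈-concatMap (λ Y → map (λ w → (A ∖ˢ single z) ∪ single w) (elements (hitset Y))) (smalls v (A ∖ˢ single z)) Y A
        (∈-smalls v (A ∖ˢ single z) Y (λ x q → ∋-∖ A (single z) x (y x q) (λ s → hitset-apart Y z h (subst (Y ∋_) (single-≡ z x s) q))) l)
        (subst (_∈ map (λ w → (A ∖ˢ single z) ∪ single w) (elements (hitset Y))) (restore A z a) (∈-map⁺ (λ w → (A ∖ˢ single z) ∪ single w) (∈-elements (hitset Y) z h))))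

    ∖-∪ : ∀ (A B C : Subset n) → (A ∖ˢ B) ∖ˢ C ≡ A ∖ˢ (B ∪ C)
    ∖-∪ A B C = ⊑-antisym ((A ∖ˢ B) ∖ˢ C) (A ∖ˢ (B ∪ C)) to from
      where
      to : ((A ∖ˢ B) ∖ˢ C) ⊑ (A ∖ˢ (B ∪ C))
      to x p = let p' , ¬c = ∖-∋ (A ∖ˢ B) C x p
                   a , ¬b = ∖-∋ A B x p' in ∋-∖ A (B ∪ C) x a (λ h → go ¬b ¬c (∪-∋ B C x h))
        where
        go : (B ∋ x → ⊥) → (C ∋ x → ⊥) → (B ∋ x) ⊎ (C ∋ x) → ⊥
        go ¬b ¬c (inj₁ b) = ¬b b
        go ¬b ¬c (inj₂ c) = ¬c c
      from : (A ∖ˢ (B ∪ C)) ⊑ ((A ∖ˢ B) ∖ˢ C)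
      from x p = let a , ¬bc = ∖-∋ A (B ∪ C) x p in
        ∋-∖ (A ∖ˢ B) C x (∋-∖ A B x a (λ b → ¬bc (∪-∋ˡ B C x b))) (λ c → ¬bc (∪-∋ʳ B C x c))

    ∪-comm : ∀ (A B : Subset n) → A ∪ B ≡ B ∪ A
    ∪-comm A B = ⊑-antisym (A ∪ B) (B ∪ A) (swap A B) (swap B A)
      where
      swap : ∀ (A B : Subset n) → (A ∪ B) ⊑ (B ∪ A)
      swap A B x p = go (∪-∋ A B x p)
        where
        go : (A ∋ x) ⊎ (B ∋ x) → B ∪ A ∋ x
        go (inj₁ a) = ∪-∋ʳ B A x a
        go (inj₂ b) = ∪-∋ˡ B A x b

    ∖-∅ : ∀ {n} (A : Subset n) → A ∖ˢ ∅ ≡ A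
    ∖-∅ [] = refl
    ∖-∅ (true ∷ A) = cong (true ∷_) (∖-∅ A)
    ∖-∅ (false ∷ A) = cong (false ∷_) (∖-∅ A)

    record Votes (K : ℕ) (B : Subset n) (z : Fin n) (R : Subset n) : Set where
      field
        blocks : Blocks K v R
        votes : ∀ i → V B (Blocks.block blocks i) ∋ z

    votes-avoid : ∀ {K x B z R} Z → ∣ Z ∣ ≤ x → Votes (K + x) B z R → Votes K B z (R ∖ˢ Z)
    votes-avoid {K} {x} {B} {z} Z Z≤x vs = build (select-blocks (Votes.blocks vs) K (touching (Votes.blocks vs) Z)
        (+-monoʳ-≤ K (≤-trans (touching-size (Votes.blocks vs) Z) Z≤x)) Z (λ i y → touching-complete (Votes.blocks vs) Z i y))
      where
      build : _ → _
      build (b' , ι , eq , _) = record { blocks = b' ; votes = λ i → subst (λ t → V B t ∋ z) (sym (eq i)) (Votes.votes vs (ι i)) }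

    module Hubs (A : Subset n) (f : F A ≡ true) (B : Subset n) (B⊑A : B ⊑ A) (B≤c : ∣ B ∣ ≤ c) {N : ℕ} (b : Blocks N v (A ∖ˢ B)) where
      open Blocks b

      poll : ∀ i → ∃[ z ] (A ∋ z × ∃[ e ] (hitset (petal B (block i) e) ∋ z))
      poll i = vote A f B B⊑A (block i) (λ x y h → proj₂ (block-injective i i x y h)) (block-∋ i)

      w : Fin N → Fin n
      w i = proj₁ (poll i)

      supporters : Fin n → Subset N
      supporters z = tabulate (λ i → lookup (single (w i)) z)

      supporters-∋ : ∀ z i → supporters z ∋ i → z ≡ w i
      supporters-∋ z i h = single-≡ (w i) z (trans (sym (lookup∘tabulate _ i)) h)

      ∋-supporters : ∀ i → supporters (w i) ∋ i
      ∋-supporters i = trans (lookup∘tabulate _ i) (single-∋ (w i))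

      w∉B : ∀ i → B ∋ w i → ⊥
      w∉B i h = let _ , _ , e , l = poll i in hitset-apart (petal B (block i) e) (w i) l (B⊑petal B (block i) e B≤c (w i) h)

      -- One of the `suc K` supporting blocks may contain `z` and is given up, so K votes for z
      -- remain.
      hub : ∀ K z → suc K ≤ ∣ supporters z ∣ → A ∋ z × (B ∋ z → ⊥) × Votes K B z ((A ∖ˢ B) ∖ˢ single z)
      hub K z h = subst (A ∋_) (sym eq) (proj₁ (proj₂ (poll i₀))) , (λ p → w∉B i₀ (subst (B ∋_) eq p)) , build (select-blocks b K I size (single z) bad)
        where
        i₀ = enum (supporters z) (inject≤ (zero {K}) h)
        eq : z ≡ w i₀
        eq = supporters-∋ z i₀ (enum-∋ (supporters z) _)
        I = (full ∖ˢ supporters z) ∪ touching b (single z)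
        bad : ∀ i x → single z ∋ block i x → I ∋ i
        bad i x p = ∪-∋ʳ (full ∖ˢ supporters z) (touching b (single z)) i (touching-complete b (single z) i x p)
        size : K + ∣ I ∣ ≤ N
        size = ≤-trans (+-monoʳ-≤ K (≤-trans (∪-size (full ∖ˢ supporters z) (touching b (single z))) (+-monoʳ-≤ _ (≤-trans (touching-size b (single z)) (≤-reflexive (single-size z))))))
          (≤-trans (≤-reflexive (eq₁ K ∣ full ∖ˢ supporters z ∣)) (≤-trans (+-monoʳ-≤ _ h)
            (≤-reflexive (trans (∖-size full (supporters z) (λ x _ → full-∋ x)) (full-size N)))))
          where
          eq₁ : ∀ K c → K + (c + 1) ≡ c + suc K
          eq₁ = solve-∀
        build : _ → Votes K B z ((A ∖ˢ B) ∖ˢ single z)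
        build (b' , ι , same-block , out) = record { blocks = b' ; votes = λ i → subst (λ t → V B t ∋ z) (sym (same-block i)) (ballot (ι i) (supported (ι i) (out i))) }
          where
          supported : ∀ i → (I ∋ i → ⊥) → supporters z ∋ i
          supported i ¬I = go (bool-case (lookup (supporters z) i))
            where
            go : _ → supporters z ∋ i
            go (inj₁ p) = p
            go (inj₂ ¬p) = ⊥-elim (¬I (∪-∋ˡ (full ∖ˢ supporters z) (touching b (single z)) i (∋-∖ full (supporters z) i (full-∋ i) (∌ {A = supporters z} ¬p))))
          ballot : ∀ i → supporters z ∋ i → V B (block i) ∋ z
          ballot i p = let _ , _ , e , l = poll i in subst (V B (block i) ∋_) (sym (supporters-∋ z i p)) (∋-⋃ (λ e → hitset (petal B (block i) e)) e (w i) l)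

      -- The points of `Z` touch at most ∣ Z ∣ blocks and receive at most ∣ Z ∣ K votes. As long as
      -- (K + 1) ∣ Z ∣ < N, some block outside `Z` votes for a point not yet removed, and that point
      -- is peeled next.
      no-hub-peel : ∀ K S → S * suc K < suc N → (∀ z → ∣ supporters z ∣ ≤ K) → ∀ s Z → Disjoint Z B → ∣ Z ∣ + s ≤ S → ∃[ R ] Peel s (A ∖ˢ Z) R
      no-hub-peel K S S≤ few zero Z d l = _ , done
      no-hub-peel K S S≤ few (suc s) Z d l = _ , peel z (petal B (block i) e) z∈ petal⊑ (petal-size B (block i) e) hit (subst (λ X → Peel s X (proj₁ rest)) (sym (∖-∪ A Z (single z))) (proj₂ rest))
        where
        I = touching b Z ∪ ⋃ᴸ (map supporters (elements Z))
        I-size : ∣ I ∣ ≤ ∣ Z ∣ * suc K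
        I-size = ≤-trans (∪-size (touching b Z) _) (≤-trans (+-mono-≤ (touching-size b Z) (≤-trans (⋃ᴸ-size K (map supporters (elements Z))
            (λ W j → let y , _ , eq = ∈-map⁻ supporters j in subst (λ W → ∣ W ∣ ≤ K) (sym eq) (few y)))
            (≤-reflexive (cong (_* K) (trans (length-map supporters (elements Z)) (elements-length Z))))))
          (≤-reflexive (sym (*-suc (∣ Z ∣) K))))
        I<N : ∣ I ∣ < N
        I<N = ≤-trans (s≤s I-size) (≤-trans (+-monoˡ-≤ (∣ Z ∣ * suc K) (s≤s z≤n)) (≤-trans (*-monoˡ-≤ (suc K) (≤-trans (≤-trans (s≤s (m≤m+n (∣ Z ∣) s)) (≤-reflexive (sym (+-suc (∣ Z ∣) s)))) l)) (≤-pred S≤)))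
        i = proj₁ (outside I I<N)
        i∉I : I ∋ i → ⊥
        i∉I = ∌ {A = I} (proj₂ (outside I I<N))
        z = w i
        e = proj₁ (proj₂ (proj₂ (poll i)))
        hit = proj₂ (proj₂ (proj₂ (poll i)))
        z∉Z : Z ∋ z → ⊥
        z∉Z p = i∉I (∪-∋ʳ (touching b Z) (⋃ᴸ (map supporters (elements Z))) i (⊑-⋃ᴸ (map supporters (elements Z)) (supporters z) (∈-map⁺ supporters (∈-elements Z z p)) i (∋-supporters i)))
        z∈ : A ∖ˢ Z ∋ z
        z∈ = ∋-∖ A Z z (proj₁ (proj₂ (poll i))) z∉Z
        petal⊑ : petal B (block i) e ⊑ (A ∖ˢ Z)
        petal⊑ y p = go (petal-⊑ B (block i) e y p)
          where
          go : (B ∋ y) ⊎ (∃[ x ] block i x ≡ y) → A ∖ˢ Z ∋ y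
          go (inj₁ q) = ∋-∖ A Z y (B⊑A y q) (λ h → d y h q)
          go (inj₂ (x , refl)) = ∋-∖ A Z y (proj₁ (∖-∋ A B y (block-∋ i x))) (λ h → i∉I (∪-∋ˡ (touching b Z) (⋃ᴸ (map supporters (elements Z))) i (touching-complete b Z i x h)))
        rest : ∃[ R ] Peel s (A ∖ˢ (Z ∪ single z)) R
        rest = no-hub-peel K S S≤ few s (Z ∪ single z) d'
          (≤-trans (+-monoˡ-≤ s (≤-trans (∪-size Z (single z)) (≤-reflexive (trans (cong (∣ Z ∣ +_) (single-size z)) (+-comm (∣ Z ∣) 1))))) (≤-trans (≤-reflexive (sym (+-suc (∣ Z ∣) s))) l))
          where
          d' : Disjoint (Z ∪ single z) B
          d' y p q = go (∪-∋ Z (single z) y p)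
            where
            go : (Z ∋ y) ⊎ (single z ∋ y) → ⊥
            go (inj₁ h) = d y h q
            go (inj₂ h) = w∉B i (subst (B ∋_) (single-≡ z y h) q)

      hub-or-peel : ∀ K s → s * suc K ≤ N → (∃[ z ] (A ∋ z × (B ∋ z → ⊥) × Votes K B z ((A ∖ˢ B) ∖ˢ single z))) ⊎ (∃[ R ] Peel s A R)
      hub-or-peel K s h = go (scan (λ z → ∣ supporters z ∣ ≤? K))
        where
        scan : ∀ {n} {P : Fin n → Set} → (∀ z → Dec (P z)) → (∃[ z ] ¬ P z) ⊎ (∀ z → P z)
        scan {zero} d = inj₂ λ ()
        scan {suc n} d with d zero | scan (λ z → d (suc z))
        ... | no ¬p | _ = inj₁ (zero , ¬p)
        ... | yes p | inj₁ (z , q) = inj₁ (suc z , q)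
        ... | yes p | inj₂ q = inj₂ λ { zero → p ; (suc z) → q z }
        go : _ → _
        go (inj₁ (z , ¬p)) = inj₁ (z , hub K z (≰⇒> ¬p))
        go (inj₂ few) = let R , p = no-hub-peel K s (s≤s h) few s ∅ (λ x p _ → ∅-∌ x p) (≤-reflexive (cong (_+ s) (∅-size n))) in
          inj₂ (R , subst (λ X → Peel s X R) (∖-∅ A) p)

    -- Hubs found in succession: each is voted for by many disjoint blocks in the presence of the
    -- earlier hubs.
    data Chain (A : Subset n) (K : ℕ) : ℕ → Subset n → Set where
      start : Chain A K 0 ∅
      next : ∀ {i B} → Chain A K i B → ∀ z → A ∋ z → (B ∋ z → ⊥) → Votes K B z ((A ∖ˢ B) ∖ˢ single z) → Chain A K (suc i) (B ∪ single z)

    Chain-size : ∀ {A K i B} → Chain A K i B → ∣ B ∣ ≡ i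
    Chain-size start = ∅-size n
    Chain-size (next {B = B} ch z _ z∉B _) = trans (add-size B z z∉B) (cong suc (Chain-size ch))

    Chain-⊑ : ∀ {A K i B} → Chain A K i B → B ⊑ A
    Chain-⊑ start x p = ⊥-elim (∅-∌ x p)
    Chain-⊑ {A} (next {B = B} ch z a _ _) x p = go (∪-∋ B (single z) x p)
      where
      go : (B ∋ x) ⊎ (single z ∋ x) → A ∋ x
      go (inj₁ b) = Chain-⊑ ch x b
      go (inj₂ s) = subst (A ∋_) (sym (single-≡ z x s)) a

    -- At every stage the chain has at most c points and so fits on the common vertices, as voting
    -- requires. Hence it grows to c + 1 hubs unless many points peel off on the way.
    chain-or-peel : ∀ A → F A ≡ true → ∀ K s N → s * suc K ≤ N → N * v + τ ≤ k → ∀ i → i ≤ τ → (∃[ B ] Chain A K i B) ⊎ (∃[ R ] Peel s A R)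
    chain-or-peel A f K s N h room zero i≤ = inj₁ (∅ , start)
    chain-or-peel A f K s N h room (suc i) i≤ = go (chain-or-peel A f K s N h room i (≤-trans (n≤1+n i) i≤))
      where
      go : (∃[ B ] Chain A K i B) ⊎ (∃[ R ] Peel s A R) → (∃[ B ] Chain A K (suc i) B) ⊎ (∃[ R ] Peel s A R)
      go (inj₂ p) = inj₂ p
      go (inj₁ (B , ch)) = extend (Hubs.hub-or-peel A f B (Chain-⊑ ch) B≤c (cut N v (A ∖ˢ B) space) K s h)
        where
        B≤c : ∣ B ∣ ≤ c
        B≤c = ≤-trans (≤-reflexive (Chain-size ch)) (≤-pred i≤)
        space : N * v ≤ ∣ A ∖ˢ B ∣
        space = +-cancelʳ-≤ (∣ B ∣) _ _ (≤-trans (+-monoʳ-≤ (N * v) (≤-trans B≤c (n≤1+n c))) (≤-trans room (≤-reflexive (sym (trans (∖-size A B (Chain-⊑ ch)) (uniform A f))))))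
        extend : _ → _
        extend (inj₁ (z , a , z∉B , vs)) = inj₁ (B ∪ single z , next ch z a z∉B vs)
        extend (inj₂ p) = inj₂ p

    -- The hubs are removed in reverse order, so that the earlier ones are still present when a hub
    -- is decoded. At most τ points are gone and each spoils at most one block, hence a voting block
    -- survives. Thus the whole chain is recoverable from the rest of the member.
    chain-peel : ∀ {A K i B} → Chain A (suc K + τ) i B → ∀ Z → Disjoint Z B → ∣ Z ∣ + i ≤ τ → Peel i (A ∖ˢ Z) ((A ∖ˢ Z) ∖ˢ B)
    chain-peel {A} start Z d l = subst (Peel 0 (A ∖ˢ Z)) (sym (∖-∅ (A ∖ˢ Z))) done
    chain-peel {A} {K} {suc i} (next {B = B} ch z a z∉B vs) Z d l = peel z (petal B t e) (∋-∖ A Z z a (λ p → d z p (∪-∋ʳ B (single z) z (single-∋ z)))) petal⊑ (petal-size B t e) (proj₂ hit)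
        (subst₂ (Peel i) (sym (∖-∪ A Z (single z))) (trans (cong (_∖ˢ B) (sym (∖-∪ A Z (single z)))) (trans (∖-∪ (A ∖ˢ Z) (single z) B) (cong ((A ∖ˢ Z) ∖ˢ_) (∪-comm (single z) B))))
          (chain-peel ch (Z ∪ single z) d' (≤-trans (+-monoˡ-≤ i (≤-trans (∪-size Z (single z)) (≤-reflexive (trans (cong (∣ Z ∣ +_) (single-size z)) (+-comm (∣ Z ∣) 1))))) (≤-trans (≤-reflexive (sym (+-suc (∣ Z ∣) i))) l))))
      where
      vs' : Votes (suc K) B z (((A ∖ˢ B) ∖ˢ single z) ∖ˢ Z)
      vs' = votes-avoid Z (≤-trans (m≤m+n (∣ Z ∣) (suc i)) l) vs
      t = Blocks.block (Votes.blocks vs') zero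
      hit = ⋃-∋ (λ e → hitset (petal B t e)) z (Votes.votes vs' zero)
      e = proj₁ hit
      petal⊑ : petal B t e ⊑ (A ∖ˢ Z)
      petal⊑ y p = go (petal-⊑ B t e y p)
        where
        go : (B ∋ y) ⊎ (∃[ x ] t x ≡ y) → A ∖ˢ Z ∋ y
        go (inj₁ b) = ∋-∖ A Z y (Chain-⊑ ch y b) (λ h → d y h (∪-∋ˡ B (single z) y b))
        go (inj₂ (x , refl)) = let p₁ , ¬Z = ∖-∋ ((A ∖ˢ B) ∖ˢ single z) Z (t x) (Blocks.block-∋ (Votes.blocks vs') zero x)
                                   p₂ , _ = ∖-∋ (A ∖ˢ B) (single z) (t x) p₁ in ∋-∖ A Z (t x) (proj₁ (∖-∋ A B (t x) p₂)) ¬Z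
      d' : Disjoint (Z ∪ single z) B
      d' y p q = go (∪-∋ Z (single z) y p)
        where
        go : (Z ∋ y) ⊎ (single z ∋ y) → ⊥
        go (inj₁ h) = d y h (∪-∋ˡ B (single z) y q)
        go (inj₂ s) = z∉B (subst (B ∋_) (single-≡ z y s) q)

    image-cong : ∀ {w} {φ ψ : Fin w → Fin n} → (∀ x → φ x ≡ ψ x) → ∀ E → image φ E ≡ image ψ E
    image-cong h [] = refl
    image-cong h (true ∷ E) = cong₂ (λ y X → single y ∪ X) (h zero) (image-cong (λ x → h (suc x)) E)
    image-cong h (false ∷ E) = image-cong (λ x → h (suc x)) E

    ⋃-cong : ∀ {m} {X Y : Fin m → Subset n} → (∀ e → X e ≡ Y e) → ⋃ X ≡ ⋃ Y
    ⋃-cong {zero} h = refl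
    ⋃-cong {suc m} h = cong₂ _∪_ (h zero) (⋃-cong (λ e → h (suc e)))

    V-cong : ∀ B {s t : Fin v → Fin n} → (∀ x → s x ≡ t x) → V B s ≡ V B t
    V-cong B h = ⋃-cong (λ e → cong hitset (image-cong (λ x → cong (λ y → fromMaybe y (Place.place (common H) B x)) (h x)) (edge e)))

    tuples : ∀ w → List (Vec (Fin n) w)
    tuples zero = [] List.∷ List.[]
    tuples (suc w) = concatMap (λ t → map (_∷ t) (allFin n)) (tuples w)

    tuples-length : ∀ w → length (tuples w) ≤ n ^ w
    tuples-length zero = ≤-refl
    tuples-length (suc w) = ≤-trans (concatMap-length (λ t → map (_∷ t) (allFin n)) n (tuples w) (λ t _ → ≤-reflexive (trans (length-map (_∷ t) (allFin n)) (length-tabulate (λ x → x)))))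
      (≤-trans (*-monoˡ-≤ n (tuples-length w)) (≤-reflexive (*-comm (n ^ w) n)))

    ∈-tuples : ∀ {w} (t : Vec (Fin n) w) → t ∈ tuples w
    ∈-tuples [] = here refl
    ∈-tuples (x ∷ t) = ∈-concatMap (λ t → map (_∷ t) (allFin n)) (tuples _) t (x ∷ t) (∈-tuples t) (∈-map⁺ (_∷ t) (∈-allFin x))

    Tuple : Set
    Tuple = Vec (Fin n) v

    voters : Subset n → Fin n → List Tuple → List Tuple
    voters B z List.[] = List.[]
    voters B z (t List.∷ ts) = if lookup (V B (lookup t)) z then t List.∷ voters B z ts else voters B z ts

    ∈-voters : ∀ B z ts t → t ∈ ts → V B (lookup t) ∋ z → t ∈ voters B z ts
    ∈-voters B z (t List.∷ ts) .t (here refl) h rewrite h = here refl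
    ∈-voters B z (s List.∷ ts) t (there i) h with lookup (V B (lookup s)) z
    ... | true = there (∈-voters B z ts t i h)
    ... | false = ∈-voters B z ts t i h

    voters-step : ∀ B z t ts → length (voters B z (t List.∷ ts)) ≡ bit (lookup (V B (lookup t)) z) + length (voters B z ts)
    voters-step B z t ts with lookup (V B (lookup t)) z
    ... | true = refl
    ... | false = refl

    sumOver : ∀ {n} → Subset n → (Fin n → ℕ) → ℕ
    sumOver [] f = 0
    sumOver (b ∷ X) f = bit b * f zero + sumOver X (λ z → f (suc z))

    sumOver-lower : ∀ {n} (X : Subset n) f u q → (∀ z → X ∋ z → u ≤ q * f z) → ∣ X ∣ * u ≤ q * sumOver X f
    sumOver-lower [] f u q h = z≤n
    sumOver-lower (true ∷ X) f u q h = ≤-trans (+-mono-≤ (h zero refl) (sumOver-lower X (λ z → f (suc z)) u q (λ z → h (suc z)))) (≤-reflexive (eq q (f zero) _))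
      where
      eq : ∀ q a b → q * a + q * b ≡ q * (1 * a + b)
      eq = solve-∀
    sumOver-lower (false ∷ X) f u q h = sumOver-lower X (λ z → f (suc z)) u q (λ z → h (suc z))

    sumOver-add : ∀ {n} (X : Subset n) f g → sumOver X (λ z → f z + g z) ≡ sumOver X f + sumOver X g
    sumOver-add [] f g = refl
    sumOver-add (b ∷ X) f g = trans (cong (bit b * (f zero + g zero) +_) (sumOver-add X (λ z → f (suc z)) (λ z → g (suc z)))) (eq (bit b) (f zero) (g zero) _ _)
      where
      eq : ∀ b x y s t → b * (x + y) + (s + t) ≡ b * x + s + (b * y + t)
      eq = solve-∀

    sumOver-bit : ∀ {n} (X W : Subset n) → sumOver X (λ z → bit (lookup W z)) ≤ ∣ W ∣
    sumOver-bit [] [] = z≤n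
    sumOver-bit (true ∷ X) (true ∷ W) = s≤s (sumOver-bit X W)
    sumOver-bit (true ∷ X) (false ∷ W) = sumOver-bit X W
    sumOver-bit (false ∷ X) (true ∷ W) = m≤n⇒m≤1+n (sumOver-bit X W)
    sumOver-bit (false ∷ X) (false ∷ W) = sumOver-bit X W

    sumOver-cong : ∀ {n} (X : Subset n) {f g} → (∀ z → f z ≡ g z) → sumOver X f ≡ sumOver X g
    sumOver-cong [] h = refl
    sumOver-cong (b ∷ X) h = cong₂ (λ x y → bit b * x + y) (h zero) (sumOver-cong X (λ z → h (suc z)))

    sumOver-zero : ∀ {n} (X : Subset n) → sumOver X (λ _ → 0) ≡ 0
    sumOver-zero [] = refl
    sumOver-zero (b ∷ X) = cong₂ _+_ (*-zeroʳ (bit b)) (sumOver-zero X)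

    voters-total : ∀ B X ts → sumOver X (λ z → length (voters B z ts)) ≤ length ts * (m * jc)
    voters-total B X List.[] = ≤-reflexive (sumOver-zero X)
    voters-total B X (t List.∷ ts) = ≤-trans (≤-reflexive (trans (sumOver-cong X (λ z → voters-step B z t ts)) (sumOver-add X (λ z → bit (lookup (V B (lookup t)) z)) (λ z → length (voters B z ts)))))
      (+-mono-≤ (≤-trans (sumOver-bit X (V B (lookup t))) (V-size B (lookup t))) (voters-total B X ts))

    module _ (1≤k : 1 ≤ k) (1≤n : 1 ≤ n) where

      -- A point is big if at least a fraction 1/Q of all v-tuples votes for it; as a tuple casts at
      -- most m jc votes, there are at most `bg` big points. Of `Q` the factor (2k)^v makes up for
      -- prescribing v points of a member, and the factor 2 is the gain per block.
      Q bg : ℕ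
      Q = 2 * (2 * k) ^ v
      bg = Q * (m * jc)

      1≤Q : 1 ≤ Q
      1≤Q = *-mono-≤ {1} {2} (s≤s z≤n) (pow-pos v (*-mono-≤ {1} {2} (s≤s z≤n) 1≤k))

      instance
        Q≢0 : NonZero Q
        Q≢0 = >-nonZero 1≤Q

      Big : Subset n → Subset n
      Big B = tabulate (λ z → n ^ v ≤ᵇ Q * length (voters B z (tuples v)))

      Big-size : ∀ B → ∣ Big B ∣ ≤ bg
      Big-size B = *-cancelʳ-pos (n ^ v) (pow-pos v 1≤n) (≤-trans
        (sumOver-lower (Big B) (λ z → length (voters B z (tuples v))) (n ^ v) Q (λ z h → ≤ᵇ⇒≤ _ _ (subst Data.Bool.T (sym (trans (sym (lookup∘tabulate _ z)) h)) _)))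
        (≤-trans (*-monoʳ-≤ Q (≤-trans (voters-total B (Big B) (tuples v)) (*-monoˡ-≤ (m * jc) (tuples-length v)))) (≤-reflexive (eq Q (n ^ v) (m * jc)))))
        where
        eq : ∀ q a b → q * (a * b) ≡ q * b * a
        eq = solve-∀

      few-voters : ∀ B z → lookup (Big B) z ≡ false → length (voters B z (tuples v)) ≤ n ^ v / Q
      few-voters B z h = subst (_≤ n ^ v / Q) (m*n/n≡m (length (voters B z (tuples v))) Q)
        (/-monoˡ-≤ Q (≤-trans (≤-reflexive (*-comm (length (voters B z (tuples v))) Q)) (<⇒≤ (≰⇒> (λ l → false≢true (trans (sym h) (trans (lookup∘tabulate _ z) (T-true (≤⇒≤ᵇ l)))))))))

      -- Chains of big points only. The list does not depend on the member and is polynomially long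
      -- in k.
      frees : ℕ → List (Subset n)
      frees zero = ∅ List.∷ List.[]
      frees (suc i) = concatMap (λ B → B List.∷ map (λ z → B ∪ single z) (elements (Big B))) (frees i)

      frees-length : ∀ i → length (frees i) ≤ suc bg ^ i
      frees-length zero = ≤-refl
      frees-length (suc i) = ≤-trans (concatMap-length (λ B → B List.∷ map (λ z → B ∪ single z) (elements (Big B))) (suc bg) (frees i)
          (λ B _ → s≤s (≤-trans (≤-reflexive (trans (length-map _ (elements (Big B))) (elements-length (Big B)))) (Big-size B))))
        (≤-trans (*-monoˡ-≤ (suc bg) (frees-length i)) (≤-reflexive (*-comm (suc bg ^ i) (suc bg))))

      frees-suc : ∀ i B → B ∈ frees i → B ∈ frees (suc i)
      frees-suc i B h = ∈-concatMap (λ B → B List.∷ map (λ z → B ∪ single z) (elements (Big B))) (frees i) B B h (here refl)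

      -- Some hub is not big and yet many disjoint blocks of the member vote for it. Few sets have
      -- this property.
      Weak : Subset n → ℕ → ℕ → Set
      Weak A K i = ∃[ B ] ∃[ z ] (B ∈ frees i × lookup (Big B) z ≡ false × Votes K B z ((A ∖ˢ B) ∖ˢ single z))

      chain-frees : ∀ {A K i B} → Chain A K i B → (B ∈ frees i) ⊎ Weak A K i
      chain-frees start = inj₁ (here refl)
      chain-frees {A} {K} {suc i} (next {B = B} ch z a z∉B vs) = go (chain-frees ch) (bool-case (lookup (Big B) z))
        where
        go : (B ∈ frees i) ⊎ Weak A K i → _ → (B ∪ single z ∈ frees (suc i)) ⊎ Weak A K (suc i)
        go (inj₂ (B' , z' , f , rest)) _ = inj₂ (B' , z' , frees-suc i B' f , rest)
        go (inj₁ f) (inj₁ big) = inj₁ (∈-concatMap (λ B → B List.∷ map (λ z → B ∪ single z) (elements (Big B))) (frees i) B (B ∪ single z) f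
          (there (∈-map⁺ (λ z → B ∪ single z) (∈-elements (Big B) z big))))
        go (inj₁ f) (inj₂ small) = inj₂ (B , z , frees-suc i B f , small , vs)

      unions : ℕ → List Tuple → List (Subset n)
      unions zero ts = ∅ List.∷ List.[]
      unions (suc a) ts = concatMap (λ t → map (image (lookup t) full ∪_) (unions a ts)) ts

      unions-length : ∀ a ts → length (unions a ts) ≤ length ts ^ a
      unions-length zero ts = ≤-refl
      unions-length (suc a) ts = concatMap-length (λ t → map (image (lookup t) full ∪_) (unions a ts)) (length ts ^ a) ts
        (λ t _ → ≤-trans (≤-reflexive (length-map _ (unions a ts))) (unions-length a ts))

      block-union : ∀ {a} → (Fin a → Fin v → Fin n) → Subset n
      block-union {zero} b = ∅
      block-union {suc a} b = image (b zero) full ∪ block-union (λ i → b (suc i))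

      block-union-∋ : ∀ {a} (b : Fin a → Fin v → Fin n) z → block-union b ∋ z → ∃[ i ] ∃[ x ] b i x ≡ z
      block-union-∋ {zero} b z h = ⊥-elim (∅-∌ z h)
      block-union-∋ {suc a} b z h = go (∪-∋ (image (b zero) full) (block-union (λ i → b (suc i))) z h)
        where
        go : _ → ∃[ i ] ∃[ x ] b i x ≡ z
        go (inj₁ p) = let x , _ , e = image-∋ (b zero) full z p in zero , x , e
        go (inj₂ p) = let i , x , e = block-union-∋ (λ i → b (suc i)) z p in suc i , x , e

      block-union-size : ∀ {a} (b : Fin a → Fin v → Fin n) → (∀ i j x y → b i x ≡ b j y → (i ≡ j) × (x ≡ y)) → ∣ block-union b ∣ ≡ a * v
      block-union-size {zero} b inj = ∅-size n
      block-union-size {suc a} b inj = trans (∪-disjoint-size (image (b zero) full) (block-union (λ i → b (suc i))) apart)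
        (cong₂ _+_ (trans (image-size (b zero) (λ x y e → proj₂ (inj zero zero x y e)) full) (full-size v))
          (block-union-size (λ i → b (suc i)) (λ i j x y e → let p , q = inj (suc i) (suc j) x y e in suc-injective p , q)))
        where
        apart : Disjoint (image (b zero) full) (block-union (λ i → b (suc i)))
        apart z p q with image-∋ (b zero) full z p | block-union-∋ (λ i → b (suc i)) z q
        ... | x , _ , e | i , y , e' with () ← proj₁ (inj zero (suc i) x y (trans e (sym e')))

      ∈-unions : ∀ {a} (b : Fin a → Fin v → Fin n) ts → (∀ i → tabulate (b i) ∈ ts) → block-union b ∈ unions a ts
      ∈-unions {zero} b ts h = here refl
      ∈-unions {suc a} b ts h = ∈-concatMap (λ t → map (image (lookup t) full ∪_) (unions a ts)) ts (tabulate (b zero)) _ (h zero)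
        (subst (λ X → (X ∪ block-union (λ i → b (suc i))) ∈ map (image (lookup (tabulate (b zero))) full ∪_) (unions a ts)) (image-cong (lookup∘tabulate (b zero)) full)
          (∈-map⁺ (image (lookup (tabulate (b zero))) full ∪_) (∈-unions (λ i → b (suc i)) ts (λ i → h (suc i)))))

      -- All sets of size κ that contain suc a disjoint blocks voting for a point z that is not big.
      sparse : ℕ → ℕ → Subset n → List (Subset n)
      sparse a κ B = concatMap (λ t → concatMap (λ z → if lookup (Big B) z then List.[] else
          concatMap (λ U → map (λ R → (image (lookup t) full ∪ U) ∪ R) (levels n (κ ∸ suc a * v))) (unions a (voters B z (tuples v))))
        (elements (V B (lookup t)))) (tuples v)

      -- The first block is arbitrary and leaves m jc choices for the hub; each of the a others is
      -- one of its voters, at most n^v / Q in number; the remaining points are free.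
      sparse-length : ∀ a κ B → length (sparse a κ B) ≤ n ^ v * (m * jc * ((n ^ v / Q) ^ a * choose n (κ ∸ suc a * v)))
      sparse-length a κ B = ≤-trans (concatMap-length _ (m * jc * X) (tuples v) (λ t _ → ≤-trans
          (concatMap-length _ X (elements (V B (lookup t))) (λ z _ → inner t z (lookup (Big B) z) refl))
          (*-monoˡ-≤ X (≤-trans (≤-reflexive (elements-length (V B (lookup t)))) (V-size B (lookup t))))))
        (*-monoˡ-≤ (m * jc * X) (tuples-length v))
        where
        C = choose n (κ ∸ suc a * v)
        X = (n ^ v / Q) ^ a * C
        inner : ∀ t z b → lookup (Big B) z ≡ b → length (if b then List.[] else
          concatMap (λ U → map (λ R → (image (lookup t) full ∪ U) ∪ R) (levels n (κ ∸ suc a * v))) (unions a (voters B z (tuples v)))) ≤ X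
        inner t z true h = z≤n
        inner t z false h = ≤-trans (concatMap-length (λ U → map (λ R → (image (lookup t) full ∪ U) ∪ R) (levels n (κ ∸ suc a * v))) C (unions a (voters B z (tuples v)))
            (λ U _ → ≤-reflexive (trans (length-map _ (levels n (κ ∸ suc a * v))) (levels-length n (κ ∸ suc a * v)))))
          (*-monoˡ-≤ C (≤-trans (unions-length a (voters B z (tuples v))) (^-monoˡ-≤ a (few-voters B z h))))

      ∈-sparse : ∀ a κ B z R → lookup (Big B) z ≡ false → Votes (suc a) B z R → ∀ R' → R ⊑ R' → ∣ R' ∣ ≡ κ → R' ∈ sparse a κ B
      ∈-sparse a κ B z R small vs R' R⊑ size = ∈-concatMap _ (tuples v) (tabulate (b zero)) R' (∈-tuples (tabulate (b zero)))
        (∈-concatMap _ (elements (V B (lookup (tabulate (b zero))))) z R' (∈-elements (V B (lookup (tabulate (b zero)))) z (ballot zero))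
          (inner (lookup (Big B) z) small))
        where
        b = Blocks.block (Votes.blocks vs)
        ballot : ∀ i → V B (lookup (tabulate (b i))) ∋ z
        ballot i = subst (_∋ z) (V-cong B (λ x → sym (lookup∘tabulate (b i) x))) (Votes.votes vs i)
        U = block-union (λ i → b (suc i))
        P = image (b zero) full ∪ U
        P⊑ : P ⊑ R'
        P⊑ y p = let i , x , e = block-union-∋ b y p in R⊑ y (subst (R ∋_) e (Blocks.block-∋ (Votes.blocks vs) i x))
        rest-size : ∣ R' ∖ˢ P ∣ ≡ κ ∸ suc a * v
        rest-size = trans (sym (m+n∸n≡m (∣ R' ∖ˢ P ∣) (∣ P ∣))) (cong₂ _∸_ (trans (∖-size R' P P⊑) size) (block-union-size b (Blocks.block-injective (Votes.blocks vs))))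
        whole : P ∪ (R' ∖ˢ P) ≡ R'
        whole = ⊑-antisym _ R' (λ y p → to y (∪-∋ P (R' ∖ˢ P) y p)) (λ y p → from y p (bool-case (lookup P y)))
          where
          to : ∀ y → (P ∋ y) ⊎ (R' ∖ˢ P ∋ y) → R' ∋ y
          to y (inj₁ p) = P⊑ y p
          to y (inj₂ q) = proj₁ (∖-∋ R' P y q)
          from : ∀ y → R' ∋ y → _ → P ∪ (R' ∖ˢ P) ∋ y
          from y r (inj₁ p) = ∪-∋ˡ P (R' ∖ˢ P) y p
          from y r (inj₂ ¬p) = ∪-∋ʳ P (R' ∖ˢ P) y (∋-∖ R' P y r (∌ {A = P} ¬p))
        inner : ∀ c → c ≡ false → R' ∈ (if c then List.[] else
          concatMap (λ U → map (λ R → (image (lookup (tabulate (b zero))) full ∪ U) ∪ R) (levels n (κ ∸ suc a * v))) (unions a (voters B z (tuples v))))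
        inner false refl = ∈-concatMap (λ U → map (λ R → (image (lookup (tabulate (b zero))) full ∪ U) ∪ R) (levels n (κ ∸ suc a * v))) (unions a (voters B z (tuples v))) U R'
          (∈-unions (λ i → b (suc i)) (voters B z (tuples v)) (λ i → ∈-voters B z (tuples v) (tabulate (b (suc i))) (∈-tuples _) (ballot (suc i))))
          (subst (_∈ map (λ R → (image (lookup (tabulate (b zero))) full ∪ U) ∪ R) (levels n (κ ∸ suc a * v)))
            (trans (cong (λ X → (X ∪ U) ∪ (R' ∖ˢ P)) (image-cong (lookup∘tabulate (b zero)) full)) whole)
            (∈-map⁺ (λ R → (image (lookup (tabulate (b zero))) full ∪ U) ∪ R) (∈-levels (κ ∸ suc a * v) (R' ∖ˢ P) rest-size)))

      κτ Pk : ℕ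
      κτ = k ∸ τ
      Pk = suc k ^ v * jc

      heavy : ℕ → Subset n → Bool
      heavy X S = choose n κτ ≤ᵇ 2 ^ X * cnt (link F S)

      residues : ℕ → List (Subset n)
      residues a = keep (sized κτ) (concatMap (sparse a κτ) (frees τ))

      -- Three kinds of members can remain uncovered: those from which c + 2 points peel off; those
      -- with a weak chain, recovered from a sparse rest; and those whose chain is in `frees` but
      -- has a light link. A chain in `frees` with a heavy link joins the cover.
      census : ∀ X a N → suc τ * suc (suc a + τ) ≤ N → N * v + τ ≤ k → suc τ ≤ k →
        Σ (List (Subset n)) λ 𝒮 → (∀ S → S ∈ 𝒮 → (∣ S ∣ ≡ τ) × choose n κτ ≤ 2 ^ X * cnt (link F S)) ×
          cnt (λ A → F A ∧ not (any 𝒮 (λ S → ⊑ᵇ S A))) ≤ Pk ^ suc τ * choose n (k ∸ suc τ) +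
            (Pk ^ τ * (suc bg ^ τ * (n ^ v * (m * jc * ((n ^ v / Q) ^ a * choose n (κτ ∸ suc a * v)))))
              + suc bg ^ τ * (_/_ (choose n κτ) (2 ^ X) {{m^n≢0 2 X}}))
      census X a N h room τ<k = 𝒮 , 𝒮-good , ≤-trans (cnt-cover _ (λ A → member L₁ A ∧ F A) (λ A → (member L₂ A ∧ F A) ∨ (any light (λ S → ⊑ᵇ S A) ∧ F A)) cover)
          (+-mono-≤ (≤-trans (list-bound L₁) L₁-length) (≤-trans (cnt-∨ (λ A → member L₂ A ∧ F A) (λ A → any light (λ S → ⊑ᵇ S A) ∧ F A)) (+-mono-≤ (≤-trans (list-bound L₂) L₂-length) light-bound)))
        where
        instance
          2^X≢0 : NonZero (2 ^ X)
          2^X≢0 = m^n≢0 2 X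
        full-size-heavy full-size-light : Subset n → Bool
        full-size-heavy S = sized τ S ∧ heavy X S
        full-size-light S = sized τ S ∧ not (heavy X S)
        𝒮 light L₁ L₂ : List (Subset n)
        𝒮 = keep full-size-heavy (frees τ)
        light = keep full-size-light (frees τ)
        L₁ = extAll (suc τ) (levels n (k ∸ suc τ))
        L₂ = extAll τ (residues a)
        𝒮-good : ∀ S → S ∈ 𝒮 → (∣ S ∣ ≡ τ) × choose n κτ ≤ 2 ^ X * cnt (link F S)
        𝒮-good S i = let _ , p = keep-∈ full-size-heavy (frees τ) S i
                         q , r = ∧-true {sized τ S} p in ≡ᵇ-true ∣ S ∣ τ q , ≤ᵇ⇒≤ _ _ (subst Data.Bool.T (sym r) _)
        member : List (Subset n) → Subset n → Bool
        member L A = any L (λ W → same W A)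
        list-bound : ∀ L → cnt (λ A → member L A ∧ F A) ≤ length L
        list-bound L = ≤-trans (cnt-any F L same 1 (λ W _ → ≤-trans (cnt-mono (λ A p → proj₁ (∧-true {same W A} p))) (cnt-same W))) (≤-reflexive (*-identityʳ (length L)))
        ∈-member : ∀ L A → A ∈ L → member L A ≡ true
        ∈-member L A i = ∈-any L (λ W → same W A) A i (∧-intro (⊑ᵇ-complete A A (λ _ p → p)) (⊑ᵇ-complete A A (λ _ p → p)))
        L₁-length : length L₁ ≤ Pk ^ suc τ * choose n (k ∸ suc τ)
        L₁-length = ≤-trans (extAll-length (suc τ) (k ∸ suc τ) (levels n (k ∸ suc τ)) (λ R i → ≤-reflexive (levels-∈ (k ∸ suc τ) R i)) (≤-reflexive (m+[n∸m]≡n τ<k)))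
          (≤-reflexive (cong (Pk ^ suc τ *_) (levels-length n (k ∸ suc τ))))
        L₂-length : length L₂ ≤ Pk ^ τ * (suc bg ^ τ * (n ^ v * (m * jc * ((n ^ v / Q) ^ a * choose n (κτ ∸ suc a * v)))))
        L₂-length = ≤-trans (extAll-length τ κτ (residues a) (λ R i → ≤-reflexive (≡ᵇ-true ∣ R ∣ κτ (proj₂ (keep-∈ (sized κτ) (concatMap (sparse a κτ) (frees τ)) R i)))) (≤-reflexive (m+[n∸m]≡n (<⇒≤ τ<k))))
          (*-monoʳ-≤ (Pk ^ τ) (≤-trans (keep-length (sized κτ) (concatMap (sparse a κτ) (frees τ))) (≤-trans (concatMap-length (sparse a κτ) _ (frees τ) (λ B _ → sparse-length a κτ B))
            (*-monoˡ-≤ _ (frees-length τ)))))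
        light-bound : cnt (λ A → any light (λ S → ⊑ᵇ S A) ∧ F A) ≤ suc bg ^ τ * (choose n κτ / 2 ^ X)
        light-bound = ≤-trans (cnt-any F light ⊑ᵇ (choose n κτ / 2 ^ X) (λ S i → ≤-trans (cnt-link F S) (bound S (keep-∈ full-size-light (frees τ) S i))))
          (*-monoˡ-≤ (choose n κτ / 2 ^ X) (≤-trans (keep-length full-size-light (frees τ)) (frees-length τ)))
          where
          not-true : ∀ {b} → not b ≡ true → b ≡ true → ⊥
          not-true {true} () _
          not-true {false} _ ()
          bound : ∀ S → (S ∈ frees τ) × full-size-light S ≡ true → cnt (link F S) ≤ choose n κτ / 2 ^ X
          bound S (_ , p) = subst (_≤ choose n κτ / 2 ^ X) (m*n/n≡m (cnt (link F S)) (2 ^ X)) (/-monoˡ-≤ (2 ^ X)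
            (≤-trans (≤-reflexive (*-comm (cnt (link F S)) (2 ^ X))) (<⇒≤ (≰⇒> (λ l → not-true (proj₂ (∧-true {sized τ S} p)) (T-true (≤⇒≤ᵇ l)))))))
        cover : ∀ A → (F A ∧ not (any 𝒮 (λ S → ⊑ᵇ S A))) ≡ true →
          ((member L₁ A ∧ F A) ≡ true) ⊎ (((member L₂ A ∧ F A) ∨ (any light (λ S → ⊑ᵇ S A) ∧ F A)) ≡ true)
        cover A p = go (chain-or-peel A f (suc a + τ) (suc τ) N h room τ ≤-refl)
          where
          f = proj₁ (∧-true {F A} p)
          uncovered = proj₂ (∧-true {F A} p)
          Goal = ((member L₁ A ∧ F A) ≡ true) ⊎ (((member L₂ A ∧ F A) ∨ (any light (λ S → ⊑ᵇ S A) ∧ F A)) ≡ true)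
          chained : ∀ S → Chain A (suc a + τ) τ S → (S ∈ frees τ) ⊎ Weak A (suc a + τ) τ → Goal
          chained S ch (inj₁ i) = inj₂ (∨-right _ (∧-intro (∈-any light (λ S → ⊑ᵇ S A) S (∈-keep full-size-light (frees τ) S i
              (∧-intro (to-sized {A = S} (Chain-size ch)) (not-heavy (heavy X S) refl))) S⊑ᵇA) f))
            where
            S⊑ᵇA = ⊑ᵇ-complete S A (Chain-⊑ ch)
            clash : ∀ {b} → not b ≡ true → b ≡ true → ⊥
            clash {true} () _
            clash {false} _ ()
            not-heavy : ∀ b → heavy X S ≡ b → not (heavy X S) ≡ true
            not-heavy false e = cong not e
            not-heavy true e = ⊥-elim (clash uncovered (∈-any 𝒮 (λ S → ⊑ᵇ S A) S (∈-keep full-size-heavy (frees τ) S i (∧-intro (to-sized {A = S} (Chain-size ch)) e)) S⊑ᵇA))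
          chained S ch (inj₂ (B , z , i , small , vs)) = inj₂ (∨-left _ (∧-intro (∈-member L₂ A (Peel-∈ (residues a) peeled
              (∈-keep (sized κτ) _ (A ∖ˢ S) (∈-concatMap (sparse a κτ) (frees τ) B (A ∖ˢ S) i
                (∈-sparse a κτ B z _ small (votes-avoid S (≤-reflexive (Chain-size ch)) vs) (A ∖ˢ S) sub R-size)) (to-sized {A = A ∖ˢ S} R-size)))) f))
            where
            R-size : ∣ A ∖ˢ S ∣ ≡ κτ
            R-size = trans (sym (m+n∸n≡m (∣ A ∖ˢ S ∣) (∣ S ∣))) (cong₂ _∸_ (trans (∖-size A S (Chain-⊑ ch)) (uniform A f)) (Chain-size ch))
            sub : (((A ∖ˢ B) ∖ˢ single z) ∖ˢ S) ⊑ (A ∖ˢ S)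
            sub x q = let q₁ , ¬S = ∖-∋ ((A ∖ˢ B) ∖ˢ single z) S x q
                          q₂ , _ = ∖-∋ (A ∖ˢ B) (single z) x q₁ in ∋-∖ A S x (proj₁ (∖-∋ A B x q₂)) ¬S
            peeled : Peel τ A (A ∖ˢ S)
            peeled = subst (λ Y → Peel τ Y (Y ∖ˢ S)) (∖-∅ A) (chain-peel ch ∅ (λ x q _ → ∅-∌ x q) (≤-reflexive (cong (_+ τ) (∅-size n))))
          go : (∃[ S ] Chain A (suc a + τ) τ S) ⊎ (∃[ R ] Peel (suc τ) A R) → Goal
          go (inj₂ (R , q)) = inj₁ (∧-intro (∈-member L₁ A (Peel-∈ (levels n (k ∸ suc τ)) q (∈-levels (k ∸ suc τ) R
              (trans (sym (m+n∸m≡n (suc τ) (∣ R ∣))) (cong (_∸ suc τ) (trans (Peel-size q) (uniform A f))))))) f)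
          go (inj₁ (S , ch)) = chained S ch (chain-frees ch)

-- Numerical bounds for the decoding argument.

module SparseCover where
  open import Defs using (Family; FinHypergraph; expSum)
  open Count
  open Fair
  open Sets
  open Tree using (any)
  open Copy using (n≤2^n)
  open Peel using (module Sparse)
  open import Data.Nat
  open import Data.Nat.Properties
  open import Data.Nat.DivMod using (m/n*n≤m; m*n/n≡m; /-monoˡ-≤)
  open import Data.Nat.Tactic.RingSolver using (solve-∀)
  open import Data.Bool using (true; not; _∧_)
  open import Data.Fin.Subset using (Subset; ∣_∣)
  open import Data.List using (List)
  open import Data.List.Membership.Propositional using (_∈_)
  open import Data.Product using (_×_; _,_; Σ; proj₁; proj₂)
  open import Data.Empty using (⊥)
  open import Relation.Binary.PropositionalEquality

  n≤2^ : ∀ {a b} → a ≤ b → a ≤ 2 ^ b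
  n≤2^ {a} {b} h = ≤-trans h (n≤2^n b)

  -- With q = k / G, G = 2E(d + 1), both A G and q + 1 are at most 2^q, so A k ≤ 4^q; and 2q (d + 1)
  -- ≤ k / E.
  poly≤exp : ∀ A d E .{{_ : NonZero E}} k → A * (2 * E * suc d) * (2 * E * suc d) ≤ k → (A * k) ^ suc d ≤ 2 ^ (k / E)
  poly≤exp A d E k h = begin
    (A * k) ^ suc d ≤⟨ ^-monoˡ-≤ (suc d) small ⟩
    (2 ^ (2 * q)) ^ suc d ≡⟨ ^-*-assoc 2 (2 * q) (suc d) ⟩
    2 ^ (2 * q * suc d) ≤⟨ ^-monoʳ-≤ 2 exponent ⟩
    2 ^ (k / E) ∎
    where
    open ≤-Reasoning
    G = 2 * E * suc d
    instance
      G≢0 : NonZero G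
      G≢0 = m*n≢0 (2 * E) (suc d) {{m*n≢0 2 E}}
    q = k / G
    cst≤q : A * G ≤ q
    cst≤q = subst (_≤ q) (m*n/n≡m (A * G) G) (/-monoˡ-≤ G h)
    small : A * k ≤ 2 ^ (2 * q)
    small = begin
      A * k ≤⟨ *-monoʳ-≤ A (n<[1+n/d]*d k G) ⟩
      A * (suc q * G) ≡⟨ eq A q G ⟩
      A * G * suc q ≤⟨ *-mono-≤ (n≤2^ cst≤q) (suc≤2^ q) ⟩
      2 ^ q * 2 ^ q ≡⟨ trans (sym (^-distribˡ-+-* 2 q q)) (cong (λ z → 2 ^ (q + z)) (sym (+-identityʳ q))) ⟩
      2 ^ (2 * q) ∎
      where
      eq : ∀ A q G → A * (suc q * G) ≡ A * G * suc q
      eq = solve-∀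
      suc≤2^ : ∀ n → suc n ≤ 2 ^ n
      suc≤2^ zero = ≤-refl
      suc≤2^ (suc n) = ≤-trans (+-mono-≤ (pow-pos {2} n (s≤s z≤n)) (suc≤2^ n)) (≤-reflexive (cong (2 ^ n +_) (sym (+-identityʳ (2 ^ n)))))
    exponent : 2 * q * suc d ≤ k / E
    exponent = subst (_≤ k / E) (m*n/n≡m (2 * q * suc d) E) (/-monoˡ-≤ E (≤-trans (≤-reflexive (eq q d E)) (m/n*n≤m k G)))
      where
      eq : ∀ q d E → 2 * q * suc d * E ≡ q * (2 * E * suc d)
      eq = solve-∀

  -- Multiset coefficients, used for e^k ≤ (1 - 1/2)^(-2k) = 4^k.
  multichoose : ℕ → ℕ → ℕ
  multichoose K zero = 1
  multichoose zero (suc i) = 0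
  multichoose (suc K) (suc i) = multichoose K (suc i) + multichoose (suc K) i

  -- 2^m times the sum of `multichoose K i` / 2^i over i ≤ m, a partial sum of the expansion of (1 -
  -- 1/2)^(-K) = 2^K.
  partial : ℕ → ℕ → ℕ
  partial K zero = 1
  partial K (suc m) = 2 * partial K m + multichoose K (suc m)

  partial-step : ∀ K m → partial (suc K) (suc m) ≡ partial K (suc m) + partial (suc K) m
  partial-step K zero = eq (multichoose K 1)
    where
    eq : ∀ x → 2 * 1 + (x + 1) ≡ 2 * 1 + x + 1
    eq = solve-∀
  partial-step K (suc m) = trans (cong (λ z → 2 * z + (multichoose K (suc (suc m)) + multichoose (suc K) (suc m))) (partial-step K m))
    (eq (partial K (suc m)) (partial (suc K) m) (multichoose K (suc (suc m))) (multichoose (suc K) (suc m)))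
    where
    eq : ∀ a b c d → 2 * (a + b) + (c + d) ≡ 2 * a + c + (2 * b + d)
    eq = solve-∀

  partial≤ : ∀ K m → partial K m ≤ 2 ^ (K + m)
  partial≤ zero zero = ≤-refl
  partial≤ zero (suc m) = ≤-trans (≤-reflexive (+-identityʳ _)) (*-monoʳ-≤ 2 (partial≤ zero m))
  partial≤ (suc K) zero = pow-pos {2} (suc K + 0) (s≤s z≤n)
  partial≤ (suc K) (suc m) = ≤-trans (≤-reflexive (partial-step K m)) (≤-trans (+-mono-≤ (partial≤ K (suc m)) (partial≤ (suc K) m))
    (≤-reflexive (cong (2 ^ (K + suc m) +_) (trans (cong (2 ^_) (sym (+-suc K m))) (sym (+-identityʳ _))))))

  -- The right side is the rising factorial K (K + 1) ... (K + i - 1).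
  power≤multichoose : ∀ K i → K ^ i ≤ i ! * multichoose K i
  power≤multichoose K zero = ≤-refl
  power≤multichoose zero (suc i) = z≤n
  power≤multichoose (suc K) (suc i) = ≤-trans (mean K i) (≤-trans (+-mono-≤ (power≤multichoose K (suc i)) (*-monoʳ-≤ (suc i) (power≤multichoose (suc K) i)))
    (≤-reflexive (eq (suc i) (i !) (multichoose K (suc i)) (multichoose (suc K) i))))
    where
    eq : ∀ s f a b → s * f * a + s * (f * b) ≡ s * f * (a + b)
    eq = solve-∀
    mean : ∀ K i → suc K ^ suc i ≤ K ^ suc i + suc i * suc K ^ i
    mean K zero = ≤-reflexive (eq₀ K)
      where
      eq₀ : ∀ K → suc K * 1 ≡ K * 1 + 1 * 1
      eq₀ = solve-∀
    mean K (suc i) = ≤-trans (*-monoʳ-≤ (suc K) (mean K i)) (≤-trans (≤-reflexive (eq₁ K (K ^ suc i) i (suc K ^ i)))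
      (≤-trans (+-monoʳ-≤ (K * K ^ suc i) (+-monoˡ-≤ (suc i * (suc K * suc K ^ i)) (^-monoˡ-≤ (suc i) (n≤1+n K)))) (≤-reflexive refl)))
      where
      eq₁ : ∀ K x i y → suc K * (x + suc i * y) ≡ K * x + (x + suc i * (suc K * y))
      eq₁ = solve-∀

  expSum≤ : ∀ k m → expSum k m ≤ 2 ^ (2 * k) * m !
  expSum≤ k m = *-cancelˡ-pos (2 ^ m) (pow-pos {2} m (s≤s z≤n)) (≤-trans (scaled m) (≤-trans (*-monoʳ-≤ (m !) (partial≤ (2 * k) m))
      (≤-reflexive (trans (cong (m ! *_) (^-distribˡ-+-* 2 (2 * k) m)) (eq (m !) (2 ^ (2 * k)) (2 ^ m))))))
    where
    eq : ∀ a b c → a * (b * c) ≡ c * (b * a)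
    eq = solve-∀
    scaled : ∀ m → 2 ^ m * expSum k m ≤ m ! * partial (2 * k) m
    scaled zero = ≤-refl
    scaled (suc m) = begin
      2 * 2 ^ m * (suc m * expSum k m + k ^ suc m) ≡⟨ eq₁ (2 ^ m) (suc m) (expSum k m) (k ^ suc m) ⟩
      2 * suc m * (2 ^ m * expSum k m) + 2 ^ suc m * k ^ suc m ≤⟨ +-mono-≤ (*-monoʳ-≤ (2 * suc m) (scaled m)) (≤-trans (≤-reflexive (sym (^-distribʳ-* (suc m) 2 k))) (power≤multichoose (2 * k) (suc m))) ⟩
      2 * suc m * (m ! * partial (2 * k) m) + suc m ! * multichoose (2 * k) (suc m) ≡⟨ eq₂ (suc m) (m !) (partial (2 * k) m) (multichoose (2 * k) (suc m)) ⟩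
      suc m ! * partial (2 * k) (suc m) ∎
      where
      open ≤-Reasoning
      eq₁ : ∀ p s e x → 2 * p * (s * e + x) ≡ 2 * s * (p * e) + 2 * p * x
      eq₁ = solve-∀
      eq₂ : ∀ s f p c → 2 * s * (f * p) + s * f * c ≡ s * f * (2 * p + c)
      eq₂ = solve-∀

  -- One level down costs a factor of order n/k, which is at least 4^X; of this 2^X is kept.
  lower-level-bound : ∀ n k κ X P → 1 ≤ k → suc κ ≤ k → 2 * suc κ ≤ n → 2 ^ X * 2 ^ X * k ≤ n →
    P * choose n κ * 2 ^ X ≤ 2 * P * choose n (suc κ)
  lower-level-bound n k κ X P 1≤k κ<k 2κ≤n big = *-cancelˡ-pos k 1≤k (begin
    k * (P * c * 2 ^ X) ≤⟨ m≤m*n _ (2 ^ X) {{m^n≢0 2 X}} ⟩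
    k * (P * c * 2 ^ X) * 2 ^ X ≡⟨ eq k P c (2 ^ X) ⟩
    P * (2 ^ X * 2 ^ X * k * c) ≤⟨ *-monoʳ-≤ P (≤-trans (*-monoˡ-≤ c big) (choose-down₁ n κ 2κ≤n)) ⟩
    P * (2 * suc κ * choose n (suc κ)) ≤⟨ *-monoʳ-≤ P (*-monoˡ-≤ (choose n (suc κ)) (*-monoʳ-≤ 2 κ<k)) ⟩
    P * (2 * k * choose n (suc κ)) ≡⟨ eq₂ P k (choose n (suc κ)) ⟩
    k * (2 * P * choose n (suc κ)) ∎)
    where
    open ≤-Reasoning
    c = choose n κ
    eq : ∀ k P c t → k * (P * c * t) * t ≡ P * (t * t * k * c)
    eq = solve-∀
    eq₂ : ∀ P k c → P * (2 * k * c) ≡ k * (2 * P * c)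
    eq₂ = solve-∀

  -- By the choice of `Q`, the X voting blocks cost n^(vX) / (2^X (2k)^(vX)) tuples, while
  -- prescribing (X + 1) v points shrinks the slice by at least (2k/n)^((X + 1) v). Up to the factor
  -- of one block, 2^X is saved.
  sparse-list-bound : ∀ n k κ X v Q w → 1 ≤ k → κ ≤ k → 2 * κ ≤ n → suc X * v ≤ κ → Q ≡ 2 * (2 * k) ^ v → .{{_ : NonZero Q}} →
    n ^ v * (w * ((n ^ v / Q) ^ X * choose n (κ ∸ suc X * v))) * 2 ^ X ≤ w * (2 * k) ^ v * choose n κ
  sparse-list-bound n k κ X v Q w 1≤k κ≤k 2κ≤n u≤κ Q≡ = *-cancelˡ-pos (y ^ X) (pow-pos X (pow-pos v (*-mono-≤ {1} {2} (s≤s z≤n) 1≤k))) (begin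
    y ^ X * (N * (w * ((N / Q) ^ X * c)) * 2 ^ X) ≡⟨ eq (y ^ X) N w ((N / Q) ^ X) c (2 ^ X) ⟩
    w * (N * ((N / Q) ^ X * (2 ^ X * y ^ X)) * c) ≡⟨ cong (λ z → w * (N * z * c)) (trans (cong ((N / Q) ^ X *_) (trans (sym (^-distribʳ-* X 2 y)) (cong (_^ X) (sym Q≡)))) (sym (^-distribʳ-* X (N / Q) Q))) ⟩
    w * (N * (N / Q * Q) ^ X * c) ≤⟨ *-monoʳ-≤ w (*-monoˡ-≤ c (*-monoʳ-≤ N (^-monoˡ-≤ X (m/n*n≤m N Q)))) ⟩
    w * (N ^ suc X * c) ≡⟨ cong (λ z → w * (z * c)) (trans (^-*-assoc n v (suc X)) (cong (n ^_) (*-comm v (suc X)))) ⟩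
    w * (n ^ u * c) ≤⟨ *-monoʳ-≤ w (choose-down n u (κ ∸ u) (subst (λ z → 2 * z ≤ n) (sym κ≡) 2κ≤n)) ⟩
    w * ((2 * (u + (κ ∸ u))) ^ u * choose n (u + (κ ∸ u))) ≡⟨ cong (λ z → w * ((2 * z) ^ u * choose n z)) κ≡ ⟩
    w * ((2 * κ) ^ u * choose n κ) ≤⟨ *-monoʳ-≤ w (*-monoˡ-≤ (choose n κ) (^-monoˡ-≤ u (*-monoʳ-≤ 2 κ≤k))) ⟩
    w * ((2 * k) ^ u * choose n κ) ≡⟨ cong (λ z → w * (z * choose n κ)) (trans (cong ((2 * k) ^_) (*-comm (suc X) v)) (sym (^-*-assoc (2 * k) v (suc X)))) ⟩
    w * (y * y ^ X * choose n κ) ≡⟨ eq₂ w y (y ^ X) (choose n κ) ⟩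
    y ^ X * (w * y * choose n κ) ∎)
    where
    open ≤-Reasoning
    N = n ^ v
    y = (2 * k) ^ v
    u = suc X * v
    c = choose n (κ ∸ u)
    κ≡ : u + (κ ∸ u) ≡ κ
    κ≡ = m+[n∸m]≡n u≤κ
    eq : ∀ yX N w q c t → yX * (N * (w * (q * c)) * t) ≡ w * (N * (q * (t * yX)) * c)
    eq = solve-∀
    eq₂ : ∀ w y yX c → w * (y * yX * c) ≡ yX * (w * y * c)
    eq₂ = solve-∀

  module _ (H : FinHypergraph) {k n : ℕ} (F : Family n) (uniform : ∀ A → F A ≡ true → ∣ A ∣ ≡ k) (free : Kernel H k F → ⊥) where
    open FinHypergraph H
    open Sparse H F uniform free using (c; τ; jc; census; Pk; bg; Q; Q≢0)

    overhead : 1 ≤ k → 1 ≤ n → ℕ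
    overhead 1≤k 1≤n = 2 * Pk 1≤k 1≤n ^ suc τ + Pk 1≤k 1≤n ^ τ * (suc (bg 1≤k 1≤n) ^ τ * (m * jc * (2 * k) ^ v)) + suc (bg 1≤k 1≤n) ^ τ

    -- `X` serves both as the exponent of heaviness and as the number of further voting blocks, so
    -- each of the three error terms is smaller than the slice by 2^X up to the polynomial
    -- `overhead`.
    sparse-cover : ∀ (1≤k : 1 ≤ k) (1≤n : 1 ≤ n) X Y → suc τ * suc (suc X + τ) * v + τ ≤ k → suc τ ≤ k → 2 * k ≤ n → 2 ^ X * 2 ^ X * k ≤ n →
      overhead 1≤k 1≤n * 2 ^ Y ≤ 2 ^ X →
      Σ (List (Subset n)) λ 𝒮 → (∀ S → S ∈ 𝒮 → (∣ S ∣ ≡ τ) × choose n (k ∸ τ) ≤ 2 ^ X * cnt (link F S)) ×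
        cnt (λ A → F A ∧ not (any 𝒮 (λ S → ⊑ᵇ S A))) * 2 ^ Y ≤ choose n (k ∸ τ)
    sparse-cover 1≤k 1≤n X Y room τ<k 2k≤n big poly = proj₁ result , proj₁ (proj₂ result) , *-cancelʳ-pos (2 ^ X) (pow-pos {2} X (s≤s z≤n)) (begin
      rest * 2 ^ Y * 2 ^ X ≡⟨ eq₁ rest (2 ^ Y) (2 ^ X) ⟩
      rest * 2 ^ X * 2 ^ Y ≤⟨ *-monoˡ-≤ (2 ^ Y) (≤-trans (*-monoˡ-≤ (2 ^ X) (proj₂ (proj₂ result))) total) ⟩
      overhead 1≤k 1≤n * C * 2 ^ Y ≡⟨ eq₁ (overhead 1≤k 1≤n) C (2 ^ Y) ⟩
      overhead 1≤k 1≤n * 2 ^ Y * C ≤⟨ *-monoˡ-≤ C poly ⟩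
      2 ^ X * C ≡⟨ *-comm (2 ^ X) C ⟩
      C * 2 ^ X ∎)
      where
      open ≤-Reasoning
      instance
        2^X≢0 : NonZero (2 ^ X)
        2^X≢0 = m^n≢0 2 X
        Q≢0′ : NonZero (Q 1≤k 1≤n)
        Q≢0′ = Q≢0 1≤k 1≤n
      κ C P B : ℕ
      κ = k ∸ τ
      C = choose n κ
      P = Pk 1≤k 1≤n
      B = suc (bg 1≤k 1≤n) ^ τ
      result = census 1≤k 1≤n X X (suc τ * suc (suc X + τ)) ≤-refl room τ<k
      rest = cnt (λ A → F A ∧ not (any (proj₁ result) (λ S → ⊑ᵇ S A)))
      eq₁ : ∀ a b c → a * b * c ≡ a * c * b
      eq₁ = solve-∀
      κ+1 : suc (k ∸ suc τ) ≡ κ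
      κ+1 = sym (+-∸-assoc 1 τ<k)
      κ≤k : κ ≤ k
      κ≤k = m∸n≤m k τ
      T = n ^ v * (m * jc * ((n ^ v / Q 1≤k 1≤n) ^ X * choose n (κ ∸ suc X * v)))
      T-small : T * 2 ^ X ≤ m * jc * (2 * k) ^ v * C
      T-small = sparse-list-bound n k κ X v (Q 1≤k 1≤n) (m * jc) 1≤k κ≤k (≤-trans (*-monoʳ-≤ 2 κ≤k) 2k≤n) fits refl
        where
        fits : suc X * v ≤ κ
        fits = subst (_≤ κ) (m+n∸n≡m (suc X * v) τ) (∸-monoˡ-≤ τ (≤-trans (+-monoˡ-≤ τ (*-monoˡ-≤ v (≤-trans (≤-trans (m≤m+n (suc X) τ) (n≤1+n _)) (m≤n*m (suc (suc X + τ)) (suc τ))))) room))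
      first : P ^ suc τ * choose n (k ∸ suc τ) * 2 ^ X ≤ 2 * P ^ suc τ * C
      first = subst (λ z → P ^ suc τ * choose n (k ∸ suc τ) * 2 ^ X ≤ 2 * P ^ suc τ * choose n z) κ+1
        (lower-level-bound n k (k ∸ suc τ) X (P ^ suc τ) 1≤k (≤-trans (≤-reflexive κ+1) κ≤k) (≤-trans (*-monoʳ-≤ 2 (≤-trans (≤-reflexive κ+1) κ≤k)) 2k≤n) big)
      total : (P ^ suc τ * choose n (k ∸ suc τ) + (P ^ τ * (B * T) + B * (C / 2 ^ X))) * 2 ^ X ≤ overhead 1≤k 1≤n * C
      total = begin
        (P ^ suc τ * choose n (k ∸ suc τ) + (P ^ τ * (B * T) + B * (C / 2 ^ X))) * 2 ^ X
          ≡⟨ eq (P ^ suc τ * choose n (k ∸ suc τ)) (P ^ τ) B T (C / 2 ^ X) (2 ^ X) ⟩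
        P ^ suc τ * choose n (k ∸ suc τ) * 2 ^ X + P ^ τ * (B * (T * 2 ^ X)) + B * (C / 2 ^ X * 2 ^ X)
          ≤⟨ +-mono-≤ (+-mono-≤ first (*-monoʳ-≤ (P ^ τ) (*-monoʳ-≤ B T-small))) (*-monoʳ-≤ B (m/n*n≤m C (2 ^ X))) ⟩
        2 * P ^ suc τ * C + P ^ τ * (B * (m * jc * (2 * k) ^ v * C)) + B * C
          ≡⟨ eq₂ (2 * P ^ suc τ) (P ^ τ) B (m * jc * (2 * k) ^ v) C ⟩
        overhead 1≤k 1≤n * C ∎
        where
        eq : ∀ a p b t d x → (a + (p * (b * t) + b * d)) * x ≡ a * x + p * (b * (t * x)) + b * (d * x)
        eq = solve-∀
        eq₂ : ∀ a p b w C → a * C + p * (b * (w * C)) + b * C ≡ (a + p * (b * w) + b) * C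
        eq₂ = solve-∀

-- Overhead estimates, and spreadness of heavy sets.

module Final where
  open import Defs
  open Count hiding (sized)
  open Fair
  open Sets
  open Copy using (module Embedding)
  open Peel using (module Sparse)
  open SparseCover
  open import Data.Nat
  open import Data.Nat.Properties
  open import Data.Nat.Tactic.RingSolver using (solve-∀)
  open import Data.Bool using (true)
  open import Data.Fin using (suc)
  open import Data.Fin.Subset using (∣_∣; _∪_)
  open import Data.List as List using (List)
  open import Data.Nat.ListAction using (sum)
  open import Data.List.Membership.Propositional using (_∈_)
  open import Data.List.Relation.Unary.Any using (here; there)
  open import Data.Product using (proj₁; proj₂)
  open import Data.Empty using (⊥)
  open import Relation.Binary.PropositionalEquality hiding (J)

  ∈-sum : ∀ {x} (xs : List ℕ) → x ∈ xs → x ≤ sum xs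
  ∈-sum (x List.∷ xs) (here refl) = m≤m+n x (sum xs)
  ∈-sum (y List.∷ xs) (there i) = ≤-trans (∈-sum xs i) (m≤n+m (sum xs) y)

  module _ (H : FinHypergraph) {k n : ℕ} (F : Family n) (uniform : IsUniform k F) (free : Kernel H k F → ⊥) (1≤k : 1 ≤ k) (1≤n : 1 ≤ n) where
    open FinHypergraph H
    open Sparse H F uniform free using (τ; jc; Pk; bg; Q)

    -- Every quantity in the overhead is at most a power of (4 + v + m) k. The degree is crude, as
    -- only its independence of k and n matters.
    overhead-poly : overhead H F uniform free 1≤k 1≤n ≤
      ((4 + v + m) * k) ^ suc (1 + suc v * suc τ + (suc v * τ + ((4 + v) * τ + (2 + v))))
    overhead-poly = begin
      overhead H F uniform free 1≤k 1≤n ≤⟨ +-mono-≤ (+-mono-≤ first second) third ⟩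
      b ^ d + b ^ d + b ^ d ≡⟨ eq (b ^ d) ⟩
      3 * b ^ d ≤⟨ *-monoˡ-≤ (b ^ d) (≤-trans (s≤s (s≤s (s≤s z≤n))) 4≤b) ⟩
      b ^ suc d ∎
      where
      open ≤-Reasoning
      b d₁ d₂ d : ℕ
      b = (4 + v + m) * k
      d₁ = 1 + suc v * suc τ
      d₂ = suc v * τ + ((4 + v) * τ + (2 + v))
      d = d₁ + d₂
      eq : ∀ x → x + x + x ≡ 3 * x
      eq = solve-∀
      part : ∀ a → a ≤ 4 + v + m → a * k ≤ b
      part a h = *-monoˡ-≤ k h
      4≤b : 4 ≤ b
      4≤b = ≤-trans (≤-trans (≤-reflexive (sym (*-identityʳ 4))) (*-monoʳ-≤ 4 1≤k)) (part 4 (≤-trans (m≤m+n 4 v) (m≤m+n (4 + v) m)))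
      1≤b : 1 ≤ b
      1≤b = ≤-trans (s≤s z≤n) 4≤b
      2≤b : 2 ≤ b
      2≤b = ≤-trans (s≤s (s≤s z≤n)) 4≤b
      2k≤b : 2 * k ≤ b
      2k≤b = part 2 (≤-trans (m≤m+n 2 (2 + v)) (m≤m+n (4 + v) m))
      k+1≤b : suc k ≤ b
      k+1≤b = ≤-trans (+-monoˡ-≤ k 1≤k) (≤-trans (≤-reflexive (cong (k +_) (sym (+-identityʳ k)))) 2k≤b)
      m≤b : m ≤ b
      m≤b = ≤-trans (m≤m*n m k {{>-nonZero 1≤k}}) (part m (m≤n+m m (4 + v)))
      jc≤b : jc ≤ b
      jc≤b = ≤-trans (+-monoˡ-≤ (m * k) (m≤m*n v k {{>-nonZero 1≤k}})) (≤-trans (≤-reflexive (sym (*-distribʳ-+ k v m))) (part (v + m) (+-monoˡ-≤ m (m≤n+m v 4))))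
      Pk≤ : Pk 1≤k 1≤n ≤ b ^ suc v
      Pk≤ = ≤-trans (*-mono-≤ (^-monoˡ-≤ v k+1≤b) jc≤b) (≤-reflexive (*-comm (b ^ v) b))
      bg≤ : suc (bg 1≤k 1≤n) ≤ b ^ (4 + v)
      bg≤ = begin
        1 + Q 1≤k 1≤n * (m * jc) ≤⟨ +-mono-≤ (pow-pos (3 + v) 1≤b) (*-mono-≤ (*-mono-≤ 2≤b (^-monoˡ-≤ v 2k≤b)) (*-mono-≤ m≤b jc≤b)) ⟩
        b ^ (3 + v) + b * b ^ v * (b * b) ≡⟨ eqb b (b ^ v) ⟩
        2 * b ^ (3 + v) ≤⟨ *-monoˡ-≤ (b ^ (3 + v)) 2≤b ⟩
        b ^ (4 + v) ∎
        where
        eqb : ∀ b x → b * (b * (b * x)) + b * x * (b * b) ≡ 2 * (b * (b * (b * x)))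
        eqb = solve-∀
      power : ∀ {x e} t → x ≤ b ^ e → x ^ t ≤ b ^ (e * t)
      power {x} {e} t h = ≤-trans (^-monoˡ-≤ t h) (≤-reflexive (^-*-assoc b e t))
      first : 2 * Pk 1≤k 1≤n ^ suc τ ≤ b ^ d
      first = ≤-trans (*-mono-≤ 2≤b (power {e = suc v} (suc τ) Pk≤)) (^-monoʳ-≤ b {{>-nonZero 1≤b}} (m≤m+n d₁ d₂))
      second : Pk 1≤k 1≤n ^ τ * (suc (bg 1≤k 1≤n) ^ τ * (m * jc * (2 * k) ^ v)) ≤ b ^ d
      second = begin
        Pk 1≤k 1≤n ^ τ * (suc (bg 1≤k 1≤n) ^ τ * (m * jc * (2 * k) ^ v))
          ≤⟨ *-mono-≤ (power {e = suc v} τ Pk≤) (*-mono-≤ (power {e = 4 + v} τ bg≤) (≤-trans (*-mono-≤ (*-mono-≤ m≤b jc≤b) (^-monoˡ-≤ v 2k≤b)) (≤-reflexive (*-assoc b b (b ^ v))))) ⟩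
        b ^ (suc v * τ) * (b ^ ((4 + v) * τ) * b ^ (2 + v)) ≡⟨ cong (b ^ (suc v * τ) *_) (^-distribˡ-+-* b ((4 + v) * τ) (2 + v)) ⟨
        b ^ (suc v * τ) * b ^ ((4 + v) * τ + (2 + v)) ≡⟨ ^-distribˡ-+-* b (suc v * τ) ((4 + v) * τ + (2 + v)) ⟨
        b ^ d₂ ≤⟨ ^-monoʳ-≤ b {{>-nonZero 1≤b}} (m≤n+m d₂ d₁) ⟩
        b ^ d ∎
      third : suc (bg 1≤k 1≤n) ^ τ ≤ b ^ d
      third = ≤-trans (power {e = 4 + v} τ bg≤) (^-monoʳ-≤ b {{>-nonZero 1≤b}} (≤-trans (≤-trans (m≤m+n ((4 + v) * τ) (2 + v)) (m≤n+m _ (suc v * τ))) (m≤n+m d₂ d₁)))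

  module Heavy (H : FinHypergraph) (2≤m : 2 ≤ FinHypergraph.m H) (q₀ s : ℕ) where
    open FinHypergraph H using (v; m)
    open Embedding H 2≤m q₀ (suc s) using (Spread; K; D; D≢0)

    -- No density increment is needed here: the trivial bound on the link of u + 1 further points is
    -- of order (κ/n)^(u + 1) of the slice, and n/k ≥ 4^X outweighs both the sparsity 2^(-X) of the
    -- link of `S` and the constant K 2^(v + 1).
    heavy-spread : ∀ {k n} τ X → τ ≤ q₀ → suc v + τ ≤ k → 1 ≤ n → 2 * k ≤ n → X ≤ k / D → 2 ^ X * 2 ^ X * k ≤ n → K * 2 ^ suc v ≤ 2 ^ X →
      (F : Family n) → IsUniform k F → ∀ S → ∣ S ∣ ≡ τ → choose n (k ∸ τ) ≤ 2 ^ X * cnt (link F S) → Spread k F S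
    heavy-spread {k} {n} τ X τ≤q₀ room 1≤n 2k≤n X≤ big K≤ F uniform S refl heavy = record
      { G = link F S ; size = τ≤q₀
      ; uniform = λ B h → trans (sym (∪-disjoint-size S B (apart B h))) (uniform (S ∪ B) (proj₂ (∧-true {disj S B} h)))
      ; apart = apart ; within = λ B h → proj₂ (∧-true {disj S B} h)
      ; dense = ≤-trans heavy (*-monoˡ-≤ g (^-monoʳ-≤ 2 X≤))
      ; dense′ = dense′
      ; spread = spread }
      where
      open ≤-Reasoning
      κ g : ℕ
      κ = k ∸ ∣ S ∣
      g = cnt (link F S)
      κ≤k : κ ≤ k
      κ≤k = m∸n≤m k (∣ S ∣)
      apart : ∀ B → link F S B ≡ true → Disjoint S B
      apart B h = disj-sound S B (proj₁ (∧-true {disj S B} h))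
      κ2X≤n : κ * 2 ^ X ≤ n
      κ2X≤n = ≤-trans (*-monoˡ-≤ (2 ^ X) κ≤k) (≤-trans (≤-reflexive (*-comm k (2 ^ X))) (≤-trans (*-monoˡ-≤ k (m≤m*n (2 ^ X) (2 ^ X) {{m^n≢0 2 X}})) big))
      dense′ : κ ^ suc s * choose n κ ≤ n ^ suc s * g
      dense′ = begin
        κ * κ ^ s * choose n κ ≤⟨ *-monoʳ-≤ (κ * κ ^ s) heavy ⟩
        κ * κ ^ s * (2 ^ X * g) ≡⟨ eq κ (κ ^ s) (2 ^ X) g ⟩
        κ * 2 ^ X * κ ^ s * g ≤⟨ *-monoˡ-≤ g (*-mono-≤ κ2X≤n (^-monoˡ-≤ s (≤-trans κ≤k (≤-trans (m≤m+n k (k + 0)) 2k≤n)))) ⟩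
        n * n ^ s * g ∎
        where
        eq : ∀ a b c d → a * b * (c * d) ≡ a * c * b * d
        eq = solve-∀
      spread : ∀ U u → ∣ U ∣ ≡ suc u → u ≤ v → cnt (link (link F S) U) * (K * n ^ u) ≤ κ ^ u * g
      spread U u eqU u≤v = *-cancelʳ-pos n 1≤n (begin
        L * (K * n ^ u) * n ≡⟨ eq₁ L K (n ^ u) n ⟩
        K * (n * n ^ u * L) ≤⟨ *-monoʳ-≤ K (*-monoʳ-≤ (n ^ suc u) L≤) ⟩
        K * (n ^ suc u * choose n (κ ∸ suc u)) ≤⟨ *-monoʳ-≤ K (choose-down n (suc u) (κ ∸ suc u) (subst (λ z → 2 * z ≤ n) (sym κ≡) (≤-trans (*-monoʳ-≤ 2 κ≤k) 2k≤n))) ⟩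
        K * ((2 * (suc u + (κ ∸ suc u))) ^ suc u * choose n (suc u + (κ ∸ suc u))) ≡⟨ cong (λ z → K * ((2 * z) ^ suc u * choose n z)) κ≡ ⟩
        K * ((2 * κ) ^ suc u * choose n κ) ≤⟨ *-monoʳ-≤ K (*-mono-≤ (≤-trans (≤-reflexive (^-distribʳ-* (suc u) 2 κ)) (*-monoˡ-≤ (κ ^ suc u) (^-monoʳ-≤ 2 (s≤s u≤v)))) heavy) ⟩
        K * (2 ^ suc v * (κ * κ ^ u) * (2 ^ X * g)) ≡⟨ eq₂ K (2 ^ suc v) κ (κ ^ u) (2 ^ X) g ⟩
        K * 2 ^ suc v * 2 ^ X * κ * (κ ^ u * g) ≤⟨ *-monoˡ-≤ (κ ^ u * g) (≤-trans (*-mono-≤ (*-monoˡ-≤ (2 ^ X) K≤) κ≤k) big) ⟩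
        n * (κ ^ u * g) ≡⟨ *-comm n (κ ^ u * g) ⟩
        κ ^ u * g * n ∎)
        where
        L = cnt (link (link F S) U)
        u<κ : suc u ≤ κ
        u<κ = ≤-trans (s≤s u≤v) (≤-trans (≤-reflexive (sym (m+n∸n≡m (suc v) (∣ S ∣)))) (∸-monoˡ-≤ (∣ S ∣) room))
        κ≡ : suc u + (κ ∸ suc u) ≡ κ
        κ≡ = m+[n∸m]≡n u<κ
        sizes : link (link F S) U ⇒ Count.sized (κ ∸ suc u)
        sizes B h = to-sized {A = B} (trans (sym (m+n∸m≡n (suc u) (∣ B ∣))) (cong (_∸ suc u) (trans (sym (trans (∪-disjoint-size U B (disj-sound U B d)) (cong (_+ ∣ B ∣) eqU)))
            (trans (sym (m+n∸m≡n (∣ S ∣) (∣ U ∪ B ∣))) (cong (_∸ ∣ S ∣) (trans (sym (∪-disjoint-size S (U ∪ B) (apart (U ∪ B) l))) (uniform (S ∪ (U ∪ B)) (proj₂ (∧-true {disj S (U ∪ B)} l)))))))))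
          where
          d = proj₁ (∧-true {disj U B} h)
          l = proj₂ (∧-true {disj U B} h)
        L≤ : L ≤ choose n (κ ∸ suc u)
        L≤ = ≤-trans (cnt-mono {F = link (link F S) U} {G = Count.sized (κ ∸ suc u)} sizes) (≤-reflexive (sized-cnt n (κ ∸ suc u)))
        eq₁ : ∀ L K x n → L * (K * x) * n ≡ K * (n * x * L)
        eq₁ = solve-∀
        eq₂ : ∀ K t κ p x g → K * (t * (κ * p) * (x * g)) ≡ K * t * x * κ * (p * g)
        eq₂ = solve-∀

-- Choice of the constants and the two ranges of n.

module Main where
  open import Defs
  open Count hiding (sized)
  open Fair
  open Sets
  open Tree using (any; common; junta-bound; remainder-bound; module Juntas)
  open Copy using (module Embedding)
  open DenseCover using (dense-cover)
  open SparseCover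
  open Final
  open import Data.Nat
  open import Data.Nat.Properties
  open import Data.Nat.DivMod using (m/n*n≤m; m*n/n≡m; /-monoˡ-≤)
  open import Data.Nat.ListAction using (sum)
  open import Data.Nat.Tactic.RingSolver using (solve-∀)
  open import Data.Bool using (Bool; true; false; not; _∧_)
  open import Data.Fin as Fin using (Fin; inject≤)
  open import Data.Fin.Properties using (inject≤-injective)
  open import Data.Vec using (lookup)
  open import Data.Fin.Subset using (Subset; ∣_∣)
  open import Data.List as List using (List)
  open import Data.List.Membership.Propositional using (_∈_)
  open import Data.List.Relation.Unary.Any using (here; there)
  open import Data.Product using (_×_; _,_; Σ; ∃-syntax; proj₁; proj₂)
  open import Data.Sum using (inj₁; inj₂)
  open import Data.Empty using (⊥; ⊥-elim)
  open import Relation.Nullary using (yes; no; Dec)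
  open import Relation.Binary.PropositionalEquality hiding (J)

  Conclusion : FinHypergraph → ℕ → ℕ → Set
  Conclusion H C j = (n k : ℕ) → C < k → k * C < n → (𝓕 : Family n) → IsUniform k 𝓕 → HPlusFree H k 𝓕 →
    ∃[ 𝓙 ] (IsUniform k 𝓙 × HPlusFree H k 𝓙 × (∃[ J ] (∣ J ∣ ≤ j × IsJunta k J 𝓙)) × JuntaBound C n k (count (𝓕 ∖ 𝓙)) (count 𝓙))

  polynomial-bound : ∀ C n k x y N c c' → x ≤ c' + N * c' → n * c' ≤ 2 * k * c → c ≤ 2 * y → 4 * suc N ≤ C → JuntaBound C n k x y
  polynomial-bound C n k x y N c c' hx hc hy hC = inj₂ (begin
    x * n ≤⟨ *-monoˡ-≤ n hx ⟩
    (c' + N * c') * n ≡⟨ eq₁ c' N n ⟩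
    suc N * (n * c') ≤⟨ *-monoʳ-≤ (suc N) (≤-trans hc (*-monoʳ-≤ (2 * k) hy)) ⟩
    suc N * (2 * k * (2 * y)) ≡⟨ eq₂ (suc N) k y ⟩
    4 * suc N * k * y ≤⟨ *-monoˡ-≤ y (*-monoˡ-≤ k hC) ⟩
    C * k * y ∎)
    where
    open ≤-Reasoning
    eq₁ : ∀ c N n → (c + N * c) * n ≡ suc N * (n * c)
    eq₁ = solve-∀
    eq₂ : ∀ N k y → N * (2 * k * (2 * y)) ≡ 4 * N * k * y
    eq₂ = solve-∀

  -- Since e^k ≤ 4^k ≤ 2^(L C), x^C e^k is at most (x 2^L)^C.
  exponential-bound : ∀ C n k x y L → x * 2 ^ L ≤ y → 2 * k ≤ L * C → JuntaBound C n k x y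
  exponential-bound C n k x y L h hk = inj₁ λ M → begin
    x ^ C * expSum k M ≤⟨ *-monoʳ-≤ (x ^ C) (expSum≤ k M) ⟩
    x ^ C * (2 ^ (2 * k) * M !) ≡⟨ *-assoc (x ^ C) (2 ^ (2 * k)) (M !) ⟨
    x ^ C * 2 ^ (2 * k) * M ! ≤⟨ *-monoˡ-≤ (M !) (*-monoʳ-≤ (x ^ C) (≤-trans (^-monoʳ-≤ 2 hk) (≤-reflexive (sym (^-*-assoc 2 L C))))) ⟩
    x ^ C * (2 ^ L) ^ C * M ! ≡⟨ cong (_* M !) (^-distribʳ-* C x (2 ^ L)) ⟨
    (x * 2 ^ L) ^ C * M ! ≤⟨ *-monoˡ-≤ (M !) (^-monoˡ-≤ C h) ⟩
    y ^ C * M ! ∎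
    where open ≤-Reasoning

  -- Of the saving 2^(2L) one factor 2^L is spent on the constants 2 (1 + 2N), the other remains.
  halving : ∀ x y L N c c' err → x ≤ err + N * c' → err * 2 ^ (2 * L) ≤ c → c' * 2 ^ (2 * L) ≤ 2 * c → c ≤ 2 * y → 2 * (1 + 2 * N) ≤ 2 ^ L → x * 2 ^ L ≤ y
  halving x y L N c c' err hx he hc hy hN = *-cancelʳ-pos (2 ^ L) (pow-pos {2} L (s≤s z≤n)) (begin
    x * t * t ≡⟨ *-assoc x t t ⟩
    x * (t * t) ≡⟨ cong (x *_) tt ⟩
    x * 2 ^ (2 * L) ≤⟨ *-monoˡ-≤ (2 ^ (2 * L)) hx ⟩
    (err + N * c') * 2 ^ (2 * L) ≡⟨ eq₁ err N c' (2 ^ (2 * L)) ⟩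
    err * 2 ^ (2 * L) + N * (c' * 2 ^ (2 * L)) ≤⟨ +-mono-≤ he (*-monoʳ-≤ N hc) ⟩
    c + N * (2 * c) ≡⟨ eq₂ c N ⟩
    (1 + 2 * N) * c ≤⟨ *-monoʳ-≤ (1 + 2 * N) hy ⟩
    (1 + 2 * N) * (2 * y) ≡⟨ eq₃ (1 + 2 * N) y ⟩
    2 * (1 + 2 * N) * y ≤⟨ *-monoˡ-≤ y hN ⟩
    t * y ≡⟨ *-comm t y ⟩
    y * t ∎)
    where
    open ≤-Reasoning
    t = 2 ^ L
    tt : t * t ≡ 2 ^ (2 * L)
    tt = trans (sym (^-distribˡ-+-* 2 L L)) (cong (λ z → 2 ^ (L + z)) (sym (+-identityʳ L)))
    eq₁ : ∀ e N c x → (e + N * c) * x ≡ e * x + N * (c * x)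
    eq₁ = solve-∀
    eq₂ : ∀ c N → c + N * (2 * c) ≡ (1 + 2 * N) * c
    eq₂ = solve-∀
    eq₃ : ∀ a y → a * (2 * y) ≡ 2 * a * y
    eq₃ = solve-∀

  -- `C` is the sum of all the lower bounds demanded of k, of n/k and of `C` itself, so each of them
  -- follows from C < k and k C < n.
  module Limits (c₀ c₁ c₂ c₃ c₄ c₅ c₆ c₇ c₈ c₉ c₁₀ c₁₁ c₁₂ c₁₃ c₁₄ : ℕ) where

    constants : List ℕ
    constants = c₀ List.∷ c₁ List.∷ c₂ List.∷ c₃ List.∷ c₄ List.∷ c₅ List.∷ c₆ List.∷ c₇ List.∷ c₈ List.∷ c₉ List.∷ c₁₀ List.∷ c₁₁ List.∷ c₁₂ List.∷ c₁₃ List.∷ c₁₄ List.∷ List.[]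

    C : ℕ
    C = sum constants

    record Large (k n : ℕ) : Set where
      field
        k₀ : c₀ ≤ k
        n₁ : c₁ * k ≤ n
        k₂ : c₂ ≤ k
        n₃ : c₃ * k ≤ n
        n₄ : c₄ * k ≤ n
        k₅ : c₅ ≤ k
        n₆ : c₆ * k ≤ n
        k₇ : c₇ ≤ k
        k₈ : c₈ ≤ k
        k₉ : c₉ ≤ k
        k₁₀ : c₁₀ ≤ k
        C₁₁ : c₁₁ ≤ C
        C₁₂ : c₁₂ ≤ C
        k₁₂ : c₁₂ ≤ k
        k₁₃ : c₁₃ ≤ k
        k₁₄ : c₁₄ ≤ k
        n₁₄ : c₁₄ * k ≤ n

    large : ∀ k n → C < k → k * C < n → Large k n
    large k n C<k kC<n = record
      { k₀ = K i₀ ; n₁ = N i₁ ; k₂ = K i₂ ; n₃ = N i₃ ; n₄ = N i₄ ; k₅ = K i₅ ; n₆ = N i₆ ; k₇ = K i₇ ; k₈ = K i₈ ; k₉ = K i₉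
      ; k₁₀ = K i₁₀ ; C₁₁ = ∈-sum constants i₁₁ ; C₁₂ = ∈-sum constants i₁₂ ; k₁₂ = K i₁₂ ; k₁₃ = K i₁₃ ; k₁₄ = K i₁₄ ; n₁₄ = N i₁₄ }
      where
      K : ∀ {c} → c ∈ constants → c ≤ k
      K i = ≤-trans (∈-sum constants i) (<⇒≤ C<k)
      N : ∀ {c} → c ∈ constants → c * k ≤ n
      N i = ≤-trans (*-monoˡ-≤ k (∈-sum constants i)) (≤-trans (≤-reflexive (*-comm C k)) (<⇒≤ kC<n))
      i₀ : c₀ ∈ constants
      i₀ = here refl
      i₁ : c₁ ∈ constants
      i₁ = there (here refl)
      i₂ : c₂ ∈ constants
      i₂ = there (there (here refl))
      i₃ : c₃ ∈ constants
      i₃ = there (there (there (here refl)))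
      i₄ : c₄ ∈ constants
      i₄ = there (there (there (there (here refl))))
      i₅ : c₅ ∈ constants
      i₅ = there (there (there (there (there (here refl)))))
      i₆ : c₆ ∈ constants
      i₆ = there (there (there (there (there (there (here refl))))))
      i₇ : c₇ ∈ constants
      i₇ = there (there (there (there (there (there (there (here refl)))))))
      i₈ : c₈ ∈ constants
      i₈ = there (there (there (there (there (there (there (there (here refl))))))))
      i₉ : c₉ ∈ constants
      i₉ = there (there (there (there (there (there (there (there (there (here refl)))))))))
      i₁₀ : c₁₀ ∈ constants
      i₁₀ = there (there (there (there (there (there (there (there (there (there (here refl))))))))))
      i₁₁ : c₁₁ ∈ constants
      i₁₁ = there (there (there (there (there (there (there (there (there (there (there (here refl)))))))))))
      i₁₂ : c₁₂ ∈ constants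
      i₁₂ = there (there (there (there (there (there (there (there (there (there (there (there (here refl))))))))))))
      i₁₃ : c₁₃ ∈ constants
      i₁₃ = there (there (there (there (there (there (there (there (there (there (there (there (there (here refl)))))))))))))
      i₁₄ : c₁₄ ∈ constants
      i₁₄ = there (there (there (there (there (there (there (there (there (there (there (there (there (there (here refl))))))))))))))

    c₁₄≤C : c₁₄ ≤ C
    c₁₄≤C = ∈-sum constants (there (there (there (there (there (there (there (there (there (there (there (there (there (there (here refl)))))))))))))))

  module Several (H : FinHypergraph) (2≤m : 2 ≤ FinHypergraph.m H) where
    open FinHypergraph H using (v; m)

    -- The error allowed is that of a star on s = c + 2 points. `q₀` covers the at most 2 (s + 1)
    -- increments of v + 1 points, and also the heavy sets of `τ` points.
    τ s q₀ : ℕ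
    τ = suc ∣ common H ∣
    s = suc τ
    q₀ = 2 * suc s * suc v + τ

    open Embedding H 2≤m q₀ (suc s) using (k-min; n-min; D; D≢0; K; Spread; spread-kernel)

    -- `A` and `d` come from `overhead-poly`. With L = k / E and X = 4L, X E₀ ≤ k; this makes X (2
    -- (s + 1)) at most k / D and leaves room for the voting blocks. 2^X pays for the overhead 2^L
    -- and the factor 2^(2L) that `halving` requires.
    c N j E₀ E d A : ℕ
    c = ∣ common H ∣
    j = junta-bound m v c q₀
    N = remainder-bound m v c q₀
    E₀ = D * (2 * suc s) * suc v
    E = 4 * E₀
    d = 1 + suc v * suc τ + (suc v * τ + ((4 + v) * τ + (2 + v)))
    A = 4 + v + m

    instance
      E≢0 : NonZero E
      E≢0 = m*n≢0 4 E₀ {{_}} {{m*n≢0 (D * (2 * suc s)) (suc v) {{m*n≢0 D (2 * suc s)}}}}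

    open Limits k-min n-min (2 * s) (2 ^ s) (4 ^ suc v * (K * K)) (suc j) (4 * j) (2 * (suc τ * v * (2 + τ) + τ)) (A * (2 * E * suc d) * (2 * E * suc d))
      (K * 2 ^ suc v * E) (2 * (1 + 2 * N) * E) (4 * suc N) (4 * E) (suc v + τ) 2 public

    module _ {k n : ℕ} (big : Large k n) (F : Family n) (uniform : IsUniform k F) (F-free : HPlusFree H k F) where
      open Large big

      2≤k : 2 ≤ k
      2≤k = k₁₄
      1≤k : 1 ≤ k
      1≤k = ≤-trans (s≤s z≤n) 2≤k
      2k≤n : 2 * k ≤ n
      2k≤n = n₁₄
      1≤n : 1 ≤ n
      1≤n = ≤-trans 1≤k (≤-trans (m≤m+n k (k + 0)) 2k≤n)
      2s≤k : 2 * s ≤ k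
      2s≤k = k₂
      s≤k : s ≤ k
      s≤k = ≤-trans (m≤m+n s (s + 0)) 2s≤k
      free : Kernel H k F → ⊥
      free K = F-free (kernel-copy H k F K)
      L X : ℕ
      L = k / E
      X = 4 * L
      XE₀≤k : X * E₀ ≤ k
      XE₀≤k = ≤-trans (≤-reflexive (eq L E₀)) (m/n*n≤m k E)
        where
        eq : ∀ L E → 4 * L * E ≡ L * (4 * E)
        eq = solve-∀
      ≤L : ∀ c → c * E ≤ k → c ≤ L
      ≤L c h = subst (_≤ L) (m*n/n≡m c E) (/-monoˡ-≤ E h)
      X≤k/D : X * (2 * suc s) ≤ k / D
      X≤k/D = subst (_≤ k / D) (m*n/n≡m (X * (2 * suc s)) D) (/-monoˡ-≤ D (≤-trans (m≤m*n _ (suc v)) (≤-trans (≤-reflexive (eq X (2 * suc s) D (suc v))) XE₀≤k)))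
        where
        eq : ∀ X t D v → X * t * D * v ≡ X * (D * t * v)
        eq = solve-∀
      L≤X : L ≤ X
      L≤X = m≤n*m L 4

      Goal : Set
      Goal = ∃[ 𝓙 ] (IsUniform k 𝓙 × HPlusFree H k 𝓙 × (∃[ J ] (∣ J ∣ ≤ j × IsJunta k J 𝓙)) × JuntaBound C n k (count (F ∖ 𝓙)) (count 𝓙))

      Cover : ℕ → Set
      Cover err = Σ (List (Subset n)) λ 𝒮 → (∀ S → S ∈ 𝒮 → Spread k F S) × cnt (λ A → F A ∧ not (any 𝒮 (λ S → ⊑ᵇ S A))) ≤ err

      module Apply {err : ℕ} (cover : Cover err) where
        private
          module J = Juntas H F free (Spread k F) q₀ (λ S sp → Spread.size sp)
            (spread-kernel k₀ n₁ F) (proj₁ cover) (proj₁ (proj₂ cover))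

        outcome : J.Outcome err
        outcome = J.outcome 2≤m uniform 2k≤n n₆ s≤k err (proj₂ (proj₂ cover))

        open J.Outcome outcome public

        remainder′ : cnt (F ∖ junta) ≤ err + N * choose n (k ∸ suc τ)
        remainder′ = remainder

        large′ : choose n (k ∸ τ) ≤ 2 * cnt junta
        large′ = J.Outcome.large outcome

        result : JuntaBound C n k (cnt (F ∖ junta)) (cnt junta) → Goal
        result bound = junta , junta-uniform , (λ copy → junta-free (copy-kernel H k junta junta-uniform copy)) ,
          (core , core-size , ≤-trans (s≤s core-size) k₅ , depends) ,
          subst₂ (JuntaBound C n k) (sym (count≡cnt (F ∖ junta))) (sym (count≡cnt junta)) bound

      κ+1 : suc (k ∸ suc τ) ≡ k ∸ τ
      κ+1 = sym (+-∸-assoc 1 s≤k)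

      κ+1≤k : suc (k ∸ suc τ) ≤ k
      κ+1≤k = ≤-trans (≤-reflexive κ+1) (m∸n≤m k τ)

      -- The uncovered members and the remainder of the tree are both of the order of a star on c +
      -- 2 points, a factor k/n below the junta.
      moderate : n ≤ 2 ^ X * 2 ^ X * k → Goal
      moderate n≤ = A.result (polynomial-bound C n k (cnt (F ∖ A.junta)) (cnt A.junta) N (choose n (k ∸ τ)) (choose n (k ∸ suc τ)) A.remainder′ step A.large′ C₁₁)
        where
        k≤ : k ≤ 2 * suc (k ∸ s)
        k≤ = ≤-trans (≤-reflexive (sym (m∸n+n≡m s≤k))) (≤-trans (+-monoʳ-≤ (k ∸ s) (subst (_≤ k ∸ s) (trans (cong (_∸ s) (cong (s +_) (+-identityʳ s))) (m+n∸m≡n s s)) (∸-monoˡ-≤ s k₂)))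
          (≤-trans (≤-reflexive (cong (k ∸ s +_) (sym (+-identityʳ (k ∸ s))))) (*-monoʳ-≤ 2 (n≤1+n (k ∸ s)))))
        cover : Cover (choose n (k ∸ suc τ))
        cover = dense-cover H 2≤m q₀ s (m≤m+n (2 * suc s * suc v) τ) X 1≤k s≤k k≤ 2k≤n n₃ n₄ X≤k/D n≤ F uniform
        module A = Apply cover
        step : n * choose n (k ∸ suc τ) ≤ 2 * k * choose n (k ∸ τ)
        step = subst (λ z → n * choose n (k ∸ suc τ) ≤ 2 * k * choose n z) κ+1 (≤-trans (choose-down₁ n (k ∸ suc τ) (≤-trans (*-monoʳ-≤ 2 κ+1≤k) 2k≤n)) (*-monoˡ-≤ (choose n (suc (k ∸ suc τ))) (*-monoʳ-≤ 2 κ+1≤k)))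

      -- All errors are below the junta by 2^L with L of order k, which is the exponential
      -- alternative of the bound.
      sparse : 2 ^ X * 2 ^ X * k ≤ n → Goal
      sparse large-n = A.result (exponential-bound C n k (cnt (F ∖ A.junta)) (cnt A.junta) L small 2k≤LC)
        where
        -- The points used by the blocks are split into a part proportional to X, at most k by the
        -- choice of `E₀`, and a constant part, at most k by the size of k; after doubling the two
        -- add up to 2k.
        room : suc τ * suc (suc X + τ) * v + τ ≤ k
        room = *-cancelˡ-pos 2 (s≤s z≤n) (≤-trans (≤-reflexive (eq (suc τ) X τ v)) (≤-trans (+-mono-≤ (≤-trans (*-monoʳ-≤ X E₀-large) XE₀≤k)
            k₇) (≤-reflexive (cong (k +_) (sym (+-identityʳ k))))))
          where
          eq : ∀ t X τ v → 2 * (t * suc (suc X + τ) * v + τ) ≡ X * (2 * t * v) + 2 * (t * v * (2 + τ) + τ)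
          eq = solve-∀
          E₀-large : 2 * suc τ * v ≤ E₀
          E₀-large = *-mono-≤ (≤-trans (*-monoʳ-≤ 2 (n≤1+n (suc τ))) (m≤n*m (2 * suc s) D)) (n≤1+n v)
        cover₀ = sparse-cover H F uniform free 1≤k 1≤n X (2 * L) room s≤k 2k≤n large-n
          (≤-trans (*-monoˡ-≤ (2 ^ (2 * L)) (≤-trans (overhead-poly H F uniform free 1≤k 1≤n) (poly≤exp A d E k k₈)))
            (≤-trans (≤-reflexive (sym (^-distribˡ-+-* 2 L (2 * L)))) (^-monoʳ-≤ 2 (m≤n+m (L + 2 * L) L))))
        err : ℕ
        err = cnt (λ A → F A ∧ not (any (proj₁ cover₀) (λ S → ⊑ᵇ S A)))
        K≤ : K * 2 ^ suc v ≤ 2 ^ X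
        K≤ = ≤-trans (n≤2^ (≤L (K * 2 ^ suc v) k₉)) (^-monoʳ-≤ 2 L≤X)
        cover : Cover err
        cover = proj₁ cover₀ , (λ S i → Heavy.heavy-spread H 2≤m q₀ s τ X (m≤n+m τ (2 * suc s * suc v)) k₁₃ 1≤n 2k≤n (≤-trans (m≤m*n X (2 * suc s)) X≤k/D) large-n K≤
          F uniform S (proj₁ (proj₁ (proj₂ cover₀) S i)) (proj₂ (proj₁ (proj₂ cover₀) S i))) , ≤-refl
        module A = Apply cover
        step : choose n (k ∸ suc τ) * 2 ^ (2 * L) ≤ 2 * choose n (k ∸ τ)
        step = subst (λ z → choose n (k ∸ suc τ) * 2 ^ (2 * L) ≤ 2 * choose n z) κ+1
          (≤-trans (*-monoʳ-≤ (choose n (k ∸ suc τ)) (^-monoʳ-≤ 2 (*-monoˡ-≤ L {2} {4} (s≤s (s≤s z≤n)))))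
            (≤-trans (≤-reflexive (cong (_* 2 ^ X) (sym (*-identityˡ (choose n (k ∸ suc τ)))))) (lower-level-bound n k (k ∸ suc τ) X 1 1≤k κ+1≤k (≤-trans (*-monoʳ-≤ 2 κ+1≤k) 2k≤n) large-n)))
        small : cnt (F ∖ A.junta) * 2 ^ L ≤ cnt A.junta
        small = halving (cnt (F ∖ A.junta)) (cnt A.junta) L N (choose n (k ∸ τ)) (choose n (k ∸ suc τ)) err A.remainder′ (proj₂ (proj₂ cover₀)) step A.large′ (n≤2^ (≤L (2 * (1 + 2 * N)) k₁₀))
        2k≤LC : 2 * k ≤ L * C
        2k≤LC = ≤-trans (*-monoʳ-≤ 2 (n<[1+n/d]*d k E)) (≤-trans (*-monoʳ-≤ 2 (*-monoˡ-≤ E (≤-trans (≤-reflexive (+-comm 1 L)) (+-monoʳ-≤ L 1≤L))))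
          (≤-trans (≤-reflexive (eq L E)) (*-monoʳ-≤ L C₁₂)))
          where
          1≤L : 1 ≤ L
          1≤L = ≤L 1 (≤-trans (≤-reflexive (*-identityˡ E)) (≤-trans (m≤n*m E 4) k₁₂))
          eq : ∀ L E → 2 * ((L + L) * E) ≡ L * (4 * E)
          eq = solve-∀

    1≤C : 1 ≤ C
    1≤C = ≤-trans (s≤s z≤n) c₁₄≤C

    several : Conclusion H C j
    several n k C<k kC<n F uniform F-free = by-size (n ≤? 2 ^ X big F uniform F-free * 2 ^ X big F uniform F-free * k)
      where
      big : Large k n
      big = large k n C<k kC<n
      by-size : Dec (n ≤ 2 ^ X big F uniform F-free * 2 ^ X big F uniform F-free * k) → Goal big F uniform F-free
      by-size (yes p) = moderate big F uniform F-free p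
      by-size (no ¬p) = sparse big F uniform F-free (<⇒≤ (≰⇒> ¬p))

  -- The vertices of the only edge are placed inside the member and all others outside of it.
  single-kernel : ∀ (H : FinHypergraph) → (∀ e e' → e ≡ e') → ∀ {k n} (F : Family n) E → (∀ e → FinHypergraph.edge H e ≡ E) → ∀ A → F A ≡ true → ∣ A ∣ ≡ k →
    FinHypergraph.v H ≤ k → FinHypergraph.v H + k ≤ n → Kernel H k F
  single-kernel H one {k} {n} F E E≡ A f size v≤k room = record
    { φ = φ ; φ-injective = λ x y → injective x y (lookup E x) (lookup E y) ; A = λ _ → A ; A∈F = λ _ → f ; A-size = λ _ → size
    ; φ∈A = λ e x h → inside x (lookup E x) (subst (_∋ x) (E≡ e) h)
    ; A∋φ = λ e x h → subst (_∋ x) (sym (E≡ e)) (outside′ x (lookup E x) h)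
    ; shared = λ e e' _ e≢e' _ _ → ⊥-elim (e≢e' (one e e')) }
    where
    open FinHypergraph H using (v)
    B : Subset n
    B = full ∖ˢ A
    v≤A : v ≤ ∣ A ∣
    v≤A = ≤-trans v≤k (≤-reflexive (sym size))
    v≤B : v ≤ ∣ B ∣
    v≤B = +-cancelʳ-≤ k v (∣ B ∣) (≤-trans room (≤-reflexive (trans (sym (full-size n)) (trans (sym (∖-size full A (λ x _ → full-∋ x))) (cong (∣ B ∣ +_) size)))))
    place : Fin v → Bool → Fin n
    place x true = enum A (inject≤ x v≤A)
    place x false = enum B (inject≤ x v≤B)
    φ : Fin v → Fin n
    φ x = place x (lookup E x)
    A∌B : ∀ x → A ∋ enum B x → ⊥
    A∌B x h = proj₂ (∖-∋ full A _ (enum-∋ B x)) h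
    injective : ∀ x y a b → place x a ≡ place y b → x ≡ y
    injective x y true true h = inject≤-injective v≤A v≤A x y (enum-injective A _ _ h)
    injective x y false false h = inject≤-injective v≤B v≤B x y (enum-injective B _ _ h)
    injective x y true false h = ⊥-elim (A∌B (inject≤ y v≤B) (subst (A ∋_) h (enum-∋ A _)))
    injective x y false true h = ⊥-elim (A∌B (inject≤ x v≤B) (subst (A ∋_) (sym h) (enum-∋ A _)))
    inside : ∀ x b → b ≡ true → A ∋ place x b
    inside x true _ = enum-∋ A _
    outside′ : ∀ x b → A ∋ place x b → b ≡ true
    outside′ x true _ = refl
    outside′ x false h = ⊥-elim (A∌B (inject≤ x v≤B) h)

  -- Without edges every family contains a copy, so the hypothesis fails. With one edge every
  -- nonempty uniform family contains one, so the family is empty and the empty junta has error 0.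
  few-edges : ∀ (H : FinHypergraph) → FinHypergraph.m H < 2 → Conclusion H (2 + FinHypergraph.v H) 0
  few-edges H@(record { m = zero }) _ n k C<k kC<n F uniform F-free = ⊥-elim (F-free (kernel-copy H k F record
      { φ = λ x → inject≤ x v≤n ; φ-injective = λ x y → inject≤-injective v≤n v≤n x y ; A = λ () ; A∈F = λ () ; A-size = λ ()
      ; φ∈A = λ () ; A∋φ = λ () ; shared = λ () }))
    where
    v≤n : FinHypergraph.v H ≤ n
    v≤n = ≤-trans (≤-trans (m≤n+m _ 2) (m≤n*m _ k {{>-nonZero (≤-trans (s≤s z≤n) C<k)}})) (<⇒≤ kC<n)
  few-edges H@(record { m = suc (suc _) }) (s≤s (s≤s ())) n k C<k kC<n F uniform F-free
  few-edges H@(record { v = v ; m = suc zero ; edge = edge }) _ n k C<k kC<n F uniform F-free with find F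
  ... | inj₁ (A , f) = ⊥-elim (F-free (kernel-copy H k F (single-kernel H (λ { Fin.zero Fin.zero → refl }) F (edge Fin.zero) (λ { Fin.zero → refl }) A f (uniform A f) v≤k room)))
    where
    v≤k : v ≤ k
    v≤k = ≤-trans (m≤n+m v 2) (<⇒≤ C<k)
    room : v + k ≤ n
    room = ≤-trans (≤-trans (+-monoˡ-≤ k v≤k) (≤-trans (≤-reflexive (eq k)) (*-monoʳ-≤ k (m≤m+n 2 v)))) (<⇒≤ kC<n)
      where
      eq : ∀ k → k + k ≡ k * 2
      eq = solve-∀
  ... | inj₂ none = (λ _ → false) , (λ _ ()) , (λ copy → false≢true (proj₁ (proj₂ (proj₂ (proj₂ copy))) Fin.zero)) ,
      (∅ , ≤-reflexive (∅-size n) , ≤-trans (s≤s (≤-reflexive (∅-size n))) (≤-trans (s≤s z≤n) C<k) , λ _ _ _ _ _ → refl) ,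
      inj₂ (≤-trans (≤-reflexive (cong (_* n) zero-count)) z≤n)
    where
    zero-count : count (F ∖ (λ _ → false)) ≡ 0
    zero-count = trans (count≡cnt (F ∖ (λ _ → false))) (trans (cnt-cong (λ A → cong (_∧ true) (none A))) (cnt-false n))

open import Defs
open import Data.Nat using (ℕ; _*_; _≤_; _<_)
open import Data.Fin.Subset using (Subset; ∣_∣)
open import Data.Product using (Σ; ∃; ∃-syntax; _×_; _,_)
open import Data.Nat using (_+_; _≤?_; s≤s; z≤n)
open import Data.Nat.Properties using (≰⇒>)
open import Relation.Nullary using (yes; no)
open Main

theorem1p2 : (H : FinHypergraph) →
    ∃[ C ] ∃[ j ] (1 ≤ C ×
    ((n k : ℕ) → C < k → k * C < n →
    (𝓕 : Family n) → IsUniform k 𝓕 → HPlusFree H k 𝓕 →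
    ∃[ 𝓙 ] (IsUniform k 𝓙 × HPlusFree H k 𝓙 ×
    (∃[ J ] (∣ J ∣ ≤ j × IsJunta k J 𝓙)) ×
    JuntaBound C n k (count (𝓕 ∖ 𝓙)) (count 𝓙))))
theorem1p2 H with 2 ≤? FinHypergraph.m H
... | yes 2≤m = Several.C H 2≤m , Several.j H 2≤m , Several.1≤C H 2≤m , Several.several H 2≤m
... | no m<2 = 2 + FinHypergraph.v H , 0 , s≤s z≤n , few-edges H (≰⇒> m<2)
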